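{- The maximal balanced path-set problem can be solved in linear time, i.e. in $O(|X|+|U|)$ time for an input acyclic digraph $\Gamma=(X,U)$.
   Context: Maximal balanced path-set problem (MBP): given an acyclic digraph $\Gamma=(X,U)$ (parallel arcs allowed), a sink $t\in X$, and a set $Z\subseteq X\setminus\{t\}$ of sources partitioned into pairs by a fixed-point-free involution $\sigma:Z\to Z$, find an inclusion-wise maximal balanced path-set. A balanced path-set is a collection of pairwise arc-disjoint directed paths, each from a node of $Z$ to $t$, such that for every $z\in Z$ the number of paths in the collection starting at $z$ equals the number starting at $\sigma(z)$ (equivalently, the paths can be partitioned into pairs of arc-disjoint paths beginning at $z$ and $\sigma(z)$ for some $z$). Maximal means no balanced path-set strictly contains it. -}

module Defs where

open import Data.Bool.Base using (if_then_else_)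
open import Data.Fin.Base using (Fin; zero; suc; toℕ)
open import Data.Fin.Properties using () renaming (_≟_ to _≟ᶠ_)
open import Data.Fin.Subset using (Subset; _∈_; _∉_)
open import Data.List.Base using (List; []; _∷_; length; filter; map; applyUpTo)
open import Data.List.Relation.Binary.Disjoint.Propositional using (Disjoint)
open import Data.List.Relation.Binary.Subset.Propositional using (_⊆_)
open import Data.List.Relation.Unary.All using (All)
open import Data.List.Relation.Unary.AllPairs using (AllPairs)
open import Data.Nat.Base using (ℕ; zero; suc; _+_; _∸_; _^_; _<_)
open import Data.Nat.Properties using (_≟_)
open import Data.Product.Base using (Σ; ∃-syntax; _×_; proj₁; proj₂)
open import Data.Vec.Base using (lookup)
open import Relation.Binary.PropositionalEquality using (_≡_; _≢_)
open import Relation.Nullary using (¬_; does)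

-- Arcs have their own identity, so parallel arcs are allowed.
record Digraph : Set where
  field
    #nodes #arcs : ℕ
    tail head    : Fin #arcs → Fin #nodes

  Node Arc : Set
  Node = Fin #nodes
  Arc  = Fin #arcs

  infixr 5 _∷_

  data Walk : Node → Node → Set where
    []  : ∀ {x} → Walk x x
    _∷_ : ∀ {y} (e : Arc) → Walk (head e) y → Walk (tail e) y

  arcs : ∀ {x y} → Walk x y → List Arc
  arcs []      = []
  arcs (e ∷ w) = e ∷ arcs w

  Acyclic : Set
  Acyclic = ∀ e → ¬ Walk (head e) (tail e)

record Instance : Set where
  field
    graph : Digraph
  open Digraph graph public
  field
    acyclic      : Acyclic
    t            : Node
    Z            : Subset #nodes
    t∉Z          : t ∉ Z
    -- Only the restriction of σ to Z is part of the data.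
    σ            : Node → Node
    σ-closed     : ∀ {z} → z ∈ Z → σ z ∈ Z
    σ-involutive : ∀ {z} → z ∈ Z → σ (σ z) ≡ z
    σ-fixfree    : ∀ {z} → z ∈ Z → σ z ≢ z

  -- Paths to the sink, given with their first node.  In an acyclic digraph no
  -- walk repeats a node, so walks and paths coincide.
  Path : Set
  Path = Σ Node (λ z → Walk z t)

  pathArcs : Path → List Arc
  pathArcs p = arcs (proj₂ p)

  startingAt : Node → List Path → ℕ
  startingAt z P = length (filter (λ p → proj₁ p ≟ᶠ z) P)

  -- Since t ∉ Z, each path has an arc; hence arc-disjointness also makes the
  -- members of the list distinct, and the list stands for a set of paths.
  record BalancedPathSet (P : List Path) : Set where
    field
      sources      : All (λ p → proj₁ p ∈ Z) P
      arc-disjoint : AllPairs (λ p q → Disjoint (pathArcs p) (pathArcs q)) P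
      balanced     : ∀ {z} → z ∈ Z → startingAt z P ≡ startingAt (σ z) P

  record MaximalBalancedPathSet (P : List Path) : Set where
    field
      isBalanced : BalancedPathSet P
      maximal    : ¬ (∃[ Q ] BalancedPathSet Q × P ⊆ Q × ¬ (Q ⊆ P))

  size : ℕ
  size = #nodes + #arcs

-- The model of computation is a random access machine with words of
-- logarithmic length.  Registers and arrays are named by numbers; a program
-- mentions only finitely many names.  Finitely many arrays can be interleaved
-- in a single memory, so they only avoid address arithmetic.
data Exp : Set where
  const   : ℕ → Exp
  reg     : ℕ → Exp
  load    : ℕ → Exp → Exp
  _⊕_ _⊖_ : Exp → Exp → Exp

infixl 6 _⊕_ _⊖_

infixr 2 _⨾_
infix  3 _≔_ _[_]≔_

data Program : Set where
  skip         : Program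
  _≔_          : (r : ℕ) → Exp → Program
  _[_]≔_       : (a : ℕ) → Exp → Exp → Program
  _⨾_          : Program → Program → Program
  ifnz         : Exp → Program → Program → Program
  while        : Exp → Program → Program

record State : Set where
  constructor state
  field
    regs   : ℕ → ℕ
    arrays : ℕ → ℕ → ℕ

open State public

update : {A : Set} → (ℕ → A) → ℕ → A → ℕ → A
update f i v j = if does (j ≟ i) then v else f j

setReg : State → ℕ → ℕ → State
setReg s r v = state (update (regs s) r v) (arrays s)

setCell : State → ℕ → ℕ → ℕ → State
setCell s a i v = state (regs s) (update (arrays s) a (update (arrays s a) i v))

eval : Exp → State → ℕ
eval (const k)  s = k
eval (reg r)    s = regs s r
eval (load a e) s = arrays s a (eval e s)
eval (e ⊕ f)    s = eval e s + eval f s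
eval (e ⊖ f)    s = eval e s ∸ eval f s

cost : Exp → ℕ
cost (const k)  = 1
cost (reg r)    = 1
cost (load a e) = 1 + cost e
cost (e ⊕ f)    = 1 + (cost e + cost f)
cost (e ⊖ f)    = 1 + (cost e + cost f)

-- Run W c s n s′ : started in s, the program c halts in s′ after n elementary
-- operations, and every number it stores, and every address it writes to, is
-- below W; intermediate values of an expression exceed W at most by a constant
-- factor and summand fixed by c.  There is no run if this bound is violated, so
-- unit-cost arithmetic cannot be exploited to manipulate long numbers.
data Run (W : ℕ) : Program → State → ℕ → State → Set where
  skip : ∀ {s} → Run W skip s 0 s
  assign : ∀ {r e s} → eval e s < W →
           Run W (r ≔ e) s (1 + cost e) (setReg s r (eval e s))
  store : ∀ {a i e s} → eval i s < W → eval e s < W →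
          Run W (a [ i ]≔ e) s (1 + (cost i + cost e))
              (setCell s a (eval i s) (eval e s))
  seq : ∀ {c d s s′ s″ m n} → Run W c s m s′ → Run W d s′ n s″ →
        Run W (c ⨾ d) s (m + n) s″
  if-true : ∀ {e c d s s′ n} → eval e s ≢ 0 → Run W c s n s′ →
            Run W (ifnz e c d) s (1 + (cost e + n)) s′
  if-false : ∀ {e c d s s′ n} → eval e s ≡ 0 → Run W d s n s′ →
             Run W (ifnz e c d) s (1 + (cost e + n)) s′
  while-done : ∀ {e c s} → eval e s ≡ 0 →
               Run W (while e c) s (1 + cost e) s
  while-step : ∀ {e c s s′ s″ m n} → eval e s ≢ 0 → Run W c s m s′ →
               Run W (while e c) s′ n s″ →
               Run W (while e c) s (1 + (cost e + (m + n))) s″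

table : ∀ {k} → (Fin k → ℕ) → ℕ → ℕ
table {zero}  f i       = 0
table {suc k} f zero    = f zero
table {suc k} f (suc i) = table (λ j → f (suc j)) i

-- The arcs come in arbitrary order, as a list of (tail, head) pairs.
input : Instance → State
input I = state inputRegs inputArrays
  where
  open Instance I

  inputRegs : ℕ → ℕ
  inputRegs 0 = #nodes
  inputRegs 1 = #arcs
  inputRegs 2 = toℕ t
  inputRegs _ = 0

  inputArrays : ℕ → ℕ → ℕ
  inputArrays 0 = table (λ e → toℕ (tail e))
  inputArrays 1 = table (λ e → toℕ (head e))
  inputArrays 2 = table (λ z → if lookup Z z then 1 else 0)
  inputArrays 3 = table (λ z → if lookup Z z then toℕ (σ z) else 0)
  inputArrays _ = λ _ → 0

-- Register 3 holds the number of paths; path j is the sequence of arcs in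
-- array 5 from position (array 4)[j] up to, excluding, (array 4)[j + 1].
output : State → List (List ℕ)
output s = applyUpTo path (regs s 3)
  where
  path : ℕ → List ℕ
  path j = applyUpTo (λ i → arrays s 5 (arrays s 4 j + i))
                     (arrays s 4 (suc j) ∸ arrays s 4 j)

-- A path from a node of Z is determined by its arcs, as it has at least one.
Encodes : (I : Instance) → State → List (Instance.Path I) → Set
Encodes I s P = output s ≡ map (λ p → map toℕ (Instance.pathArcs I p)) P

-- Words of k · log₂ (1 + |X| + |U|) bits.
wordBound : ℕ → Instance → ℕ
wordBound k I = (1 + Instance.size I) ^ k

{-# OPTIONS --safe #-}
module Submission where

-- The nodes are numbered topologically, with the sink t last.  A stack of visited nodes
-- grows backwards from t; each of them keeps an arc that leads down the stack.  When a
-- source a comes to the top, two tokens start at a and σ a.  Always the token at the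
-- smaller node moves, and two tokens at one node leave it by different arcs, so that their
-- walks are arc-disjoint.  If both tokens arrive at t, a pair of paths has been found; its
-- arcs are deleted, and nodes that can no longer be left are removed.  Otherwise all walks
-- of both tokens are forced through one arc, so there is no pair of paths from a and σ a.
-- In either case the arcs examined in vain can be forgotten: in an arc-disjoint pair that
-- uses one of them, a kept arc can take its place.  Hence every arc is examined boundedly
-- often, and each iteration of the main loop decreases a measure that is linear at first.

open import Defs
open import Data.Bool.Base using (true; false; if_then_else_)
open import Data.Empty using (⊥; ⊥-elim)
open import Data.Fin.Base using (Fin; zero; suc; toℕ; fromℕ<)
open import Data.List.Base using (List; []; _∷_; _++_; length; map; concat; applyUpTo; filter)
open import Data.List.Membership.Propositional using (_∈_; _∉_)
open import Data.List.Membership.Propositional.Properties using (∈-++⁺ˡ; ∈-++⁺ʳ; ∈-++⁻; ∈-map⁺; ∈-map⁻; ∈-concat⁺′; ∈-concat⁻′; ∈-∃++; ∈-filter⁺; ∈-filter⁻)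
open import Data.List.Properties using (applyUpTo-∷ʳ; map-++; length-++; concat-++; ++-assoc; ++-identityʳ; map-∘; concat-map; filter-++; filter-accept; filter-reject; map-cong)
open import Data.List.Relation.Binary.Disjoint.Propositional using (Disjoint)
open import Data.List.Relation.Binary.Subset.Propositional using (_⊆_)
open import Data.List.Relation.Unary.All using (All; []; _∷_)
open import Data.List.Relation.Unary.AllPairs using (AllPairs; []; _∷_)
open import Data.List.Relation.Unary.Any using (here; there; Any; any?)
open import Data.Nat.Base
open import Data.Nat.Properties
open import Data.Nat.Solver using (module +-*-Solver)
open import Data.Product.Base using (Σ; ∃-syntax; _×_; _,_; proj₁; proj₂)
open import Data.Sum.Base using (_⊎_; inj₁; inj₂; [_,_]′)
open import Data.Vec.Base using (lookup)
open import Data.Vec.Properties using ([]=⇒lookup; lookup⇒[]=)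
open import Function.Base using (_∘_; _$_)
open import Relation.Binary.Definitions using (tri<; tri≈; tri>)
open import Relation.Binary.PropositionalEquality
open import Relation.Nullary using (¬_; yes; no; contradiction; Dec)
open import Relation.Nullary.Decidable using (dec-true; dec-false; _×-dec_; ¬?)
open import Data.List.Membership.DecPropositional using () renaming (_∈?_ to member?)
import Data.List.Relation.Unary.All as All
import Data.List.Relation.Unary.AllPairs.Properties as AllPairsP
open import Data.Fin.Properties using (toℕ<n; toℕ-injective; toℕ-fromℕ<) renaming (_≟_ to _≟ᶠ_)
open import Data.Fin.Subset using () renaming (_∈_ to _∈ˢ_)
import Data.List.Relation.Unary.All.Properties as AllP
import Data.List.Relation.Unary.AllPairs as AllPairs

open +-*-Solver using (solve; _:+_; _:*_; _:=_; con)

-- The obstacle is the time bound: a token that lands on the stack must not walk along it again, and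
-- a search that retreats must not start anew from its sources. So most moves of the tokens exist in
-- the proof only. The program stores the kept arc `kp` and the route `rt` of each node; `Reach`
-- tells which pairs of positions these arcs allow. The stack is cut into segments, and the lowest
-- node of a segment, its root, lies on every chain of kept arcs that comes from above. A token
-- known to be somewhere in a segment can thus be treated by looking at the root alone. Forgetting
-- an arc must remain sound when paths chosen later have taken other arcs away. Therefore `Maximal`
-- speaks about all sets `F` of arcs that may be removed. Exchanges work because `F` is closed under
-- continuation to the sink: if every walk from the head of an arc passes `h`, the arc can be in `F`
-- only together with `h`. The measure is a sum of credits on list entries, sources, stack entries
-- and unwritten arcs, chosen so that each step is paid for by what it removes.

update-same : {A : Set} (f : ℕ → A) (i : ℕ) (v : A) → update f i v i ≡ v
update-same f i v rewrite dec-true (i ≟ i) refl = refl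

update-other : {A : Set} (f : ℕ → A) (i : ℕ) (v : A) {j : ℕ} → j ≢ i → update f i v j ≡ f j
update-other f i v {j} j≢i rewrite dec-false (j ≟ i) j≢i = refl

-- Symbolic execution and running times

-- Both branches are added, rather than compared, to keep the arithmetic linear. Loops lie outside
-- `Exec`; their cost comes from `while-halts`.
maxCost : Program → ℕ
maxCost skip         = 0
maxCost (r ≔ e)      = 1 + cost e
maxCost (a [ i ]≔ e) = 1 + (cost i + cost e)
maxCost (c ⨾ d)      = maxCost c + maxCost d
maxCost (ifnz e c d) = 1 + (cost e + (maxCost c + maxCost d))
maxCost (while e c)  = 0

-- A run of a loop-free program together with the postcondition Q.  The value
-- of each expression can be replaced by an equal one, which keeps the states
-- of a symbolic execution small.
data Exec (W : ℕ) (Q : State → Set) : Program → State → Set where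
  done   : ∀ {s} → Q s → Exec W Q skip s
  assign : ∀ {r e s v} → eval e s ≡ v → v < W → Q (setReg s r v) → Exec W Q (r ≔ e) s
  store  : ∀ {a i e s j v} → eval i s ≡ j → eval e s ≡ v → j < W → v < W →
           Q (setCell s a j v) → Exec W Q (a [ i ]≔ e) s
  skip⨾  : ∀ {c s} → Exec W Q c s → Exec W Q (skip ⨾ c) s
  assign⨾ : ∀ {r e s v c} → eval e s ≡ v → v < W → Exec W Q c (setReg s r v) →
            Exec W Q ((r ≔ e) ⨾ c) s
  store⨾ : ∀ {a i e s j v c} → eval i s ≡ j → eval e s ≡ v → j < W → v < W →
           Exec W Q c (setCell s a j v) → Exec W Q ((a [ i ]≔ e) ⨾ c) s
  assoc⨾ : ∀ {c d k s} → Exec W Q (c ⨾ (d ⨾ k)) s → Exec W Q ((c ⨾ d) ⨾ k) s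
  branch : ∀ {e c d s} → (eval e s ≢ 0 → Exec W Q c s) → (eval e s ≡ 0 → Exec W Q d s) →
           Exec W Q (ifnz e c d) s
  branch⨾ : ∀ {e c d k s} → (eval e s ≢ 0 → Exec W Q (c ⨾ k) s) →
            (eval e s ≡ 0 → Exec W Q (d ⨾ k) s) → Exec W Q ((ifnz e c d) ⨾ k) s

Halts : ℕ → (State → Set) → Program → ℕ → State → Set
Halts W Q c bound s = ∃[ n ] ∃[ s′ ] (Run W c s n s′ × n ≤ bound × Q s′)

private
  ⨾-true : ∀ {W Q e c d k s} → eval e s ≢ 0 → Halts W Q (c ⨾ k) (maxCost c + maxCost k) s →
           Halts W Q (ifnz e c d ⨾ k) (maxCost (ifnz e c d) + maxCost k) s
  ⨾-true {e = e} {c} {d} {k} nz (_ , s′ , seq {m = m} {n = n} r₁ r₂ , le , q) =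
    _ , s′ , seq (if-true nz r₁) r₂ , bound , q
    where
    bound : 1 + (cost e + m) + n ≤ 1 + (cost e + (maxCost c + maxCost d)) + maxCost k
    bound = begin
      1 + (cost e + m) + n  ≡⟨ cong suc (+-assoc (cost e) m n) ⟩
      1 + (cost e + (m + n))  ≤⟨ s≤s (+-monoʳ-≤ (cost e) le) ⟩
      1 + (cost e + (maxCost c + maxCost k))
        ≤⟨ s≤s (+-monoʳ-≤ (cost e) (+-monoˡ-≤ (maxCost k) (m≤m+n (maxCost c) (maxCost d)))) ⟩
      1 + (cost e + (maxCost c + maxCost d + maxCost k))
        ≡⟨ cong suc (sym (+-assoc (cost e) (maxCost c + maxCost d) (maxCost k))) ⟩
      1 + (cost e + (maxCost c + maxCost d)) + maxCost k ∎
      where open ≤-Reasoning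

  ⨾-false : ∀ {W Q e c d k s} → eval e s ≡ 0 → Halts W Q (d ⨾ k) (maxCost d + maxCost k) s →
            Halts W Q (ifnz e c d ⨾ k) (maxCost (ifnz e c d) + maxCost k) s
  ⨾-false {e = e} {c} {d} {k} z (_ , s′ , seq {m = m} {n = n} r₁ r₂ , le , q) =
    _ , s′ , seq (if-false z r₁) r₂ , bound , q
    where
    bound : 1 + (cost e + m) + n ≤ 1 + (cost e + (maxCost c + maxCost d)) + maxCost k
    bound = begin
      1 + (cost e + m) + n  ≡⟨ cong suc (+-assoc (cost e) m n) ⟩
      1 + (cost e + (m + n))  ≤⟨ s≤s (+-monoʳ-≤ (cost e) le) ⟩
      1 + (cost e + (maxCost d + maxCost k))
        ≤⟨ s≤s (+-monoʳ-≤ (cost e) (+-monoˡ-≤ (maxCost k) (m≤n+m (maxCost d) (maxCost c)))) ⟩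
      1 + (cost e + (maxCost c + maxCost d + maxCost k))
        ≡⟨ cong suc (sym (+-assoc (cost e) (maxCost c + maxCost d) (maxCost k))) ⟩
      1 + (cost e + (maxCost c + maxCost d)) + maxCost k ∎
      where open ≤-Reasoning

exec-halts : ∀ {W Q c s} → Exec W Q c s → Halts W Q c (maxCost c) s
exec-halts (done q) = 0 , _ , skip , z≤n , q
exec-halts (assign refl lt q) = _ , _ , assign lt , ≤-refl , q
exec-halts (store refl refl lt₁ lt₂ q) = _ , _ , store lt₁ lt₂ , ≤-refl , q
exec-halts (skip⨾ x) with exec-halts x
... | n , s′ , r , le , q = _ , s′ , seq skip r , le , q
exec-halts {c = (r ≔ e) ⨾ _} (assign⨾ refl lt x) with exec-halts x
... | n , s′ , run , le , q = _ , s′ , seq (assign lt) run , +-monoʳ-≤ (1 + cost e) le , q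
exec-halts {c = (a [ i ]≔ e) ⨾ _} (store⨾ refl refl lt₁ lt₂ x) with exec-halts x
... | n , s′ , run , le , q =
  _ , s′ , seq (store lt₁ lt₂) run , +-monoʳ-≤ (1 + (cost i + cost e)) le , q
exec-halts {c = (c ⨾ d) ⨾ k} (assoc⨾ x) with exec-halts x
... | _ , s′ , seq {m = l} r₁ (seq {m = m} {n = n} r₂ r₃) , le , q =
  _ , s′ , seq (seq r₁ r₂) r₃ ,
  ≤-trans (≤-reflexive (+-assoc l m n))
          (≤-trans le (≤-reflexive (sym (+-assoc (maxCost c) (maxCost d) (maxCost k))))) , q
exec-halts {c = ifnz e c d} {s} (branch f g) with eval e s ≟ 0
... | yes z with exec-halts (g z)
...   | n , s′ , r , le , q = _ , s′ , if-false z r ,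
        s≤s (+-monoʳ-≤ (cost e) (≤-trans le (m≤n+m (maxCost d) (maxCost c)))) , q
exec-halts {c = ifnz e c d} {s} (branch f g) | no nz with exec-halts (f nz)
...   | n , s′ , r , le , q = _ , s′ , if-true nz r ,
        s≤s (+-monoʳ-≤ (cost e) (≤-trans le (m≤m+n (maxCost c) (maxCost d)))) , q
exec-halts {c = ifnz e c d ⨾ k} {s} (branch⨾ f g) with eval e s ≟ 0
... | yes z = ⨾-false {e = e} {c} {d} {k} z (exec-halts (g z))
... | no nz = ⨾-true {e = e} {c} {d} {k} nz (exec-halts (f nz))

private
  while-bound : ∀ c m n k μ μ′ → m ≤ k → n ≤ (suc c + k) * suc μ′ → μ′ < μ →
                1 + (c + (m + n)) ≤ (suc c + k) * suc μ
  while-bound c m n k μ μ′ m≤k n≤ μ′<μ = begin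
    1 + (c + (m + n))           ≡⟨ cong suc (sym (+-assoc c m n)) ⟩
    suc c + m + n               ≤⟨ +-mono-≤ (+-monoʳ-≤ (suc c) m≤k) n≤ ⟩
    (suc c + k) + (suc c + k) * suc μ′   ≡⟨ sym (*-suc (suc c + k) (suc μ′)) ⟩
    (suc c + k) * suc (suc μ′)  ≤⟨ *-monoʳ-≤ (suc c + k) (s≤s μ′<μ) ⟩
    (suc c + k) * suc μ         ∎
    where open ≤-Reasoning

-- There are at most `μ` rounds and one failing test, hence the factor `suc μ`. The index `a`
-- carries logical data that no register holds and that may change in every round.
while-halts : ∀ {W e body} {A : Set} (I : A → State → Set) (μ : A → State → ℕ) →
  (∀ a s → I a s → eval e s ≢ 0 →
     Exec W (λ s′ → ∃[ a′ ] (I a′ s′ × μ a′ s′ < μ a s)) body s) →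
  ∀ a s → I a s →
  Halts W (λ s′ → ∃[ a′ ] (I a′ s′ × eval e s′ ≡ 0)) (while e body)
        ((suc (cost e) + maxCost body) * suc (μ a s)) s
while-halts {W} {e} {body} I μ step a s i = go (μ a s) a s ≤-refl i
  where
  go : ∀ k a s → μ a s ≤ k → I a s →
       Halts W (λ s′ → ∃[ a′ ] (I a′ s′ × eval e s′ ≡ 0)) (while e body)
             ((suc (cost e) + maxCost body) * suc (μ a s)) s
  go k a s le i with eval e s ≟ 0
  ... | yes z = _ , s , while-done z ,
        ≤-trans (m≤m+n (suc (cost e)) (maxCost body))
                (m≤m*n (suc (cost e) + maxCost body) (suc (μ a s))) , a , i , z
  ... | no nz with exec-halts (step a s i nz)
  go zero    a s le i | no nz | _ , _ , _ , _ , a′ , _ , lt = contradiction (≤-trans lt le) λ()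
  go (suc k) a s le i | no nz | m , s₁ , r₁ , m≤ , a′ , i′ , lt
    with go k a′ s₁ (≤-pred (≤-trans lt le)) i′
  ... | n , s₂ , r₂ , n≤ , q =
    _ , s₂ , while-step nz r₁ r₂ , while-bound (cost e) m n (maxCost body) _ _ m≤ n≤ lt , q

-- Sums over nodes, and stacks and linked lists in arrays

sumTo : (ℕ → ℕ) → ℕ → ℕ
sumTo f zero    = 0
sumTo f (suc n) = f n + sumTo f n

sumTo-cong : ∀ {f g} n → (∀ x → x < n → f x ≡ g x) → sumTo f n ≡ sumTo g n
sumTo-cong zero    eq = refl
sumTo-cong (suc n) eq = cong₂ _+_ (eq n ≤-refl) (sumTo-cong n (λ x lt → eq x (m≤n⇒m≤1+n lt)))

sumTo-change : ∀ {f g} n v → v < n → (∀ x → x ≢ v → g x ≡ f x) →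
               sumTo g n + f v ≡ sumTo f n + g v
sumTo-change {f} {g} (suc n) v v<n eq with v ≟ n
... | yes refl = begin
  g n + sumTo g n + f n   ≡⟨ cong (λ k → g n + k + f n) (sumTo-cong n (λ x lt → eq x (<⇒≢ lt))) ⟩
  g n + sumTo f n + f n   ≡⟨ solve 3 (λ a b c → a :+ b :+ c := c :+ b :+ a) refl (g n) (sumTo f n) (f n) ⟩
  f n + sumTo f n + g n   ∎
  where open ≡-Reasoning
... | no v≢n = begin
  g n + sumTo g n + f v   ≡⟨ +-assoc (g n) _ _ ⟩
  g n + (sumTo g n + f v) ≡⟨ cong₂ _+_ (eq n (λ n≡v → v≢n (sym n≡v)))
                                       (sumTo-change n v (≤∧≢⇒< (≤-pred v<n) v≢n) eq) ⟩
  f n + (sumTo f n + g v) ≡⟨ sym (+-assoc (f n) _ _) ⟩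
  f n + sumTo f n + g v   ∎
  where open ≡-Reasoning

sumTo-mono : ∀ {f g} n → (∀ x → x < n → f x ≤ g x) → sumTo f n ≤ sumTo g n
sumTo-mono zero    le = z≤n
sumTo-mono (suc n) le = +-mono-≤ (le n ≤-refl) (sumTo-mono n (λ x lt → le x (m≤n⇒m≤1+n lt)))

sumTo-const : ∀ c n → sumTo (λ _ → c) n ≡ n * c
sumTo-const c zero    = refl
sumTo-const c (suc n) = cong (c +_) (sumTo-const c n)

-- The first length xs cells of f hold xs, the head of the list on top.
data Stack (f : ℕ → ℕ) : List ℕ → Set where
  []  : Stack f []
  _∷_ : ∀ {x xs} → f (length xs) ≡ x → Stack f xs → Stack f (x ∷ xs)

stack-above : ∀ {f xs i v} → Stack f xs → length xs ≤ i → Stack (update f i v) xs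
stack-above [] le = []
stack-above {f} {i = i} {v} (_∷_ {xs = xs} eq st) le =
  trans (update-other f i v (<⇒≢ le)) eq ∷ stack-above st (<⇒≤ le)

stack-push : ∀ {f xs} v → Stack f xs → Stack (update f (length xs) v) (v ∷ xs)
stack-push {f} {xs} v st = update-same f (length xs) v ∷ stack-above st ≤-refl

data Linked (next : ℕ → ℕ) : ℕ → List ℕ → Set where
  nil  : Linked next 0 []
  cons : ∀ {p xs} → p ≢ 0 → Linked next (next p) xs → Linked next p (p ∷ xs)

linked-update : ∀ {next p xs i v} → Linked next p xs → All (_≢ i) xs → Linked (update next i v) p xs
linked-update nil [] = nil
linked-update {next} {i = i} {v} (cons {p} nz l) (p≢i ∷ al) =
  cons nz (subst (λ q → Linked (update next i v) q _) (sym (update-other next i v p≢i))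
                 (linked-update l al))

-- Graphs and stacks

-- Nodes are the numbers below N, arcs the numbers 1, …, M.
record Graph : Set₁ where
  field
    N M t         : ℕ
    tl hd key σ   : ℕ → ℕ
    Z             : ℕ → Set

  Arc : ℕ → Set
  Arc e = 0 < e × e ≤ M

  Out : ℕ → ℕ → Set
  Out x e = Arc e × tl e ≡ x

  field
    t<N      : t < N
    tl<N     : ∀ {e} → Arc e → tl e < N
    hd<N     : ∀ {e} → Arc e → hd e < N
    -- The sink has the greatest key whatever arcs leave it, so its own arcs are exempt.
    key-mono : ∀ {e} → Arc e → tl e ≢ t → key (tl e) < key (hd e)
    key-inj  : ∀ {x y} → x < N → y < N → key x ≡ key y → x ≡ y
    key-t    : ∀ {x} → x < N → x ≢ t → key x < key t
    Z<N      : ∀ {z} → Z z → z < N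
    Z-σ      : ∀ {z} → Z z → Z (σ z)
    σ-invol  : ∀ {z} → Z z → σ (σ z) ≡ z
    σ-free   : ∀ {z} → Z z → σ z ≢ z
    t∉Z      : ¬ Z t

data Stamped (pos : ℕ → ℕ) : List ℕ → Set where
  []  : Stamped pos []
  _∷_ : ∀ {x xs} → pos x ≡ length xs → Stamped pos xs → Stamped pos (x ∷ xs)

stamp-bound : ∀ {pos x xs} → Stamped pos xs → x ∈ xs → pos x < length xs
stamp-bound (eq ∷ s) (here refl) = s≤s (≤-reflexive eq)
stamp-bound (eq ∷ s) (there x∈)  = m≤n⇒m≤1+n (stamp-bound s x∈)

stamp-cong : ∀ {pos pos′ xs} → (∀ {x} → x ∈ xs → pos′ x ≡ pos x) → Stamped pos xs → Stamped pos′ xs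
stamp-cong eq []       = []
stamp-cong eq (p ∷ s) = trans (eq (here refl)) p ∷ stamp-cong (λ x∈ → eq (there x∈)) s

compare-by : ∀ {R : Set} m n → (m < n → R) → (m ≡ n → R) → (n < m → R) → R
compare-by m n f g h with <-cmp m n
... | tri< lt _ _ = f lt
... | tri≈ _ eq _ = g eq
... | tri> _ _ gt = h gt

record Mem : Set where
  constructor mem
  field
    st pos kp rt dl : ℕ → ℕ
    cur inn         : ℕ → List ℕ
    S               : List ℕ

-- Serves as an eliminator: a property of an updated value is proved by the two cases, without a
-- `with` in each caller.
update-if : {A : Set} (f : ℕ → A) (i : ℕ) (v : A) (j : ℕ) (Q : A → Set) →
            (j ≡ i → Q v) → (j ≢ i → Q (f j)) → Q (update f i v j)
update-if f i v j Q eq ne with j ≟ i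
... | yes refl = subst Q (sym (update-same f i v)) (eq refl)
... | no  j≢i  = subst Q (sym (update-other f i v j≢i)) (ne j≢i)

-- Registers 0 – 2 hold the sizes and the sink, 3 the number of finished paths,
-- 4 the phase, 5, 6 and 7 the heights of the stacks S, P and L (arrays 15, 16 and 17),
-- 8 the root r, 9 the current node x, 10 the source a, 11 the number of arcs
-- written, 12 which of the two paths is being written; 13 – 19 are auxiliary.
-- Arrays 6 and 7 (8 and 9) hold the lists of unprocessed arcs leaving (entering)
-- each node; 10 – 14 hold dl (nonzero for arcs that are reserved or gone), st (the status
-- of a node), pos (its height in S), kp and rt (the arcs it has reserved); 18 the keys.
-- The list pointer 0 is nil, whence the shift by one of the arcs.
_≠ₑ_ : Exp → Exp → Exp
e ≠ₑ f = (e ⊖ f) ⊕ (f ⊖ e)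

inc dec : ℕ → Program
inc r = r ≔ reg r ⊕ const 1
dec r = r ≔ reg r ⊖ const 1

tailₑ headₑ : ℕ → Exp
tailₑ r = load 0 (reg r ⊖ const 1)
headₑ r = load 1 (reg r ⊖ const 1)

cleanBody backBody searchBody writeBody mainBody : Program

cleanBody =
  ifnz (reg 7)
    (dec 7 ⨾ 15 [ reg 5 ]≔ load 17 (reg 7) ⨾ inc 5)
    (ifnz (reg 5 ⊖ const 1)
      (14 ≔ load 15 (reg 5 ⊖ const 1) ⨾
       15 ≔ load 6 (reg 14) ⨾
       ifnz (reg 15)
         (ifnz (load 10 (reg 15))
           (6 [ reg 14 ]≔ load 7 (reg 15))
           (11 [ reg 14 ]≔ const 0 ⨾ dec 5))
         (11 [ reg 14 ]≔ const 3 ⨾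
          15 ≔ load 8 (reg 14) ⨾
          ifnz (reg 15)
            (8 [ reg 14 ]≔ load 9 (reg 15) ⨾
             10 [ reg 15 ]≔ const 1 ⨾
             16 ≔ tailₑ 15 ⨾
             -- The tail needs a new test only if it is fresh and the removed arc was the first of
             -- its list. The first arc of a fresh node is always available, so any other arc may
             -- disappear unnoticed.
             ifnz ((load 6 (reg 16) ≠ₑ reg 15) ⊕ load 11 (reg 16))
               skip
               (11 [ reg 16 ]≔ const 1 ⨾ 15 [ reg 5 ]≔ reg 16 ⨾ inc 5))
            (dec 5)))
      (16 [ const 0 ]≔ reg 2 ⨾ 6 ≔ const 1 ⨾ 4 ≔ const 2))

backBody =
  14 ≔ load 15 (reg 5 ⊖ const 1) ⨾
  ifnz (load 2 (reg 14))
    (9 ≔ load 3 (reg 14) ⨾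
     -- Statuses are at most 3, so this is nonzero exactly if the partner is dead.
     ifnz (load 11 (reg 9) ⊖ const 2)
       (2 [ reg 14 ]≔ const 0)
       (10 ≔ reg 14 ⨾ dec 6 ⨾ 8 ≔ load 16 (reg 6) ⨾ 4 ≔ const 3))
    (15 ≔ load 8 (reg 14) ⨾
     ifnz (reg 15)
       (8 [ reg 14 ]≔ load 9 (reg 15) ⨾
        16 ≔ tailₑ 15 ⨾
        ifnz (load 10 (reg 15) ⊕ load 11 (reg 16))
          skip
          (10 [ reg 15 ]≔ const 1 ⨾
           11 [ reg 16 ]≔ const 2 ⨾
           12 [ reg 16 ]≔ reg 5 ⨾
           13 [ reg 16 ]≔ reg 15 ⨾
           14 [ reg 16 ]≔ reg 15 ⨾
           15 [ reg 5 ]≔ reg 16 ⨾ inc 5 ⨾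
           16 [ reg 6 ]≔ reg 16 ⨾ inc 6))
       (ifnz (reg 5 ⊖ const 1)
         (11 [ reg 14 ]≔ const 3 ⨾ dec 5 ⨾
          -- A root is the lowest node of its segment; when it leaves the stack, the segment is
          -- gone.
          ifnz (load 16 (reg 6 ⊖ const 1) ≠ₑ reg 14) skip (dec 6))
         (4 ≔ const 0)))

-- The root is listed because its untried arcs may still be needed on the retreat. The continuation
-- `k` lets a split, which also sets the current node, share this code.
descend : Program → Program
descend k = 17 [ reg 7 ]≔ reg 8 ⨾ inc 7 ⨾ dec 6 ⨾ 8 ≔ load 16 (reg 6) ⨾ k

searchBody =
  ifnz (load 11 (reg 9))
    -- The current node lies below the segment of `r`, so the waiting token has to go on to a lower
    -- segment.
    (ifnz (load 12 (reg 8) ⊖ load 12 (reg 9))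
      (descend skip)
      -- Both tokens are now in segments from `r` upwards; if `r` is the sink, they have arrived.
      (ifnz (reg 8 ≠ₑ reg 2)
        (15 ≔ load 6 (reg 8) ⨾
         ifnz (reg 15)
           (6 [ reg 8 ]≔ load 7 (reg 15) ⨾
            ifnz (load 10 (reg 15))
              skip
              (10 [ reg 15 ]≔ const 1 ⨾ 14 [ reg 8 ]≔ reg 15 ⨾ descend (9 ≔ headₑ 15)))
           (ifnz (reg 7)
             (14 ≔ load 17 (reg 7 ⊖ const 1) ⨾
              -- The first landing of a listed node makes its route the kept arc; any later landing
              -- in the same group adds nothing, and the route falls back to the kept arc.
              ifnz (load 13 (reg 14))
                (14 [ reg 14 ]≔ load 13 (reg 14))
                (13 [ reg 14 ]≔ load 14 (reg 14)) ⨾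
              15 ≔ load 6 (reg 14) ⨾
              ifnz (reg 15)
                (6 [ reg 14 ]≔ load 7 (reg 15) ⨾
                 ifnz (load 10 (reg 15))
                   skip
                   (10 [ reg 15 ]≔ const 1 ⨾ 14 [ reg 14 ]≔ reg 15 ⨾ 9 ≔ headₑ 15))
                (dec 7 ⨾
                 -- Status 2 belongs to a former root, which has its place on the main stack
                 -- already.
                 ifnz (load 11 (reg 14) ⊖ const 1)
                   skip
                   (11 [ reg 14 ]≔ const 2 ⨾ 12 [ reg 14 ]≔ reg 5 ⨾
                    15 [ reg 5 ]≔ reg 14 ⨾ inc 5)))
             (2 [ reg 10 ]≔ const 0 ⨾ 16 [ reg 6 ]≔ reg 8 ⨾ inc 6 ⨾ 4 ≔ const 2)))
        (9 ≔ load 3 (reg 10) ⨾ 12 ≔ const 0 ⨾ 4 ≔ const 4)))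
    -- A fresh node that precedes `r` in key moves at once; otherwise the waiting token can pass `r`
    -- first.
    (ifnz (load 18 (reg 8) ⊖ load 18 (reg 9))
      (15 ≔ load 6 (reg 9) ⨾
       11 [ reg 9 ]≔ const 1 ⨾
       13 [ reg 9 ]≔ const 0 ⨾
       14 [ reg 9 ]≔ reg 15 ⨾
       10 [ reg 15 ]≔ const 1 ⨾
       6 [ reg 9 ]≔ load 7 (reg 15) ⨾
       17 [ reg 7 ]≔ reg 9 ⨾ inc 7 ⨾
       9 ≔ headₑ 15)
      (descend skip))

writeBody =
  ifnz (reg 9 ≠ₑ reg 2)
    (15 ≔ load 14 (reg 9) ⨾
     5 [ reg 11 ]≔ reg 15 ⊖ const 1 ⨾
     inc 11 ⨾
     14 [ reg 9 ]≔ load 13 (reg 9) ⨾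
     9 ≔ headₑ 15)
    (inc 3 ⨾ 4 [ reg 3 ]≔ reg 11 ⨾
     ifnz (reg 12) (4 ≔ const 1) (12 ≔ const 1 ⨾ 9 ≔ reg 10))

mainBody =
  ifnz (reg 4 ⊖ const 1)
    (ifnz (reg 4 ⊖ const 2)
      (ifnz (reg 4 ⊖ const 3) writeBody searchBody)
      backBody)
    cleanBody

-- Tests of the program and weights of the measure

yes-branch : ∀ {W Q e c d s} → eval e s ≢ 0 → Exec W Q c s → Exec W Q (ifnz e c d) s
yes-branch nz x = branch (λ _ → x) (λ z → ⊥-elim (nz z))

no-branch : ∀ {W Q e c d s} → eval e s ≡ 0 → Exec W Q d s → Exec W Q (ifnz e c d) s
no-branch z x = branch (λ nz → ⊥-elim (nz z)) (λ _ → x)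

differ-0 : ∀ m → (m ∸ m) + (m ∸ m) ≡ 0
differ-0 m = cong₂ _+_ (n∸n≡0 m) (n∸n≡0 m)

differ-≢ : ∀ {m n} → (m ∸ n) + (n ∸ m) ≡ 0 → m ≡ n
differ-≢ {m} {n} eq = ≤-antisym (m∸n≡0⇒m≤n (m+n≡0⇒m≡0 (m ∸ n) eq))
                                (m∸n≡0⇒m≤n (m+n≡0⇒n≡0 (m ∸ n) eq))

stack-top : ∀ {f x xs} → Stack f (x ∷ xs) → f (length xs) ≡ x
stack-top (eq ∷ _) = eq

stack-tail : ∀ {f x xs} → Stack f (x ∷ xs) → Stack f xs
stack-tail (_ ∷ s) = s

linked-cons : ∀ {f p xs c cs} → Linked f p xs → xs ≡ c ∷ cs → p ≡ c × c ≢ 0 × Linked f (f c) cs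
linked-cons (cons nz l) refl = refl , nz , l

linked-nil : ∀ {f p xs} → Linked f p xs → xs ≡ [] → p ≡ 0
linked-nil nil refl = refl

sum-drop : ∀ {f g d} n v → v < n → (∀ x → x ≢ v → g x ≡ f x) → f v ≡ g v + d →
           sumTo g n + d ≡ sumTo f n
sum-drop {f} {g} {d} n v v<n eq fv = +-cancelʳ-≡ (g v) _ _ (begin
  sumTo g n + d + g v   ≡⟨ solve 3 (λ a b c → a :+ b :+ c := a :+ (c :+ b)) refl (sumTo g n) d (g v) ⟩
  sumTo g n + (g v + d) ≡⟨ cong (sumTo g n +_) (sym fv) ⟩
  sumTo g n + f v       ≡⟨ sumTo-change n v v<n eq ⟩
  sumTo f n + g v       ∎)
  where open ≡-Reasoning

-- The logical variables: un e is 1 as long as the arc e has not been written; part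
-- and rest make up the path that is being written.
record Ghost : Set where
  constructor ghost
  field
    cur inn   : ℕ → List ℕ
    S P L     : List ℕ
    un        : ℕ → ℕ
    ps        : List (List ℕ)
    part rest : List ℕ
    first     : ℕ

memory : State → Ghost → Mem
memory s g = mem (arrays s 11) (arrays s 12) (arrays s 13) (arrays s 14) (arrays s 10)
                 (Ghost.cur g) (Ghost.inn g) (Ghost.S g)

-- An entry of `cur` frees 3, more than the 2 for listing its node. An entry of `inn` frees 5, more
-- than the 1 + 3 for a node pushed on `S` and `P`. A source frees 5 when its search fails, which
-- puts a root back on `P` for 3 and raises the phase weight by 1.
nodeWeight : (act : ℕ → ℕ) (cur inn : ℕ → List ℕ) → ℕ → ℕ
nodeWeight act cur inn x = 3 * length (cur x) + (5 * length (inn x) + 5 * act x)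

-- The weight rises from 0 to 8 when the first arc of the first path is written, at the expense of
-- the 10 attached to that arc. The ends of the two paths lower it to 7 and 6, and the fall from 6
-- to 2 after cleaning pays for the sink on `P`. The argument `first` is 1 until the current path
-- has an arc.
phaseWeight : (md ph first : ℕ) → ℕ
phaseWeight 1 _ _ = 6
phaseWeight 2 _ _ = 2
phaseWeight 3 _ _ = 1
phaseWeight 4 0 1 = 0
phaseWeight 4 0 _ = 8
phaseWeight 4 _ _ = 7
phaseWeight _ _ _ = 0

-- A descent turns 3 for a root into 2 for a listed node, and finishing a listed node turns 2 into
-- at most 1. The factor 10 of an unwritten arc exceeds every phase weight.
rest-weight : (S P L : List ℕ) (u p : ℕ) → ℕ
rest-weight S P L u p = length S + (3 * length P + (2 * length L + (10 * u + p)))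

weight-lt : ∀ {A A′ r r′} d → A′ + d ≡ A → r′ < d + r → A′ + r′ < A + r
weight-lt {A} {A′} {r} {r′} d refl lt = begin-strict
  A′ + r′      <⟨ +-monoʳ-< A′ lt ⟩
  A′ + (d + r) ≡⟨ sym (+-assoc A′ d r) ⟩
  A′ + d + r   ∎
  where open ≤-Reasoning

cur-weight : ∀ {act cur inn v c cs} → cur v ≡ c ∷ cs →
  nodeWeight act cur inn v ≡ nodeWeight act (update cur v cs) inn v + 3
cur-weight {act} {cur} {inn} {v} {c} {cs} eq =
  trans (cong (λ es → 3 * length es + w) eq)
    (trans (solve 2 (λ k w → con 3 :* (con 1 :+ k) :+ w := con 3 :* k :+ w :+ con 3) refl (length cs) w)
           (cong (λ es → 3 * length es + w + 3) (sym (update-same cur v cs))))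
  where
  w : ℕ
  w = 5 * length (inn v) + 5 * act v

inn-weight : ∀ {act cur inn v c cs} → inn v ≡ c ∷ cs →
  nodeWeight act cur inn v ≡ nodeWeight act cur (update inn v cs) v + 5
inn-weight {act} {cur} {inn} {v} {c} {cs} eq =
  trans (cong (λ es → a + (5 * length es + w)) eq)
    (trans (solve 3 (λ a k w → a :+ (con 5 :* (con 1 :+ k) :+ w) := a :+ (con 5 :* k :+ w) :+ con 5) refl
              a (length cs) w)
           (cong (λ es → a + (5 * length es + w) + 5) (sym (update-same inn v cs))))
  where
  a w : ℕ
  a = 3 * length (cur v)
  w = 5 * act v

act-weight : ∀ {act cur inn v} →
  nodeWeight act cur inn v ≡ nodeWeight (update act v 0) cur inn v + 5 * act v
act-weight {act} {cur} {inn} {v} =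
  trans (solve 3 (λ a k w → a :+ (k :+ w) := a :+ (k :+ con 0) :+ w) refl a k (5 * act v))
        (cong (λ d → a + (k + 5 * d) + 5 * act v) (sym (update-same act v 0)))
  where
  a k : ℕ
  a = 3 * length (cur v)
  k = 5 * length (inn v)

length-≤-S : ∀ S P L u p → length S ≤ rest-weight S P L u p
length-≤-S S P L u p = m≤m+n _ _

length-≤-P : ∀ S P L u p → length P ≤ rest-weight S P L u p
length-≤-P S P L u p = ≤-trans (m≤n*m (length P) 3) (≤-trans (m≤m+n _ _) (m≤n+m _ (length S)))

length-≤-L : ∀ S P L u p → length L ≤ rest-weight S P L u p
length-≤-L S P L u p = ≤-trans (m≤n*m (length L) 2) (≤-trans (m≤m+n _ _)
  (≤-trans (m≤n+m _ (3 * length P)) (m≤n+m _ (length S))))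

length-suc : ∀ {k} n → k ≡ n → k + 1 ≡ suc n
length-suc n refl = +-comm n 1

0≢suc : ∀ {k n} → k ≡ suc n → k ≢ 0
0≢suc refl ()

one-less : ∀ {k n} → k ≡ suc n → k ∸ 1 ≡ n
one-less refl = refl

≤3-not-≤2 : ∀ {k} → k ≤ 3 → k ∸ 2 ≢ 0 → k ≡ 3
≤3-not-≤2 {0} _ ne = ⊥-elim (ne refl)
≤3-not-≤2 {1} _ ne = ⊥-elim (ne refl)
≤3-not-≤2 {2} _ ne = ⊥-elim (ne refl)
≤3-not-≤2 {3} _ ne = refl
≤3-not-≤2 {suc (suc (suc (suc _)))} (s≤s (s≤s (s≤s ()))) ne

five-times : ∀ {k} → k ≢ 0 → 5 ≤ 5 * k
five-times {zero} ne = ⊥-elim (ne refl)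
five-times {suc k} ne = *-monoʳ-≤ 5 {1} {suc k} (s≤s z≤n)

applyUpTo-cong : {A : Set} (f g : ℕ → A) (n : ℕ) → (∀ {j} → j < n → f j ≡ g j) → applyUpTo f n ≡ applyUpTo g n
applyUpTo-cong f g zero eq = refl
applyUpTo-cong f g (suc n) eq =
  cong₂ _∷_ (eq (s≤s z≤n)) (applyUpTo-cong (f ∘ suc) (g ∘ suc) n (λ lt → eq (s≤s lt)))

monus-pos : ∀ {m n} → m ∸ n ≢ 0 → n < m
monus-pos ne = ≰⇒> (λ le → ne (m≤n⇒m∸n≡0 le))

concat-pair : ∀ ps (X Y : List ℕ) → concat (ps ++ X ∷ Y ∷ []) ≡ concat ps ++ (X ++ Y)
concat-pair ps X Y = trans (sym (concat-++ ps (X ∷ Y ∷ []))) (cong (λ Z → concat ps ++ X ++ Z) (++-identityʳ Y))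

-- B bounds the measure of the main loop, W the numbers that are stored.
record Capacity (N M : ℕ) : Set where
  field
    B W  : ℕ
    fits : ∀ {v} → v ≤ suc B → v < W
    N≤B  : N ≤ B
    M≤B  : M ≤ B
    4≤B  : 4 ≤ B

-- The forest on the stack and the walks of the tokens

module Algorithm (G : Graph) where
  open Graph G public

  -- Status codes: 0 fresh, 1 reached but unfinished, 2 on the main stack, 3 dead.
  Marked : (ℕ → ℕ) → ℕ → Set
  Marked st x = st x ≡ 1 ⊎ st x ≡ 2

  data Chain (kp : ℕ → ℕ) : ℕ → ℕ → Set where
    here : ∀ {x} → Chain kp x x
    step : ∀ {x y} → x ≢ t → Chain kp (hd (kp x)) y → Chain kp x y

  chain-next : ∀ {kp x y} → Chain kp x y → x ≢ y → x ≢ t × Chain kp (hd (kp x)) y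
  chain-next here         x≢y = ⊥-elim (x≢y refl)
  chain-next (step x≢t c) x≢y = x≢t , c

  out-key : ∀ {x e} → x ≢ t → Out x e → key x < key (hd e)
  out-key x≢t (arc , refl) = key-mono arc x≢t

  -- Node x hangs on the main stack S by its arc kp x, which leads down the stack;
  -- C lists the roots of the segments of the stack, topmost first.
  record Forest (st pos kp : ℕ → ℕ) (S C : List ℕ) : Set where
    field
      stacked : Stamped pos S
      pos-t   : pos t ≡ 0
      vis-S   : ∀ {x} → st x ≡ 2 → x ∈ S
      S-vis   : ∀ {x} → x ∈ S → st x ≡ 2
      S<N     : ∀ {x} → x ∈ S → x < N
      kp-out  : ∀ {x} → st x ≡ 2 → x ≢ t → Out x (kp x)
      kp-vis  : ∀ {x} → st x ≡ 2 → x ≢ t → st (hd (kp x)) ≡ 2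
      kp-pos  : ∀ {x} → st x ≡ 2 → x ≢ t → pos (hd (kp x)) < pos x
      C-vis   : ∀ {x} → x ∈ C → st x ≡ 2
      t∈C     : t ∈ C
      C-pos   : AllPairs (λ x y → pos y < pos x) C
      thru    : ∀ {x ρ} → st x ≡ 2 → ρ ∈ C → pos ρ ≤ pos x → Chain kp x ρ

    vis<N : ∀ {x} → st x ≡ 2 → x < N
    vis<N v = S<N (vis-S v)

    t-vis : st t ≡ 2
    t-vis = C-vis t∈C

    kp-key : ∀ {x} → st x ≡ 2 → x ≢ t → key x < key (hd (kp x))
    kp-key v x≢t = out-key x≢t (kp-out v x≢t)

    pos>0 : ∀ {x} → st x ≡ 2 → x ≢ t → 0 < pos x
    pos>0 v x≢t = ≤-<-trans z≤n (kp-pos v x≢t)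

    chain-vis : ∀ {x y} → st x ≡ 2 → Chain kp x y → st y ≡ 2
    chain-vis v here         = v
    chain-vis v (step x≢t c) = chain-vis (kp-vis v x≢t) c

    chain-pos : ∀ {x y} → st x ≡ 2 → Chain kp x y → pos y ≤ pos x
    chain-pos v here         = ≤-refl
    chain-pos v (step x≢t c) = ≤-trans (chain-pos (kp-vis v x≢t) c) (<⇒≤ (kp-pos v x≢t))

    chain-key : ∀ {x y} → st x ≡ 2 → Chain kp x y → key x ≤ key y
    chain-key v here         = ≤-refl
    chain-key v (step x≢t c) = ≤-trans (<⇒≤ (kp-key v x≢t)) (chain-key (kp-vis v x≢t) c)

    uniq-pos : ∀ {x y} → st x ≡ 2 → st y ≡ 2 → pos x ≡ pos y → x ≡ y
    uniq-pos v w = go stacked (vis-S v) (vis-S w)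
      where
      go : ∀ {xs x y} → Stamped pos xs → x ∈ xs → y ∈ xs → pos x ≡ pos y → x ≡ y
      go (p ∷ s) (here refl) (here refl) eq = refl
      go (p ∷ s) (here refl) (there y∈) eq =
        contradiction (trans (sym eq) p) (<⇒≢ (stamp-bound s y∈))
      go (p ∷ s) (there x∈) (here refl) eq =
        contradiction (trans eq p) (<⇒≢ (stamp-bound s x∈))
      go (p ∷ s) (there x∈) (there y∈) eq = go s x∈ y∈ eq

  -- Deleted arcs may linger in the lists, because removing them from the middle would cost time;
  -- completeness is demanded for available arcs only.
  record Arcs (st dl : ℕ → ℕ) (cur inn : ℕ → List ℕ) : Set where
    field
      cur-out : ∀ {x e} → e ∈ cur x → Out x e
      inn-in  : ∀ {x e} → e ∈ inn x → Arc e × hd e ≡ x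
      av-cur  : ∀ {e} → Arc e → dl e ≡ 0 → e ∈ cur (tl e)
      av-inn  : ∀ {e} → Arc e → dl e ≡ 0 → st (tl e) ≢ 3 → tl e ≢ t → e ∈ inn (hd e)
      st-≤    : ∀ x → st x ≤ 3
      st-N    : ∀ {x} → st x ≢ 0 → x < N

  -- Guarantees that a token entering a node never gets into a dead end: an available arc does not
  -- lead to a dead node, and a fresh node can be left by its first arc at once.
  record Clean (st dl : ℕ → ℕ) (cur : ℕ → List ℕ) : Set where
    field
      nd    : ∀ {e} → Arc e → dl e ≡ 0 → st (tl e) ≢ 3 → tl e ≢ t → st (hd e) ≢ 3
      fresh : ∀ {x} → x < N → st x ≡ 0 → ∃[ c ] ∃[ cs ] (cur x ≡ c ∷ cs × dl c ≡ 0)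

  record Routes (st kp rt dl : ℕ → ℕ) : Set where
    field
      rt-out : ∀ {x} → Marked st x → x ≢ t → Out x (rt x)
      rt-dl  : ∀ {x} → Marked st x → x ≢ t → dl (rt x) ≢ 0
      kp-dl  : ∀ {x} → Marked st x → x ≢ t → kp x ≢ 0 → dl (kp x) ≢ 0

  -- Untried arcs survive only at roots and listed nodes. From all other stacked nodes the kept arc
  -- is the only way on, which is what makes a failed search conclusive.
  record Tight (st kp rt : ℕ → ℕ) (cur : ℕ → List ℕ) (C L : List ℕ) : Set where
    field
      exh  : ∀ {x} → st x ≡ 2 → x ≢ t → x ∉ C → x ∉ L → cur x ≡ [] × rt x ≡ kp x
      C-rt : ∀ {x} → x ∈ C → rt x ≡ kp x

    rt≡kp : ∀ {x} → st x ≡ 2 → x ≢ t → x ∉ L → rt x ≡ kp x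
    rt≡kp {x} v x≢t x∉L with member? _≟_ x C
    ... | yes x∈C = C-rt x∈C
    ... | no  x∉C = proj₂ (exh v x≢t x∉C x∉L)

  -- Two tokens start at b and a.  The one with the smaller key follows its
  -- route arc; two tokens at one node leave it by different arcs.  Hence the
  -- walks of the tokens are arc-disjoint.
  data Reach (st kp rt : ℕ → ℕ) (b a : ℕ) : ℕ → ℕ → Set where
    start : Reach st kp rt b a b a
    swap  : ∀ {x y} → Reach st kp rt b a x y → Reach st kp rt b a y x
    move  : ∀ {x y} → Reach st kp rt b a x y → Marked st x → x ≢ t → Out x (rt x) →
            key x < key y → Reach st kp rt b a (hd (rt x)) y
    split : ∀ {x} → Reach st kp rt b a x x → Marked st x → x ≢ t → Out x (rt x) →
            Out x (kp x) → rt x ≢ kp x → Reach st kp rt b a (hd (rt x)) (hd (kp x))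

  -- Since the token with the smaller key moves, each node that has been left lies below both
  -- present positions in key. Arcs of all other nodes can change without affecting what has been
  -- reached.
  reach-frame : ∀ {st kp rt st′ kp′ rt′ b a x y} →
    (∀ {u} → Marked st u → key u < key x → key u < key y →
       Marked st′ u × kp′ u ≡ kp u × rt′ u ≡ rt u) →
    Reach st kp rt b a x y → Reach st′ kp′ rt′ b a x y
  reach-frame f start    = start
  reach-frame f (swap r) = swap (reach-frame (λ m u<x u<y → f m u<y u<x) r)
  reach-frame {st′ = st′} {kp′} {rt′} {b} {a} f (move {x} {y} r m x≢t o x<y)
    with f m (out-key x≢t o) x<y
  ... | m′ , _ , eq = subst (λ e → Reach st′ kp′ rt′ b a (hd e) y) eq
    (move (reach-frame (λ mu u<x u<y → f mu (<-trans u<x (out-key x≢t o)) u<y) r)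
          m′ x≢t (subst (Out x) (sym eq) o) x<y)
  reach-frame {st′ = st′} {kp′} {rt′} {b} {a} f (split {x} r m x≢t o o′ ne)
    with f m (out-key x≢t o) (out-key x≢t o′)
  ... | m′ , eqk , eq = subst₂ (λ e k → Reach st′ kp′ rt′ b a (hd e) (hd k)) eq eqk
    (split (reach-frame (λ mu u<x u<y → f mu (<-trans u<x (out-key x≢t o))
                                             (<-trans u<x (out-key x≢t o′))) r)
           m′ x≢t (subst (Out x) (sym eq) o) (subst (Out x) (sym eqk) o′)
           (λ e → ne (trans (sym eq) (trans e eqk))))

  -- The walk of one token along routes. `A` records the nodes it leaves, so that two such walks can
  -- be seen not to meet.
  data Via (st rt : ℕ → ℕ) (A : ℕ → Set) : ℕ → ℕ → Set where
    here : ∀ {x} → Via st rt A x x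
    step : ∀ {x y} → A x → Marked st x → x ≢ t → Out x (rt x) →
           Via st rt A (hd (rt x)) y → Via st rt A x y

  via-key : ∀ {st rt A x y} → Via st rt A x y → key x ≤ key y
  via-key here               = ≤-refl
  via-key (step _ _ x≢t o v) = ≤-trans (<⇒≤ (out-key x≢t o)) (via-key v)

  -- The keys dictate who moves, and the walks have no node in common, so no split intervenes. The
  -- first token completes its walk, while the other one is stopped by the order of the keys,
  -- possibly before `e`.
  interleave : ∀ {st kp rt b a A B x y m e} → Reach st kp rt b a x y →
    Via st rt A x m → Via st rt B y e → (∀ {u w} → A u → B w → key u ≢ key w) →
    key m ≤ key e →
    ∃[ y′ ] (Reach st kp rt b a m y′ × key m ≤ key y′ × Via st rt B y′ e)
  interleave {x = x} {y} r here here dis le = _ , r , le , here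
  interleave {x = x} {y} r here (step B my y≢t o v) dis le with key x ≤? key y
  ... | yes x≤y = y , r , x≤y , step B my y≢t o v
  ... | no x≰y  = interleave (swap (move (swap r) my y≢t o (≰⇒> x≰y))) here v dis le
  interleave {x = x} {y} r (step A mx x≢t o v) here dis le =
    interleave (move r mx x≢t o (<-≤-trans (out-key x≢t o) (≤-trans (via-key v) le))) v here dis le
  interleave {x = x} {y} r u@(step A mx x≢t o v) w@(step B my y≢t o′ v′) dis le =
    compare-by (key x) (key y)
      (λ x<y → interleave (move r mx x≢t o x<y) v w dis le)
      (λ eq → contradiction eq (dis A B))
      (λ y<x → interleave (swap (move (swap r) my y≢t o′ y<x)) u v′ dis le)

  -- If x waits, the other token can walk up to any node whose key is at most that of x.
  advance : ∀ {st kp rt b a B x y e} → Reach st kp rt b a x y → Via st rt B y e →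
            key e ≤ key x → Reach st kp rt b a x e
  advance r here le = r
  advance r (step _ my y≢t o v) le =
    advance (swap (move (swap r) my y≢t o
              (<-≤-trans (out-key y≢t o) (≤-trans (via-key v) le)))) v le

  -- The arc kept by x can be discarded after a success, as nothing more leaves its head.
  Settled : (kp : ℕ → ℕ) (cur : ℕ → List ℕ) → ℕ → Set
  Settled kp cur x = hd (kp x) ≢ t × cur (hd (kp x)) ≡ []

  -- The three ways in which a kept arc is accounted for in a success: by then the sink is the only
  -- root, the kept arc of a listed node of the second kind is on the paths found, and a settled arc
  -- can be discarded.
  Kstar : (st kp rt : ℕ → ℕ) (cur : ℕ → List ℕ) (C L : List ℕ) (b a : ℕ) → Set
  Kstar st kp rt cur C L b a = ∀ {x} → Marked st x → x ≢ t → kp x ≢ 0 →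
    x ∈ C ⊎ (x ∈ L × (rt x ≡ kp x ⊎ Reach st kp rt b a x x)) ⊎ Settled kp cur x

  -- The invariant of a search

  -- Nodes already passed by a token of the search whose current node is x: they
  -- do not lie below the segment in which the tokens are going to meet.
  Good : (st pos : ℕ → ℕ) (C L : List ℕ) (x y : ℕ) → Set
  Good st pos C L x y = y ∈ L ⊎ y ≡ x ⊎
    (st y ≡ 2 × (∀ {ρ} → ρ ∈ C → (st x ≡ 2 → pos ρ ≤ pos x) → pos ρ ≤ pos y))

  -- L holds the unfinished nodes by decreasing key; r is the root of the segment
  -- to which the search has come down.
  record Listed (st pos kp rt : ℕ → ℕ) (r : ℕ) (P L : List ℕ) (b a x : ℕ) : Set where
    field
      L1      : ∀ {n} → st n ≡ 1 → n ∈ L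
      L-mark  : ∀ {n} → n ∈ L → Marked st n
      L≢t     : ∀ {n} → n ∈ L → n ≢ t
      L-sort  : AllPairs (λ u w → key w < key u) L
      L-r     : ∀ {n} → n ∈ L → key n < key r
      L-pos   : ∀ {n} → n ∈ L → st n ≡ 2 → pos r < pos n
      L-Q     : ∀ {n} → n ∈ L → st n ≡ 1 → kp n ≢ 0 →
                Out n (kp n) × st (hd (kp n)) ≡ 2 × pos r ≤ pos (hd (kp n))
      rt-good : ∀ {n} → n ∈ L → Good st pos (r ∷ P) L x (hd (rt n))
      b-good  : Good st pos (r ∷ P) L x b
      a-vis   : st a ≡ 2
      a-pos   : pos r ≤ pos a
      passed  : ∀ {n} → n ∈ L → ∃[ y ] (Reach st kp rt b a n y × key n ≤ key y ×
                  (y ≡ n ⊎ Good st pos (r ∷ P) L x y))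
      x-st    : st x ≡ 0 ⊎ st x ≡ 2
      x<N     : x < N

  -- Moves along kept arcs are not simulated: the program still holds `x` when the token has
  -- advanced to `x̂`. It may do so as long as it does not fall below a root that is at or below
  -- `x`.
  data Token (st pos : ℕ → ℕ) (C : List ℕ) (x : ℕ) : ℕ → Set where
    new : st x ≡ 0 → Token st pos C x x
    old : ∀ {x̂} → st x ≡ 2 → st x̂ ≡ 2 → pos x̂ ≤ pos x →
          (∀ {ρ} → ρ ∈ C → pos ρ ≤ pos x → pos ρ ≤ pos x̂) → Token st pos C x x̂

  -- Going forward, `ŷ` is the position of the waiting token, known only to be at or above `r`. On
  -- the retreat no common position is recorded; each listed node has its own in `passed`.
  data Phase (st pos kp rt : ℕ → ℕ) (cur : ℕ → List ℕ) (r : ℕ) (P L : List ℕ) (b a x : ℕ) : Set where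
    forward : ∀ {x̂ ŷ} → Reach st kp rt b a x̂ ŷ → Token st pos (r ∷ P) x x̂ →
              st ŷ ≡ 2 → pos r ≤ pos ŷ →
              (∀ {n} → n ∈ L → key n < key x̂ × key n < key ŷ) →
              Phase st pos kp rt cur r P L b a x
    back    : st x ≡ 2 → pos r ≤ pos x → cur r ≡ [] → r ≢ t → Phase st pos kp rt cur r P L b a x

  record InvF (m : Mem) (r : ℕ) (P L : List ℕ) (b a x : ℕ) : Set where
    open Mem m
    field
      forest : Forest st pos kp S (r ∷ P)
      arcs   : Arcs st dl cur inn
      clean  : Clean st dl cur
      routes : Routes st kp rt dl
      tight  : Tight st kp rt cur (r ∷ P) L
      kstar  : Kstar st kp rt cur (r ∷ P) L b a
      listed : Listed st pos kp rt r P L b a x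
      phase  : Phase st pos kp rt cur r P L b a x
    open Forest forest public
    open Arcs arcs public
    open Clean clean public
    open Routes routes public
    open Tight tight public
    open Listed listed public

  -- Chains of kept arcs and descents past a root

  chain-frame : ∀ {st pos kp kp′ S C x ρ} → Forest st pos kp S C →
    (∀ {u} → st u ≡ 2 → kp′ u ≡ kp u) → st x ≡ 2 → Chain kp x ρ → Chain kp′ x ρ
  chain-frame f eq v here = here
  chain-frame {kp′ = kp′} {ρ = ρ} f eq v (step x≢t c) =
    step x≢t (subst (λ e → Chain kp′ (hd e) ρ) (sym (eq v))
                    (chain-frame f eq (Forest.kp-vis f v x≢t) c))

  forest-frame : ∀ {st pos kp st′ kp′ S C} → Forest st pos kp S C →
    (∀ {u} → st′ u ≡ 2 → st u ≡ 2) → (∀ {u} → st u ≡ 2 → st′ u ≡ 2) →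
    (∀ {u} → st u ≡ 2 → kp′ u ≡ kp u) → Forest st′ pos kp′ S C
  forest-frame {pos = pos} {st′ = st′} f to from eq = record
    { stacked = stacked ; pos-t = pos-t
    ; vis-S = λ v → vis-S (to v) ; S-vis = λ x∈ → from (S-vis x∈) ; S<N = S<N
    ; kp-out = λ {x} v x≢t → subst (Out x) (sym (eq (to v))) (kp-out (to v) x≢t)
    ; kp-vis = λ v x≢t → subst (λ e → st′ (hd e) ≡ 2) (sym (eq (to v))) (from (kp-vis (to v) x≢t))
    ; kp-pos = λ {x} v x≢t → subst (λ e → pos (hd e) < pos x) (sym (eq (to v))) (kp-pos (to v) x≢t)
    ; C-vis = λ x∈ → from (C-vis x∈) ; t∈C = t∈C ; C-pos = C-pos
    ; thru = λ v ρ∈ le → chain-frame f eq (to v) (thru (to v) ρ∈ le) }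
    where open Forest f

  -- Tokens follow `rt`, chains follow `kp`. Agreement is asked only strictly above `ρ`, up to
  -- height `k` and from `key y` upwards, because listed nodes elsewhere may be trying other arcs.
  chain-via : ∀ {st pos kp rt dl S C y ρ k} → Forest st pos kp S C → Routes st kp rt dl →
    st y ≡ 2 → pos y ≤ k → Chain kp y ρ →
    (∀ {u} → st u ≡ 2 → u ≢ t → pos ρ < pos u → pos u ≤ k → key y ≤ key u → rt u ≡ kp u) →
    Via st rt (λ u → st u ≡ 2 × pos ρ < pos u × pos u ≤ k) y ρ
  chain-via f ro v le here eq = here
  chain-via {st} {pos} {kp} {rt} {y = y} {ρ} {k} f ro v le (step y≢t c) eq =
    step (v , ρ<y , le) (inj₂ v) y≢t (Routes.rt-out ro (inj₂ v) y≢t)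
      (subst (λ e → Via st rt _ (hd e) ρ) (sym (eq v y≢t ρ<y le ≤-refl))
        (chain-via f ro (kp-vis v y≢t) (≤-trans (<⇒≤ (kp-pos v y≢t)) le) c
          (λ vu u≢t ρ<u u≤k le′ → eq vu u≢t ρ<u u≤k (≤-trans (<⇒≤ (kp-key v y≢t)) le′))))
    where
    open Forest f
    ρ<y : pos ρ < pos y
    ρ<y = ≤-<-trans (chain-pos (kp-vis v y≢t) c) (kp-pos v y≢t)

  forest-tail : ∀ {st pos kp S r P} → Forest st pos kp S (r ∷ P) → r ≢ t → Forest st pos kp S P
  forest-tail {r = r} {P} f r≢t = record
    { stacked = stacked ; pos-t = pos-t ; vis-S = vis-S ; S-vis = S-vis ; S<N = S<N
    ; kp-out = kp-out ; kp-vis = kp-vis ; kp-pos = kp-pos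
    ; C-vis = λ x∈ → C-vis (there x∈) ; t∈C = tail t∈C ; C-pos = tl-pairs C-pos
    ; thru = λ v ρ∈ → thru v (there ρ∈) }
    where
    open Forest f
    tail : t ∈ r ∷ P → t ∈ P
    tail (here t≡r) = ⊥-elim (r≢t (sym t≡r))
    tail (there t∈) = t∈
    tl-pairs : ∀ {R : ℕ → ℕ → Set} {x xs} → AllPairs R (x ∷ xs) → AllPairs R xs
    tl-pairs (_ ∷ ps) = ps

  -- Exists because the sink is a root of height 0.
  root-below : ∀ {st pos kp S C} → Forest st pos kp S C → ∀ p →
    ∃[ d ] (d ∈ C × pos d ≤ p × (∀ {ρ} → ρ ∈ C → pos ρ ≤ p → pos ρ ≤ pos d))
  root-below {pos = pos} {C = C} f p = go C t∈C C-pos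
    where
    open Forest f
    go : ∀ D → t ∈ D → AllPairs (λ x y → pos y < pos x) D →
         ∃[ d ] (d ∈ D × pos d ≤ p × (∀ {ρ} → ρ ∈ D → pos ρ ≤ p → pos ρ ≤ pos d))
    go (x ∷ D) t∈ (al ∷ ps) with pos x ≤? p
    ... | yes le = x , here refl , le , λ { (here refl) _ → ≤-refl
                                          ; (there ρ∈) _ → <⇒≤ (All.lookup al ρ∈) }
    ... | no gt with t∈
    ...   | here refl = contradiction (≤-trans (≤-reflexive pos-t) z≤n) gt
    ...   | there t∈D with go D t∈D ps
    ...     | d , d∈ , le , best = d , there d∈ , le ,
              λ { (here refl) le′ → contradiction le′ gt ; (there ρ∈) le′ → best ρ∈ le′ }

  good-move : ∀ {st pos r P L x y} → Good st pos (r ∷ P) L x y → Good st pos P (r ∷ L) x y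
  good-move (inj₁ y∈)              = inj₁ (there y∈)
  good-move (inj₂ (inj₁ eq))       = inj₂ (inj₁ eq)
  good-move (inj₂ (inj₂ (v , le))) = inj₂ (inj₂ (v , λ ρ∈ → le (there ρ∈)))

  module RootStep {m r ρ P L b a x} (i : InvF m r (ρ ∷ P) L b a x) (r≢t : r ≢ t) where
    open Mem m
    open InvF i

    r-vis : st r ≡ 2
    r-vis = C-vis (here refl)

    ρ<r : pos ρ < pos r
    ρ<r with C-pos
    ... | al ∷ _ = All.lookup al (here refl)

    r→ρ : r ≢ t × Chain kp (hd (kp r)) ρ
    r→ρ = chain-next (thru r-vis (there (here refl)) (<⇒≤ ρ<r)) (λ { refl → <-irrefl refl ρ<r })

    next-vis : st (hd (kp r)) ≡ 2
    next-vis = kp-vis r-vis r≢t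

    next-pos : pos ρ ≤ pos (hd (kp r))
    next-pos = chain-pos next-vis (proj₂ r→ρ)

    P-below : ∀ {ρ′} → ρ′ ∈ ρ ∷ P → pos ρ′ ≤ pos ρ
    P-below (here refl) = ≤-refl
    P-below (there ρ∈) with C-pos
    ... | _ ∷ (al ∷ _) = <⇒≤ (All.lookup al ρ∈)

    rt-r : rt r ≡ kp r
    rt-r = C-rt (here refl)

    -- Only listed nodes may have a route other than the kept arc, and their keys are too small for
    -- them to lie on the way.
    below-r : ∀ {ŷ} → st ŷ ≡ 2 → pos r ≤ pos ŷ → (∀ {n} → n ∈ L → key n < key ŷ) →
      Via st rt (λ u → st u ≡ 2 × pos r < pos u × pos u ≤ pos ŷ) ŷ r
    below-r v le ab = chain-via forest routes v ≤-refl (thru v (here refl) le)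
      (λ vu u≢t _ _ le′ → rt≡kp vu u≢t (λ u∈L → <⇒≱ (ab u∈L) le′))

    leave-r : ∀ {x′} → Reach st kp rt b a x′ r → key r < key x′ →
      Reach st kp rt b a x′ (hd (kp r))
    leave-r {x′} R lt = subst (λ e → Reach st kp rt b a x′ (hd e)) rt-r
      (swap (move (swap R) (inj₂ r-vis) r≢t (rt-out (inj₂ r-vis) r≢t) lt))

    key-L : ∀ {k} → key r < k → ∀ {n} → n ∈ r ∷ L → key n < k × key n < key (hd (kp r))
    key-L lt (here refl) = lt , kp-key r-vis r≢t
    key-L lt (there n∈) = <-trans (L-r n∈) lt , <-trans (L-r n∈) (kp-key r-vis r≢t)

    r<ρ : key r < key ρ
    r<ρ = <-≤-trans (kp-key r-vis r≢t) (chain-key next-vis (proj₂ r→ρ))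

  -- The hypotheses `above₀` and `above₂` reflect the tests of the program. Either of them ensures
  -- that the waiting token can reach `r` and leave it before the other token needs to act beyond
  -- its own segment.
  module MoveStep {m r ρ P L b a x} (i : InvF m r (ρ ∷ P) L b a x) (r≢t : r ≢ t)
    (above₀ : Mem.st m x ≡ 0 → key r ≤ key x)
    (above₂ : Mem.st m x ≡ 2 → Mem.pos m x < Mem.pos m r) where
    open Mem m
    open InvF i
    open RootStep i r≢t

    result : (∃[ y ] (Reach st kp rt b a r y × key r ≤ key y ×
                       (y ≡ r ⊎ Good st pos (ρ ∷ P) (r ∷ L) x y))) ×
             Phase st pos kp rt cur ρ P (r ∷ L) b a x
    result with phase
    ... | back v le _ _ = contradiction (above₂ v) (≤⇒≯ le)
    -- `x` is fresh and comes after `r`, so only the waiting token moves.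
    ... | forward {ŷ = ŷ} R (new fr) v le ab =
      (_ , swap R₁ , above₀ fr , inj₂ (inj₂ (inj₁ refl))) ,
      forward (leave-r R₁ r<x) (new fr) next-vis next-pos (key-L r<x)
      where
      R₁ : Reach st kp rt b a x r
      R₁ = advance R (below-r v le (λ n∈ → proj₂ (ab n∈))) (above₀ fr)
      r<x : key r < key x
      r<x = ≤∧≢⇒< (above₀ fr) (λ eq → differ (key-inj (vis<N r-vis) x<N eq))
        where
        differ : r ≢ x
        differ refl = contradiction (trans (sym r-vis) fr) λ()
    -- Both tokens are on the stack: one walks to `r`, the other towards the root `d` of the segment
    -- of `x`. The heights keep the two walks apart, and `r` precedes `d` in key because its chain
    -- passes `d`.
    ... | forward {x̂ = x̂} {ŷ} R (old vx vx̂ x̂≤x deep) v le ab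
      with root-below forest (pos x)
    ...   | d , d∈ , d≤x , best
      with interleave (swap R) (below-r v le (λ n∈ → proj₂ (ab n∈)))
             (chain-via forest routes vx̂ ≤-refl (thru vx̂ d∈ (deep d∈ d≤x))
               (λ {u} vu u≢t _ u≤x̂ _ → rt≡kp vu u≢t (λ u∈L →
                 <⇒≱ (<-trans (above₂ vx) (L-pos u∈L vu)) (≤-trans u≤x̂ x̂≤x))))
             (λ (vu , r<u , _) (vw , _ , w≤) eq → differ vu vw r<u w≤ (key-inj (vis<N vu) (vis<N vw) eq))
             (chain-key r-vis (thru r-vis d∈ (≤-trans d≤x (<⇒≤ (above₂ vx)))))
      where
      differ : ∀ {u w} → st u ≡ 2 → st w ≡ 2 → pos r < pos u → pos w ≤ pos x̂ → u ≢ w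
      differ _ _ r<u w≤ refl = <⇒≱ (<-trans (above₂ vx) r<u) (≤-trans w≤ x̂≤x)
    ...     | x′ , R₁ , r≤x′ , via =
      (x′ , R₁ , r≤x′ , inj₂ (inj₂ (inj₂ (vx′ , λ ρ∈ le′ →
          ≤-trans (best (there ρ∈) (le′ vx)) d≤x′)))) ,
      forward (leave-r (swap R₁) r<x′) (old vx vx′ (≤-trans x′≤x̂ x̂≤x)
                 (λ ρ∈ le′ → ≤-trans (best (there ρ∈) le′) d≤x′))
              next-vis next-pos (key-L r<x′)
      where
      via-end : ∀ {y} → Via st rt (λ u → st u ≡ 2 × pos d < pos u × pos u ≤ pos x̂) y d →
                st y ≡ 2 × pos d ≤ pos y × pos y ≤ pos x̂
      via-end here = C-vis d∈ , ≤-refl , deep d∈ d≤x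
      via-end (step (v , lt , le) _ _ _ _) = v , <⇒≤ lt , le
      vx′ : st x′ ≡ 2
      vx′ = proj₁ (via-end via)
      d≤x′ : pos d ≤ pos x′
      d≤x′ = proj₁ (proj₂ (via-end via))
      x′≤x̂ : pos x′ ≤ pos x̂
      x′≤x̂ = proj₂ (proj₂ (via-end via))
      r<x′ : key r < key x′
      r<x′ = ≤∧≢⇒< r≤x′ (λ eq → apart (key-inj (vis<N r-vis) (vis<N vx′) eq))
        where
        apart : r ≢ x′
        apart refl = <⇒≱ (above₂ vx) (≤-trans x′≤x̂ x̂≤x)

    moved : InvF m ρ P (r ∷ L) b a x
    moved = record
      { forest = forest-tail forest r≢t
      ; arcs = arcs ; clean = clean ; routes = routes
      ; tight = record
        { exh = λ v x≢t x∉ x∉L → exh v x≢t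
            (λ { (here refl) → x∉L (here refl) ; (there x∈) → x∉ x∈ }) (λ x∈ → x∉L (there x∈))
        ; C-rt = λ x∈ → C-rt (there x∈) }
      ; kstar = λ mk x≢t k≢0 → star (kstar mk x≢t k≢0)
      ; listed = record
        { L1 = λ eq → there (L1 eq)
        ; L-mark = λ { (here refl) → inj₂ r-vis ; (there n∈) → L-mark n∈ }
        ; L≢t = λ { (here refl) → r≢t ; (there n∈) → L≢t n∈ }
        ; L-sort = All.tabulate (λ n∈ → L-r n∈) ∷ L-sort
        ; L-r = λ { (here refl) → r<ρ ; (there n∈) → <-trans (L-r n∈) r<ρ }
        ; L-pos = λ { (here refl) _ → ρ<r ; (there n∈) v → <-trans ρ<r (L-pos n∈ v) }
        ; L-Q = λ { (here refl) q → contradiction (trans (sym r-vis) q) λ()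
                  ; (there n∈) q k → let o , v , le = L-Q n∈ q k in o , v , ≤-trans (<⇒≤ ρ<r) le }
        ; rt-good = λ { (here refl) → subst (λ e → Good st pos (ρ ∷ P) (r ∷ L) x (hd e)) (sym rt-r)
                          (inj₂ (inj₂ (next-vis , λ ρ∈ _ → ≤-trans (P-below ρ∈) next-pos)))
                      ; (there n∈) → shift (rt-good n∈) }
        ; b-good = shift b-good
        ; a-vis = a-vis
        ; a-pos = ≤-trans (<⇒≤ ρ<r) a-pos
        ; passed = λ { (here refl) → proj₁ result
                     ; (there n∈) → let y , R , le , g = passed n∈ in y , R , le , weaken g }
        ; x-st = x-st ; x<N = x<N }
      ; phase = proj₂ result }
      where
      shift : ∀ {y} → Good st pos (r ∷ ρ ∷ P) L x y → Good st pos (ρ ∷ P) (r ∷ L) x y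
      shift = good-move {st} {pos}
      weaken : ∀ {y n} → y ≡ n ⊎ Good st pos (r ∷ ρ ∷ P) L x y → y ≡ n ⊎ Good st pos (ρ ∷ P) (r ∷ L) x y
      weaken (inj₁ eq) = inj₁ eq
      weaken (inj₂ g)  = inj₂ (shift g)
      star : ∀ {n} → n ∈ r ∷ ρ ∷ P ⊎ (n ∈ L × (rt n ≡ kp n ⊎ Reach st kp rt b a n n)) ⊎ Settled kp cur n →
             n ∈ ρ ∷ P ⊎ (n ∈ r ∷ L × (rt n ≡ kp n ⊎ Reach st kp rt b a n n)) ⊎ Settled kp cur n
      star (inj₁ (here refl))       = inj₂ (inj₁ (here refl , inj₁ rt-r))
      star (inj₁ (there n∈))        = inj₁ n∈
      star (inj₂ (inj₁ (n∈ , how))) = inj₂ (inj₁ (there n∈ , how))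
      star (inj₂ (inj₂ s))          = inj₂ (inj₂ s)

  -- Steps of the tokens

  0≢1 : ∀ {n : ℕ} → n ≡ 0 → n ≢ 1
  0≢1 refl ()

  0≢2 : ∀ {n : ℕ} → n ≡ 0 → n ≢ 2
  0≢2 refl ()

  1≢2 : ∀ {n : ℕ} → n ≡ 1 → n ≢ 2
  1≢2 refl ()

  mark≢0 : ∀ {k : ℕ} → k ≡ 1 ⊎ k ≡ 2 → k ≢ 0
  mark≢0 (inj₁ eq) eq′ = 0≢1 eq′ eq
  mark≢0 (inj₂ eq) eq′ = 0≢2 eq′ eq

  mark≢3 : ∀ {k : ℕ} → k ≡ 1 ⊎ k ≡ 2 → k ≢ 3
  mark≢3 (inj₁ eq) eq′ = contradiction (trans (sym eq) eq′) λ()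
  mark≢3 (inj₂ eq) eq′ = contradiction (trans (sym eq) eq′) λ()

  arcs-st : ∀ {st st′ dl cur inn} → Arcs st dl cur inn →
    (∀ {u} → st′ u ≢ 3 → st u ≢ 3) → (∀ u → st′ u ≤ 3) → (∀ {u} → st′ u ≢ 0 → u < N) →
    Arcs st′ dl cur inn
  arcs-st A f le n = record
    { cur-out = cur-out ; inn-in = inn-in ; av-cur = av-cur
    ; av-inn = λ arc av ne → av-inn arc av (f ne) ; st-≤ = le ; st-N = n }
    where open Arcs A

  arcs-pop : ∀ {st dl cur inn x c cs} → Arcs st dl cur inn → cur x ≡ c ∷ cs →
    Arcs st (update dl c 1) (update cur x cs) inn
  arcs-pop {st} {dl} {cur} {inn} {x} {c} {cs} A eq = record
    { cur-out = λ {y} {e} → update-if cur x cs y (λ es → e ∈ es → Out y e)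
        (λ { refl e∈ → cur-out (subst (e ∈_) (sym eq) (there e∈)) }) (λ _ → cur-out)
    ; inn-in = inn-in
    ; av-cur = λ {e} arc av → update-if cur x cs (tl e) (e ∈_)
        (λ tl≡x → drop e arc tl≡x av (subst (e ∈_) (trans (cong cur tl≡x) eq) (av-cur arc (was e av))))
        (λ _ → av-cur arc (was e av))
    ; av-inn = λ {e} arc av → av-inn arc (was e av)
    ; st-≤ = st-≤ ; st-N = st-N }
    where
    open Arcs A
    was : ∀ e → update dl c 1 e ≡ 0 → dl e ≡ 0
    was e = update-if dl c 1 e (λ d → d ≡ 0 → dl e ≡ 0) (λ _ ()) (λ _ z → z)
    drop : ∀ e → Arc e → tl e ≡ x → update dl c 1 e ≡ 0 → e ∈ c ∷ cs → e ∈ cs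
    drop e _ _ av (here refl) = contradiction (trans (sym (update-same dl c 1)) av) λ()
    drop e _ _ av (there e∈)  = e∈

  arcs-skip : ∀ {st dl cur inn x c cs} → Arcs st dl cur inn → cur x ≡ c ∷ cs → dl c ≢ 0 →
    Arcs st dl (update cur x cs) inn
  arcs-skip {st} {dl} {cur} {inn} {x} {c} {cs} A eq nz = record
    { cur-out = λ {y} {e} → update-if cur x cs y (λ es → e ∈ es → Out y e)
        (λ { refl e∈ → cur-out (subst (e ∈_) (sym eq) (there e∈)) }) (λ _ → cur-out)
    ; inn-in = inn-in
    ; av-cur = λ {e} arc av → update-if cur x cs (tl e) (e ∈_)
        (λ tl≡x → drop e av (subst (e ∈_) (trans (cong cur tl≡x) eq) (av-cur arc av)))
        (λ _ → av-cur arc av)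
    ; av-inn = av-inn ; st-≤ = st-≤ ; st-N = st-N }
    where
    open Arcs A
    drop : ∀ e → dl e ≡ 0 → e ∈ c ∷ cs → e ∈ cs
    drop e av (here refl) = contradiction av nz
    drop e av (there e∈)  = e∈

  clean-pop : ∀ {st st′ dl cur inn x c cs} → Clean st dl cur → Arcs st dl cur inn → Out x c →
    (∀ {u} → st′ u ≡ 0 → st u ≡ 0 × u ≢ x) → (∀ {u} → st′ u ≢ 3 → st u ≢ 3) →
    (∀ {u} → st u ≢ 3 → st′ u ≢ 3) → Clean st′ (update dl c 1) (update cur x cs)
  clean-pop {st} {st′} {dl} {cur} {x = x} {c} {cs} C A out f g h = record
    { nd = λ {e} arc av ne tl≢t → h (nd arc (was e av) (g ne) tl≢t)
    ; fresh = fr }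
    where
    open Clean C
    was : ∀ e → update dl c 1 e ≡ 0 → dl e ≡ 0
    was e = update-if dl c 1 e (λ d → d ≡ 0 → dl e ≡ 0) (λ _ ()) (λ _ z → z)
    fr : ∀ {u} → u < N → st′ u ≡ 0 →
         ∃[ d ] ∃[ ds ] (update cur x cs u ≡ d ∷ ds × update dl c 1 d ≡ 0)
    fr {u} u<N eq with f eq
    ... | eq₀ , u≢x with fresh u<N eq₀
    ...   | d , ds , eqc , av = d , ds , trans (update-other cur x cs u≢x) eqc ,
            trans (update-other dl c 1 (λ { refl → u≢x
              (trans (sym (proj₂ (Arcs.cur-out A (subst (d ∈_) (sym eqc) (here refl))))) (proj₂ out)) })) av

  clean-skip : ∀ {st dl cur x cs} → Clean st dl cur → st x ≢ 0 → Clean st dl (update cur x cs)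
  clean-skip {st} {dl} {cur} {x} {cs} C nz = record { nd = nd ; fresh = fr }
    where
    open Clean C
    fr : ∀ {u} → u < N → st u ≡ 0 → ∃[ d ] ∃[ ds ] (update cur x cs u ≡ d ∷ ds × dl d ≡ 0)
    fr {u} u<N eq with fresh u<N eq
    ... | d , ds , eqc , av = d , ds , trans (update-other cur x cs (λ { refl → nz eq })) eqc , av

  dl-up : ∀ dl {c e} → dl e ≢ 0 → update dl c 1 e ≢ 0
  dl-up dl {c} {e} nz = update-if dl c 1 e (_≢ 0) (λ _ ()) (λ _ → nz)

  routes-pop : ∀ {st st′ kp kp′ rt dl x c} → Routes st kp rt dl → Out x c →
    (∀ {u} → u ≢ x → Marked st′ u → Marked st u) → (∀ {u} → u ≢ x → kp′ u ≡ kp u) →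
    (kp′ x ≢ 0 → dl (kp′ x) ≢ 0) → Routes st′ kp′ (update rt x c) (update dl c 1)
  routes-pop {st} {st′} {kp} {kp′} {rt} {dl} {x} {c} R out f k kx = record
    { rt-out = λ {u} mk u≢t → update-if rt x c u (Out u) (λ { refl → out }) (λ u≢x → rt-out (f u≢x mk) u≢t)
    ; rt-dl = λ {u} mk u≢t → update-if rt x c u (λ e → update dl c 1 e ≢ 0)
        (λ _ eq → contradiction (trans (sym (update-same dl c 1)) eq) λ())
        (λ u≢x → dl-up dl (rt-dl (f u≢x mk) u≢t))
    ; kp-dl = kd }
    where
    open Routes R
    kd : ∀ {u} → Marked st′ u → u ≢ t → kp′ u ≢ 0 → update dl c 1 (kp′ u) ≢ 0
    kd {u} mk u≢t nz with u ≟ x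
    ... | yes refl = dl-up dl (kx nz)
    ... | no u≢x   = dl-up dl (subst (λ e → dl e ≢ 0) (sym (k u≢x))
                       (kp-dl (f u≢x mk) u≢t (λ z → nz (trans (k u≢x) z))))

  reach-update : ∀ {st kp rt st′ kp′ rt′ b a x n y} → key n ≤ key x →
    (∀ {u} → u ≢ x → Marked st u → Marked st′ u × kp′ u ≡ kp u × rt′ u ≡ rt u) →
    Reach st kp rt b a n y → Reach st′ kp′ rt′ b a n y
  reach-update le f = reach-frame λ mk u<n _ → f (λ { refl → <⇒≱ u<n le }) mk

  settled-pop : ∀ (cur : ℕ → List ℕ) {x c cs h} → cur x ≡ c ∷ cs → cur h ≡ [] →
    update cur x cs h ≡ []
  settled-pop cur {x} {c} {cs} eq z =
    trans (update-other cur x cs (λ { refl → contradiction (trans (sym z) eq) λ() })) z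

  module _ {m r P L b a x} (i : InvF m r P L b a x) where
    open Mem m
    open InvF i

    roots-≤ : ∀ {ρ} → ρ ∈ r ∷ P → pos ρ ≤ pos r
    roots-≤ (here refl) = ≤-refl
    roots-≤ (there ρ∈) with C-pos
    ... | al ∷ _ = <⇒≤ (All.lookup al ρ∈)

    r-visited : st r ≡ 2
    r-visited = C-vis (here refl)

    L∌C : ∀ {n} → n ∈ L → n ∉ r ∷ P
    L∌C n∈ n∈C = <⇒≱ (L-pos n∈ (C-vis n∈C)) (roots-≤ n∈C)

    top-max : ∀ {v L′ n} → L ≡ v ∷ L′ → n ∈ L → key n ≤ key v
    top-max refl (here refl) = ≤-refl
    top-max refl (there n∈) with L-sort
    ... | al ∷ _ = <⇒≤ (All.lookup al n∈)

    -- The head of an available arc out of a node y that is not below the listed nodes.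
    head-status : ∀ {y c} → Out y c → y ≢ t → dl c ≡ 0 → st y ≢ 3 →
      (∀ {n} → n ∈ L → key n ≤ key y) → st (hd c) ≡ 0 ⊎ st (hd c) ≡ 2
    head-status {y} {c} (arc , refl) y≢t av ne ab with st (hd c) in eq | st-≤ (hd c)
    ... | 0 | _ = inj₁ refl
    ... | 1 | _ = contradiction (out-key y≢t (arc , refl)) (≤⇒≯ (ab (L1 eq)))
    ... | 2 | _ = inj₂ refl
    ... | 3 | _ = contradiction eq (nd arc av ne y≢t)
    ... | suc (suc (suc (suc _))) | s≤s (s≤s (s≤s ()))

    token-at : ∀ {st′ y C} → st′ y ≡ 0 ⊎ st′ y ≡ 2 → Token st′ pos C y y
    token-at (inj₁ z) = new z
    token-at (inj₂ v) = old v v ≤-refl (λ _ le → le)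

    skip-arc : ∀ {y c cs} → cur y ≡ c ∷ cs → dl c ≢ 0 → st y ≢ 0 →
      InvF (record m { cur = update cur y cs }) r P L b a x
    skip-arc {y} {c} {cs} eq nz ne = record
      { forest = forest ; arcs = arcs-skip arcs eq nz ; clean = clean-skip clean ne
      ; routes = routes
      ; tight = record
        { exh = λ v x≢t x∉C x∉L → let z , e = exh v x≢t x∉C x∉L in settled-pop cur eq z , e
        ; C-rt = C-rt }
      ; kstar = λ mk x≢t k → star (kstar mk x≢t k)
      ; listed = listed
      ; phase = ph phase }
      where
      star : ∀ {n} → n ∈ r ∷ P ⊎ (n ∈ L × (rt n ≡ kp n ⊎ Reach st kp rt b a n n)) ⊎ Settled kp cur n →
             n ∈ r ∷ P ⊎ (n ∈ L × (rt n ≡ kp n ⊎ Reach st kp rt b a n n)) ⊎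
             Settled kp (update cur y cs) n
      star (inj₁ z)                  = inj₁ z
      star (inj₂ (inj₁ z))           = inj₂ (inj₁ z)
      star (inj₂ (inj₂ (h≢t , z)))   = inj₂ (inj₂ (h≢t , settled-pop cur eq z))
      ph : Phase st pos kp rt cur r P L b a x → Phase st pos kp rt (update cur y cs) r P L b a x
      ph (forward R T v le ab) = forward R T v le ab
      ph (back v le z r≢t)     = back v le (settled-pop cur eq z) r≢t

    -- The waiting token first runs towards `r` until its key is at least that of `x`; then `x` is
    -- the one to move, by its first arc. The kept arc is set to 0, as it is not yet known where the
    -- walks from `x` land.
    push-node : ∀ {c cs} → st x ≡ 0 → key x < key r → cur x ≡ c ∷ cs → dl c ≡ 0 →
      InvF (record m { st = update st x 1 ; kp = update kp x 0 ; rt = update rt x c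
                     ; dl = update dl c 1 ; cur = update cur x cs })
           r P (x ∷ L) b a (hd c)
    push-node {c} {cs} fr x<r eqc av with phase
    ... | back v _ _ _ = ⊥-elim (0≢2 fr v)
    ... | forward R (old v _ _ _) _ _ _ = ⊥-elim (0≢2 fr v)
    ... | forward {ŷ = ŷ} R (new _) vŷ ŷ≥ ab
      with interleave {A = λ _ → ⊥} R here
             (chain-via forest routes vŷ ≤-refl (thru vŷ (here refl) ŷ≥)
               (λ {u} vu u≢t _ _ le → rt≡kp vu u≢t (λ u∈L → <⇒≱ (proj₂ (ab u∈L)) le)))
             (λ ()) (<⇒≤ x<r)
    ...   | y , R₁ , x≤y , via = record
      { forest = forest-frame forest
          (λ {u} → update-if st x 1 u (λ k → k ≡ 2 → st u ≡ 2) (λ _ ()) (λ _ z → z))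
          (λ {u} v → trans (update-other st x 1 (vis≢x v)) v)
          (λ v → update-other kp x 0 (vis≢x v))
      ; arcs = arcs-st (arcs-pop arcs eqc)
          (λ {u} → update-if st x 1 u (λ k → k ≢ 3 → st u ≢ 3) (λ { refl _ z → contradiction (trans (sym fr) z) λ() })
                             (λ _ z → z))
          (λ u → update-if st x 1 u (_≤ 3) (λ _ → s≤s z≤n) (λ _ → st-≤ u))
          (λ {u} → update-if st x 1 u (λ k → k ≢ 0 → u < N) (λ { refl _ → x<N }) (λ _ → st-N))
      ; clean = clean-pop clean arcs out
          (λ {u} → update-if st x 1 u (λ k → k ≡ 0 → st u ≡ 0 × u ≢ x) (λ _ ()) (λ ne z → z , ne))
          (λ {u} → update-if st x 1 u (λ k → k ≢ 3 → st u ≢ 3) (λ { refl _ z → contradiction (trans (sym fr) z) λ() })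
                             (λ _ z → z))
          (λ {u} ne → update-if st x 1 u (_≢ 3) (λ _ ()) (λ _ → ne))
      ; routes = routes-pop routes out (λ u≢x → unmark u≢x) (λ u≢x → update-other kp x 0 u≢x)
          (λ nz → contradiction (update-same kp x 0) nz)
      ; tight = record
        { exh = λ v u≢t u∉C u∉L → let z , e = exh (vis′ v) u≢t u∉C (u∉L ∘ there)
                                      u≢x = u∉L ∘ here in
                settled-pop cur eqc z ,
                trans (update-other rt x c u≢x) (trans e (sym (update-other kp x 0 u≢x)))
        ; C-rt = λ u∈C → let u≢x = vis≢x (C-vis u∈C) in
                trans (update-other rt x c u≢x) (trans (C-rt u∈C) (sym (update-other kp x 0 u≢x))) }
      ; kstar = star
      ; listed = record
        { L1 = λ {n} → update-if st x 1 n (λ k → k ≡ 1 → n ∈ x ∷ L) (λ { refl _ → here refl }) (λ _ z → there (L1 z))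
        ; L-mark = λ { (here refl) → inj₁ (update-same st x 1) ; (there n∈) → mark (L≢x n∈) (L-mark n∈) }
        ; L≢t = λ { (here refl) → x≢t ; (there n∈) → L≢t n∈ }
        ; L-sort = All.tabulate (λ n∈ → proj₁ (ab n∈)) ∷ L-sort
        ; L-r = λ { (here refl) → x<r ; (there n∈) → L-r n∈ }
        ; L-pos = λ { (here refl) z → ⊥-elim (1≢2 (update-same st x 1) z)
                    ; (there n∈) z → L-pos n∈ (vis′ z) }
        ; L-Q = λ { (here refl) _ nz → contradiction (update-same kp x 0) nz
                  ; (there n∈) → lq n∈ }
        ; rt-good = λ { (here refl) → inj₂ (inj₁ (cong hd (update-same rt x c)))
                      ; (there n∈) → subst (λ e → Good (update st x 1) pos (r ∷ P) (x ∷ L) (hd c) (hd e))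
                          (sym (update-other rt x c (L≢x n∈))) (good (rt-good n∈)) }
        ; b-good = good b-good
        ; a-vis = trans (update-other st x 1 (vis≢x a-vis)) a-vis
        ; a-pos = a-pos
        ; passed = λ { (here refl) → y , frame ≤-refl R₁ , x≤y , inj₂ (inj₂ (inj₂
                         (trans (update-other st x 1 (vis≢x vy)) vy , λ ρ∈ _ → ≤-trans (roots-≤ ρ∈) r≤y)))
                     ; (there n∈) → let w , Rn , le , g = passed n∈ in
                         w , frame (<⇒≤ (proj₁ (ab n∈))) Rn , le , [ inj₁ , inj₂ ∘ good ]′ g }
        ; x-st = hst
        ; x<N = hd<N (proj₁ out) }
      ; phase = forward
          (subst (λ e → Reach (update st x 1) (update kp x 0) (update rt x c) b a (hd e) y) (update-same rt x c)
            (move {rt = update rt x c} (frame ≤-refl R₁) (inj₁ (update-same st x 1)) x≢t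
                  (subst (Out x) (sym (update-same rt x c)) out) x<y))
          (token-at {st′ = update st x 1} hst)
          (trans (update-other st x 1 (vis≢x vy)) vy) r≤y
          λ { (here refl) → out-key x≢t out , x<y
            ; (there n∈) → <-trans (proj₁ (ab n∈)) (out-key x≢t out) , <-trans (proj₁ (ab n∈)) x<y } }
      where
      out : Out x c
      out = cur-out (subst (c ∈_) (sym eqc) (here refl))
      vis≢x : ∀ {u} → st u ≡ 2 → u ≢ x
      vis≢x v refl = 0≢2 fr v
      x≢t : x ≢ t
      x≢t x≡t = vis≢x t-vis (sym x≡t)
      vis′ : ∀ {u} → update st x 1 u ≡ 2 → st u ≡ 2
      vis′ {u} = update-if st x 1 u (λ k → k ≡ 2 → st u ≡ 2) (λ _ ()) (λ _ z → z)
      L≢x : ∀ {n} → n ∈ L → n ≢ x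
      L≢x n∈ refl = <-irrefl refl (proj₁ (ab n∈))
      mark : ∀ {u} → u ≢ x → Marked st u → Marked (update st x 1) u
      mark u≢x = subst (λ k → k ≡ 1 ⊎ k ≡ 2) (sym (update-other st x 1 u≢x))
      unmark : ∀ {u} → u ≢ x → Marked (update st x 1) u → Marked st u
      unmark u≢x = subst (λ k → k ≡ 1 ⊎ k ≡ 2) (update-other st x 1 u≢x)
      via-end : ∀ {w} → Via st rt (λ u → st u ≡ 2 × pos r < pos u × pos u ≤ pos ŷ) w r →
                st w ≡ 2 × pos r ≤ pos w
      via-end here = r-visited , ≤-refl
      via-end (step (v , lt , _) _ _ _ _) = v , <⇒≤ lt
      vy : st y ≡ 2
      vy = proj₁ (via-end via)
      r≤y : pos r ≤ pos y
      r≤y = proj₂ (via-end via)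
      x<y : key x < key y
      x<y = ≤∧≢⇒< x≤y (λ eq → vis≢x vy (sym (key-inj x<N (vis<N vy) eq)))
      frame : ∀ {n w} → key n ≤ key x → Reach st kp rt b a n w →
              Reach (update st x 1) (update kp x 0) (update rt x c) b a n w
      frame le = reach-update {st′ = update st x 1} {update kp x 0} {update rt x c} le (λ u≢x mk → mark u≢x mk , update-other kp x 0 u≢x , update-other rt x c u≢x)
      hst : update st x 1 (hd c) ≡ 0 ⊎ update st x 1 (hd c) ≡ 2
      hst = subst (λ k → k ≡ 0 ⊎ k ≡ 2)
        (sym (update-other st x 1 (λ eq → <-irrefl (cong key (sym eq)) (out-key x≢t out))))
        (head-status out x≢t av (λ z → contradiction (trans (sym fr) z) λ()) (λ n∈ → <⇒≤ (proj₁ (ab n∈))))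
      good : ∀ {u} → Good st pos (r ∷ P) L x u → Good (update st x 1) pos (r ∷ P) (x ∷ L) (hd c) u
      good (inj₁ u∈)               = inj₁ (there u∈)
      good (inj₂ (inj₁ refl))      = inj₁ (here refl)
      good (inj₂ (inj₂ (v , le)))  =
        inj₂ (inj₂ (trans (update-other st x 1 (vis≢x v)) v , λ ρ∈ _ → le ρ∈ (λ z → ⊥-elim (0≢2 fr z))))
      lq : ∀ {n} → n ∈ L → update st x 1 n ≡ 1 → update kp x 0 n ≢ 0 →
           Out n (update kp x 0 n) × update st x 1 (hd (update kp x 0 n)) ≡ 2 ×
           pos r ≤ pos (hd (update kp x 0 n))
      lq {n} n∈ q nz = subst (λ e → Out n e × update st x 1 (hd e) ≡ 2 × pos r ≤ pos (hd e)) (sym eqk)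
        (let o , v , le = L-Q n∈ (trans (sym (update-other st x 1 (L≢x n∈))) q) (λ z → nz (trans eqk z))
         in o , trans (update-other st x 1 (vis≢x v)) v , le)
        where
        eqk : update kp x 0 n ≡ kp n
        eqk = update-other kp x 0 (L≢x n∈)
      star : Kstar (update st x 1) (update kp x 0) (update rt x c) (update cur x cs) (r ∷ P) (x ∷ L) b a
      star {n} mk n≢t nz with n ≟ x
      ... | yes refl = contradiction (update-same kp x 0) nz
      ... | no n≢x with kstar (unmark n≢x mk) n≢t (λ z → nz (trans (update-other kp x 0 n≢x) z))
      ...   | inj₁ n∈ = inj₁ n∈
      ...   | inj₂ (inj₁ (n∈ , inj₁ e)) = inj₂ (inj₁ (there n∈ , inj₁
                (trans (update-other rt x c n≢x) (trans e (sym (update-other kp x 0 n≢x))))))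
      ...   | inj₂ (inj₁ (n∈ , inj₂ Rn)) = inj₂ (inj₁ (there n∈ , inj₂ (frame (<⇒≤ (proj₁ (ab n∈))) Rn)))
      ...   | inj₂ (inj₂ (h≢t , z)) = inj₂ (inj₂
                (subst (λ e → hd e ≢ t × update cur x cs (hd e) ≡ []) (sym (update-other kp x 0 n≢x))
                  (h≢t , settled-pop cur eqc z)))

  -- Meetings of the tokens

  arc≢0 : ∀ {x e} → Out x e → e ≢ 0
  arc≢0 ((() , _) , _) refl

  -- The search has come to a visited node x of the segment with root r.
  module Meet {m r P L b a x} (i : InvF m r P L b a x)
              (vx : Mem.st m x ≡ 2) (r≤x : Mem.pos m r ≤ Mem.pos m x) where
    open Mem m
    open InvF i

    good-meet : ∀ {y} → Good st pos (r ∷ P) L x y → y ∈ L ⊎ (st y ≡ 2 × pos r ≤ pos y)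
    good-meet (inj₁ y∈)              = inj₁ y∈
    good-meet (inj₂ (inj₁ refl))     = inj₂ (vx , r≤x)
    good-meet (inj₂ (inj₂ (v , le))) = inj₂ (v , le (here refl) (λ _ → r≤x))

    -- Induction along the chain to `r`: the last node before `r` would keep an arc into `r`, and
    -- `Kstar` allows this only if `r` is exhausted and not the sink. So nothing but listed nodes
    -- hangs on a root that is still alive.
    no-hang : (cur r ≡ [] → r ≢ t → ⊥) → ∀ {u} → st u ≡ 2 → pos r ≤ pos u →
      (∀ {n} → n ∈ L → key n < key u) → u ≡ r
    no-hang alive v le ab = go v (thru v (here refl) le) ab
      where
      go : ∀ {u} → st u ≡ 2 → Chain kp u r → (∀ {n} → n ∈ L → key n < key u) → u ≡ r
      go v here ab = refl
      go {u} v (step u≢t c) ab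
        with go (kp-vis v u≢t) c (λ n∈ → <-trans (ab n∈) (kp-key v u≢t))
           | kstar (inj₂ v) u≢t (arc≢0 (kp-out v u≢t))
      ... | h≡r | inj₁ u∈C = contradiction
              (<-≤-trans (subst (λ h → pos h < pos u) h≡r (kp-pos v u≢t)) (roots-≤ i u∈C)) (<-irrefl refl)
      ... | h≡r | inj₂ (inj₁ (u∈L , _)) = contradiction (ab u∈L) (<-irrefl refl)
      ... | h≡r | inj₂ (inj₂ (h≢t , z)) =
        ⊥-elim (alive (subst (λ h → cur h ≡ []) h≡r z) (λ r≡t → h≢t (trans h≡r r≡t)))

    -- No walking is required: by `no-hang`, tokens in the segment of a live root already stand on
    -- the root.
    both-at-root : (cur r ≡ [] → r ≢ t → ⊥) → Reach st kp rt b a r r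
    both-at-root alive with phase
    ... | back _ _ z r≢t = ⊥-elim (alive z r≢t)
    ... | forward R (new z) _ _ _ = ⊥-elim (0≢2 z vx)
    ... | forward R (old _ vx̂ _ deep) vŷ r≤ŷ ab =
      subst₂ (Reach st kp rt b a)
        (no-hang alive vx̂ (deep (here refl) r≤x) (λ n∈ → proj₁ (ab n∈)))
        (no-hang alive vŷ r≤ŷ (λ n∈ → proj₂ (ab n∈))) R

  -- A live root where both tokens stand is left by two arcs: one token tries the new arc, and the
  -- other follows the kept arc towards the next root. The meeting itself is stored in `Kstar`,
  -- since it puts the kept arc on the paths of a later success.
  module SplitStep {m r ρ P L b a x} (i : InvF m r (ρ ∷ P) L b a x) (r≢t : r ≢ t)
    (vx : Mem.st m x ≡ 2) (r≤x : Mem.pos m r ≤ Mem.pos m x)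
    {c cs} (eqc : Mem.cur m r ≡ c ∷ cs) (av : Mem.dl m c ≡ 0) where
    open Mem m
    open InvF i
    open RootStep i r≢t
    open Meet i vx r≤x

    rt₁ dl₁ : ℕ → ℕ
    rt₁ = update rt r c
    dl₁ = update dl c 1

    out : Out r c
    out = cur-out (subst (c ∈_) (sym eqc) (here refl))

    R : Reach st kp rt b a r r
    R = both-at-root (λ z _ → contradiction (trans (sym z) eqc) λ())

    frame : ∀ {n w} → key n ≤ key r → Reach st kp rt b a n w → Reach st kp rt₁ b a n w
    frame le = reach-update {rt′ = rt₁} le (λ u≢r mk → mk , refl , update-other rt r c u≢r)

    L≢r : ∀ {n} → n ∈ L → n ≢ r
    L≢r n∈ refl = <-irrefl refl (L-r n∈)

    P≢r : ∀ {n} → n ∈ ρ ∷ P → n ≢ r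
    P≢r n∈ refl = <⇒≱ ρ<r (P-below n∈)

    good : ∀ {u} → Good st pos (r ∷ ρ ∷ P) L x u → Good st pos (ρ ∷ P) (r ∷ L) (hd c) u
    good g with good-meet g
    ... | inj₁ u∈        = inj₁ (there u∈)
    ... | inj₂ (v , r≤u) = inj₂ (inj₂ (v , λ ρ∈ _ → ≤-trans (roots-≤ i (there ρ∈)) r≤u))

    next : ℕ
    next = hd (kp r)

    hst : st (hd c) ≡ 0 ⊎ st (hd c) ≡ 2
    hst = head-status i out r≢t av (mark≢3 (inj₂ r-vis)) (λ n∈ → <⇒≤ (L-r n∈))

    R₁ : Reach st kp rt₁ b a (hd c) next
    R₁ = subst (λ e → Reach st kp rt₁ b a (hd e) next) (update-same rt r c)
      (split {rt = rt₁} (frame ≤-refl R) (inj₂ r-vis) r≢t (subst (Out r) (sym (update-same rt r c)) out)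
        (kp-out r-vis r≢t)
        -- The two arcs differ because the new one was available while the kept one was reserved.
        (λ eq → kp-dl (inj₂ r-vis) r≢t (arc≢0 (kp-out r-vis r≢t))
          (subst (λ e → dl e ≡ 0) (trans (sym (update-same rt r c)) eq) av)))

    star : Kstar st kp rt₁ (update cur r cs) (ρ ∷ P) (r ∷ L) b a
    star {n} mk n≢t nz with kstar mk n≢t nz
    ... | inj₁ (here refl) = inj₂ (inj₁ (here refl , inj₂ (frame ≤-refl R)))
    ... | inj₁ (there n∈) = inj₁ n∈
    ... | inj₂ (inj₁ (n∈ , inj₁ e)) =
      inj₂ (inj₁ (there n∈ , inj₁ (trans (update-other rt r c (L≢r n∈)) e)))
    ... | inj₂ (inj₁ (n∈ , inj₂ Rn)) = inj₂ (inj₁ (there n∈ , inj₂ (frame (<⇒≤ (L-r n∈)) Rn)))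
    ... | inj₂ (inj₂ (h≢t , z)) = inj₂ (inj₂ (h≢t , settled-pop cur eqc z))

    splitted : InvF (record m { rt = rt₁ ; dl = dl₁ ; cur = update cur r cs }) ρ P (r ∷ L) b a (hd c)
    splitted = record
      { forest = forest-tail forest r≢t
      ; arcs = arcs-pop arcs eqc
      ; clean = clean-pop clean arcs out
          (λ z → z , λ { refl → 0≢2 z r-vis }) (λ z → z) (λ z → z)
      ; routes = routes-pop routes out (λ _ z → z) (λ _ → refl) (kp-dl (inj₂ r-vis) r≢t)
      ; tight = record
        { exh = λ v u≢t u∉C u∉L →
            let z , e = exh v u≢t (λ { (here refl) → u∉L (here refl) ; (there x∈) → u∉C x∈ }) (u∉L ∘ there)
            in settled-pop cur eqc z , trans (update-other rt r c (u∉L ∘ here)) e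
        ; C-rt = λ u∈C → trans (update-other rt r c (P≢r u∈C)) (C-rt (there u∈C)) }
      ; kstar = star
      ; listed = record
        { L1 = λ eq → there (L1 eq)
        ; L-mark = λ { (here refl) → inj₂ r-vis ; (there n∈) → L-mark n∈ }
        ; L≢t = λ { (here refl) → r≢t ; (there n∈) → L≢t n∈ }
        ; L-sort = All.tabulate (λ n∈ → L-r n∈) ∷ L-sort
        ; L-r = λ { (here refl) → r<ρ ; (there n∈) → <-trans (L-r n∈) r<ρ }
        ; L-pos = λ { (here refl) _ → ρ<r ; (there n∈) v → <-trans ρ<r (L-pos n∈ v) }
        ; L-Q = λ { (here refl) q → contradiction (trans (sym r-vis) q) λ()
                  ; (there n∈) q k → let o , v , le = L-Q n∈ q k in o , v , ≤-trans (<⇒≤ ρ<r) le }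
        ; rt-good = λ { (here refl) → inj₂ (inj₁ (cong hd (update-same rt r c)))
                      ; (there n∈) → subst (λ e → Good st pos (ρ ∷ P) (r ∷ L) (hd c) (hd e))
                          (sym (update-other rt r c (L≢r n∈))) (good (rt-good n∈)) }
        ; b-good = good b-good
        ; a-vis = a-vis
        ; a-pos = ≤-trans (<⇒≤ ρ<r) a-pos
        ; passed = λ { (here refl) → r , frame ≤-refl R , ≤-refl , inj₁ refl
                     ; (there n∈) → let y , Rn , le , g = passed n∈ in
                         y , frame (<⇒≤ (L-r n∈)) Rn , le , [ inj₁ , inj₂ ∘ good ]′ g }
        ; x-st = hst
        ; x<N = hd<N (proj₁ out) }
      ; phase = forward R₁ (token-at i hst) next-vis next-pos
          λ { (here refl) → out-key r≢t out , kp-key r-vis r≢t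
            ; (there n∈) → <-trans (L-r n∈) (out-key r≢t out) , <-trans (L-r n∈) (kp-key r-vis r≢t) } }

  -- Both tokens are stuck in the group of the exhausted root r; v is the latest unfinished node.
  module Back {m r P v L b a x} (i : InvF m r P (v ∷ L) b a x)
    (vx : Mem.st m x ≡ 2) (r≤x : Mem.pos m r ≤ Mem.pos m x)
    (r-exh : Mem.cur m r ≡ []) (r≢t : r ≢ t) where
    open Mem m
    open InvF i
    open Meet i vx r≤x

    v≢t : v ≢ t
    v≢t = L≢t (here refl)

    v-mark : Marked st v
    v-mark = L-mark (here refl)

    later : ∀ {n} → n ∈ L → key n < key v
    later n∈ with L-sort
    ... | al ∷ _ = All.lookup al n∈

    L≢v : ∀ {n} → n ∈ L → n ≢ v
    L≢v n∈ refl = <-irrefl refl (later n∈)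

    not-listed : ∀ {h} → key v < key h → h ∉ v ∷ L
    not-listed lt (here refl) = <-irrefl refl lt
    not-listed lt (there h∈)  = <-asym lt (later h∈)

    -- Nothing is listed above `key v` and no root lies above `r`, so by `Tight` all untried arcs of
    -- such a node are gone. The sink is excluded by its height 0.
    group : ∀ {h} → st h ≡ 2 → pos r ≤ pos h → key v < key h → h ≢ t × cur h ≡ []
    group {h} vh r≤h v<h = h≢t , ex
      where
      h≢t : h ≢ t
      h≢t refl = contradiction (<-≤-trans (pos>0 (r-visited i) r≢t) (≤-trans r≤h (≤-reflexive pos-t))) λ()
      ex : cur h ≡ []
      ex with h ≟ r
      ... | yes refl = r-exh
      ... | no h≢r = proj₁ (exh vh h≢t h∉C (not-listed v<h))
        where
        h∉C : h ∉ r ∷ P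
        h∉C h∈ = h≢r (uniq-pos vh (r-visited i) (≤-antisym (roots-≤ i h∈) r≤h))

    rt-head : st (hd (rt v)) ≡ 2 × pos r ≤ pos (hd (rt v))
    rt-head with good-meet (rt-good (here refl))
    ... | inj₁ h∈ = contradiction h∈ (not-listed (out-key v≢t (rt-out v-mark v≢t)))
    ... | inj₂ z  = z

    vis∈L : ∀ {u} → st u ≡ 2 → u ∉ v ∷ L → u ≢ v
    vis∈L _ u∉ refl = u∉ (here refl)

    C≢v : ∀ {u} → u ∈ r ∷ P → u ≢ v
    C≢v u∈ refl = L∌C i (here refl) u∈

    -- The walk from `v` has landed in the group of `r` for the first time. The arc is settled at
    -- once, because the nodes of the group with greater key than `v` are exhausted.
    module Fresh-keep (k0 : kp v ≡ 0) where
      kp₁ : ℕ → ℕ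
      kp₁ = update kp v (rt v)

      v1 : st v ≡ 1
      v1 with v-mark
      ... | inj₁ eq = eq
      ... | inj₂ eq = contradiction k0 (arc≢0 (kp-out eq v≢t))

      vis≢v : ∀ {u} → st u ≡ 2 → u ≢ v
      vis≢v eq refl = 1≢2 v1 eq

      frame : ∀ {n w} → key n ≤ key v → Reach st kp rt b a n w → Reach st kp₁ rt b a n w
      frame le = reach-update {kp′ = kp₁} le (λ u≢v mk → mk , update-other kp v (rt v) u≢v , refl)

      star : Kstar st kp₁ rt cur (r ∷ P) (v ∷ L) b a
      star {n} mk n≢t nz with n ≟ v
      ... | yes refl = inj₂ (inj₂ (subst (λ e → hd e ≢ t × cur (hd e) ≡ []) (sym (update-same kp v (rt v)))
              (group (proj₁ rt-head) (proj₂ rt-head) (out-key v≢t (rt-out v-mark v≢t)))))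
      ... | no n≢v with kstar mk n≢t (λ z → nz (trans (update-other kp v (rt v) n≢v) z))
      ...   | inj₁ n∈ = inj₁ n∈
      ...   | inj₂ (inj₁ (n∈ , inj₁ e)) =
              inj₂ (inj₁ (n∈ , inj₁ (trans e (sym (update-other kp v (rt v) n≢v)))))
      ...   | inj₂ (inj₁ (n∈ , inj₂ Rn)) = inj₂ (inj₁ (n∈ , inj₂ (frame (top-max i refl n∈) Rn)))
      ...   | inj₂ (inj₂ s) =
              inj₂ (inj₂ (subst (λ e → hd e ≢ t × cur (hd e) ≡ []) (sym (update-other kp v (rt v) n≢v)) s))

      lq : ∀ {n} → n ∈ v ∷ L → st n ≡ 1 → kp₁ n ≢ 0 →
           Out n (kp₁ n) × st (hd (kp₁ n)) ≡ 2 × pos r ≤ pos (hd (kp₁ n))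
      lq {n} n∈ q = update-if kp v (rt v) n (λ e → e ≢ 0 → Out n e × st (hd e) ≡ 2 × pos r ≤ pos (hd e))
        (λ { refl _ → rt-out v-mark v≢t , rt-head }) (λ _ → L-Q n∈ q)

      resolved : InvF (record m { kp = kp₁ }) r P (v ∷ L) b a x
      resolved = record
        { forest = forest-frame forest (λ z → z) (λ z → z) (λ eq → update-other kp v (rt v) (vis≢v eq))
        ; arcs = arcs ; clean = clean
        ; routes = record
          { rt-out = rt-out ; rt-dl = rt-dl
          ; kp-dl = λ {u} mk u≢t → update-if kp v (rt v) u (λ e → e ≢ 0 → dl e ≢ 0)
              (λ _ _ → rt-dl v-mark v≢t) (λ _ → kp-dl mk u≢t) }
        ; tight = record
          { exh = λ vu u≢t u∉C u∉L → let z , e = exh vu u≢t u∉C u∉L in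
              z , trans e (sym (update-other kp v (rt v) (vis≢v vu)))
          ; C-rt = λ u∈ → trans (C-rt u∈) (sym (update-other kp v (rt v) (C≢v u∈))) }
        ; kstar = star
        ; listed = record
          { L1 = L1 ; L-mark = L-mark ; L≢t = L≢t ; L-sort = L-sort ; L-r = L-r ; L-pos = L-pos
          ; L-Q = lq ; rt-good = rt-good ; b-good = b-good ; a-vis = a-vis ; a-pos = a-pos
          ; passed = λ n∈ → let y , Rn , le , g = passed n∈ in y , frame (top-max i refl n∈) Rn , le , g
          ; x-st = x-st ; x<N = x<N }
        ; phase = back vx r≤x r-exh r≢t }

    -- Two arcs of `v` lead into the same group, and the later one is dropped. Where the kept arc
    -- leads is known from `L-Q` for an unfinished node, and from the chain to `r` for a former
    -- root.
    module Old-keep (k≢0 : kp v ≢ 0) where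
      rt₁ : ℕ → ℕ
      rt₁ = update rt v (kp v)

      kp-head : Out v (kp v) × st (hd (kp v)) ≡ 2 × pos r ≤ pos (hd (kp v))
      kp-head with v-mark
      ... | inj₁ eq = L-Q (here refl) eq k≢0
      ... | inj₂ eq = kp-out eq v≢t , kp-vis eq v≢t ,
        chain-pos (kp-vis eq v≢t) (proj₂ (chain-next
          (thru eq (here refl) (<⇒≤ (L-pos (here refl) eq))) (λ { refl → <-irrefl refl (L-pos (here refl) eq) })))

      settled : Settled kp cur v
      settled = group (proj₁ (proj₂ kp-head)) (proj₂ (proj₂ kp-head)) (out-key v≢t (proj₁ kp-head))

      frame : ∀ {n w} → key n ≤ key v → Reach st kp rt b a n w → Reach st kp rt₁ b a n w
      frame le = reach-update {rt′ = rt₁} le (λ u≢v mk → mk , refl , update-other rt v (kp v) u≢v)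

      star : Kstar st kp rt₁ cur (r ∷ P) (v ∷ L) b a
      star {n} mk n≢t nz with n ≟ v
      ... | yes refl = inj₂ (inj₁ (here refl , inj₁ (update-same rt v (kp v))))
      ... | no n≢v with kstar mk n≢t nz
      ...   | inj₁ n∈ = inj₁ n∈
      ...   | inj₂ (inj₁ (n∈ , inj₁ e)) = inj₂ (inj₁ (n∈ , inj₁ (trans (update-other rt v (kp v) n≢v) e)))
      ...   | inj₂ (inj₁ (n∈ , inj₂ Rn)) = inj₂ (inj₁ (n∈ , inj₂ (frame (top-max i refl n∈) Rn)))
      ...   | inj₂ (inj₂ s) = inj₂ (inj₂ s)

      resolved : InvF (record m { rt = rt₁ }) r P (v ∷ L) b a x
      resolved = record
        { forest = forest ; arcs = arcs ; clean = clean
        ; routes = record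
          { rt-out = λ {u} mk u≢t → update-if rt v (kp v) u (Out u)
              (λ { refl → proj₁ kp-head }) (λ _ → rt-out mk u≢t)
          ; rt-dl = λ {u} mk u≢t → update-if rt v (kp v) u (λ e → dl e ≢ 0)
              (λ _ → kp-dl v-mark v≢t k≢0) (λ _ → rt-dl mk u≢t)
          ; kp-dl = kp-dl }
        ; tight = record
          { exh = λ vu u≢t u∉C u∉L → let z , e = exh vu u≢t u∉C u∉L in
              z , trans (update-other rt v (kp v) (vis∈L vu u∉L)) e
          ; C-rt = λ u∈ → trans (update-other rt v (kp v) (C≢v u∈)) (C-rt u∈) }
        ; kstar = star
        ; listed = record
          { L1 = L1 ; L-mark = L-mark ; L≢t = L≢t ; L-sort = L-sort ; L-r = L-r ; L-pos = L-pos
          ; L-Q = L-Q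
          ; rt-good = λ {n} n∈ → update-if rt v (kp v) n (λ e → Good st pos (r ∷ P) (v ∷ L) x (hd e))
              (λ _ → inj₂ (inj₂ (proj₁ (proj₂ kp-head) ,
                       λ ρ∈ _ → ≤-trans (roots-≤ i ρ∈) (proj₂ (proj₂ kp-head)))))
              (λ _ → rt-good n∈)
          ; b-good = b-good ; a-vis = a-vis ; a-pos = a-pos
          ; passed = λ n∈ → let y , Rn , le , g = passed n∈ in y , frame (top-max i refl n∈) Rn , le , g
          ; x-st = x-st ; x<N = x<N }
        ; phase = back vx r≤x r-exh r≢t }

    -- After the landing of v has been recorded, v takes its next arc or is finished.
    module Resolved (k≢0 : kp v ≢ 0) (rt≡ : rt v ≡ kp v) where
      open Old-keep k≢0 using (kp-head; settled)

      good-take : ∀ {w u} → Good st pos (r ∷ P) (v ∷ L) x u → Good st pos (r ∷ P) (v ∷ L) w u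
      good-take g with good-meet g
      ... | inj₁ u∈        = inj₁ u∈
      ... | inj₂ (vu , le) = inj₂ (inj₂ (vu , λ ρ∈ _ → ≤-trans (roots-≤ i ρ∈) le))

      module Take {c cs} (eqc : cur v ≡ c ∷ cs) (av : dl c ≡ 0) where
        rt₁ dl₁ : ℕ → ℕ
        rt₁ = update rt v c
        dl₁ = update dl c 1

        out : Out v c
        out = cur-out (subst (c ∈_) (sym eqc) (here refl))

        frame : ∀ {n w} → key n ≤ key v → Reach st kp rt b a n w → Reach st kp rt₁ b a n w
        frame le = reach-update {rt′ = rt₁} le (λ u≢v mk → mk , refl , update-other rt v c u≢v)

        hst : st (hd c) ≡ 0 ⊎ st (hd c) ≡ 2
        hst = head-status i out v≢t av (mark≢3 v-mark) (top-max i refl)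

        star : Kstar st kp rt₁ (update cur v cs) (r ∷ P) (v ∷ L) b a
        star {n} mk n≢t nz with n ≟ v
        ... | yes refl = inj₂ (inj₂ (proj₁ settled , settled-pop cur eqc (proj₂ settled)))
        ... | no n≢v with kstar mk n≢t nz
        ...   | inj₁ n∈ = inj₁ n∈
        ...   | inj₂ (inj₁ (n∈ , inj₁ e)) = inj₂ (inj₁ (n∈ , inj₁ (trans (update-other rt v c n≢v) e)))
        ...   | inj₂ (inj₁ (n∈ , inj₂ Rn)) = inj₂ (inj₁ (n∈ , inj₂ (frame (top-max i refl n∈) Rn)))
        ...   | inj₂ (inj₂ (h≢t , z)) = inj₂ (inj₂ (h≢t , settled-pop cur eqc z))

        -- `passed` has preserved a position in which `v` is to move, so the search resumes there
        -- and not at the sources. If the other token is at `v` as well, the tokens split; otherwise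
        -- only the one at `v` moves.
        start-over : Phase st pos kp rt₁ (update cur v cs) r P (v ∷ L) b a (hd c)
        start-over with passed (here refl)
        ... | y , R , v≤y , g with v ≟ y
        ...   | yes refl = forward
                  (subst (λ e → Reach st kp rt₁ b a (hd e) (hd (kp v))) (update-same rt v c)
                    (split {rt = rt₁} (frame ≤-refl R) v-mark v≢t
                      (subst (Out v) (sym (update-same rt v c)) out) (proj₁ kp-head)
                      (λ eq → kp-dl v-mark v≢t k≢0
                        (subst (λ e → dl e ≡ 0) (trans (sym (update-same rt v c)) eq) av))))
                  (token-at i hst) (proj₁ (proj₂ kp-head)) (proj₂ (proj₂ kp-head))
                  λ { (here refl) → out-key v≢t out , out-key v≢t (proj₁ kp-head)
                    ; (there n∈) → <-trans (later n∈) (out-key v≢t out) ,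
                                   <-trans (later n∈) (out-key v≢t (proj₁ kp-head)) }
        ...   | no v≢y = forward
                  (subst (λ e → Reach st kp rt₁ b a (hd e) y) (update-same rt v c)
                    (move {rt = rt₁} (frame ≤-refl R) v-mark v≢t
                      (subst (Out v) (sym (update-same rt v c)) out) v<y))
                  (token-at i hst) (proj₁ vy) (proj₂ vy)
                  λ { (here refl) → out-key v≢t out , v<y
                    ; (there n∈) → <-trans (later n∈) (out-key v≢t out) , <-trans (later n∈) v<y }
          where
          vy : st y ≡ 2 × pos r ≤ pos y
          vy = [ (λ y≡v → ⊥-elim (v≢y (sym y≡v)))
               , (λ g′ → [ (λ { (here y≡v) → ⊥-elim (v≢y (sym y≡v))
                              ; (there y∈) → contradiction (later y∈) (≤⇒≯ v≤y) })
                         , (λ z → z) ]′ (good-meet g′)) ]′ g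
          v<y : key v < key y
          v<y = ≤∧≢⇒< v≤y (λ eq → v≢y (key-inj (st-N (mark≢0 v-mark)) (vis<N (proj₁ vy)) eq))

        taken : InvF (record m { rt = rt₁ ; dl = dl₁ ; cur = update cur v cs }) r P (v ∷ L) b a (hd c)
        taken = record
          { forest = forest
          ; arcs = arcs-pop arcs eqc
          ; clean = clean-pop clean arcs out
              (λ z → z , λ { refl → mark≢0 v-mark z }) (λ z → z) (λ z → z)
          ; routes = routes-pop routes out (λ _ z → z) (λ _ → refl) (kp-dl v-mark v≢t)
          ; tight = record
            { exh = λ vu u≢t u∉C u∉L → let z , e = exh vu u≢t u∉C u∉L in
                settled-pop cur eqc z , trans (update-other rt v c (vis∈L vu u∉L)) e
            ; C-rt = λ u∈ → trans (update-other rt v c (C≢v u∈)) (C-rt u∈) }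
          ; kstar = star
          ; listed = record
            { L1 = L1 ; L-mark = L-mark ; L≢t = L≢t ; L-sort = L-sort ; L-r = L-r ; L-pos = L-pos
            ; L-Q = L-Q
            ; rt-good = λ {n} n∈ → update-if rt v c n (λ e → Good st pos (r ∷ P) (v ∷ L) (hd c) (hd e))
                (λ _ → inj₂ (inj₁ refl)) (λ _ → good-take (rt-good n∈))
            ; b-good = good-take b-good ; a-vis = a-vis ; a-pos = a-pos
            ; passed = λ n∈ → let y , Rn , le , g = passed n∈ in
                y , frame (top-max i refl n∈) Rn , le , [ inj₁ , inj₂ ∘ good-take ]′ g
            ; x-st = hst ; x<N = hd<N (proj₁ out) }
          ; phase = start-over }

      module Finish (ex : cur v ≡ []) where
        star : Kstar st kp rt cur (r ∷ P) L b a
        star {n} mk n≢t nz with kstar mk n≢t nz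
        ... | inj₁ n∈ = inj₁ n∈
        ... | inj₂ (inj₁ (here refl , _)) = inj₂ (inj₂ settled)
        ... | inj₂ (inj₁ (there n∈ , how)) = inj₂ (inj₁ (n∈ , how))
        ... | inj₂ (inj₂ s) = inj₂ (inj₂ s)

        sorted : AllPairs (λ u w → key w < key u) L
        sorted with L-sort
        ... | _ ∷ ps = ps

        -- A former root stays where it is on the stack and becomes an ordinary node of the segment
        -- of `r`.
        module Root (v2 : st v ≡ 2) where
          good : ∀ {u} → Good st pos (r ∷ P) (v ∷ L) x u → Good st pos (r ∷ P) L x u
          good g with good-meet g
          ... | inj₁ (here refl) =
            inj₂ (inj₂ (v2 , λ ρ∈ _ → ≤-trans (roots-≤ i ρ∈) (<⇒≤ (L-pos (here refl) v2))))
          ... | inj₁ (there u∈)  = inj₁ u∈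
          ... | inj₂ (vu , le)   = inj₂ (inj₂ (vu , λ ρ∈ _ → ≤-trans (roots-≤ i ρ∈) le))

          finished : InvF m r P L b a x
          finished = record
            { forest = forest ; arcs = arcs ; clean = clean ; routes = routes
            ; tight = record
              { exh = λ {u} vu u≢t u∉C u∉L → ex′ vu u≢t u∉C u∉L
              ; C-rt = C-rt }
            ; kstar = star
            ; listed = record
              { L1 = λ {n} eq → drop eq (L1 eq)
              ; L-mark = λ n∈ → L-mark (there n∈) ; L≢t = λ n∈ → L≢t (there n∈) ; L-sort = sorted
              ; L-r = λ n∈ → L-r (there n∈) ; L-pos = λ n∈ → L-pos (there n∈)
              ; L-Q = λ n∈ → L-Q (there n∈)
              ; rt-good = λ n∈ → good (rt-good (there n∈))
              ; b-good = good b-good ; a-vis = a-vis ; a-pos = a-pos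
              ; passed = λ n∈ → let y , Rn , le , g = passed (there n∈) in
                  y , Rn , le , [ inj₁ , inj₂ ∘ good ]′ g
              ; x-st = x-st ; x<N = x<N }
            ; phase = back vx r≤x r-exh r≢t }
            where
            drop : ∀ {n} → st n ≡ 1 → n ∈ v ∷ L → n ∈ L
            drop eq (here refl) = ⊥-elim (1≢2 eq v2)
            drop eq (there n∈)  = n∈
            ex′ : ∀ {u} → st u ≡ 2 → u ≢ t → u ∉ r ∷ P → u ∉ L → cur u ≡ [] × rt u ≡ kp u
            ex′ {u} vu u≢t u∉C u∉L with u ≟ v
            ... | yes refl = ex , rt≡
            ... | no u≢v = exh vu u≢t u∉C λ { (here eq) → u≢v eq ; (there u∈) → u∉L u∈ }

        -- The node goes on top of the stack, into the segment of `r`: its kept arc leads into that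
        -- segment, so its chain passes all roots.
        module Joined (v1 : st v ≡ 1) where
          st₁ pos₁ : ℕ → ℕ
          st₁ = update st v 2
          pos₁ = update pos v (length S)

          vis≢v : ∀ {u} → st u ≡ 2 → u ≢ v
          vis≢v eq refl = 1≢2 v1 eq

          up : ∀ {u} → st u ≡ 2 → st₁ u ≡ 2
          up vu = trans (update-other st v 2 (vis≢v vu)) vu

          down : ∀ {u} → u ≢ v → st₁ u ≡ 2 → st u ≡ 2
          down u≢v = trans (sym (update-other st v 2 u≢v))

          pos-old : ∀ {u} → st u ≡ 2 → pos₁ u ≡ pos u
          pos-old vu = update-other pos v (length S) (vis≢v vu)

          pos-v : pos₁ v ≡ length S
          pos-v = update-same pos v (length S)

          head-vis : st (hd (kp v)) ≡ 2
          head-vis = proj₁ (proj₂ kp-head)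

          r<v : pos r < length S
          r<v = stamp-bound stacked (vis-S (r-visited i))

          mark : ∀ {u} → Marked st u → Marked st₁ u
          mark {u} mk with u ≟ v
          ... | yes refl = inj₂ (update-same st v 2)
          ... | no u≢v   = subst (λ k → k ≡ 1 ⊎ k ≡ 2) (sym (update-other st v 2 u≢v)) mk

          unmark : ∀ {u} → Marked st₁ u → Marked st u
          unmark {u} mk with u ≟ v
          ... | yes refl = v-mark
          ... | no u≢v   = subst (λ k → k ≡ 1 ⊎ k ≡ 2) (update-other st v 2 u≢v) mk

          frame : ∀ {n w} → Reach st kp rt b a n w → Reach st₁ kp rt b a n w
          frame = reach-frame (λ mk _ _ → mark mk , refl , refl)

          root-pos : ∀ {ρ} → ρ ∈ r ∷ P → pos₁ ρ ≡ pos ρ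
          root-pos ρ∈ = pos-old (C-vis ρ∈)

          deep : ∀ {ρ u} → ρ ∈ r ∷ P → st u ≡ 2 → pos r ≤ pos u → pos₁ ρ ≤ pos₁ u
          deep ρ∈ vu le = ≤-trans (≤-reflexive (root-pos ρ∈)) (≤-trans (≤-trans (roots-≤ i ρ∈) le)
                            (≤-reflexive (sym (pos-old vu))))

          good : ∀ {u} → Good st pos (r ∷ P) (v ∷ L) x u → Good st₁ pos₁ (r ∷ P) L x u
          good g with good-meet g
          ... | inj₁ (here refl) = inj₂ (inj₂ (update-same st v 2 , λ ρ∈ _ →
                  ≤-trans (≤-reflexive (root-pos ρ∈)) (≤-trans (roots-≤ i ρ∈)
                    (≤-trans (<⇒≤ r<v) (≤-reflexive (sym pos-v))))))
          ... | inj₁ (there u∈)  = inj₁ u∈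
          ... | inj₂ (vu , le)   = inj₂ (inj₂ (up vu , λ ρ∈ _ → deep ρ∈ vu le))

          forest₁ : Forest st₁ pos₁ kp (v ∷ S) (r ∷ P)
          forest₁ = record
            { stacked = pos-v ∷ stamp-cong (λ u∈ → pos-old (S-vis u∈)) stacked
            ; pos-t = trans (pos-old t-vis) pos-t
            ; vis-S = vs
            ; S-vis = λ { (here refl) → update-same st v 2 ; (there u∈) → up (S-vis u∈) }
            ; S<N = λ { (here refl) → st-N (mark≢0 v-mark) ; (there u∈) → S<N u∈ }
            ; kp-out = ko ; kp-vis = kv ; kp-pos = kps
            ; C-vis = λ u∈ → up (C-vis u∈) ; t∈C = t∈C
            ; C-pos = pairs (λ u∈ → C-vis u∈) C-pos
            ; thru = th }
            where
            vs : ∀ {u} → st₁ u ≡ 2 → u ∈ v ∷ S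
            vs {u} eq with u ≟ v
            ... | yes refl = here refl
            ... | no u≢v   = there (vis-S (down u≢v eq))
            ko : ∀ {u} → st₁ u ≡ 2 → u ≢ t → Out u (kp u)
            ko {u} eq u≢t with u ≟ v
            ... | yes refl = proj₁ kp-head
            ... | no u≢v   = kp-out (down u≢v eq) u≢t
            kv : ∀ {u} → st₁ u ≡ 2 → u ≢ t → st₁ (hd (kp u)) ≡ 2
            kv {u} eq u≢t with u ≟ v
            ... | yes refl = up head-vis
            ... | no u≢v   = up (kp-vis (down u≢v eq) u≢t)
            kps : ∀ {u} → st₁ u ≡ 2 → u ≢ t → pos₁ (hd (kp u)) < pos₁ u
            kps {u} eq u≢t with u ≟ v
            ... | yes refl = subst₂ _<_ (sym (pos-old head-vis)) (sym pos-v)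
                               (stamp-bound stacked (vis-S head-vis))
            ... | no u≢v   = subst₂ _<_ (sym (pos-old (kp-vis (down u≢v eq) u≢t)))
                               (sym (pos-old (down u≢v eq))) (kp-pos (down u≢v eq) u≢t)
            pairs : ∀ {D} → (∀ {u} → u ∈ D → st u ≡ 2) → AllPairs (λ u w → pos w < pos u) D →
                    AllPairs (λ u w → pos₁ w < pos₁ u) D
            pairs f [] = []
            pairs f (al ∷ ps) =
              All.tabulate (λ w∈ → subst₂ _<_ (sym (pos-old (f (there w∈)))) (sym (pos-old (f (here refl))))
                (All.lookup al w∈)) ∷ pairs (λ u∈ → f (there u∈)) ps
            th : ∀ {u ρ} → st₁ u ≡ 2 → ρ ∈ r ∷ P → pos₁ ρ ≤ pos₁ u → Chain kp u ρ
            th {u} eq ρ∈ le with u ≟ v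
            ... | yes refl = step v≢t (thru head-vis ρ∈ (≤-trans (roots-≤ i ρ∈) (proj₂ (proj₂ kp-head))))
            ... | no u≢v   = thru (down u≢v eq) ρ∈
                               (subst₂ _≤_ (root-pos ρ∈) (pos-old (down u≢v eq)) le)

          finished : InvF (record m { st = st₁ ; pos = pos₁ ; S = v ∷ S }) r P L b a x
          finished = record
            { forest = forest₁
            ; arcs = arcs-st arcs
                (λ {u} → update-if st v 2 u (λ k → k ≢ 3 → st u ≢ 3)
                  (λ { refl _ → mark≢3 v-mark }) (λ _ z → z))
                (λ u → update-if st v 2 u (_≤ 3) (λ _ → s≤s (s≤s z≤n)) (λ _ → st-≤ u))
                (λ {u} → update-if st v 2 u (λ k → k ≢ 0 → u < N)
                  (λ { refl _ → st-N (mark≢0 v-mark) }) (λ _ → st-N))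
            ; clean = record
              { nd = λ {e} arc av ne tl≢t → update-if st v 2 (hd e) (_≢ 3) (λ _ ())
                  (λ _ → nd arc av (λ z → three z ne) tl≢t)
              ; fresh = λ {u} u<N → update-if st v 2 u
                  (λ k → k ≡ 0 → ∃[ c ] ∃[ cs ] (cur u ≡ c ∷ cs × dl c ≡ 0)) (λ _ ()) (λ _ → fresh u<N) }
            ; routes = record
              { rt-out = λ mk → rt-out (unmark mk) ; rt-dl = λ mk → rt-dl (unmark mk)
              ; kp-dl = λ mk → kp-dl (unmark mk) }
            ; tight = record { exh = ex′ ; C-rt = C-rt }
            ; kstar = λ mk n≢t nz → star′ (star (unmark mk) n≢t nz)
            ; listed = record
              { L1 = one
              ; L-mark = λ n∈ → mark (L-mark (there n∈)) ; L≢t = λ n∈ → L≢t (there n∈) ; L-sort = sorted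
              ; L-r = λ n∈ → L-r (there n∈)
              ; L-pos = λ n∈ eq → let vn = down (L≢v n∈) eq in
                  subst₂ _<_ (sym (pos-old (r-visited i))) (sym (pos-old vn)) (L-pos (there n∈) vn)
              ; L-Q = λ n∈ q nz → let o , vh , le = L-Q (there n∈) (trans (sym (update-other st v 2 (L≢v n∈))) q) nz
                  in o , up vh , subst₂ _≤_ (sym (pos-old (r-visited i))) (sym (pos-old vh)) le
              ; rt-good = λ n∈ → good (rt-good (there n∈))
              ; b-good = good b-good ; a-vis = up a-vis
              ; a-pos = subst₂ _≤_ (sym (pos-old (r-visited i))) (sym (pos-old a-vis)) a-pos
              ; passed = λ n∈ → let y , Rn , le , g = passed (there n∈) in
                  y , frame Rn , le , [ inj₁ , inj₂ ∘ good ]′ g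
              ; x-st = inj₂ (up vx) ; x<N = x<N }
            ; phase = back (up vx) (subst₂ _≤_ (sym (pos-old (r-visited i))) (sym (pos-old vx)) r≤x) r-exh r≢t }
            where
            three : ∀ {u} → st u ≡ 3 → st₁ u ≢ 3 → ⊥
            three {u} z ne = ne (trans (update-other st v 2 (λ { refl → mark≢3 v-mark z })) z)
            one : ∀ {n} → st₁ n ≡ 1 → n ∈ L
            one {n} eq with n ≟ v
            ... | yes refl = ⊥-elim (1≢2 eq (update-same st v 2))
            ... | no n≢v with L1 (trans (sym (update-other st v 2 n≢v)) eq)
            ...   | here n≡v  = ⊥-elim (n≢v n≡v)
            ...   | there n∈ = n∈
            ex′ : ∀ {u} → st₁ u ≡ 2 → u ≢ t → u ∉ r ∷ P → u ∉ L → cur u ≡ [] × rt u ≡ kp u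
            ex′ {u} eq u≢t u∉C u∉L with u ≟ v
            ... | yes refl = ex , rt≡
            ... | no u≢v = exh (down u≢v eq) u≢t u∉C λ { (here e) → u≢v e ; (there u∈) → u∉L u∈ }
            star′ : ∀ {n} → n ∈ r ∷ P ⊎ (n ∈ L × (rt n ≡ kp n ⊎ Reach st kp rt b a n n)) ⊎ Settled kp cur n →
                    n ∈ r ∷ P ⊎ (n ∈ L × (rt n ≡ kp n ⊎ Reach st₁ kp rt b a n n)) ⊎ Settled kp cur n
            star′ (inj₁ z)                       = inj₁ z
            star′ (inj₂ (inj₁ (n∈ , inj₁ e)))    = inj₂ (inj₁ (n∈ , inj₁ e))
            star′ (inj₂ (inj₁ (n∈ , inj₂ Rn)))   = inj₂ (inj₁ (n∈ , inj₂ (frame Rn)))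
            star′ (inj₂ (inj₂ s))                = inj₂ (inj₂ s)

  -- Growing the stack backwards

  -- Between two searches no node is unfinished.
  record InvB (m : Mem) (P : List ℕ) : Set where
    open Mem m
    field
      forest : Forest st pos kp S P
      arcs   : Arcs st dl cur inn
      clean  : Clean st dl cur
      routes : Routes st kp rt dl
      tight  : Tight st kp rt cur P []
      noQ    : ∀ x → st x ≢ 1
      kstar  : ∀ {x} → st x ≡ 2 → x ≢ t → x ∈ P ⊎ Settled kp cur x
    open Forest forest public
    open Arcs arcs public
    open Clean clean public
    open Routes routes public
    open Tight tight public

  status-02 : ∀ {m P y} → InvB m P → Mem.st m y ≢ 3 → Mem.st m y ≡ 0 ⊎ Mem.st m y ≡ 2
  status-02 {m} {y = y} i ne with Mem.st m y in eq | InvB.st-≤ i y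
  ... | 0 | _ = inj₁ refl
  ... | 1 | _ = ⊥-elim (InvB.noQ i y eq)
  ... | 2 | _ = inj₂ refl
  ... | 3 | _ = ⊥-elim (ne refl)
  ... | suc (suc (suc (suc _))) | s≤s (s≤s (s≤s ()))

  -- With `a` on top of the stack, the waiting token is in the topmost segment from the start.
  start-search : ∀ {m r P a S₁} → InvB m (r ∷ P) → Mem.S m ≡ a ∷ S₁ → Z a → Mem.st m (σ a) ≢ 3 →
    InvF m r P [] (σ a) a (σ a)
  start-search {m} {r} {P} {a} {S₁} i refl za ne = record
    { forest = forest ; arcs = arcs ; clean = clean ; routes = routes ; tight = tight
    ; kstar = λ { {x} (inj₁ eq) _ _ → ⊥-elim (noQ x eq)
                ; (inj₂ eq) x≢t _ → [ inj₁ , inj₂ ∘ inj₂ ]′ (kstar eq x≢t) }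
    ; listed = record
      { L1 = λ {n} eq → ⊥-elim (noQ n eq) ; L-mark = λ () ; L≢t = λ () ; L-sort = [] ; L-r = λ ()
      ; L-pos = λ () ; L-Q = λ () ; rt-good = λ () ; b-good = inj₂ (inj₁ refl)
      ; a-vis = va ; a-pos = top (C-vis (here refl)) ; passed = λ ()
      ; x-st = status-02 i ne ; x<N = Z<N (Z-σ za) }
    ; phase = forward start tok va (top (C-vis (here refl))) (λ ()) }
    where
    open Mem m
    open InvB i
    va : st a ≡ 2
    va = S-vis (here refl)
    top : ∀ {y} → st y ≡ 2 → pos y ≤ pos a
    top v with stacked | stamp-bound stacked (vis-S v)
    ... | eq ∷ _ | lt = ≤-trans (≤-pred lt) (≤-reflexive (sym eq))
    tok : Token st pos (r ∷ P) (σ a) (σ a)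
    tok with status-02 i ne
    ... | inj₁ z = new z
    ... | inj₂ v = old v v ≤-refl (λ _ le → le)

  end-search : ∀ {m r P b a x} → InvF m r P [] b a x → InvB m (r ∷ P)
  end-search {m} {r} {P} i = record
    { forest = forest ; arcs = arcs ; clean = clean ; routes = routes ; tight = tight
    ; noQ = λ x eq → contradiction (L1 eq) λ()
    ; kstar = λ v x≢t → star (kstar (inj₂ v) x≢t (arc≢0 (kp-out v x≢t))) }
    where
    open Mem m
    open InvF i
    star : ∀ {n X} → n ∈ r ∷ P ⊎ (n ∈ [] × X) ⊎ Settled kp cur n → n ∈ r ∷ P ⊎ Settled kp cur n
    star (inj₁ z) = inj₁ z
    star (inj₂ (inj₂ s)) = inj₂ s

  module Top {m P x S₁} (i : InvB m P) (eqS : Mem.S m ≡ x ∷ S₁) where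
    open Mem m
    open InvB i

    x-vis : st x ≡ 2
    x-vis = S-vis (subst (x ∈_) (sym eqS) (here refl))

    x-pos : pos x ≡ length S₁
    x-pos = go (subst (Stamped pos) eqS stacked)
      where
      go : Stamped pos (x ∷ S₁) → pos x ≡ length S₁
      go (eq ∷ _) = eq

    top : ∀ {y} → st y ≡ 2 → pos y ≤ pos x
    top {y} v = ≤-trans (≤-pred (subst (λ s → pos y < length s) eqS (stamp-bound stacked (vis-S v))))
                        (≤-reflexive (sym x-pos))

    -- An available arc into x cannot come from a visited node, by acyclicity.
    tail-unvisited : ∀ {e} → Arc e → hd e ≡ x → dl e ≡ 0 → tl e ≢ t → st (tl e) ≢ 2
    tail-unvisited {e} arc refl av u≢t v =
      <⇒≱ (key-mono arc u≢t) (chain-key x-vis (thru x-vis root (top v)))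
      where
      root : tl e ∈ P
      root with member? _≟_ (tl e) P
      ... | yes u∈ = u∈
      ... | no u∉  = contradiction
              (subst (e ∈_) (proj₁ (exh v u≢t u∉ (λ ()))) (av-cur arc av)) λ()

    skip-in : ∀ {c cs} → inn x ≡ c ∷ cs → (dl c ≡ 0 → st (tl c) ≢ 0) →
      InvB (record m { inn = update inn x cs }) P
    skip-in {c} {cs} eqi bad = record
      { forest = forest ; clean = clean ; routes = routes ; tight = tight ; noQ = noQ ; kstar = kstar
      ; arcs = record
        { cur-out = cur-out
        ; inn-in = λ {y} {e} → update-if inn x cs y (λ es → e ∈ es → Arc e × hd e ≡ y)
            (λ { refl e∈ → inn-in (subst (e ∈_) (sym eqi) (there e∈)) }) (λ _ → inn-in)
        ; av-cur = av-cur
        ; av-inn = λ {e} arc av ne u≢t → update-if inn x cs (hd e) (e ∈_)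
            (λ h≡x → drop arc h≡x av ne u≢t (subst (e ∈_) (trans (cong inn h≡x) eqi) (av-inn arc av ne u≢t)))
            (λ _ → av-inn arc av ne u≢t)
        ; st-≤ = st-≤ ; st-N = st-N } }
      where
      drop : ∀ {e} → Arc e → hd e ≡ x → dl e ≡ 0 → st (tl e) ≢ 3 → tl e ≢ t → e ∈ c ∷ cs → e ∈ cs
      drop arc h≡x av ne u≢t (there e∈) = e∈
      drop arc h≡x av ne u≢t (here refl) =
        ⊥-elim ([ bad av , tail-unvisited arc h≡x av u≢t ]′ (status-02 i ne))

    -- The kept arc leads to the old top `x`, whose chain passes all roots; therefore the new node
    -- can be a root itself.
    module Push {c cs} (eqi : inn x ≡ c ∷ cs) (av : dl c ≡ 0) (fr : st (tl c) ≡ 0) where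
      u : ℕ
      u = tl c

      st₁ pos₁ kp₁ rt₁ dl₁ : ℕ → ℕ
      st₁ = update st u 2
      pos₁ = update pos u (length S)
      kp₁ = update kp u c
      rt₁ = update rt u c
      dl₁ = update dl c 1

      arc : Arc c
      arc = proj₁ (inn-in (subst (c ∈_) (sym eqi) (here refl)))

      h≡x : hd c ≡ x
      h≡x = proj₂ (inn-in (subst (c ∈_) (sym eqi) (here refl)))

      vis≢u : ∀ {y} → st y ≡ 2 → y ≢ u
      vis≢u v refl = 0≢2 fr v

      u≢t : u ≢ t
      u≢t u≡t = vis≢u t-vis (sym u≡t)

      up : ∀ {y} → st y ≡ 2 → st₁ y ≡ 2
      up v = trans (update-other st u 2 (vis≢u v)) v

      down : ∀ {y} → y ≢ u → st₁ y ≡ 2 → st y ≡ 2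
      down ne = trans (sym (update-other st u 2 ne))

      pos-old : ∀ {y} → st y ≡ 2 → pos₁ y ≡ pos y
      pos-old v = update-other pos u (length S) (vis≢u v)

      pos-u : pos₁ u ≡ length S
      pos-u = update-same pos u (length S)

      kp-u : hd (kp₁ u) ≡ x
      kp-u = trans (cong hd (update-same kp u c)) h≡x

      kp-old : ∀ {y} → y ≢ u → kp₁ y ≡ kp y
      kp-old = update-other kp u c

      wasn : ∀ {e} → dl₁ e ≡ 0 → dl e ≡ 0
      wasn {e} = update-if dl c 1 e (λ d → d ≡ 0 → dl e ≡ 0) (λ _ ()) (λ _ z → z)

      unmark : ∀ {y} → y ≢ u → Marked st₁ y → Marked st y
      unmark ne = subst (λ k → k ≡ 1 ⊎ k ≡ 2) (update-other st u 2 ne)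

      forest₁ : Forest st₁ pos₁ kp₁ (u ∷ S) (u ∷ P)
      forest₁ = record
        { stacked = pos-u ∷ stamp-cong (λ y∈ → pos-old (S-vis y∈)) stacked
        ; pos-t = trans (pos-old t-vis) pos-t
        ; vis-S = vs
        ; S-vis = λ { (here refl) → update-same st u 2 ; (there y∈) → up (S-vis y∈) }
        ; S<N = λ { (here refl) → tl<N arc ; (there y∈) → S<N y∈ }
        ; kp-out = ko ; kp-vis = kv ; kp-pos = kps
        ; C-vis = λ { (here refl) → update-same st u 2 ; (there y∈) → up (C-vis y∈) }
        ; t∈C = there t∈C
        ; C-pos = All.tabulate (λ y∈ → subst₂ _<_ (sym (pos-old (C-vis y∈))) (sym pos-u)
                    (stamp-bound stacked (vis-S (C-vis y∈)))) ∷ pairs (λ y∈ → C-vis y∈) C-pos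
        ; thru = th }
        where
        vs : ∀ {y} → st₁ y ≡ 2 → y ∈ u ∷ S
        vs {y} eq with y ≟ u
        ... | yes refl = here refl
        ... | no y≢u   = there (vis-S (down y≢u eq))
        ko : ∀ {y} → st₁ y ≡ 2 → y ≢ t → Out y (kp₁ y)
        ko {y} eq y≢t = update-if kp u c y (Out y) (λ { refl → arc , refl }) (λ ne → kp-out (down ne eq) y≢t)
        kv : ∀ {y} → st₁ y ≡ 2 → y ≢ t → st₁ (hd (kp₁ y)) ≡ 2
        kv {y} eq y≢t = update-if kp u c y (λ e → st₁ (hd e) ≡ 2)
          (λ _ → subst (λ h → st₁ h ≡ 2) (sym h≡x) (up x-vis)) (λ ne → up (kp-vis (down ne eq) y≢t))
        kps : ∀ {y} → st₁ y ≡ 2 → y ≢ t → pos₁ (hd (kp₁ y)) < pos₁ y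
        kps {y} eq y≢t with y ≟ u
        ... | yes refl = subst₂ _<_ (sym (trans (cong pos₁ kp-u) (pos-old x-vis))) (sym pos-u)
                           (stamp-bound stacked (vis-S x-vis))
        ... | no ne = subst₂ _<_ (sym (trans (cong (pos₁ ∘ hd) (kp-old ne)) (pos-old (kp-vis (down ne eq) y≢t))))
                        (sym (pos-old (down ne eq))) (kp-pos (down ne eq) y≢t)
        pairs : ∀ {D} → (∀ {y} → y ∈ D → st y ≡ 2) → AllPairs (λ y w → pos w < pos y) D →
                AllPairs (λ y w → pos₁ w < pos₁ y) D
        pairs f [] = []
        pairs f (al ∷ ps) =
          All.tabulate (λ w∈ → subst₂ _<_ (sym (pos-old (f (there w∈)))) (sym (pos-old (f (here refl))))
            (All.lookup al w∈)) ∷ pairs (λ y∈ → f (there y∈)) ps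
        lift : ∀ {y ρ} → st y ≡ 2 → Chain kp y ρ → Chain kp₁ y ρ
        lift = chain-frame forest (λ v → kp-old (vis≢u v))
        th : ∀ {y ρ} → st₁ y ≡ 2 → ρ ∈ u ∷ P → pos₁ ρ ≤ pos₁ y → Chain kp₁ y ρ
        th {y} eq (here refl) le with y ≟ u
        ... | yes refl = here
        ... | no ne = contradiction (subst₂ _≤_ pos-u (pos-old (down ne eq)) le)
                        (<⇒≱ (stamp-bound stacked (vis-S (down ne eq))))
        th {y} {ρ} eq (there ρ∈) le with y ≟ u
        ... | yes refl = step u≢t (subst (λ h → Chain kp₁ h ρ) (sym kp-u)
                           (lift x-vis (thru x-vis ρ∈ (top (C-vis ρ∈)))))
        ... | no ne = lift (down ne eq) (thru (down ne eq) ρ∈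
                        (subst₂ _≤_ (pos-old (C-vis ρ∈)) (pos-old (down ne eq)) le))

      pushed : InvB (record m { st = st₁ ; pos = pos₁ ; kp = kp₁ ; rt = rt₁ ; dl = dl₁
                              ; inn = update inn x cs ; S = u ∷ S }) (u ∷ P)
      pushed = record
        { forest = forest₁
        ; arcs = record
          { cur-out = cur-out
          ; inn-in = λ {y} {e} → update-if inn x cs y (λ es → e ∈ es → Arc e × hd e ≡ y)
              (λ { refl e∈ → inn-in (subst (e ∈_) (sym eqi) (there e∈)) }) (λ _ → inn-in)
          ; av-cur = λ ar av′ → av-cur ar (wasn av′)
          ; av-inn = λ {e} ar av′ ne t≢ → update-if inn x cs (hd e) (e ∈_)
              (λ hx → drop av′ (subst (e ∈_) (trans (cong inn hx) eqi) (av-inn ar (wasn av′) (not3 ne) t≢)))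
              (λ _ → av-inn ar (wasn av′) (not3 ne) t≢)
          ; st-≤ = λ y → update-if st u 2 y (_≤ 3) (λ _ → s≤s (s≤s z≤n)) (λ _ → st-≤ y)
          ; st-N = λ {y} → update-if st u 2 y (λ k → k ≢ 0 → y < N) (λ { refl _ → tl<N arc }) (λ _ → st-N) }
        ; clean = record
          { nd = λ {e} ar av′ ne t≢ → update-if st u 2 (hd e) (_≢ 3) (λ _ ())
              (λ _ → nd ar (wasn av′) (not3 ne) t≢)
          ; fresh = frs }
        ; routes = record
          { rt-out = λ {y} mk y≢t → update-if rt u c y (Out y) (λ { refl → arc , refl })
              (λ ne → rt-out (unmark ne mk) y≢t)
          ; rt-dl = λ {y} mk y≢t → update-if rt u c y (λ e → dl₁ e ≢ 0) (λ _ → c-gone)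
              (λ ne → dl-up dl (rt-dl (unmark ne mk) y≢t))
          ; kp-dl = λ {y} mk y≢t → update-if kp u c y (λ e → e ≢ 0 → dl₁ e ≢ 0) (λ _ _ → c-gone)
              (λ ne nz → dl-up dl (kp-dl (unmark ne mk) y≢t nz)) }
        ; tight = record
          { exh = λ {y} v y≢t y∉ _ → let ne = λ y≡u → y∉ (here y≡u)
                                         z , e = exh (down ne v) y≢t (y∉ ∘ there) (λ ()) in
              z , trans (update-other rt u c ne) (trans e (sym (kp-old ne)))
          ; C-rt = λ { (here refl) → trans (update-same rt u c) (sym (update-same kp u c))
                     ; {y} (there y∈) → let ne = vis≢u (C-vis y∈) in
                         trans (update-other rt u c ne) (trans (C-rt y∈) (sym (kp-old ne))) } }
        ; noQ = λ y → update-if st u 2 y (_≢ 1) (λ _ ()) (λ _ → noQ y)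
        ; kstar = star }
        where
        c-gone : dl₁ c ≢ 0
        c-gone z = contradiction (trans (sym (update-same dl c 1)) z) λ()
        drop : ∀ {e} → dl₁ e ≡ 0 → e ∈ c ∷ cs → e ∈ cs
        drop av′ (here refl) = ⊥-elim (c-gone av′)
        drop av′ (there e∈) = e∈
        not3 : ∀ {y} → st₁ y ≢ 3 → st y ≢ 3
        not3 {y} = update-if st u 2 y (λ k → k ≢ 3 → st y ≢ 3)
          (λ { refl _ z → contradiction (trans (sym fr) z) λ() }) (λ _ z → z)
        frs : ∀ {y} → y < N → st₁ y ≡ 0 → ∃[ d ] ∃[ ds ] (cur y ≡ d ∷ ds × dl₁ d ≡ 0)
        frs {y} y<N eq with y ≟ u
        ... | yes refl = contradiction (trans (sym (update-same st u 2)) eq) λ()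
        ... | no ne with fresh y<N (trans (sym (update-other st u 2 ne)) eq)
        ...   | d , ds , eqd , avd = d , ds , eqd , trans (update-other dl c 1 (λ { refl → ne
                  (sym (proj₂ (cur-out (subst (d ∈_) (sym eqd) (here refl))))) })) avd
        star : ∀ {y} → st₁ y ≡ 2 → y ≢ t → y ∈ u ∷ P ⊎ Settled kp₁ cur y
        star {y} eq y≢t with y ≟ u
        ... | yes refl = inj₁ (here refl)
        ... | no ne with kstar (down ne eq) y≢t
        ...   | inj₁ y∈ = inj₁ (there y∈)
        ...   | inj₂ s  = inj₂ (subst (λ e → hd e ≢ t × cur (hd e) ≡ []) (sym (kp-old ne)) s)

    -- Heights fall along kept arcs, so nothing hangs on the top node. The list `P₁` covers both the
    -- case that `x` is a root and the case that it is not.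
    module Pop (x≢t : x ≢ t) (eqi : inn x ≡ []) {P₁} (sub : ∀ {ρ} → ρ ∈ P₁ → ρ ∈ P × ρ ≢ x)
      (sup : ∀ {ρ} → ρ ∈ P → ρ ≢ x → ρ ∈ P₁) (sorted : AllPairs (λ y w → pos w < pos y) P₁) where

      st₁ : ℕ → ℕ
      st₁ = update st x 3

      gone : ∀ {y} → st₁ y ≡ 2 → y ≢ x
      gone eq refl = contradiction (trans (sym (update-same st x 3)) eq) λ()

      down : ∀ {y} → st₁ y ≡ 2 → st y ≡ 2
      down eq = trans (sym (update-other st x 3 (gone eq))) eq

      up : ∀ {y} → st y ≡ 2 → y ≢ x → st₁ y ≡ 2
      up v ne = trans (update-other st x 3 ne) v

      not3 : ∀ {y} → st₁ y ≢ 3 → st y ≢ 3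
      not3 {y} = update-if st x 3 y (λ k → k ≢ 3 → st y ≢ 3) (λ _ z → ⊥-elim (z refl)) (λ _ z → z)

      S₁-stamped : Stamped pos S₁
      S₁-stamped = go (subst (Stamped pos) eqS stacked)
        where
        go : Stamped pos (x ∷ S₁) → Stamped pos S₁
        go (_ ∷ s) = s

      S₁≢x : ∀ {y} → y ∈ S₁ → y ≢ x
      S₁≢x y∈ refl = <-irrefl x-pos (stamp-bound S₁-stamped y∈)

      unmark : ∀ {y} → Marked st₁ y → Marked st y
      unmark {y} = update-if st x 3 y (λ k → k ≡ 1 ⊎ k ≡ 2 → Marked st y)
        (λ { _ (inj₁ ()) ; _ (inj₂ ()) }) (λ _ z → z)

      forest₁ : Forest st₁ pos kp S₁ P₁
      forest₁ = record
        { stacked = S₁-stamped ; pos-t = pos-t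
        ; vis-S = λ {y} v → below (gone v) (subst (y ∈_) eqS (vis-S (down v)))
        ; S-vis = λ {y} y∈ → up (S-vis (subst (y ∈_) (sym eqS) (there y∈))) (S₁≢x y∈)
        ; S<N = λ {y} y∈ → S<N (subst (y ∈_) (sym eqS) (there y∈))
        ; kp-out = λ v → kp-out (down v)
        ; kp-vis = λ v y≢t → up (kp-vis (down v) y≢t) (λ { refl →
            <⇒≱ (kp-pos (down v) y≢t) (top (down v)) })
        ; kp-pos = λ v → kp-pos (down v)
        ; C-vis = λ y∈ → up (C-vis (proj₁ (sub y∈))) (proj₂ (sub y∈))
        ; t∈C = sup t∈C (x≢t ∘ sym)
        ; C-pos = sorted
        ; thru = λ v ρ∈ → thru (down v) (proj₁ (sub ρ∈)) }
        where
        below : ∀ {y} → y ≢ x → y ∈ x ∷ S₁ → y ∈ S₁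
        below ne (here eq) = ⊥-elim (ne eq)
        below ne (there y∈) = y∈

      popped : InvB (record m { st = st₁ ; S = S₁ }) P₁
      popped = record
        { forest = forest₁
        ; arcs = arcs-st arcs not3
            (λ y → update-if st x 3 y (_≤ 3) (λ _ → ≤-refl) (λ _ → st-≤ y))
            (λ {y} → update-if st x 3 y (λ k → k ≢ 0 → y < N) (λ { refl _ → vis<N x-vis }) (λ _ → st-N))
        ; clean = record
          { nd = λ {e} ar av ne t≢ → update-if st x 3 (hd e) (_≢ 3)
              (λ hx _ → contradiction (subst (e ∈_) (trans (cong inn hx) eqi) (av-inn ar av (not3 ne) t≢)) λ())
              (λ _ → nd ar av (not3 ne) t≢)
          ; fresh = λ {y} y<N → update-if st x 3 y
              (λ k → k ≡ 0 → ∃[ c ] ∃[ cs ] (cur y ≡ c ∷ cs × dl c ≡ 0)) (λ _ ()) (λ _ → fresh y<N) }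
        ; routes = record
          { rt-out = λ mk → rt-out (unmark mk) ; rt-dl = λ mk → rt-dl (unmark mk)
          ; kp-dl = λ mk → kp-dl (unmark mk) }
        ; tight = record
          { exh = λ v y≢t y∉ _ → exh (down v) y≢t (λ y∈ → y∉ (sup y∈ (gone v))) (λ ())
          ; C-rt = λ y∈ → C-rt (proj₁ (sub y∈)) }
        ; noQ = λ y → update-if st x 3 y (_≢ 1) (λ _ ()) (λ _ → noQ y)
        ; kstar = λ v y≢t → [ (λ y∈ → inj₁ (sup y∈ (gone v))) , inj₂ ]′ (kstar (down v) y≢t) }

    pop-root : ∀ {P₁} → P ≡ x ∷ P₁ → x ≢ t → inn x ≡ [] →
      InvB (record m { st = update st x 3 ; S = S₁ }) P₁
    pop-root {P₁} refl x≢t eqi = Pop.popped x≢t eqi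
      (λ ρ∈ → there ρ∈ , λ { refl → <-irrefl refl (All.lookup (hd-all C-pos) ρ∈) })
      (λ { (here eq) ne → ⊥-elim (ne eq) ; (there ρ∈) _ → ρ∈ }) (tail-pairs C-pos)
      where
      hd-all : ∀ {R : ℕ → ℕ → Set} {y ys} → AllPairs R (y ∷ ys) → All (R y) ys
      hd-all (al ∷ _) = al
      tail-pairs : ∀ {R : ℕ → ℕ → Set} {y ys} → AllPairs R (y ∷ ys) → AllPairs R ys
      tail-pairs (_ ∷ ps) = ps

    pop-other : ∀ {ρ P₁} → P ≡ ρ ∷ P₁ → ρ ≢ x → x ≢ t → inn x ≡ [] →
      InvB (record m { st = update st x 3 ; S = S₁ }) P
    pop-other {ρ} refl ρ≢x x≢t eqi = Pop.popped x≢t eqi (λ ρ∈ → ρ∈ , other ρ∈) (λ ρ∈ _ → ρ∈) C-pos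
      where
      other : ∀ {y} → y ∈ P → y ≢ x
      other (here refl) = ρ≢x
      other (there y∈) refl with C-pos
      ... | al ∷ _ = <⇒≱ (All.lookup al y∈) (top (C-vis (here refl)))

  -- Existence of pairs of paths

  infixr 5 _∷_
  data Route : ℕ → List ℕ → ℕ → Set where
    []  : ∀ {x} → Route x [] x
    _∷_ : ∀ {x e es y} → Out x e → Route (hd e) es y → Route x (e ∷ es) y

  _⟨++⟩_ : ∀ {x es y fs z} → Route x es y → Route y fs z → Route x (es ++ fs) z
  []      ⟨++⟩ q = q
  (o ∷ p) ⟨++⟩ q = o ∷ (p ⟨++⟩ q)

  route-cut : ∀ {x es y e} → Route x es y → e ∈ es →
    ∃[ as ] ∃[ bs ] (es ≡ as ++ e ∷ bs × Route x as (tl e) × Route (hd e) bs y)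
  route-cut {x} (o ∷ p) (here refl) = [] , _ , refl , subst (λ y → Route x [] y) (sym (proj₂ o)) [] , p
  route-cut (o ∷ p) (there e∈) with route-cut p e∈
  ... | as , bs , refl , p₁ , p₂ = _ ∷ as , bs , refl , o ∷ p₁ , p₂

  inner-keys : ∀ {x es y e} → Route x es y → (∀ {g} → g ∈ es → tl g ≢ t) → e ∈ es →
    key x ≤ key (tl e) × key (tl e) < key y
  inner-keys {x} {es = f ∷ _} {y} (o ∷ p) nt e∈ with last-key p (λ g∈ → nt (there g∈))
    where
    last-key : ∀ {x es y} → Route x es y → (∀ {g} → g ∈ es → tl g ≢ t) → key x ≤ key y
    last-key [] nt = ≤-refl
    last-key ((arc , refl) ∷ p) nt =
      ≤-trans (<⇒≤ (key-mono arc (nt (here refl)))) (last-key p (λ g∈ → nt (there g∈)))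
  inner-keys ((arc , refl) ∷ p) nt (here refl) | le = ≤-refl , <-≤-trans (key-mono arc (nt (here refl))) le
  inner-keys ((arc , refl) ∷ p) nt (there e∈) | _ with inner-keys p (λ g∈ → nt (there g∈)) e∈
  ... | le , lt = ≤-trans (<⇒≤ (key-mono arc (nt (here refl)))) le , lt

  -- F is a set of arcs such that any arc of F can be continued within F up to t.
  Closed : (R : ℕ → Set) → List ℕ → Set
  Closed R F = ∀ {e} → e ∈ F → R e × (hd e ≡ t ⊎ ∃[ f ] (Out (hd e) f × f ∈ F))

  Feasible : (R : ℕ → Set) → ℕ → Set
  Feasible R z = ∃[ as ] ∃[ bs ] (Route z as t × Route (σ z) bs t ×
    (∀ {e} → e ∈ as → R e) × (∀ {e} → e ∈ bs → R e) × Disjoint as bs)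

  _∖_ : (ℕ → Set) → List ℕ → ℕ → Set
  (R ∖ F) e = R e × e ∉ F

  -- As long as arcs of U are not used, it makes no difference whether a pair is
  -- sought in U or among the remaining arcs R.  The set F stands for the arcs of
  -- paths that will be chosen later.
  record Maximal (R U : ℕ → Set) (act : ℕ → ℕ) : Set where
    field
      sound : ∀ {e} → R e → U e
      pairs : ∀ F → Closed R F → ∀ {z} → Z z → Feasible (U ∖ F) z → act z ≢ 0 × Feasible (R ∖ F) z

  feasible-σ : ∀ {R z} → Z z → Feasible R z → Feasible R (σ z)
  feasible-σ {R} {z} zz (as , bs , p , q , Ra , Rb , dis) =
    bs , as , q , subst (λ w → Route w as t) (sym (σ-invol zz)) p , Rb , Ra , λ (x , y) → dis (y , x)

  feasible-map : ∀ {R R′ z} → (∀ {e} → R e → R′ e) → Feasible R z → Feasible R′ z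
  feasible-map f (as , bs , p , q , Ra , Rb , dis) =
    as , bs , p , q , (λ e∈ → f (Ra e∈)) , (λ e∈ → f (Rb e∈)) , dis

  closed-map : ∀ {R R′ F} → (∀ {e} → R e → R′ e) → Closed R F → Closed R′ F
  closed-map f c e∈ = f (proj₁ (c e∈)) , proj₂ (c e∈)

  -- A pair for `z` is also one for `σ z`, so both activities may be assumed to be nonzero; removing
  -- a node from the stack relies on this.
  maximal-step : ∀ {R R′ U act act′} → Maximal R U act → (∀ {e} → R′ e → R e) →
    (∀ F → Closed R′ F → ∀ {z} → Z z → act z ≢ 0 → act (σ z) ≢ 0 →
       Feasible (R ∖ F) z → act′ z ≢ 0 × Feasible (R′ ∖ F) z) →
    Maximal R′ U act′
  maximal-step {R} {R′} {U} {act} {act′} mx sub conv = record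
    { sound = λ r → sound (sub r) ; pairs = prs }
    where
    open Maximal mx
    prs : ∀ F → Closed R′ F → ∀ {z} → Z z → Feasible (U ∖ F) z → act′ z ≢ 0 × Feasible (R′ ∖ F) z
    prs F cl zz fe = conv F cl zz (proj₁ (pairs F (closed-map sub cl) zz fe))
      (proj₁ (pairs F (closed-map sub cl) (Z-σ zz) (feasible-σ zz fe)))
      (proj₂ (pairs F (closed-map sub cl) zz fe))

  maximal-U : ∀ {R U U′ act} → Maximal R U act → (∀ {e} → U′ e → U e) → (∀ {e} → R e → U′ e) →
    Maximal R U′ act
  maximal-U mx f g = record
    { sound = g
    ; pairs = λ F cl zz fe → Maximal.pairs mx F cl zz (feasible-map (λ (u , e∉) → f u , e∉) fe) }

  maximal-≗ : ∀ {R R′ U act} → Maximal R U act → (∀ {e} → R′ e → R e) → (∀ {e} → R e → R′ e) →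
    Maximal R′ U act
  maximal-≗ mx sub sup = maximal-step mx sub λ F cl zz az _ fe →
    az , feasible-map (λ (r , e∉) → sup r , e∉) fe

  -- Every walk of R-arcs from the given node to t contains h.
  data Forced (R : ℕ → Set) (h : ℕ) : ℕ → Set where
    last : ∀ {n} → n ≢ t → (∀ {e} → R e → tl e ≡ n → e ≡ h) → Forced R h n
    next : ∀ {n k} → n ≢ t → (∀ {e} → R e → tl e ≡ n → e ≡ k) → Forced R h (hd k) → Forced R h n

  forced-on : ∀ {R h n es} → Forced R h n → Route n es t → (∀ {e} → e ∈ es → R e) → h ∈ es
  forced-on (last n≢t _) [] _ = ⊥-elim (n≢t refl)
  forced-on (next n≢t _ _) [] _ = ⊥-elim (n≢t refl)
  forced-on (last _ only) (o ∷ p) Re = here (sym (only (Re (here refl)) (proj₂ o)))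
  forced-on (next _ only f) (o ∷ p) Re with only (Re (here refl)) (proj₂ o)
  ... | refl = there (forced-on f p (λ e∈ → Re (there e∈)))

  -- The bound `k` on the distance to the key of the sink decreases with each arc of the
  -- continuation.
  closed-route : ∀ {R F} → (∀ {e} → R e → Arc e × tl e ≢ t) → Closed R F → ∀ {e} → e ∈ F →
    ∃[ es ] (Route (hd e) es t × (∀ {g} → g ∈ es → g ∈ F))
  closed-route {R} {F} proper cl {e₀} e₀∈ = go (key t) e₀∈ (m∸n≤m _ (key (hd e₀)))
    where
    go : ∀ k {e} → e ∈ F → key t ∸ key (hd e) ≤ k → ∃[ es ] (Route (hd e) es t × (∀ {g} → g ∈ es → g ∈ F))
    go k {e} e∈ le with cl e∈
    ... | _ , inj₁ eq = [] , subst (λ y → Route (hd e) [] y) eq [] , λ ()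
    ... | _ , inj₂ (f , o , f∈) with proper (proj₁ (cl f∈))
    ...   | arc , nt with subst (λ y → key y < key (hd f)) (proj₂ o) (key-mono arc nt)
    ...     | lt with k
    ...       | zero = contradiction (≤-trans (m∸n≡0⇒m≤n (n≤0⇒n≡0 le)) (<⇒≤ lt)) below
      where
      below : ¬ key t ≤ key (hd f)
      below t≤ = <⇒≱ (≤-<-trans (m∸n≡0⇒m≤n (n≤0⇒n≡0 le)) lt) (key-≤ (hd<N arc))
        where
        key-≤ : ∀ {y} → y < N → key y ≤ key t
        key-≤ {y} y<N with y ≟ t
        ... | yes refl = ≤-refl
        ... | no y≢t   = <⇒≤ (key-t y<N y≢t)
    ...       | suc k′ with go k′ f∈ (≤-pred (≤-trans (∸-monoʳ-< lt (key-≤ (hd<N arc))) le))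
      where
      key-≤ : ∀ {y} → y < N → key y ≤ key t
      key-≤ {y} y<N with y ≟ t
      ... | yes refl = ≤-refl
      ... | no y≢t   = <⇒≤ (key-t y<N y≢t)
    ...         | es , p , es∈ = f ∷ es , o ∷ p , λ { (here refl) → f∈ ; (there g∈) → es∈ g∈ }

  -- If all walks through the arcs k and e out of v pass h, a walk using e can use k instead.
  module Detour {R : ℕ → Set} {h v e k : ℕ} {rs : List ℕ} (proper : ∀ {g} → R g → Arc g × tl g ≢ t)
    (oe : Out v e) (ok : Out v k) (Rk : R k) (k≢e : k ≢ e) (v≢t : v ≢ t)
    (fe : Forced R h (hd e)) (fk : Forced R h (hd k))
    (way : Route (hd k) rs (tl h)) (Rh : R h)
    (on-way : ∀ {g} → g ∈ rs → R g × Forced R h (hd g)) where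

    -- The head of each new arc before `h` is forced through `h`. If such an arc were in `bs`, then
    -- `h` would be in `bs`; if it were in `F`, the continuation would bring `h` into `F`. But `h`
    -- lies on `as`, which avoids both.
    detour : ∀ {F z as bs y} → Closed R F → Route z as t → Route y bs t →
      (∀ {g} → g ∈ as → R g × g ∉ F) → (∀ {g} → g ∈ bs → R g × g ∉ F) → Disjoint as bs → e ∈ as →
      ∃[ as′ ] (Route z as′ t × (∀ {g} → g ∈ as′ → (R g × g ≢ e) × g ∉ F) × Disjoint as′ bs)
    detour {F} {z} {as} {bs} cl p q Ra Rb dis e∈ with route-cut p e∈
    ... | as₁ , as₂ , refl , p₁ , p₂
      with route-cut p₂ (forced-on fe p₂ (λ g∈ → proj₁ (Ra (∈-++⁺ʳ as₁ (there g∈)))))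
    ...   | as₃ , as₄ , refl , _ , p₄ =
      as₁ ++ k ∷ rs ++ h ∷ as₄ ,
      p₁ ⟨++⟩ (subst (λ y → Out y k) (sym (proj₂ oe)) ok ∷ (way ⟨++⟩ ((proj₁ (proper Rh) , refl) ∷ p₄))) ,
      (λ g∈ → props g∈) , λ (g∈ , g∈b) → apart g∈ g∈b
      where
      orig : ∀ {g} → g ∈ h ∷ as₄ → g ∈ as₁ ++ e ∷ as₃ ++ h ∷ as₄
      orig g∈ = ∈-++⁺ʳ as₁ (there (∈-++⁺ʳ as₃ g∈))
      h∈ : h ∈ as₁ ++ e ∷ as₃ ++ h ∷ as₄
      h∈ = orig (here refl)
      new-∉F : ∀ {g} → R g → Forced R h (hd g) → g ∉ F
      new-∉F Rg f g∈ with closed-route proper cl g∈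
      ... | es , r , es∈ = proj₂ (Ra h∈) (es∈ (forced-on f r (λ g∈ → proj₁ (cl (es∈ g∈)))))
      new-∉b : ∀ {g} → Forced R h (hd g) → g ∉ bs
      new-∉b f g∈ with route-cut q g∈
      ... | bs₁ , bs₂ , refl , _ , q₂ =
        dis (h∈ , ∈-++⁺ʳ bs₁ (there (forced-on f q₂ (λ g∈ → proj₁ (Rb (∈-++⁺ʳ bs₁ (there g∈)))))))
      tails : ∀ {g} → g ∈ as₁ ++ e ∷ as₃ ++ h ∷ as₄ → tl g ≢ t
      tails g∈ = proj₂ (proper (proj₁ (Ra g∈)))
      early : ∀ {g} → g ∈ as₁ → g ≢ e
      early g∈ refl = <-irrefl refl (proj₂ (inner-keys p₁ (λ g∈ → tails (∈-++⁺ˡ g∈)) g∈))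
      v<e : key v < key (hd e)
      v<e = out-key v≢t oe
      late : ∀ {g} → g ∈ h ∷ as₄ → g ≢ e
      late g∈ refl = <⇒≱ v<e (subst (λ y → key (hd e) ≤ key y) (proj₂ oe)
        (proj₁ (inner-keys p₂ (λ g∈ → tails (∈-++⁺ʳ as₁ (there g∈))) (∈-++⁺ʳ as₃ g∈))))
      way≢e : ∀ {g} → g ∈ rs → g ≢ e
      way≢e g∈ refl = <⇒≱ (out-key v≢t ok) (subst (λ y → key (hd k) ≤ key y) (proj₂ oe)
        (proj₁ (inner-keys way (λ g∈ → proj₂ (proper (proj₁ (on-way g∈)))) g∈)))
      props : ∀ {g} → g ∈ as₁ ++ k ∷ rs ++ h ∷ as₄ → (R g × g ≢ e) × g ∉ F
      props g∈ with ∈-++⁻ as₁ g∈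
      ... | inj₁ g∈₁ = (proj₁ (Ra (∈-++⁺ˡ g∈₁)) , early g∈₁) , proj₂ (Ra (∈-++⁺ˡ g∈₁))
      ... | inj₂ (here refl) = (Rk , k≢e) , new-∉F Rk fk
      ... | inj₂ (there g∈₂) with ∈-++⁻ rs g∈₂
      ...   | inj₁ g∈₃ = (proj₁ (on-way g∈₃) , way≢e g∈₃) , new-∉F (proj₁ (on-way g∈₃)) (proj₂ (on-way g∈₃))
      ...   | inj₂ g∈₄ = (proj₁ (Ra (orig g∈₄)) , late g∈₄) , proj₂ (Ra (orig g∈₄))
      apart : ∀ {g} → g ∈ as₁ ++ k ∷ rs ++ h ∷ as₄ → g ∉ bs
      apart g∈ g∈b with ∈-++⁻ as₁ g∈
      ... | inj₁ g∈₁ = dis (∈-++⁺ˡ g∈₁ , g∈b)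
      ... | inj₂ (here refl) = new-∉b fk g∈b
      ... | inj₂ (there g∈₂) with ∈-++⁻ rs g∈₂
      ...   | inj₁ g∈₃ = new-∉b (proj₂ (on-way g∈₃)) g∈b
      ...   | inj₂ g∈₄ = dis (orig g∈₄ , g∈b)

    drop-arc : ∀ {F z} → Closed R F → Feasible (R ∖ F) z → Feasible ((λ g → R g × g ≢ e) ∖ F) z
    drop-arc {F} cl (as , bs , p , q , Ra , Rb , dis) with member? _≟_ e as
    ... | yes e∈ = let as′ , p′ , Ra′ , dis′ = detour cl p q Ra Rb dis e∈ in
      as′ , bs , p′ , q , Ra′ ,
      (λ g∈ → (proj₁ (Rb g∈) , λ { refl → dis (e∈ , g∈) }) , proj₂ (Rb g∈)) , dis′
    ... | no e∉ with member? _≟_ e bs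
    ...   | yes e∈ = let bs′ , q′ , Rb′ , dis′ = detour cl q p Rb Ra (λ (x , y) → dis (y , x)) e∈ in
      as , bs′ , p , q′ ,
      (λ g∈ → (proj₁ (Ra g∈) , λ { refl → e∉ g∈ }) , proj₂ (Ra g∈)) , Rb′ , λ (x , y) → dis′ (y , x)
    ...   | no e∉b = as , bs , p , q ,
      (λ g∈ → (proj₁ (Ra g∈) , λ { refl → e∉ g∈ }) , proj₂ (Ra g∈)) ,
      (λ g∈ → (proj₁ (Rb g∈) , λ { refl → e∉b g∈ }) , proj₂ (Rb g∈)) , dis

  -- Live arcs, and why forgetting arcs is sound

  Kept : (st kp rt : ℕ → ℕ) → ℕ → Set
  Kept st kp rt e = Marked st (tl e) × (kp (tl e) ≡ e ⊎ rt (tl e) ≡ e)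

  -- The arcs a future pair may use. A reserved arc that its tail no longer stores as `kp` or `rt`
  -- has been forgotten; this is how arcs are dropped without touching `dl`.
  Live : (st kp rt dl : ℕ → ℕ) → ℕ → Set
  Live st kp rt dl e = (Arc e × tl e ≢ t) × st (tl e) ≢ 3 × (dl e ≡ 0 ⊎ Kept st kp rt e)

  LiveM : Mem → ℕ → Set
  LiveM m = Live (Mem.st m) (Mem.kp m) (Mem.rt m) (Mem.dl m)

  -- Node x reserves the arc c as its next route.
  module Reserve {st st′ kp kp′ rt dl : ℕ → ℕ} {x c : ℕ} (av : dl c ≡ 0) (out : Out x c) (nt : x ≢ t)
    (nd : st x ≢ 3) (mk : Marked st′ x) (off : ∀ {u} → u ≢ x → st′ u ≡ st u × kp′ u ≡ kp u)
    (kept : Marked st x → (rt x ≡ kp x × kp′ x ≡ kp x))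
    (kept′ : kp′ x ≡ 0 ⊎ kp′ x ≡ c ⊎ (Marked st x × kp′ x ≡ kp x)) where

    rt′ dl′ : ℕ → ℕ
    rt′ = update rt x c
    dl′ = update dl c 1

    -- The arc `c` merely changes from available to kept. The overwritten route of a marked node
    -- equals its kept arc, so no live arc is lost.
    to : ∀ {e} → Live st kp rt dl e → Live st′ kp′ rt′ dl′ e
    to {e} (pr , ne , how) with tl e ≟ x
    ... | yes eq = pr , subst (λ u → st′ u ≢ 3) (sym eq) (mark≢3 mk) , same how
      where
      same : dl e ≡ 0 ⊎ Kept st kp rt e → dl′ e ≡ 0 ⊎ Kept st′ kp′ rt′ e
      same (inj₁ z) with e ≟ c
      ... | yes refl = inj₂ (subst (λ u → Marked st′ u × (kp′ u ≡ e ⊎ rt′ u ≡ e)) (sym eq)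
                         (mk , inj₂ (update-same rt x e)))
      ... | no e≢c = inj₁ (trans (update-other dl c 1 e≢c) z)
      same (inj₂ (mk₀ , k)) = inj₂ (subst (λ u → Marked st′ u × (kp′ u ≡ e ⊎ rt′ u ≡ e)) (sym eq)
        (mk , inj₁ (via-kp (subst (λ u → kp u ≡ e ⊎ rt u ≡ e) eq k))))
        where
        mkx = kept (subst (Marked st) eq mk₀)
        via-kp : kp x ≡ e ⊎ rt x ≡ e → kp′ x ≡ e
        via-kp (inj₁ k≡) = trans (proj₂ mkx) k≡
        via-kp (inj₂ r≡) = trans (proj₂ mkx) (trans (sym (proj₁ mkx)) r≡)
    ... | no u≢x = pr , subst (_≢ 3) (sym (proj₁ (off u≢x))) ne , other how
      where
      other : dl e ≡ 0 ⊎ Kept st kp rt e → dl′ e ≡ 0 ⊎ Kept st′ kp′ rt′ e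
      other (inj₁ z) = inj₁ (trans (update-other dl c 1 (λ { refl → u≢x (proj₂ out) })) z)
      other (inj₂ (m , k)) = inj₂ (subst (λ s → s ≡ 1 ⊎ s ≡ 2) (sym (proj₁ (off u≢x))) m ,
        [ (λ k≡ → inj₁ (trans (proj₂ (off u≢x)) k≡)) , (λ r≡ → inj₂ (trans (update-other rt x c u≢x) r≡)) ]′ k)

    from : ∀ {e} → Live st′ kp′ rt′ dl′ e → Live st kp rt dl e
    from {e} (pr , ne , how) with tl e ≟ x
    ... | yes eq = pr , subst (λ u → st u ≢ 3) (sym eq) nd , same how
      where
      same : dl′ e ≡ 0 ⊎ Kept st′ kp′ rt′ e → dl e ≡ 0 ⊎ Kept st kp rt e
      same (inj₁ z) = inj₁ (update-if dl c 1 e (λ d → d ≡ 0 → dl e ≡ 0) (λ _ ()) (λ _ z → z) z)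
      same (inj₂ (_ , k)) with subst (λ u → kp′ u ≡ e ⊎ rt′ u ≡ e) eq k
      ... | inj₂ r≡ = inj₁ (subst (λ d → dl d ≡ 0) (trans (sym (update-same rt x c)) r≡) av)
      ... | inj₁ k≡ = [ (λ z → contradiction (subst (0 <_) (trans (sym k≡) z) (proj₁ (proj₁ pr))) λ())
        , [ (λ c≡ → inj₁ (subst (λ d → dl d ≡ 0) (trans (sym c≡) k≡) av))
          , (λ (m , kk) → inj₂ (subst (λ u → Marked st u × (kp u ≡ e ⊎ rt u ≡ e)) (sym eq)
                (m , inj₁ (trans (sym kk) k≡)))) ]′ ]′ kept′
    ... | no u≢x = pr , subst (_≢ 3) (proj₁ (off u≢x)) ne , other how
      where
      other : dl′ e ≡ 0 ⊎ Kept st′ kp′ rt′ e → dl e ≡ 0 ⊎ Kept st kp rt e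
      other (inj₁ z) = inj₁ (update-if dl c 1 e (λ d → d ≡ 0 → dl e ≡ 0) (λ _ ()) (λ _ z → z) z)
      other (inj₂ (m , k)) = inj₂ (subst (λ s → s ≡ 1 ⊎ s ≡ 2) (proj₁ (off u≢x)) m ,
        [ (λ k≡ → inj₁ (trans (sym (proj₂ (off u≢x))) k≡))
        , (λ r≡ → inj₂ (trans (sym (update-other rt x c u≢x)) r≡)) ]′ k)

  module _ {m r P L b a x U act} (i : InvF m r P L b a x) (mx : Maximal (LiveM m) U act) where
    open Mem m
    open InvF i

    max-push : ∀ {c cs} → st x ≡ 0 → cur x ≡ c ∷ cs → dl c ≡ 0 →
      Maximal (Live (update st x 1) (update kp x 0) (update rt x c) (update dl c 1)) U act
    max-push {c} fr eqc av = maximal-≗ mx R.from R.to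
      where
      module R = Reserve {st} {update st x 1} {kp} {update kp x 0} {rt} {dl} av
        (cur-out (subst (c ∈_) (sym eqc) (here refl)))
        (λ eq → 0≢2 fr (trans (cong st eq) t-vis)) (λ z → contradiction (trans (sym fr) z) λ())
        (inj₁ (update-same st x 1)) (λ ne → update-other st x 1 ne , update-other kp x 0 ne)
        (λ mk → ⊥-elim (mark≢0 mk fr)) (inj₁ (update-same kp x 0))

    max-reserve : ∀ {y c cs} → cur y ≡ c ∷ cs → dl c ≡ 0 → y ≢ t → Marked st y → rt y ≡ kp y →
      Maximal (Live st kp (update rt y c) (update dl c 1)) U act
    max-reserve {y} {c} eqc av y≢t mk eq = maximal-≗ mx R.from R.to
      where
      module R = Reserve {st} {st} {kp} {kp} {rt} {dl} av
        (cur-out (subst (c ∈_) (sym eqc) (here refl))) y≢t (mark≢3 mk) mk (λ _ → refl , refl)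
        (λ _ → eq , refl) (inj₂ (inj₂ (mk , refl)))

    max-resolve-new : ∀ {v} → Marked st v → kp v ≡ 0 →
      Maximal (Live st (update kp v (rt v)) rt dl) U act
    max-resolve-new {v} mk k0 = maximal-≗ mx from to
      where
      from : ∀ {e} → Live st (update kp v (rt v)) rt dl e → Live st kp rt dl e
      from {e} (pr , ne , inj₁ z) = pr , ne , inj₁ z
      from {e} (pr , ne , inj₂ (m , inj₂ k)) = pr , ne , inj₂ (m , inj₂ k)
      from {e} (pr , ne , inj₂ (m , inj₁ k)) = pr , ne , inj₂ (m ,
        update-if kp v (rt v) (tl e) (λ k → k ≡ e → kp (tl e) ≡ e ⊎ rt (tl e) ≡ e)
          (λ eq r≡ → inj₂ (trans (cong rt eq) r≡)) (λ _ k≡ → inj₁ k≡) k)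
      to : ∀ {e} → Live st kp rt dl e → Live st (update kp v (rt v)) rt dl e
      to (pr , ne , inj₁ z) = pr , ne , inj₁ z
      to (pr , ne , inj₂ (m , inj₂ k)) = pr , ne , inj₂ (m , inj₂ k)
      to {e} (pr , ne , inj₂ (m , inj₁ k)) = pr , ne , inj₂ (m , inj₁ (trans (update-other kp v (rt v)
        (λ { refl → contradiction (subst (0 <_) (trans (sym k) k0) (proj₁ (proj₁ pr))) λ() })) k))

    max-join : ∀ {v} → st v ≡ 1 → Maximal (Live (update st v 2) kp rt dl) U act
    max-join {v} v1 = maximal-≗ mx from to
      where
      from : ∀ {e} → Live (update st v 2) kp rt dl e → Live st kp rt dl e
      from {e} (pr , ne , how) with tl e ≟ v
      ... | yes refl = pr , mark≢3 (inj₁ v1) , [ inj₁ , (λ (_ , k) → inj₂ (inj₁ v1 , k)) ]′ how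
      ... | no u≢v = pr , subst (_≢ 3) (update-other st v 2 u≢v) ne ,
        [ inj₁ , (λ (m , k) → inj₂ (subst (λ s → s ≡ 1 ⊎ s ≡ 2) (update-other st v 2 u≢v) m , k)) ]′ how
      to : ∀ {e} → Live st kp rt dl e → Live (update st v 2) kp rt dl e
      to {e} (pr , ne , how) with tl e ≟ v
      ... | yes refl = pr , mark≢3 (inj₂ (update-same st v 2)) ,
              [ inj₁ , (λ (_ , k) → inj₂ (inj₂ (update-same st v 2) , k)) ]′ how
      ... | no u≢v = pr , subst (_≢ 3) (sym (update-other st v 2 u≢v)) ne ,
        [ inj₁ , (λ (m , k) → inj₂ (subst (λ s → s ≡ 1 ⊎ s ≡ 2) (sym (update-other st v 2 u≢v)) m , k)) ]′ how

    -- The unlisted nodes of the group of an exhausted root have no way out but kp r.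
    module Stuck (r-exh : cur r ≡ []) (r≢t : r ≢ t) where
      stuck : ∀ {u} → st u ≡ 2 → pos r ≤ pos u → u ∉ L → u ≢ t × cur u ≡ [] × rt u ≡ kp u
      stuck {u} vu r≤u u∉L = u≢t , ex , rt≡kp vu u≢t u∉L
        where
        u≢t : u ≢ t
        u≢t refl = contradiction (<-≤-trans (pos>0 (r-visited i) r≢t) (≤-trans r≤u (≤-reflexive pos-t))) λ()
        ex : cur u ≡ []
        ex with u ≟ r
        ... | yes refl = r-exh
        ... | no u≢r = proj₁ (exh vu u≢t
                (λ u∈ → u≢r (uniq-pos vu (r-visited i) (≤-antisym (roots-≤ i u∈) r≤u))) u∉L)

      only-keep : ∀ {u e} → st u ≡ 2 → pos r ≤ pos u → u ∉ L → LiveM m e → tl e ≡ u → e ≡ kp u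
      only-keep vu r≤u u∉ (pr , _ , how) refl with stuck vu r≤u u∉
      ... | _ , ex , eq with how
      ...   | inj₁ z = contradiction (subst (_ ∈_) ex (av-cur (proj₁ pr) z)) λ()
      ...   | inj₂ (_ , inj₁ k) = sym k
      ...   | inj₂ (_ , inj₂ k) = trans (sym k) eq

      -- The threshold `k₀` is a key from which on nothing is listed: 0 in a failure, the successor
      -- of `key v` on a retreat. Keys grow along the chain, so all of it is unlisted and has single
      -- exits.
      forced : ∀ {u} k₀ → (∀ {w} → k₀ ≤ key w → w ∉ L) → st u ≡ 2 → k₀ ≤ key u → Chain kp u r →
        Forced (LiveM m) (kp r) u
      forced k₀ nl vu le here = last r≢t (only-keep vu ≤-refl (nl le))
      forced k₀ nl vu le (step u≢t c) =
        next u≢t (only-keep vu (≤-trans (chain-pos (kp-vis vu u≢t) c) (<⇒≤ (kp-pos vu u≢t))) (nl le))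
          (forced k₀ nl (kp-vis vu u≢t) (≤-trans le (<⇒≤ (kp-key vu u≢t))) c)

      keep-live : ∀ {u} → st u ≡ 2 → u ≢ t → LiveM m (kp u)
      keep-live vu u≢t with kp-out vu u≢t
      ... | arc , eq = (arc , λ z → u≢t (trans (sym eq) z)) ,
        subst (λ w → st w ≢ 3) (sym eq) (mark≢3 (inj₂ vu)) ,
        inj₂ (inj₂ (trans (cong st eq) vu) , inj₁ (cong kp eq))

      descent : ∀ {u} k₀ → (∀ {w} → k₀ ≤ key w → w ∉ L) → st u ≡ 2 → k₀ ≤ key u → Chain kp u r →
        ∃[ rs ] (Route u rs r × (∀ {g} → g ∈ rs → LiveM m g × Forced (LiveM m) (kp r) (hd g)))
      descent k₀ nl vu le here = [] , [] , λ ()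
      descent {u} k₀ nl vu le (step u≢t c) with descent k₀ nl (kp-vis vu u≢t) (≤-trans le (<⇒≤ (kp-key vu u≢t))) c
      ... | rs , p , on = kp u ∷ rs , kp-out vu u≢t ∷ p ,
        λ { (here refl) → keep-live vu u≢t ,
              forced k₀ nl (kp-vis vu u≢t) (≤-trans le (<⇒≤ (kp-key vu u≢t))) c
          ; (there g∈) → on g∈ }

  module _ {m r P v L b a x U act} (i : InvF m r P (v ∷ L) b a x) (mx : Maximal (LiveM m) U act)
    (vx : Mem.st m x ≡ 2) (r≤x : Mem.pos m r ≤ Mem.pos m x)
    (r-exh : Mem.cur m r ≡ []) (r≢t : r ≢ t) where
    open Mem m
    open InvF i
    open Back i vx r≤x r-exh r≢t
    open Stuck i mx r-exh r≢t

    -- The arc rt v and the older arc kp v lead into the same group, so rt v is redundant.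
    max-resolve-old : kp v ≢ 0 → Maximal (Live st kp (update rt v (kp v)) dl) U act
    max-resolve-old k≢0 = maximal-step mx from conv
      where
      open Old-keep k≢0
      out-e : Out v (rt v)
      out-e = rt-out v-mark v≢t
      unlisted : ∀ {w} → suc (key v) ≤ key w → w ∉ v ∷ L
      unlisted = not-listed
      from : ∀ {e} → Live st kp rt₁ dl e → LiveM m e
      from {e} (pr , ne , inj₁ z) = pr , ne , inj₁ z
      from {e} (pr , ne , inj₂ (m , inj₁ k)) = pr , ne , inj₂ (m , inj₁ k)
      from {e} (pr , ne , inj₂ (m , inj₂ k)) = pr , ne , inj₂ (m ,
        update-if rt v (kp v) (tl e) (λ g → g ≡ e → kp (tl e) ≡ e ⊎ rt (tl e) ≡ e)
          (λ eq r≡ → inj₁ (trans (cong kp eq) r≡)) (λ _ r≡ → inj₂ r≡) k)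
      to : ∀ {e} → LiveM m e → e ≢ rt v ⊎ rt v ≡ kp v → Live st kp rt₁ dl e
      to (pr , ne , inj₁ z) _ = pr , ne , inj₁ z
      to (pr , ne , inj₂ (m , inj₁ k)) _ = pr , ne , inj₂ (m , inj₁ k)
      to {e} (pr , ne , inj₂ (m , inj₂ k)) how = pr , ne , inj₂ (m ,
        update-if rt v (kp v) (tl e) (λ g → kp (tl e) ≡ e ⊎ g ≡ e)
          (λ eq → [ (λ e≢ → ⊥-elim (e≢ (trans (sym k) (cong rt eq))))
                  , (λ r≡k → inj₂ (trans (sym r≡k) (trans (cong rt (sym eq)) k))) ]′ how)
          (λ _ → inj₂ k))
      head-chain : ∀ {h} → st h ≡ 2 → pos r ≤ pos h → Chain kp h r
      head-chain vh le = thru vh (here refl) le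
      conv : ∀ F → Closed (Live st kp rt₁ dl) F → ∀ {z} → Z z → act z ≢ 0 → act (σ z) ≢ 0 →
        Feasible (LiveM m ∖ F) z → act z ≢ 0 × Feasible (Live st kp rt₁ dl ∖ F) z
      conv F cl zz az _ fe with rt v ≟ kp v
      ... | yes eq = az , feasible-map (λ (l , e∉) → to l (inj₂ eq) , e∉) fe
      ... | no ne with descent (suc (key v)) unlisted (proj₁ (proj₂ kp-head)) (out-key v≢t (proj₁ kp-head))
                         (head-chain (proj₁ (proj₂ kp-head)) (proj₂ (proj₂ kp-head)))
      ...   | rs , way , on = az , feasible-map (λ ((l , g≢) , g∉) → to l (inj₁ g≢) , g∉)
        (Detour.drop-arc {R = LiveM m} {h = kp r} proj₁ out-e (proj₁ kp-head) Rk (ne ∘ sym) v≢t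
          (forced (suc (key v)) unlisted (proj₁ rt-head) (out-key v≢t out-e)
            (head-chain (proj₁ rt-head) (proj₂ rt-head)))
          (forced (suc (key v)) unlisted (proj₁ (proj₂ kp-head)) (out-key v≢t (proj₁ kp-head))
            (head-chain (proj₁ (proj₂ kp-head)) (proj₂ (proj₂ kp-head))))
          (subst (Route _ rs) (sym (proj₂ (kp-out (r-visited i) r≢t))) way)
          (keep-live (r-visited i) r≢t) on (closed-map from cl) fe)
        where
        Rk : LiveM m (kp v)
        Rk = (proj₁ (proj₁ kp-head) , λ z → v≢t (trans (sym (proj₂ (proj₁ kp-head))) z)) ,
          subst (λ w → st w ≢ 3) (sym (proj₂ (proj₁ kp-head))) (mark≢3 v-mark) ,
          inj₂ (subst (Marked st) (sym (proj₂ (proj₁ kp-head))) v-mark ,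
                inj₁ (cong kp (proj₂ (proj₁ kp-head))))

  -- `b-good` has been carried through the search for this moment: it places `σ a` in the same group
  -- as `a`. With nothing listed, both paths of a pair would contain `kp r`.
  max-fail : ∀ {m r P a x U act} → InvF m r P [] (σ a) a x → Maximal (LiveM m) U act →
    Mem.st m x ≡ 2 → Mem.pos m r ≤ Mem.pos m x → Mem.cur m r ≡ [] → r ≢ t →
    Maximal (LiveM m) U (update act a 0)
  max-fail {m} {r} {a = a} {act = act} i mx vx r≤x r-exh r≢t = maximal-step mx (λ l → l) conv
    where
    open Mem m
    open InvF i
    open Stuck i mx r-exh r≢t
    through : ∀ {u es} → st u ≡ 2 → pos r ≤ pos u → Route u es t → (∀ {e} → e ∈ es → LiveM m e) → kp r ∈ es
    through vu le p Re = forced-on (forced 0 (λ _ ()) vu z≤n (thru vu (here refl) le)) p Re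
    b-in : st (σ a) ≡ 2 × pos r ≤ pos (σ a)
    b-in with Meet.good-meet i vx r≤x b-good
    ... | inj₂ z = z
    conv : ∀ F → Closed (LiveM m) F → ∀ {z} → Z z → act z ≢ 0 → act (σ z) ≢ 0 →
      Feasible (LiveM m ∖ F) z → update act a 0 z ≢ 0 × Feasible (LiveM m ∖ F) z
    conv F cl {z} zz az _ fe@(as , bs , p , q , Ra , Rb , dis) =
      update-if act a 0 z (_≢ 0)
        (λ { refl _ → dis (through a-vis a-pos p (λ e∈ → proj₁ (Ra e∈)) ,
                           through (proj₁ b-in) (proj₂ b-in) q (λ e∈ → proj₁ (Rb e∈))) })
        (λ _ → az) , fe

  max-dead : ∀ {m U act z₀} → Maximal (LiveM m) U act → Z z₀ → Mem.st m (σ z₀) ≡ 3 →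
    Maximal (LiveM m) U (update act z₀ 0)
  max-dead {m} {act = act} {z₀} mx z∈ dead = maximal-step mx (λ l → l) conv
    where
    empty : ∀ {F bs y} → Route y bs t → Mem.st m y ≡ 3 → y ≢ t → ¬ (∀ {e} → e ∈ bs → (LiveM m ∖ F) e)
    empty [] d y≢t _ = y≢t refl
    empty ((_ , refl) ∷ _) d _ Rb = proj₁ (proj₂ (proj₁ (Rb (here refl)))) d
    conv : ∀ F → Closed (LiveM m) F → ∀ {z} → Z z → act z ≢ 0 → act (σ z) ≢ 0 →
      Feasible (LiveM m ∖ F) z → update act z₀ 0 z ≢ 0 × Feasible (LiveM m ∖ F) z
    conv F cl {z} zz az _ fe@(as , bs , p , q , Ra , Rb , dis) =
      update-if act z₀ 0 z (_≢ 0)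
        (λ { refl _ → empty {F} q dead (λ eq → t∉Z (subst Z eq (Z-σ zz))) (λ e∈ → Rb e∈) })
        (λ _ → az) , fe

  avoid-node : ∀ {x y es} → Route y es t → y ≢ x → (∀ {e} → e ∈ es → hd e ≢ x) → ∀ {e} → e ∈ es → tl e ≢ x
  avoid-node ((_ , refl) ∷ p) y≢x nh (here refl) = y≢x
  avoid-node (o ∷ p) y≢x nh (there e∈) = avoid-node p (nh (here refl)) (λ g∈ → nh (there g∈)) e∈

  -- No live arc enters `x`: an available one would be in the empty list, and a kept one leads down
  -- the stack. Only a pair with a path from `x` could use its arcs, and `act x ≡ 0` excludes this
  -- on either side of `σ`.
  max-pop : ∀ {m P x S₁ U act} (i : InvB m P) (eqS : Mem.S m ≡ x ∷ S₁) → Maximal (LiveM m) U act →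
    x ≢ t → Mem.inn m x ≡ [] → act x ≡ 0 →
    Maximal (Live (update (Mem.st m) x 3) (Mem.kp m) (Mem.rt m) (Mem.dl m)) U act
  max-pop {m} {P} {x} {act = act} i eqS mx x≢t eqi ax = maximal-step mx from conv
    where
    open Mem m
    open InvB i
    open Top i eqS
    from : ∀ {e} → Live (update st x 3) kp rt dl e → LiveM m e
    from {e} (pr , ne , how) with tl e ≟ x
    ... | yes refl = ⊥-elim (ne (update-same st x 3))
    ... | no u≢x = pr , subst (_≢ 3) (update-other st x 3 u≢x) ne ,
      [ inj₁ , (λ (m , k) → inj₂ (subst (λ s → s ≡ 1 ⊎ s ≡ 2) (update-other st x 3 u≢x) m , k)) ]′ how
    to : ∀ {e} → LiveM m e → tl e ≢ x → Live (update st x 3) kp rt dl e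
    to {e} (pr , ne , how) u≢x = pr , subst (_≢ 3) (sym (update-other st x 3 u≢x)) ne ,
      [ inj₁ , (λ (m , k) → inj₂ (subst (λ s → s ≡ 1 ⊎ s ≡ 2) (sym (update-other st x 3 u≢x)) m , k)) ]′ how
    not-into : ∀ {e} → LiveM m e → hd e ≢ x
    not-into ((arc , nt) , ne , inj₁ z) refl = contradiction (subst (_ ∈_) eqi (av-inn arc z ne nt)) λ()
    not-into ((arc , nt) , ne , inj₂ (inj₁ q , _)) refl = noQ _ q
    not-into {e} ((arc , nt) , ne , inj₂ (inj₂ v , k)) refl =
      <⇒≱ (subst (λ g → pos (hd g) < pos (tl e)) (keep k) (kp-pos v nt)) (top v)
      where
      keep : kp (tl e) ≡ e ⊎ rt (tl e) ≡ e → kp (tl e) ≡ e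
      keep (inj₁ eq) = eq
      keep (inj₂ eq) = trans (sym (rt≡kp v nt (λ ()))) eq
    conv : ∀ F → Closed (Live (update st x 3) kp rt dl) F → ∀ {z} → Z z → act z ≢ 0 → act (σ z) ≢ 0 →
      Feasible (LiveM m ∖ F) z → act z ≢ 0 × Feasible (Live (update st x 3) kp rt dl ∖ F) z
    conv F cl {z} zz az aσ (as , bs , p , q , Ra , Rb , dis) = az , as , bs , p , q ,
      (λ e∈ → to (proj₁ (Ra e∈)) (avoid-node p (λ { refl → az ax }) (λ g∈ → not-into (proj₁ (Ra g∈))) e∈) ,
              proj₂ (Ra e∈)) ,
      (λ e∈ → to (proj₁ (Rb e∈)) (avoid-node q (λ eq → aσ (trans (cong act eq) ax))
                (λ g∈ → not-into (proj₁ (Rb g∈))) e∈) , proj₂ (Rb e∈)) , dis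

  max-bpush : ∀ {m P c U act} (i : InvB m P) → Maximal (LiveM m) U act → Arc c →
    Mem.dl m c ≡ 0 → Mem.st m (tl c) ≡ 0 →
    Maximal (Live (update (Mem.st m) (tl c) 2) (update (Mem.kp m) (tl c) c)
                  (update (Mem.rt m) (tl c) c) (update (Mem.dl m) c 1)) U act
  max-bpush {m} {c = c} i mx arc av fr = maximal-≗ mx R.from R.to
    where
    open Mem m
    open InvB i
    u : ℕ
    u = tl c
    module R = Reserve {st} {update st u 2} {kp} {update kp u c} {rt} {dl} av (arc , refl)
      (λ eq → 0≢2 fr (trans (cong st eq) t-vis)) (λ z → contradiction (trans (sym fr) z) λ())
      (inj₂ (update-same st u 2)) (λ ne → update-other st u 2 ne , update-other kp u c ne)
      (λ mk → ⊥-elim (mark≢0 mk fr)) (inj₂ (inj₁ (update-same kp u c)))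

  -- The paths of a successful search

  -- The schedule of `Reach`, but built from its end at the sink, so that the arcs of both walks can
  -- be collected by recursion.
  data Walks (st kp rt : ℕ → ℕ) : ℕ → ℕ → List ℕ → List ℕ → Set where
    done  : Walks st kp rt t t [] []
    left  : ∀ {x y X Y} → key x < key y → Marked st x → x ≢ t → Out x (rt x) →
            Walks st kp rt (hd (rt x)) y X Y → Walks st kp rt x y (rt x ∷ X) Y
    right : ∀ {x y X Y} → key y < key x → Marked st y → y ≢ t → Out y (rt y) →
            Walks st kp rt x (hd (rt y)) X Y → Walks st kp rt x y X (rt y ∷ Y)
    both  : ∀ {x X Y} → Marked st x → x ≢ t → Out x (rt x) → Out x (kp x) → rt x ≢ kp x →
            Walks st kp rt (hd (rt x)) (hd (kp x)) X Y → Walks st kp rt x x (rt x ∷ X) (kp x ∷ Y)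

  walks-swap : ∀ {st kp rt x y X Y} → Walks st kp rt x y X Y → ∃[ X′ ] ∃[ Y′ ] Walks st kp rt y x X′ Y′
  walks-swap done = _ , _ , done
  walks-swap (left lt m nt o w) = let _ , _ , w′ = walks-swap w in _ , _ , right lt m nt o w′
  walks-swap (right lt m nt o w) = let _ , _ , w′ = walks-swap w in _ , _ , left lt m nt o w′
  walks-swap (both m nt o o′ ne w) = _ , _ , both m nt o o′ ne w

  reach-walks : ∀ {st kp rt b a x y X Y} → Reach st kp rt b a x y → Walks st kp rt x y X Y →
    ∃[ X′ ] ∃[ Y′ ] Walks st kp rt b a X′ Y′
  reach-walks start w = _ , _ , w
  reach-walks (swap r) w = let _ , _ , w′ = walks-swap w in reach-walks r w′
  reach-walks (move r m nt o lt) w = reach-walks r (left lt m nt o w)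
  reach-walks (split r m nt o o′ ne) w = reach-walks r (both m nt o o′ ne w)

  module _ {st kp rt : ℕ → ℕ} where

    walks-keys : ∀ {x y X Y} → Walks st kp rt x y X Y →
      (∀ {e} → e ∈ X → key x ≤ key (tl e)) × (∀ {e} → e ∈ Y → key y ≤ key (tl e))
    walks-keys done = (λ ()) , λ ()
    walks-keys (left lt m nt o w) with walks-keys w
    ... | kx , ky = (λ { (here refl) → ≤-reflexive (cong key (sym (proj₂ o))) ; (there e∈) → ≤-trans (<⇒≤ (out-key nt o)) (kx e∈) }) , ky
    walks-keys (right lt m nt o w) with walks-keys w
    ... | kx , ky = kx , λ { (here refl) → ≤-reflexive (cong key (sym (proj₂ o))) ; (there e∈) → ≤-trans (<⇒≤ (out-key nt o)) (ky e∈) }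
    walks-keys {x} (both m nt o o′ ne w) with walks-keys w
    ... | kx , ky =
      (λ { (here refl) → ≤-reflexive (cong key (sym (proj₂ o)))
         ; (there e∈) → ≤-trans (<⇒≤ (out-key nt o)) (kx e∈) }) ,
      (λ { (here refl) → ≤-reflexive (cong key (sym (proj₂ o′)))
         ; (there e∈) → ≤-trans (<⇒≤ (out-key nt o′)) (ky e∈) })

    walks-routes : ∀ {x y X Y} → Walks st kp rt x y X Y → Route x X t × Route y Y t
    walks-routes done = [] , []
    walks-routes (left _ _ _ o w) = let p , q = walks-routes w in o ∷ p , q
    walks-routes (right _ _ _ o w) = let p , q = walks-routes w in p , o ∷ q
    walks-routes (both _ _ o o′ _ w) = let p , q = walks-routes w in o ∷ p , o′ ∷ q

    below-tails : ∀ {X : List ℕ} {y n e} → (∀ {g} → g ∈ X → key y ≤ key (tl g)) → tl e ≡ n → key n < key y → e ∉ X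
    below-tails ks refl lt e∈ = <⇒≱ lt (ks e∈)

    -- The tail of an arc has the smallest key among the tails of all arcs taken from then on,
    -- strictly so except at a split, where the two arcs differ by construction.
    walks-distinct : ∀ {x y X Y} → Walks st kp rt x y X Y → AllPairs _≢_ (X ++ Y)
    walks-distinct w = go w
      where
      fresh-head : ∀ {e : ℕ} {X} → e ∉ X → All (e ≢_) X
      fresh-head e∉ = All.tabulate (λ { g∈ refl → e∉ g∈ })
      ∉-++ : ∀ {e : ℕ} X {Y} → e ∉ X → e ∉ Y → e ∉ X ++ Y
      ∉-++ X e∉X e∉Y e∈ = [ e∉X , e∉Y ]′ (∈-++⁻ X e∈)
      insert : ∀ {e : ℕ} X {Y} → e ∉ X → e ∉ Y → AllPairs _≢_ (X ++ Y) → AllPairs _≢_ (X ++ e ∷ Y)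
      insert [] _ e∉Y ps = fresh-head e∉Y ∷ ps
      insert {e} (g ∷ X) e∉X e∉Y (al ∷ ps) =
        All.tabulate (λ {h} h∈ → [ (λ h∈X → All.lookup al (∈-++⁺ˡ h∈X))
          , (λ { (here refl) eq → e∉X (here (sym eq)) ; (there h∈Y) → All.lookup al (∈-++⁺ʳ X h∈Y) }) ]′ (∈-++⁻ X h∈))
        ∷ insert X (e∉X ∘ there) e∉Y ps
      go : ∀ {x y X Y} → Walks st kp rt x y X Y → AllPairs _≢_ (X ++ Y)
      go done = []
      go {X = _ ∷ X} (left lt m nt o w) = let kx , ky = walks-keys w in
        fresh-head (∉-++ X (below-tails kx (proj₂ o) (out-key nt o)) (below-tails ky (proj₂ o) lt)) ∷ go w
      go {X = X} {_ ∷ Y} (right lt m nt o w) = let kx , ky = walks-keys w in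
        insert X (below-tails kx (proj₂ o) lt) (below-tails ky (proj₂ o) (out-key nt o)) (go w)
      go {X = _ ∷ X} {_ ∷ Y} (both m nt o o′ ne w) = let kx , ky = walks-keys w in
        fresh-head (∉-++ X (below-tails kx (proj₂ o) (out-key nt o))
          (λ { (here eq) → ne eq ; (there e∈) → below-tails ky (proj₂ o) (out-key nt o′) e∈ }))
        ∷ insert X (below-tails kx (proj₂ o′) (out-key nt o)) (below-tails ky (proj₂ o′) (out-key nt o′)) (go w)

    walks-kept : ∀ {x y X Y e} → Walks st kp rt x y X Y → e ∈ X ⊎ e ∈ Y →
      Kept st kp rt e × Arc e × tl e ≢ t
    walks-kept done (inj₁ ())
    walks-kept done (inj₂ ())
    walks-kept (left _ m nt (arc , eq) w) (inj₁ (here refl)) =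
      (subst (Marked st) (sym eq) m , inj₂ (cong rt eq)) , arc , (λ z → nt (trans (sym eq) z))
    walks-kept (left _ _ _ _ w) (inj₁ (there e∈)) = walks-kept w (inj₁ e∈)
    walks-kept (left _ _ _ _ w) (inj₂ e∈) = walks-kept w (inj₂ e∈)
    walks-kept (right _ m nt (arc , eq) w) (inj₂ (here refl)) =
      (subst (Marked st) (sym eq) m , inj₂ (cong rt eq)) , arc , (λ z → nt (trans (sym eq) z))
    walks-kept (right _ _ _ _ w) (inj₂ (there e∈)) = walks-kept w (inj₂ e∈)
    walks-kept (right _ _ _ _ w) (inj₁ e∈) = walks-kept w (inj₁ e∈)
    walks-kept (both m nt (arc , eq) _ _ w) (inj₁ (here refl)) =
      (subst (Marked st) (sym eq) m , inj₂ (cong rt eq)) , arc , (λ z → nt (trans (sym eq) z))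
    walks-kept (both m nt _ (arc , eq) _ w) (inj₂ (here refl)) =
      (subst (Marked st) (sym eq) m , inj₁ (cong kp eq)) , arc , (λ z → nt (trans (sym eq) z))
    walks-kept (both _ _ _ _ _ w) (inj₁ (there e∈)) = walks-kept w (inj₁ e∈)
    walks-kept (both _ _ _ _ _ w) (inj₂ (there e∈)) = walks-kept w (inj₂ e∈)

    -- The moves of the tokens are deterministic, so all reachable positions lie on the walks.
    module OnWalks {b a X₀ Y₀} (w₀ : Walks st kp rt b a X₀ Y₀) where
      Used : ℕ → Set
      Used e = e ∈ X₀ ⊎ e ∈ Y₀

      Suffix : ℕ → ℕ → Set
      Suffix x y = ∃[ X ] ∃[ Y ] (Walks st kp rt x y X Y ×
                     (∀ {e} → e ∈ X → Used e) × (∀ {e} → e ∈ Y → Used e))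

      suffix : ∀ {x y} → Reach st kp rt b a x y → Suffix x y ⊎ Suffix y x
      suffix start = inj₁ (_ , _ , w₀ , inj₁ , inj₂)
      suffix (swap r) = [ inj₂ , inj₁ ]′ (suffix r)
      suffix (move r m nt o lt) with suffix r
      ... | inj₁ (_ , _ , left _ _ _ _ w , u₁ , u₂) = inj₁ (_ , _ , w , u₁ ∘ there , u₂)
      ... | inj₁ (_ , _ , right gt _ _ _ w , u₁ , u₂) = ⊥-elim (<-asym lt gt)
      ... | inj₁ (_ , _ , both _ _ _ _ _ w , u₁ , u₂) = ⊥-elim (<-irrefl refl lt)
      ... | inj₁ (_ , _ , done , _) = ⊥-elim (nt refl)
      ... | inj₂ (_ , _ , right _ _ _ _ w , u₁ , u₂) = inj₂ (_ , _ , w , u₁ , u₂ ∘ there)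
      ... | inj₂ (_ , _ , left gt _ _ _ w , u₁ , u₂) = ⊥-elim (<-asym lt gt)
      ... | inj₂ (_ , _ , both _ _ _ _ _ w , u₁ , u₂) = ⊥-elim (<-irrefl refl lt)
      ... | inj₂ (_ , _ , done , _) = ⊥-elim (nt refl)
      suffix (split r m nt o o′ ne) with [ (λ z → z) , (λ z → z) ]′ (suffix r)
      ... | _ , _ , both _ _ _ _ _ w , u₁ , u₂ = inj₁ (_ , _ , w , u₁ ∘ there , u₂ ∘ there)
      ... | _ , _ , left gt _ _ _ w , u₁ , u₂ = ⊥-elim (<-irrefl refl gt)
      ... | _ , _ , right gt _ _ _ w , u₁ , u₂ = ⊥-elim (<-irrefl refl gt)
      ... | _ , _ , done , _ = ⊥-elim (nt refl)

      used-rt : ∀ {n y} → Reach st kp rt b a n y → key n ≤ key y → n ≢ t → Used (rt n)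
      used-rt r le nt with suffix r
      ... | inj₁ (_ , _ , left _ _ _ _ w , u₁ , u₂) = u₁ (here refl)
      ... | inj₁ (_ , _ , both _ _ _ _ _ w , u₁ , u₂) = u₁ (here refl)
      ... | inj₁ (_ , _ , right gt _ _ _ w , u₁ , u₂) = ⊥-elim (<⇒≱ gt le)
      ... | inj₁ (_ , _ , done , _) = ⊥-elim (nt refl)
      ... | inj₂ (_ , _ , right _ _ _ _ w , u₁ , u₂) = u₂ (here refl)
      ... | inj₂ (_ , _ , both _ _ _ _ _ w , u₁ , u₂) = u₁ (here refl)
      ... | inj₂ (_ , _ , left gt _ _ _ w , u₁ , u₂) = ⊥-elim (<⇒≱ gt le)
      ... | inj₂ (_ , _ , done , _) = ⊥-elim (nt refl)

      used-kp : ∀ {n} → Reach st kp rt b a n n → n ≢ t → Used (kp n)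
      used-kp r nt with [ (λ z → z) , (λ z → z) ]′ (suffix r)
      ... | _ , _ , both _ _ _ _ _ w , u₁ , u₂ = u₂ (here refl)
      ... | _ , _ , left gt _ _ _ w , u₁ , u₂ = ⊥-elim (<-irrefl refl gt)
      ... | _ , _ , right gt _ _ _ w , u₁ , u₂ = ⊥-elim (<-irrefl refl gt)
      ... | _ , _ , done , _ = ⊥-elim (nt refl)

  -- After a success the reserved arcs are either used or discarded, so only available arcs remain.
  LiveK : (st dl : ℕ → ℕ) → ℕ → Set
  LiveK st dl e = (Arc e × tl e ≢ t) × st (tl e) ≢ 3 × dl e ≡ 0

  module Succeed {m P L b a x U act} (i : InvF m t P L b a x) (mx : Maximal (LiveM m) U act)
    (vx : Mem.st m x ≡ 2) (t≤x : Mem.pos m t ≤ Mem.pos m x) where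
    open Mem m
    open InvF i

    P≡[] : P ≡ []
    P≡[] = bottom C-pos
      where
      bottom : ∀ {D} → AllPairs (λ u w → pos w < pos u) (t ∷ D) → D ≡ []
      bottom {[]} _ = refl
      bottom {ρ ∷ _} ((lt ∷ _) ∷ _) = contradiction (subst (pos ρ <_) pos-t lt) λ()

    result : ∃[ X ] ∃[ Y ] Walks st kp rt b a X Y
    result = reach-walks (Meet.both-at-root i vx t≤x (λ _ ne → ne refl)) done

    X Y : List ℕ
    X = proj₁ result
    Y = proj₁ (proj₂ result)

    walks : Walks st kp rt b a X Y
    walks = proj₂ (proj₂ result)

    open OnWalks walks

    used-dl : ∀ {e} → Used e → dl e ≢ 0
    used-dl u with walks-kept walks u
    ... | (mk , inj₁ k) , arc , nt = subst (λ g → dl g ≢ 0) k (kp-dl mk nt (λ z →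
            contradiction (subst (0 <_) (trans (sym k) z) (proj₁ arc)) λ()))
    ... | (mk , inj₂ k) , arc , nt = subst (λ g → dl g ≢ 0) k (rt-dl mk nt)

    used-live : ∀ {e} → Used e → LiveM m e
    used-live u with walks-kept walks u
    ... | k@(mk , _) , arc , nt = (arc , nt) , mark≢3 mk , inj₂ k

    -- A reserved arc that is not used leads to a node without available arcs.
    unused-settled : ∀ {e} → (Arc e × tl e ≢ t) → Kept st kp rt e → ¬ Used e → hd e ≢ t × cur (hd e) ≡ []
    unused-settled {e} (arc , nt) (mk , how) un = by-keep (keep how)
      where
      n = tl e
      listed-rt : n ∈ L → Used (rt n)
      listed-rt n∈ = let y , R , le , _ = passed n∈ in used-rt R le nt
      keep : kp n ≡ e ⊎ rt n ≡ e → kp n ≡ e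
      keep (inj₁ k) = k
      keep (inj₂ r) with member? _≟_ n L
      ... | yes n∈ = ⊥-elim (un (subst Used r (listed-rt n∈)))
      ... | no n∉ = [ (λ q → ⊥-elim (n∉ (L1 q))) , (λ v → trans (sym (rt≡kp v nt n∉)) r) ]′ mk
      by-keep : kp n ≡ e → hd e ≢ t × cur (hd e) ≡ []
      by-keep k with kstar mk nt (λ z → contradiction (subst (0 <_) (trans (sym k) z) (proj₁ arc)) λ())
      ... | inj₁ n∈ = ⊥-elim (nt (only-t (subst (λ P → n ∈ t ∷ P) P≡[] n∈)))
        where
        only-t : n ∈ t ∷ [] → n ≡ t
        only-t (here eq) = eq
      ... | inj₂ (inj₁ (n∈ , inj₁ r)) = ⊥-elim (un (subst Used (trans r k) (listed-rt n∈)))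
      ... | inj₂ (inj₁ (n∈ , inj₂ R)) = ⊥-elim (un (subst Used k (used-kp R nt)))
      ... | inj₂ (inj₂ s) = subst (λ g → hd g ≢ t × cur (hd g) ≡ []) k s

    -- Induction from the sink: if a live arc off the paths found were only reserved, it would lead
    -- to a node other than the sink without available arcs, while the next arc of the route is
    -- available.
    route-available : ∀ {y es} → Route y es t → (∀ {e} → e ∈ es → LiveM m e × ¬ Used e) →
      ∀ {e} → e ∈ es → dl e ≡ 0
    route-available (_∷_ {es = es} o p) f (there e∈) = route-available p (λ g∈ → f (there g∈)) e∈
    route-available {es = e ∷ es} (o ∷ p) f (here refl) with f (here refl)
    ... | (pr , _ , inj₁ z) , _ = z
    ... | (pr , _ , inj₂ k) , un with unused-settled pr k un
    ...   | h≢t , ex = go p (route-available p (λ g∈ → f (there g∈)))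
      where
      go : ∀ {es} → Route (hd e) es t → (∀ {g} → g ∈ es → dl g ≡ 0) → dl e ≡ 0
      go [] _ = ⊥-elim (h≢t refl)
      go ((arc , eq) ∷ _) av = contradiction
        (subst (_ ∈_) (trans (cong cur eq) ex) (av-cur arc (av (here refl)))) λ()

    -- Here the quantification over `F` pays off: the arcs of the new pair join `F`, which stays
    -- closed because both walks end at the sink.
    maximal : Maximal (LiveK st dl) (U ∖ (X ++ Y)) act
    maximal = record
      { sound = λ (pr , ne , z) → Maximal.sound mx (pr , ne , inj₁ z) , λ e∈ → used-dl (∈-++⁻ X e∈) z
      ; pairs = prs }
      where
      prs : ∀ F → Closed (LiveK st dl) F → ∀ {z} → Z z → Feasible ((U ∖ (X ++ Y)) ∖ F) z →
        act z ≢ 0 × Feasible (LiveK st dl ∖ F) z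
      prs F cl {z} zz fe with Maximal.pairs mx (F ++ X ++ Y) closed zz
          (feasible-map (λ ((u , e∉XY) , e∉F) → u , λ e∈ → [ e∉F , e∉XY ]′ (∈-++⁻ F e∈)) fe)
        where
        next-in : ∀ {y es e} → Route y es t → e ∈ es → hd e ≡ t ⊎ ∃[ f ] (Out (hd e) f × f ∈ es)
        next-in (o ∷ []) (here refl) = inj₁ refl
        next-in (o ∷ (o′ ∷ p)) (here refl) = inj₂ (_ , o′ , there (here refl))
        next-in (o ∷ p) (there e∈) with next-in p e∈
        ... | inj₁ eq = inj₁ eq
        ... | inj₂ (f , of , f∈) = inj₂ (f , of , there f∈)
        closed : Closed (LiveM m) (F ++ X ++ Y)
        closed {e} e∈ with ∈-++⁻ F e∈
        ... | inj₁ e∈F = let (pr , ne , z) , c = cl e∈F in (pr , ne , inj₁ z) ,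
              [ inj₁ , (λ (f , o , f∈) → inj₂ (f , o , ∈-++⁺ˡ f∈)) ]′ c
        ... | inj₂ e∈′ with ∈-++⁻ X e∈′
        ...   | inj₁ e∈X = used-live (inj₁ e∈X) ,
                [ inj₁ , (λ (f , o , f∈) → inj₂ (f , o , ∈-++⁺ʳ F (∈-++⁺ˡ f∈))) ]′
                  (next-in (proj₁ (walks-routes walks)) e∈X)
        ...   | inj₂ e∈Y = used-live (inj₂ e∈Y) ,
                [ inj₁ , (λ (f , o , f∈) → inj₂ (f , o , ∈-++⁺ʳ F (∈-++⁺ʳ X f∈))) ]′
                  (next-in (proj₂ (walks-routes walks)) e∈Y)
      ... | az , as , bs , p , q , Ra , Rb , dis =
        az , as , bs , p , q , (λ e∈ → avail p Ra e∈) , (λ e∈ → avail q Rb e∈) , dis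
        where
        avail : ∀ {y es} → Route y es t → (∀ {e} → e ∈ es → (LiveM m ∖ (F ++ X ++ Y)) e) →
          ∀ {e} → e ∈ es → (LiveK st dl ∖ F) e
        avail p R e∈ with R e∈
        ... | (pr , ne , _) , e∉ = (pr , ne , route-available p (λ g∈ → proj₁ (R g∈) , λ u →
                proj₂ (R g∈) (∈-++⁺ʳ F ([ ∈-++⁺ˡ , ∈-++⁺ʳ X ]′ u))) e∈) , λ e∈F → e∉ (∈-++⁺ˡ e∈F)

  -- Removal of dead nodes

  data Based : List ℕ → Set where
    base : Based (t ∷ [])
    _∷_  : ∀ {x xs} → x ≢ t × x < N → Based xs → Based (x ∷ xs)

  t∈based : ∀ {xs} → Based xs → t ∈ xs
  t∈based base    = here refl
  t∈based (_ ∷ b) = there (t∈based b)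

  -- The nodes of S (other than t) and L wait for a test whether they still have
  -- an available arc; all other nodes are fresh or dead.
  record InvK (st pos kp rt dl : ℕ → ℕ) (cur inn : ℕ → List ℕ) (S L : List ℕ) : Set where
    field
      arcs     : Arcs st dl cur inn
      t-two    : st t ≡ 2
      pos-t    : pos t ≡ 0
      rt-t     : rt t ≡ kp t
      based    : Based S
      L-ok     : All (λ x → x ≢ t × x < N) L
      waiting  : ∀ {x} → st x ≢ 0 → st x ≢ 3 → x ∈ S ⊎ x ∈ L
      dead-cur : ∀ {x} → x ∈ S ⊎ x ∈ L → st x ≡ 3 → cur x ≡ []
      dead-in  : ∀ {e} → Arc e → dl e ≡ 0 → st (tl e) ≢ 3 → tl e ≢ t → st (hd e) ≡ 3 → hd e ∈ S
      fresh    : ∀ {x} → x < N → st x ≡ 0 → ∃[ c ] ∃[ cs ] (cur x ≡ c ∷ cs × dl c ≡ 0)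
    open Arcs arcs public

  flush-node : ∀ {st pos kp rt dl cur inn S v L} → InvK st pos kp rt dl cur inn S (v ∷ L) →
    InvK st pos kp rt dl cur inn (v ∷ S) L
  flush-node i = record
    { arcs = arcs ; t-two = t-two ; pos-t = pos-t ; rt-t = rt-t ; based = All.head L-ok ∷ based
    ; L-ok = All.tail L-ok
    ; waiting = λ n0 n3 → move₁ (waiting n0 n3)
    ; dead-cur = λ x∈ → dead-cur (move₂ x∈)
    ; dead-in = λ arc av ne nt d → there (dead-in arc av ne nt d)
    ; fresh = fresh }
    where
    open InvK i
    move₁ : ∀ {x v S L} → x ∈ S ⊎ x ∈ v ∷ L → x ∈ v ∷ S ⊎ x ∈ L
    move₁ (inj₁ x∈) = inj₁ (there x∈)
    move₁ (inj₂ (here eq)) = inj₁ (here eq)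
    move₁ (inj₂ (there x∈)) = inj₂ x∈
    move₂ : ∀ {x v S L} → x ∈ v ∷ S ⊎ x ∈ L → x ∈ S ⊎ x ∈ v ∷ L
    move₂ (inj₁ (here eq)) = inj₂ (here eq)
    move₂ (inj₁ (there x∈)) = inj₁ x∈
    move₂ (inj₂ x∈) = inj₂ (there x∈)

  module _ {st pos kp rt dl cur inn n S} (n≢t : n ≢ t) (n<N : n < N)
    (i : InvK st pos kp rt dl cur inn (n ∷ S) []) where
    open InvK i

    based-tail : Based S
    based-tail = go based n≢t
      where
      go : ∀ {x xs} → Based (x ∷ xs) → x ≢ t → Based xs
      go base ne = ⊥-elim (ne refl)
      go (_ ∷ b) _ = b

    drop-top : ∀ {x} → x ≢ n → x ∈ n ∷ S ⊎ x ∈ [] → x ∈ S ⊎ x ∈ []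
    drop-top ne (inj₁ (here eq)) = ⊥-elim (ne eq)
    drop-top ne (inj₁ (there x∈)) = inj₁ x∈

    advance-cur : ∀ {c cs} → cur n ≡ c ∷ cs → dl c ≢ 0 → st n ≢ 0 →
      InvK st pos kp rt dl (update cur n cs) inn (n ∷ S) []
    advance-cur {c} {cs} eq nz n0 = record
      { arcs = arcs-skip arcs eq nz ; t-two = t-two ; pos-t = pos-t ; rt-t = rt-t ; based = based
      ; L-ok = L-ok ; waiting = waiting
      ; dead-cur = λ x∈ d → settled-pop cur eq (dead-cur x∈ d)
      ; dead-in = dead-in
      ; fresh = λ {x} x<N z → let d , ds , eqd , av = fresh x<N z in
          d , ds , trans (update-other cur n cs (λ { refl → n0 z })) eqd , av }

    advance-fresh : ∀ {c cs} → cur n ≡ c ∷ cs → dl c ≢ 0 → st n ≡ 0 → ⊥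
    advance-fresh eq nz z with fresh n<N z
    ... | d , ds , eqd , av with trans (sym eq) eqd
    ...   | refl = nz av

    -- An available arc at the head of the list is all a fresh node has to offer; the arcs that `n`
    -- had reserved are gone for good.
    accept : ∀ {c cs} → cur n ≡ c ∷ cs → dl c ≡ 0 →
      InvK (update st n 0) pos kp rt dl cur inn S []
    accept {c} {cs} eq av = record
      { arcs = arcs-st arcs
          (λ {u} → update-if st n 0 u (λ k → k ≢ 3 → st u ≢ 3) (λ { refl _ → alive }) (λ _ z → z))
          (λ u → update-if st n 0 u (_≤ 3) (λ _ → z≤n) (λ _ → st-≤ u))
          (λ {u} → update-if st n 0 u (λ k → k ≢ 0 → u < N) (λ { refl _ → n<N }) (λ _ → st-N))
      ; t-two = trans (update-other st n 0 (n≢t ∘ sym)) t-two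
      ; pos-t = pos-t ; rt-t = rt-t ; based = based-tail ; L-ok = []
      ; waiting = λ {x} → update-if st n 0 x (λ k → k ≢ 0 → k ≢ 3 → x ∈ S ⊎ x ∈ [])
          (λ _ z → ⊥-elim (z refl)) (λ ne n0 n3 → drop-top ne (waiting n0 n3))
      ; dead-cur = λ {x} x∈ → update-if st n 0 x (λ k → k ≡ 3 → cur x ≡ [])
          (λ _ ()) (λ _ → dead-cur ([ inj₁ ∘ there , inj₂ ]′ x∈))
      ; dead-in = λ {e} arc av′ ne nt d → below {e} arc av′ ne nt d
      ; fresh = λ {x} x<N → update-if st n 0 x
          (λ k → k ≡ 0 → ∃[ d ] ∃[ ds ] (cur x ≡ d ∷ ds × dl d ≡ 0))
          (λ { refl _ → c , cs , eq , av }) (λ _ → fresh x<N) }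
      where
      alive : st n ≢ 3
      alive z = contradiction (trans (sym (dead-cur (inj₁ (here refl)) z)) eq) λ()
      below : ∀ {e} → Arc e → dl e ≡ 0 → update st n 0 (tl e) ≢ 3 → tl e ≢ t →
              update st n 0 (hd e) ≡ 3 → hd e ∈ S
      below {e} arc av′ ne nt d with hd e ≟ n
      ... | yes refl = contradiction (trans (sym (update-same st n 0)) d) λ()
      ... | no h≢n with dead-in arc av′
              (update-if st n 0 (tl e) (λ k → k ≢ 3 → st (tl e) ≢ 3) (λ eq _ → subst (λ u → st u ≢ 3) (sym eq) alive)
                (λ _ z → z) ne) nt (trans (sym (update-other st n 0 h≢n)) d)
      ...   | here eq  = ⊥-elim (h≢n eq)
      ...   | there h∈ = h∈

    accept-live : ∀ {c cs U act} → cur n ≡ c ∷ cs → Maximal (LiveK st dl) U act →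
      Maximal (LiveK (update st n 0) dl) U act
    accept-live eq mx = maximal-≗ mx
      (λ {e} (pr , ne , z) → pr , update-if st n 0 (tl e) (λ k → k ≢ 3 → st (tl e) ≢ 3)
        (λ eqn _ d → contradiction
          (trans (sym (dead-cur (inj₁ (here refl)) (trans (cong st (sym eqn)) d))) eq) λ())
        (λ _ z → z) ne , z)
      (λ {e} (pr , ne , z) → pr , update-if st n 0 (tl e) (_≢ 3) (λ _ ()) (λ _ → ne) , z)

    -- The dead node stays on the stack until its entering arcs have been scanned; `dead-in` permits
    -- available arcs into dead nodes only as long as these are on the stack.
    kill : cur n ≡ [] → InvK (update st n 3) pos kp rt dl cur inn (n ∷ S) []
    kill ex = record
      { arcs = arcs-st arcs not3
          (λ u → update-if st n 3 u (_≤ 3) (λ _ → ≤-refl) (λ _ → st-≤ u))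
          (λ {u} → update-if st n 3 u (λ k → k ≢ 0 → u < N) (λ { refl _ → n<N }) (λ _ → st-N))
      ; t-two = trans (update-other st n 3 (n≢t ∘ sym)) t-two
      ; pos-t = pos-t ; rt-t = rt-t ; based = based ; L-ok = []
      ; waiting = λ {x} → update-if st n 3 x (λ k → k ≢ 0 → k ≢ 3 → x ∈ n ∷ S ⊎ x ∈ [])
          (λ _ _ z → ⊥-elim (z refl)) (λ _ → waiting)
      ; dead-cur = λ {x} x∈ → update-if st n 3 x (λ k → k ≡ 3 → cur x ≡ [])
          (λ { refl _ → ex }) (λ _ → dead-cur x∈)
      ; dead-in = λ {e} arc av ne nt → update-if st n 3 (hd e) (λ k → k ≡ 3 → hd e ∈ n ∷ S)
          (λ eq _ → here eq) (λ _ → dead-in arc av (not3 ne) nt)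
      ; fresh = λ {x} x<N → update-if st n 3 x
          (λ k → k ≡ 0 → ∃[ d ] ∃[ ds ] (cur x ≡ d ∷ ds × dl d ≡ 0)) (λ _ ()) (λ _ → fresh x<N) }
      where
      not3 : ∀ {u} → update st n 3 u ≢ 3 → st u ≢ 3
      not3 {u} = update-if st n 3 u (λ k → k ≢ 3 → st u ≢ 3) (λ _ z → ⊥-elim (z refl)) (λ _ z → z)

    kill-live : ∀ {U act} → cur n ≡ [] → Maximal (LiveK st dl) U act →
      Maximal (LiveK (update st n 3) dl) U act
    kill-live ex mx = maximal-≗ mx
      (λ {e} (pr , ne , z) → pr , update-if st n 3 (tl e) (λ k → k ≢ 3 → st (tl e) ≢ 3)
        (λ _ z → ⊥-elim (z refl)) (λ _ z → z) ne , z)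
      (λ {e} (pr , ne , z) → pr , update-if st n 3 (tl e) (_≢ 3)
        (λ eqn _ → contradiction (subst (e ∈_) (trans (cong cur eqn) ex) (av-cur (proj₁ pr) z)) λ())
        (λ _ → ne) , z)

    discard : st n ≡ 3 → inn n ≡ [] → InvK st pos kp rt dl cur inn S []
    discard d eqi = record
      { arcs = arcs ; t-two = t-two ; pos-t = pos-t ; rt-t = rt-t ; based = based-tail ; L-ok = []
      ; waiting = λ n0 n3 → drop-top (λ { refl → n3 d }) (waiting n0 n3)
      ; dead-cur = λ x∈ → dead-cur ([ inj₁ ∘ there , inj₂ ]′ x∈)
      ; dead-in = λ {e} arc av ne nt z → [ (λ x → x) , (λ ()) ]′ (drop-top
          (λ eq → contradiction (subst (e ∈_) (trans (cong inn eq) eqi) (av-inn arc av ne nt)) λ())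
          (inj₁ (dead-in arc av ne nt z)))
      ; fresh = fresh }

    module Scan {c cs} (d : st n ≡ 3) (eqi : inn n ≡ c ∷ cs) where
      arc : Arc c
      arc = proj₁ (inn-in (subst (c ∈_) (sym eqi) (here refl)))

      h≡n : hd c ≡ n
      h≡n = proj₂ (inn-in (subst (c ∈_) (sym eqi) (here refl)))

      dl₁ : ℕ → ℕ
      dl₁ = update dl c 1

      was : ∀ {e} → dl₁ e ≡ 0 → e ≢ c × dl e ≡ 0
      was {e} z with e ≟ c
      ... | yes refl = contradiction (trans (sym (update-same dl c 1)) z) λ()
      ... | no e≢c = e≢c , trans (sym (update-other dl c 1 e≢c)) z

      arcs₁ : Arcs st dl₁ cur (update inn n cs)
      arcs₁ = record
        { cur-out = cur-out
        ; inn-in = λ {y} {e} → update-if inn n cs y (λ es → e ∈ es → Arc e × hd e ≡ y)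
            (λ { refl e∈ → inn-in (subst (e ∈_) (sym eqi) (there e∈)) }) (λ _ → inn-in)
        ; av-cur = λ ar z → av-cur ar (proj₂ (was z))
        ; av-inn = λ {e} ar z ne nt → update-if inn n cs (hd e) (e ∈_)
            (λ hn → rest (proj₁ (was z)) (subst (e ∈_) (trans (cong inn hn) eqi)
                      (av-inn ar (proj₂ (was z)) ne nt)))
            (λ _ → av-inn ar (proj₂ (was z)) ne nt)
        ; st-≤ = st-≤ ; st-N = st-N }
        where
        rest : ∀ {e} → e ≢ c → e ∈ c ∷ cs → e ∈ cs
        rest ne (here eq) = ⊥-elim (ne eq)
        rest ne (there e∈) = e∈

      fresh₁ : ∀ {x} → x < N → st x ≡ 0 → (x ≡ tl c → ∀ {ds} → cur x ≢ c ∷ ds) →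
        ∃[ e ] ∃[ ds ] (cur x ≡ e ∷ ds × dl₁ e ≡ 0)
      fresh₁ {x} x<N z no-c with fresh x<N z
      ... | e , ds , eqd , av with e ≟ c
      ...   | yes refl = ⊥-elim (no-c (sym (proj₂ (cur-out (subst (e ∈_) (sym eqd) (here refl))))) eqd)
      ...   | no e≢c = e , ds , eqd , trans (update-other dl c 1 e≢c) av

      -- A live route neither ends in the dead node, which is not the sink, nor leaves it, as tails
      -- of live arcs are not dead.
      live : ∀ {U act} → Maximal (LiveK st dl) U act → Maximal (LiveK st dl₁) U act
      live mx = maximal-step mx (λ (pr , ne , z) → pr , ne , proj₂ (was z))
        λ F cl zz az _ (as , bs , p , q , Ra , Rb , dis) →
          az , as , bs , p , q , (λ e∈ → keep p Ra e∈) , (λ e∈ → keep q Rb e∈) , dis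
        where
        enters : ∀ {F y es} → Route y es t → (∀ {e} → e ∈ es → (LiveK st dl ∖ F) e) → ∀ {e} → e ∈ es → hd e ≢ n
        enters (_ ∷ []) R (here refl) eq = n≢t (sym eq)
        enters (_ ∷ ((_ , eq′) ∷ _)) R (here refl) eq =
          proj₁ (proj₂ (proj₁ (R (there (here refl))))) (trans (cong st (trans eq′ eq)) d)
        enters (_ ∷ p) R (there e∈) = enters p (λ g∈ → R (there g∈)) e∈
        keep : ∀ {F y es} → Route y es t → (∀ {e} → e ∈ es → (LiveK st dl ∖ F) e) →
          ∀ {e} → e ∈ es → (LiveK st dl₁ ∖ F) e
        keep p R e∈ with R e∈
        ... | (pr , ne , z) , e∉ =
          (pr , ne , trans (update-other dl c 1 (λ { refl → enters p R e∈ h≡n })) z) , e∉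

      scan-skip : (st (tl c) ≡ 0 → ∀ {ds} → cur (tl c) ≢ c ∷ ds) →
        InvK st pos kp rt dl₁ cur (update inn n cs) (n ∷ S) []
      scan-skip no-c = record
        { arcs = arcs₁ ; t-two = t-two ; pos-t = pos-t ; rt-t = rt-t ; based = based ; L-ok = []
        ; waiting = waiting ; dead-cur = dead-cur
        ; dead-in = λ ar z → dead-in ar (proj₂ (was z))
        ; fresh = λ x<N z → fresh₁ x<N z (λ { refl → no-c z }) }

      scan-push : st (tl c) ≡ 0 →
        InvK (update st (tl c) 1) pos kp rt dl₁ cur (update inn n cs) (tl c ∷ n ∷ S) []
      scan-push u0 = record
        { arcs = arcs-st arcs₁ not3
            (λ u → update-if st (tl c) 1 u (_≤ 3) (λ _ → s≤s z≤n) (λ _ → st-≤ u))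
            (λ {u} → update-if st (tl c) 1 u (λ k → k ≢ 0 → u < N) (λ { refl _ → tl<N arc }) (λ _ → st-N))
        ; t-two = trans (update-other st (tl c) 1 (u≢t ∘ sym)) t-two
        ; pos-t = pos-t ; rt-t = rt-t ; based = (u≢t , tl<N arc) ∷ based ; L-ok = []
        ; waiting = λ {x} → update-if st (tl c) 1 x (λ k → k ≢ 0 → k ≢ 3 → x ∈ tl c ∷ n ∷ S ⊎ x ∈ [])
            (λ eq _ _ → inj₁ (here eq)) (λ _ n0 n3 → [ inj₁ ∘ there , inj₂ ]′ (waiting n0 n3))
        ; dead-cur = λ {x} x∈ → update-if st (tl c) 1 x (λ k → k ≡ 3 → cur x ≡ [])
            (λ _ ()) (λ ne → dead-cur (sub ne x∈))
        ; dead-in = λ {e} ar z ne nt → update-if st (tl c) 1 (hd e) (λ k → k ≡ 3 → hd e ∈ tl c ∷ n ∷ S)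
            (λ _ ()) (λ _ dd → there (dead-in ar (proj₂ (was z)) (not3 ne) nt dd))
        ; fresh = λ {x} x<N → update-if st (tl c) 1 x
            (λ k → k ≡ 0 → ∃[ e ] ∃[ ds ] (cur x ≡ e ∷ ds × dl₁ e ≡ 0)) (λ _ ())
            (λ ne z → fresh₁ x<N z (λ eq → ⊥-elim (ne eq))) }
        where
        u≢t : tl c ≢ t
        u≢t eq = 0≢2 (trans (cong st (sym eq)) u0) t-two
        not3 : ∀ {u} → update st (tl c) 1 u ≢ 3 → st u ≢ 3
        not3 {u} = update-if st (tl c) 1 u (λ k → k ≢ 3 → st u ≢ 3)
          (λ { refl _ z → contradiction (trans (sym u0) z) λ() }) (λ _ z → z)
        sub : ∀ {x} → x ≢ tl c → x ∈ tl c ∷ n ∷ S ⊎ x ∈ [] → x ∈ n ∷ S ⊎ x ∈ []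
        sub ne (inj₁ (here eq)) = ⊥-elim (ne eq)
        sub ne (inj₁ (there x∈)) = inj₁ x∈

      push-live : ∀ {U act} → st (tl c) ≡ 0 → Maximal (LiveK st dl) U act →
        Maximal (LiveK (update st (tl c) 1) dl₁) U act
      push-live u0 mx = maximal-≗ (live mx)
        (λ {e} (pr , ne , z) → pr , update-if st (tl c) 1 (tl e) (λ k → k ≢ 3 → st (tl e) ≢ 3)
          (λ eq _ dd → contradiction (trans (sym (trans (cong st eq) u0)) dd) λ()) (λ _ z → z) ne , z)
        (λ {e} (pr , ne , z) → pr , update-if st (tl c) 1 (tl e) (_≢ 3) (λ _ ()) (λ _ → ne) , z)

  clean-done : ∀ {st pos kp rt dl cur inn} → InvK st pos kp rt dl cur inn (t ∷ []) [] →
    InvB (mem st pos kp rt dl cur inn (t ∷ [])) (t ∷ [])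
  clean-done {st} {pos} {kp} {rt} {dl} {cur} i = record
    { forest = record
      { stacked = pos-t ∷ []
      ; pos-t = pos-t
      ; vis-S = λ v → here (only-t (λ z → 0≢2 z v) (mark≢3 (inj₂ v)))
      ; S-vis = λ { (here refl) → t-two }
      ; S<N = λ { (here refl) → t<N }
      ; kp-out = λ v ne → ⊥-elim (ne (vis-t v)) ; kp-vis = λ v ne → ⊥-elim (ne (vis-t v))
      ; kp-pos = λ v ne → ⊥-elim (ne (vis-t v))
      ; C-vis = λ { (here refl) → t-two } ; t∈C = here refl ; C-pos = [] ∷ []
      ; thru = λ { v (here refl) _ → subst (λ x → Chain kp x t) (sym (vis-t v)) here } }
    ; arcs = arcs
    ; clean = record
      { nd = λ arc av ne nt d → contradiction (trans (sym t-two) (trans (cong st (sym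
          (in-t (dead-in arc av ne nt d)))) d)) λ()
      ; fresh = fresh }
    ; routes = record
      { rt-out = λ mk ne → ⊥-elim (ne (only-t (mark≢0 mk) (mark≢3 mk)))
      ; rt-dl = λ mk ne → ⊥-elim (ne (only-t (mark≢0 mk) (mark≢3 mk)))
      ; kp-dl = λ mk ne → ⊥-elim (ne (only-t (mark≢0 mk) (mark≢3 mk))) }
    ; tight = record
      { exh = λ v ne → ⊥-elim (ne (vis-t v))
      ; C-rt = λ { (here refl) → rt-t } }
    ; noQ = λ x q → 1≢2 q (trans (cong st (only-t (mark≢0 (inj₁ q)) (mark≢3 (inj₁ q)))) t-two)
    ; kstar = λ v ne → ⊥-elim (ne (vis-t v)) }
    where
    open InvK i
    in-t : ∀ {x} → x ∈ t ∷ [] → x ≡ t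
    in-t (here eq) = eq
    only-t : ∀ {x} → st x ≢ 0 → st x ≢ 3 → x ≡ t
    only-t n0 n3 with waiting n0 n3
    ... | inj₁ x∈ = in-t x∈
    vis-t : ∀ {x} → st x ≡ 2 → x ≡ t
    vis-t v = only-t (λ z → 0≢2 z v) (mark≢3 (inj₂ v))

  clean-live : ∀ {m P U act} → InvB m P → Mem.S m ≡ t ∷ [] →
    Maximal (LiveK (Mem.st m) (Mem.dl m)) U act → Maximal (LiveM m) U act
  clean-live {m} i eqS mx = maximal-≗ mx
    (λ { (pr , ne , inj₁ z) → pr , ne , z
       ; (pr , ne , inj₂ (inj₁ q , _)) → ⊥-elim (noQ _ q)
       ; (pr , ne , inj₂ (inj₂ v , _)) → ⊥-elim (proj₂ pr (in-t (subst (_ ∈_) eqS (vis-S v)))) })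
    (λ (pr , ne , z) → pr , ne , inj₁ z)
    where
    open Mem m
    open InvB i
    in-t : ∀ {x} → x ∈ t ∷ [] → x ≡ t
    in-t (here eq) = eq

  success-clean : ∀ {m P L b a x} → InvF m t P L b a x →
    InvK (Mem.st m) (Mem.pos m) (Mem.kp m) (Mem.rt m) (Mem.dl m) (Mem.cur m) (Mem.inn m) (Mem.S m) L
  success-clean {m} {L = L} i = record
    { arcs = arcs ; t-two = t-vis ; pos-t = pos-t ; rt-t = C-rt (here refl)
    ; based = ground stacked S<N (vis-S t-vis)
    ; L-ok = All.tabulate (λ n∈ → L≢t n∈ , st-N (mark≢0 (L-mark n∈)))
    ; waiting = wait
    ; dead-cur = λ x∈ d → ⊥-elim (mark≢3 ([ inj₂ ∘ S-vis , L-mark ]′ x∈) d)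
    ; dead-in = λ arc av ne nt d → ⊥-elim (nd arc av ne nt d)
    ; fresh = fresh }
    where
    open Mem m
    open InvF i
    ground : ∀ {S} → Stamped pos S → (∀ {x} → x ∈ S → x < N) → t ∈ S → Based S
    ground {x ∷ []} (eq ∷ s) f (here refl) = base
    ground {x ∷ y ∷ S} (eq ∷ s) f (here refl) = contradiction (trans (sym pos-t) eq) λ()
    ground {x ∷ S} (eq ∷ s) f (there t∈) =
      ((λ { refl → <-irrefl eq (stamp-bound s t∈) }) , f (here refl)) ∷ ground s (λ x∈ → f (there x∈)) t∈
    wait : ∀ {x} → st x ≢ 0 → st x ≢ 3 → x ∈ S ⊎ x ∈ L
    wait {x} n0 n3 with st x in eq | st-≤ x
    ... | 0 | _ = ⊥-elim (n0 refl)
    ... | 1 | _ = inj₂ (L1 eq)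
    ... | 2 | _ = inj₁ (vis-S eq)
    ... | 3 | _ = ⊥-elim (n3 refl)
    ... | suc (suc (suc (suc _))) | s≤s (s≤s (s≤s ()))

  data Follow (rt : ℕ → ℕ) : ℕ → List ℕ → Set where
    stop : Follow rt t []
    along   : ∀ {x es} → x ≢ t → Out x (rt x) → Follow rt (hd (rt x)) es → Follow rt x (rt x ∷ es)

  -- The routes left when a token has followed the given arcs, replacing each route
  -- used by the second arc kept for its node.
  after : (rt kp : ℕ → ℕ) → List ℕ → ℕ → ℕ
  after rt kp []       = rt
  after rt kp (e ∷ es) = after (update rt (tl e) (kp (tl e))) kp es

  after-local : ∀ {rt rt′} kp es {u} → rt u ≡ rt′ u → after rt kp es u ≡ after rt′ kp es u
  after-local kp [] eq = eq
  after-local {rt} {rt′} kp (e ∷ es) {u} eq = after-local kp es step′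
    where
    step′ : update rt (tl e) (kp (tl e)) u ≡ update rt′ (tl e) (kp (tl e)) u
    step′ with u ≟ tl e
    ... | yes refl = trans (update-same rt u (kp u)) (sym (update-same rt′ u (kp u)))
    ... | no ne = trans (update-other rt (tl e) (kp (tl e)) ne)
                    (trans eq (sym (update-other rt′ (tl e) (kp (tl e)) ne)))

  after-other : ∀ {rt} kp es {u} → (∀ {e} → e ∈ es → tl e ≢ u) → after rt kp es u ≡ rt u
  after-other kp [] ne = refl
  after-other {rt} kp (e ∷ es) ne = trans (after-other kp es (λ e∈ → ne (there e∈)))
    (update-other rt (tl e) (kp (tl e)) (λ eq → ne (here refl) (sym eq)))

  follow-frame : ∀ {rt rt′ x es} → (∀ {u} → key x ≤ key u → rt′ u ≡ rt u) → Follow rt x es → Follow rt′ x es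
  follow-frame eq stop = stop
  follow-frame {rt} {rt′} {x} eq (along {es = es} x≢t o f) =
    subst (λ e → Follow rt′ x (e ∷ es)) (eq ≤-refl)
      (along x≢t (subst (Out x) (sym (eq ≤-refl)) o)
        (subst (λ e → Follow rt′ (hd e) es) (sym (eq ≤-refl))
          (follow-frame (λ le → eq (≤-trans (<⇒≤ (out-key x≢t o)) le)) f)))

  -- A node common to both walks is left at a split, first by its route and then by its kept arc. At
  -- all other nodes of the second walk the first one has changed nothing.
  walks-follow : ∀ {st kp rt x y X Y} → Walks st kp rt x y X Y →
    Follow rt x X × Follow (after rt kp X) y Y
  walks-follow done = stop , stop
  walks-follow {kp = kp} {rt} (left {x} {y} {X} lt m nt o w) with walks-follow w
  ... | f , g = along nt o f , follow-frame
    (λ {u} le → after-local kp X (update-other rt (tl (rt x)) (kp (tl (rt x)))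
      (λ { refl → <⇒≱ lt (subst (λ v → key y ≤ key v) (proj₂ o) le) }))) g
  walks-follow {kp = kp} {rt} {X = X} (right {x} {y} {Y = Y} lt m nt o w) with walks-follow w
  ... | f , g = f , subst (λ e → Follow (after rt kp X) y (e ∷ Y)) same
    (along nt (subst (Out y) (sym same) o) (subst (λ e → Follow (after rt kp X) (hd e) Y) (sym same) g))
    where
    same : after rt kp X y ≡ rt y
    same = after-other kp X (λ { e∈ refl → <⇒≱ lt (proj₁ (walks-keys w) e∈) })
  walks-follow {kp = kp} {rt} (both {x} {X} {Y} m nt o o′ ne w) with walks-follow w
  ... | f , g = along nt o f , subst (λ e → Follow r₁ x (e ∷ Y)) same
    (along nt (subst (Out x) (sym same) o′) (subst (λ e → Follow r₁ (hd e) Y) (sym same)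
      (follow-frame (λ {u} le → after-local kp X (update-other rt (tl (rt x)) (kp (tl (rt x)))
        (λ { refl → <⇒≱ (out-key nt o′) (subst (λ v → key (hd (kp x)) ≤ key v) (proj₂ o) le) }))) g)))
    where
    r₁ : ℕ → ℕ
    r₁ = after rt kp (rt x ∷ X)
    same : r₁ x ≡ kp x
    same = trans (after-other kp X (λ { e∈ refl → <⇒≱ (out-key nt o) (proj₁ (walks-keys w) e∈) }))
      (trans (cong (update rt (tl (rt x)) (kp (tl (rt x)))) (sym (proj₂ o)))
        (trans (update-same rt (tl (rt x)) (kp (tl (rt x)))) (cong kp (proj₂ o))))

  -- The invariant of the main loop

  measure : Ghost → State → ℕ
  measure g s = sumTo (nodeWeight (arrays s 2) cur inn) N +
      rest-weight S P L (sumTo un (suc M)) (phaseWeight (regs s 4) (regs s 12) first)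
    where open Ghost g

  -- The arguments are single registers and arrays instead of a state: writing to any other location
  -- leaves the type unchanged up to computation, and the same proof can be passed on.
  record Static (r0 r1 r2 : ℕ) (a0 a1 a3 a18 : ℕ → ℕ) : Set where
    field
      r-N : r0 ≡ N
      r-M : r1 ≡ M
      r-t : r2 ≡ t
      a-tl : ∀ e → a0 e ≡ tl (suc e)
      a-hd : ∀ e → a1 e ≡ hd (suc e)
      a-σ  : ∀ {z} → Z z → a3 z ≡ σ z
      a-key : ∀ x → a18 x ≡ key x

    tail≡ : ∀ {c} → c ≢ 0 → a0 (c ∸ 1) ≡ tl c
    tail≡ {zero}  nz = ⊥-elim (nz refl)
    tail≡ {suc c} nz = a-tl c

    head≡ : ∀ {c} → c ≢ 0 → a1 (c ∸ 1) ≡ hd c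
    head≡ {zero}  nz = ⊥-elim (nz refl)
    head≡ {suc c} nz = a-hd c

  record Stacks (r5 r6 r7 : ℕ) (a15 a16 a17 : ℕ → ℕ) (S P L : List ℕ) : Set where
    field
      h-S : r5 ≡ length S
      h-P : r6 ≡ length P
      h-L : r7 ≡ length L
      s-S : Stack a15 S
      s-P : Stack a16 P
      s-L : Stack a17 L

  record Lists (a6 a7 a8 a9 : ℕ → ℕ) (cur inn : ℕ → List ℕ) : Set where
    field
      l-cur : ∀ x → Linked a7 (a6 x) (cur x)
      l-inn : ∀ x → Linked a9 (a8 x) (inn x)

  pop-cur : ∀ {a6 a7 a8 a9 cur inn x c cs} → Lists a6 a7 a8 a9 cur inn → cur x ≡ c ∷ cs →
    Lists (update a6 x (a7 c)) a7 a8 a9 (update cur x cs) inn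
  pop-cur {a6} {a7} {cur = cur} {x = x} {c} {cs} l eq = record
    { l-cur = λ y → pop y ; l-inn = l-inn }
    where
    open Lists l
    pop : ∀ y → Linked a7 (update a6 x (a7 c) y) (update cur x cs y)
    pop y with y ≟ x
    ... | yes refl = subst₂ (Linked a7) (sym (update-same a6 y (a7 c))) (sym (update-same cur y cs))
                       (proj₂ (proj₂ (linked-cons (l-cur y) eq)))
    ... | no ne = subst₂ (Linked a7) (sym (update-other a6 x (a7 c) ne)) (sym (update-other cur x cs ne)) (l-cur y)

  pop-inn : ∀ {a6 a7 a8 a9 cur inn x c cs} → Lists a6 a7 a8 a9 cur inn → inn x ≡ c ∷ cs →
    Lists a6 a7 (update a8 x (a9 c)) a9 cur (update inn x cs)
  pop-inn {a8 = a8} {a9} {inn = inn} {x} {c} {cs} l eq = record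
    { l-cur = l-cur ; l-inn = λ y → pop y }
    where
    open Lists l
    pop : ∀ y → Linked a9 (update a8 x (a9 c) y) (update inn x cs y)
    pop y with y ≟ x
    ... | yes refl = subst₂ (Linked a9) (sym (update-same a8 y (a9 c))) (sym (update-same inn y cs))
                       (proj₂ (proj₂ (linked-cons (l-inn y) eq)))
    ... | no ne = subst₂ (Linked a9) (sym (update-other a8 x (a9 c) ne)) (sym (update-other inn x cs ne)) (l-inn y)

  -- The sum includes the index 0, which is no arc, whence the total `suc M`. The equation bounds
  -- the number of written arcs and thereby the addresses of the output.
  record Account (act un : ℕ → ℕ) (op : ℕ) (ps : List (List ℕ)) : Set where
    field
      act-Z  : ∀ {z} → act z ≢ 0 → Z z
      op-un  : op + sumTo un (suc M) ≡ suc M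

  -- The output arrays hold the finished paths ps, followed by the arcs of part.
  record Output (cnt op : ℕ) (a4 a5 : ℕ → ℕ) (ps : List (List ℕ)) (part : List ℕ) : Set where
    field
      finished : applyUpTo (λ j → applyUpTo (λ i → a5 (a4 j + i)) (a4 (suc j) ∸ a4 j)) cnt ≡ map (map pred) ps
      bounded  : ∀ {j} → j ≤ cnt → a4 j ≤ a4 cnt
      current  : applyUpTo (λ i → a5 (a4 cnt + i)) (length part) ≡ map pred part
      position : op ≡ a4 cnt + length part

  data Pairs : List (List ℕ) → Set where
    none : Pairs []
    more : ∀ {ps z X Y} → Pairs ps → Z z → Route (σ z) X t → Route z Y t → Pairs (ps ++ X ∷ Y ∷ [])

  Unused : List (List ℕ) → ℕ → Set
  Unused ps e = Arc e × e ∉ concat ps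

  record Found (un : ℕ → ℕ) (ps : List (List ℕ)) : Set where
    field
      pairs    : Pairs ps
      distinct : AllPairs _≢_ (concat ps)
      un-one   : ∀ {e} → Unused ps e → un e ≡ 1

  -- The pair counts as chosen from the moment it is found, so the maximality condition already
  -- refers to `ps` extended by `X` and `Y`. `kp-small` is an inequality only, because the kept arc
  -- copied to `rt` may be 0.
  record Writing (s : State) (g : Ghost) : Set where
    open Ghost g
    field
      X Y      : List ℕ
      clean    : InvK (arrays s 11) (arrays s 12) (arrays s 13) (arrays s 14) (arrays s 10) cur inn S L
      maximal  : Maximal (LiveK (arrays s 11) (arrays s 10)) (Unused (ps ++ X ∷ Y ∷ [])) (arrays s 2)
      pairs    : Pairs ps
      source   : Z (regs s 10)
      route-X  : Route (σ (regs s 10)) X t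
      route-Y  : Route (regs s 10) Y t
      distinct : AllPairs _≢_ (concat (ps ++ X ∷ Y ∷ []))
      un-one   : ∀ {e} → Unused (ps ++ X ∷ Y ∷ []) e → un e ≡ 1
      no-roots : P ≡ []
      kp-small : ∀ {e} → e ∈ X ++ Y → arrays s 13 (tl e) ≤ M

  -- The last component expresses that every path has an arc: it keeps the number of finished paths
  -- within the number of written arcs, which bounds register 3.
  data Progress (s : State) (g : Ghost) : (X Y : List ℕ) → Set where
    first-path : ∀ {X Y} → let open Ghost g in regs s 12 ≡ 0 →
      Output (regs s 3) (regs s 11) (arrays s 4) (arrays s 5) ps part →
      X ≡ part ++ rest → Follow (arrays s 14) (regs s 9) rest →
      Follow (after (arrays s 14) (arrays s 13) rest) (regs s 10) Y →
      (∀ {e} → e ∈ rest ++ Y → un e ≡ 1) → AllPairs _≢_ (rest ++ Y) →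
      (first ≡ 1 × rest ≢ [] × regs s 3 ≤ regs s 11) ⊎ (first ≡ 0 × regs s 3 < regs s 11) →
      Progress s g X Y
    second-path : ∀ {X Y} → let open Ghost g in regs s 12 ≡ 1 →
      Output (regs s 3) (regs s 11) (arrays s 4) (arrays s 5) (ps ++ X ∷ []) part →
      Y ≡ part ++ rest → Follow (arrays s 14) (regs s 9) rest →
      (∀ {e} → e ∈ rest → un e ≡ 1) → AllPairs _≢_ rest →
      (first ≡ 1 × rest ≢ [] × regs s 3 ≤ regs s 11) ⊎ (first ≡ 0 × regs s 3 < regs s 11) →
      Progress s g X Y

  data Mode (s : State) (g : Ghost) : Set where
    cleaning : let open Ghost g in regs s 4 ≡ 1 →
      InvK (arrays s 11) (arrays s 12) (arrays s 13) (arrays s 14) (arrays s 10) cur inn S L →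
      Maximal (LiveK (arrays s 11) (arrays s 10)) (Unused ps) (arrays s 2) → P ≡ [] →
      Found un ps → Output (regs s 3) (regs s 11) (arrays s 4) (arrays s 5) ps [] → regs s 3 ≤ regs s 11 →
      Mode s g
    backing : let open Ghost g in regs s 4 ≡ 2 → InvB (memory s g) P →
      Maximal (LiveM (memory s g)) (Unused ps) (arrays s 2) → L ≡ [] → Based S →
      Found un ps → Output (regs s 3) (regs s 11) (arrays s 4) (arrays s 5) ps [] → regs s 3 ≤ regs s 11 →
      Mode s g
    searching : let open Ghost g in regs s 4 ≡ 3 →
      InvF (memory s g) (regs s 8) P L (σ (regs s 10)) (regs s 10) (regs s 9) → Z (regs s 10) →
      arrays s 2 (regs s 10) ≢ 0 →
      Maximal (LiveM (memory s g)) (Unused ps) (arrays s 2) → Based S →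
      Found un ps → Output (regs s 3) (regs s 11) (arrays s 4) (arrays s 5) ps [] → regs s 3 ≤ regs s 11 →
      Mode s g
    writing : regs s 4 ≡ 4 → (w : Writing s g) → Progress s g (Writing.X w) (Writing.Y w) → Mode s g
    halted : let open Ghost g in regs s 4 ≡ 0 →
      (∀ {z} → Z z → ¬ Feasible (Unused ps) z) →
      Found un ps → Output (regs s 3) (regs s 11) (arrays s 4) (arrays s 5) ps [] → Mode s g

  record Inv (B : ℕ) (g : Ghost) (s : State) : Set where
    open Ghost g
    field
      static  : Static (regs s 0) (regs s 1) (regs s 2) (arrays s 0) (arrays s 1) (arrays s 3) (arrays s 18)
      stacks  : Stacks (regs s 5) (regs s 6) (regs s 7) (arrays s 15) (arrays s 16) (arrays s 17) S P L
      lists   : Lists (arrays s 6) (arrays s 7) (arrays s 8) (arrays s 9) cur inn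
      account : Account (arrays s 2) un (regs s 11) ps
      small   : measure g s ≤ B
      mode    : Mode s g

  -- Simulation of the program

  module Simulation (capacity : Capacity N M) where
    open Capacity capacity public

    Post : Ghost → State → State → Set
    Post g s s′ = ∃[ g′ ] (Inv B g′ s′ × measure g′ s′ < measure g s)

    node-fits : ∀ {x} → x < N → x < W
    node-fits lt = fits (≤-trans (<⇒≤ lt) (m≤n⇒m≤1+n N≤B))

    arc-fits : ∀ {e} → Arc e → e < W
    arc-fits (_ , le) = fits (≤-trans le (m≤n⇒m≤1+n M≤B))

    const-fits : ∀ {k} → k ≤ 4 → k < W
    const-fits le = fits (≤-trans le (m≤n⇒m≤1+n 4≤B))

    linked-fits : ∀ {f p xs} → Linked f p xs → (∀ {e} → e ∈ xs → Arc e) → p < W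
    linked-fits nil f = const-fits z≤n
    linked-fits (cons nz l) f = arc-fits (f (here refl))

    module At {g : Ghost} {s : State} (i : Inv B g s) where
      open Ghost g public
      open Inv i public
      open Static static public
      open Stacks stacks public
      open Lists lists public
      open Account account public

      post : ∀ {s′} g′ →
        Static (regs s′ 0) (regs s′ 1) (regs s′ 2) (arrays s′ 0) (arrays s′ 1) (arrays s′ 3) (arrays s′ 18) →
        Stacks (regs s′ 5) (regs s′ 6) (regs s′ 7) (arrays s′ 15) (arrays s′ 16) (arrays s′ 17)
               (Ghost.S g′) (Ghost.P g′) (Ghost.L g′) →
        Lists (arrays s′ 6) (arrays s′ 7) (arrays s′ 8) (arrays s′ 9) (Ghost.cur g′) (Ghost.inn g′) →
        Account (arrays s′ 2) (Ghost.un g′) (regs s′ 11) (Ghost.ps g′) → Mode s′ g′ →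
        measure g′ s′ < measure g s → Post g s s′
      post g′ st sk ls ac md lt = g′ , record
        { static = st ; stacks = sk ; lists = ls ; account = ac
        ; small = ≤-trans (<⇒≤ lt) small ; mode = md } , lt

      rest-≤ : rest-weight S P L (sumTo un (suc M)) (phaseWeight (regs s 4) (regs s 12) first) ≤ B
      rest-≤ = ≤-trans (m≤n+m _ (sumTo (nodeWeight (arrays s 2) cur inn) N)) small

      S-fits : suc (length S) < W
      S-fits = fits (s≤s (≤-trans (length-≤-S S P L (sumTo un (suc M)) (phaseWeight (regs s 4) (regs s 12) first)) rest-≤))

      P-fits : suc (length P) < W
      P-fits = fits (s≤s (≤-trans (length-≤-P S P L (sumTo un (suc M)) (phaseWeight (regs s 4) (regs s 12) first)) rest-≤))

      L-fits : suc (length L) < W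
      L-fits = fits (s≤s (≤-trans (length-≤-L S P L (sumTo un (suc M)) (phaseWeight (regs s 4) (regs s 12) first)) rest-≤))

      below-fits : ∀ {k m} → k ≤ m → m < W → k < W
      below-fits = ≤-<-trans

      node-lt : ∀ act′ cur′ inn′ {r′} v d → v < N →
        (∀ x → x ≢ v → nodeWeight act′ cur′ inn′ x ≡ nodeWeight (arrays s 2) cur inn x) →
        nodeWeight (arrays s 2) cur inn v ≡ nodeWeight act′ cur′ inn′ v + d →
        r′ < d + rest-weight S P L (sumTo un (suc M)) (phaseWeight (regs s 4) (regs s 12) first) →
        sumTo (nodeWeight act′ cur′ inn′) N + r′ < measure g s
      node-lt act′ cur′ inn′ v d v<N same eq lt = weight-lt d (sum-drop N v v<N same eq) lt

      cur-other : ∀ {v cs} x → x ≢ v → nodeWeight (arrays s 2) (update cur v cs) inn x ≡ nodeWeight (arrays s 2) cur inn x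
      cur-other {v} {cs} x ne = cong (λ k → 3 * length k + (5 * length (inn x) + 5 * arrays s 2 x))
                                     (update-other cur v cs ne)

      inn-other : ∀ {v cs} x → x ≢ v → nodeWeight (arrays s 2) cur (update inn v cs) x ≡ nodeWeight (arrays s 2) cur inn x
      inn-other {v} {cs} x ne = cong (λ k → 3 * length (cur x) + (5 * length k + 5 * arrays s 2 x))
                                     (update-other inn v cs ne)

      act-other : ∀ {v} x → x ≢ v → nodeWeight (update (arrays s 2) v 0) cur inn x ≡ nodeWeight (arrays s 2) cur inn x
      act-other {v} x ne = cong (λ k → 3 * length (cur x) + (5 * length (inn x) + 5 * k))
                                (update-other (arrays s 2) v 0 ne)

      phase≡ : ℕ → ℕ
      phase≡ k = phaseWeight k (regs s 12) first

      other-lt : ∀ {r′ p} → phaseWeight (regs s 4) (regs s 12) first ≡ p →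
        r′ < rest-weight S P L (sumTo un (suc M)) p →
        sumTo (nodeWeight (arrays s 2) cur inn) N + r′ < measure g s
      other-lt refl lt = +-monoʳ-< (sumTo (nodeWeight (arrays s 2) cur inn) N) lt

    -- Simulation of the cleaning phase

    CleanPre : State → Ghost → Set
    CleanPre s (ghost cur inn S P L un ps part rest first) =
      InvK (arrays s 11) (arrays s 12) (arrays s 13) (arrays s 14) (arrays s 10) cur inn S L ×
      Maximal (LiveK (arrays s 11) (arrays s 10)) (Unused ps) (arrays s 2) ×
      Found un ps × Output (regs s 3) (regs s 11) (arrays s 4) (arrays s 5) ps [] × regs s 3 ≤ regs s 11

    module Flush {cur inn S v L un ps part rest first s}
      (i : Inv B (ghost cur inn S [] (v ∷ L) un ps part rest first) s) (md : regs s 4 ≡ 1) where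
      open At i hiding (cur; inn; S; L; un; ps; part; rest; first)

      flush : CleanPre s (ghost cur inn S [] (v ∷ L) un ps part rest first) →
              Exec W (Post (ghost cur inn S [] (v ∷ L) un ps part rest first) s) cleanBody s
      flush (K , mx , fo , out , cnt) = yes-branch (0≢suc h-L) $
        assign⨾ (cong (_∸ 1) h-L) (below-fits (m≤n⇒m≤1+n (n≤1+n _)) L-fits) $
        store⨾ h-S (stack-top s-L) (below-fits (n≤1+n _) S-fits) (node-fits (proj₂ (All.head (InvK.L-ok K)))) $
        assign (length-suc _ h-S) S-fits $
          post (ghost cur inn (v ∷ S) [] L un ps part rest first) static
            (record { h-S = refl ; h-P = h-P ; h-L = refl
                    ; s-S = stack-push v s-S ; s-P = s-P ; s-L = stack-tail s-L })
            lists account (cleaning md (flush-node K) mx refl fo out cnt)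
            (other-lt refl (≤-reflexive (solve 3 (λ s l q →
                con 2 :+ s :+ (con 2 :* l :+ q) := s :+ (con 2 :* (con 1 :+ l) :+ q))
              refl (length S) (length L) _)))

    module CleanEnd {cur inn un ps part rest first s}
      (i : Inv B (ghost cur inn (Graph.t G ∷ []) [] [] un ps part rest first) s) (md : regs s 4 ≡ 1) where
      open At i hiding (cur; inn; un; ps; part; rest; first)

      to-backing : CleanPre s (ghost cur inn (t ∷ []) [] [] un ps part rest first) →
                   Exec W (Post (ghost cur inn (t ∷ []) [] [] un ps part rest first) s) cleanBody s
      to-backing (K , mx , fo , out , cnt) = no-branch h-L $ no-branch (cong (_∸ 1) h-S) $
        store⨾ refl r-t (const-fits z≤n) (node-fits t<N) $
        assign⨾ refl (const-fits (s≤s z≤n)) $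
        assign refl (const-fits (s≤s (s≤s z≤n))) $
          post (ghost cur inn (t ∷ []) (t ∷ []) [] un ps part rest first) static
            (record { h-S = h-S ; h-P = refl ; h-L = h-L ; s-S = s-S
                    ; s-P = update-same (arrays s 16) 0 t ∷ [] ; s-L = s-L })
            lists account
            (backing refl (clean-done K) (clean-live (clean-done K) refl mx) refl base fo out cnt)
            (other-lt (cong phase≡ md) (≤-reflexive (solve 1 (λ u →
                con 5 :+ (u :+ con 2) := con 1 :+ (u :+ con 6)) refl (10 * sumTo un (suc M)))))

    module CleanNode {cur inn n S un ps part rest first s} (S≢[] : S ≢ [])
      (i : Inv B (ghost cur inn (n ∷ S) [] [] un ps part rest first) s) (md : regs s 4 ≡ 1)
      (n≢t : n ≢ Graph.t G) (n<N : n < Graph.N G)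
      (pre : CleanPre s (ghost cur inn (n ∷ S) [] [] un ps part rest first)) where
      open At i hiding (cur; inn; S; un; ps; part; rest; first)

      K = proj₁ pre
      mx = proj₁ (proj₂ pre)
      fo = proj₁ (proj₂ (proj₂ pre))
      out = proj₁ (proj₂ (proj₂ (proj₂ pre)))
      cnt = proj₂ (proj₂ (proj₂ (proj₂ pre)))

      g₀ : Ghost
      g₀ = ghost cur inn (n ∷ S) [] [] un ps part rest first

      sp≢1 : regs s 5 ∸ 1 ≢ 0
      sp≢1 z = go S≢[] (trans (sym (cong (_∸ 1) h-S)) z)
        where
        go : ∀ {xs : List ℕ} → xs ≢ [] → length xs ≢ 0
        go {[]} ne _ = ne refl

      top : arrays s 15 (regs s 5 ∸ 1) ≡ n
      top = trans (cong (arrays s 15) (cong (_∸ 1) h-S)) (stack-top s-S)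

      S-tail-fits : length S < W
      S-tail-fits = below-fits (m≤n⇒m≤1+n (n≤1+n _)) S-fits

      skip-or-accept : ∀ {c cs} → cur n ≡ c ∷ cs → Exec W (Post g₀ s) cleanBody s
      skip-or-accept {c} {cs} eq with linked-cons (l-cur n) eq | arrays s 10 c ≟ 0
      ... | p≡c , nz , l | yes av = no-branch h-L $ yes-branch sp≢1 $
        assign⨾ top (node-fits n<N) $
        assign⨾ p≡c (arc-fits arc) $
        yes-branch nz $
        no-branch av $
        store⨾ refl refl (node-fits n<N) (const-fits z≤n) $
        assign (cong (_∸ 1) h-S) S-tail-fits $
          post (ghost cur inn S [] [] un ps part rest first) static
            (record { h-S = refl ; h-P = h-P ; h-L = h-L ; s-S = stack-tail s-S ; s-P = s-P ; s-L = s-L })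
            lists account
            (cleaning md (accept n≢t n<N K eq av) (accept-live n≢t n<N K eq mx) refl fo out cnt)
            (other-lt refl ≤-refl)
        where
        arc : Arc c
        arc = proj₁ (InvK.cur-out K (subst (c ∈_) (sym eq) (here refl)))
      ... | p≡c , nz , l | no dead = no-branch h-L $ yes-branch sp≢1 $
        assign⨾ top (node-fits n<N) $
        assign⨾ p≡c (arc-fits arc) $
        yes-branch nz $
        yes-branch dead $
        store refl refl (node-fits n<N)
          (linked-fits l (λ e∈ → proj₁ (InvK.cur-out K (subst (_ ∈_) (sym eq) (there e∈))))) $
          post (ghost (update cur n cs) inn (n ∷ S) [] [] un ps part rest first) static stacks
            (pop-cur lists eq) account
            (cleaning md (advance-cur n≢t n<N K eq dead (λ z → advance-fresh n≢t n<N K eq dead z)) mx refl fo out cnt)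
            (node-lt (arrays s 2) (update cur n cs) inn n 3 n<N cur-other (cur-weight {arrays s 2} {cur} {inn} eq) (s≤s (m≤n+m _ 2)))
        where
        arc : Arc c
        arc = proj₁ (InvK.cur-out K (subst (c ∈_) (sym eq) (here refl)))

      killed : cur n ≡ [] → InvK (update (arrays s 11) n 3) (arrays s 12) (arrays s 13) (arrays s 14) (arrays s 10)
                                 cur inn (n ∷ S) []
      killed ex = kill n≢t n<N K ex

      discard-node : cur n ≡ [] → inn n ≡ [] → Exec W (Post g₀ s) cleanBody s
      discard-node ex exi = no-branch h-L $ yes-branch sp≢1 $
        assign⨾ top (node-fits n<N) $
        assign⨾ (linked-nil (l-cur n) ex) (const-fits z≤n) $
        no-branch refl $
        store⨾ refl refl (node-fits n<N) (const-fits (s≤s (s≤s (s≤s z≤n)))) $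
        assign⨾ (linked-nil (l-inn n) exi) (const-fits z≤n) $
        no-branch refl $
        assign (cong (_∸ 1) h-S) S-tail-fits $
          post (ghost cur inn S [] [] un ps part rest first) static
            (record { h-S = refl ; h-P = h-P ; h-L = h-L ; s-S = stack-tail s-S ; s-P = s-P ; s-L = s-L })
            lists account
            (cleaning md (discard n≢t n<N (killed ex) (update-same (arrays s 11) n 3) exi)
              (kill-live n≢t n<N K ex mx) refl fo out cnt)
            (other-lt refl ≤-refl)

      scan-node : ∀ {c cs} → cur n ≡ [] → inn n ≡ c ∷ cs → Exec W (Post g₀ s) cleanBody s
      scan-node {c} {cs} ex eqi with linked-cons (l-inn n) eqi
      ... | p≡c , nz , l = no-branch h-L $ yes-branch sp≢1 $
        assign⨾ top (node-fits n<N) $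
        assign⨾ (linked-nil (l-cur n) ex) (const-fits z≤n) $
        no-branch refl $
        store⨾ refl refl (node-fits n<N) (const-fits (s≤s (s≤s (s≤s z≤n)))) $
        assign⨾ p≡c (arc-fits Sc.arc) $
        yes-branch nz $
        store⨾ refl refl (node-fits n<N)
          (linked-fits l (λ e∈ → proj₁ (InvK.inn-in K (subst (_ ∈_) (sym eqi) (there e∈))))) $
        store⨾ refl refl (arc-fits Sc.arc) (const-fits (s≤s z≤n)) $
        assign⨾ (tail≡ nz) (node-fits (tl<N Sc.arc)) $
        branch skipping pushing
        where
        module Sc = Scan n≢t n<N (killed ex) (update-same (arrays s 11) n 3) eqi
        st₁ : ℕ → ℕ
        st₁ = update (arrays s 11) n 3
        u : ℕ
        u = tl c
        s₁ : State
        s₁ = setReg (setCell (setCell (setReg (setCell (setReg (setReg s 14 n) 15 0) 11 n 3) 15 c) 8 n (arrays s 9 c)) 10 c 1) 16 u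
        push-prog : Program
        push-prog = 11 [ reg 16 ]≔ const 1 ⨾ 15 [ reg 5 ]≔ reg 16 ⨾ inc 5
        test : ℕ
        test = (arrays s 6 u ∸ c) + (c ∸ arrays s 6 u) + st₁ u
        skipping : test ≢ 0 → Exec W (Post g₀ s) skip s₁
        skipping ne = done (post (ghost cur (update inn n cs) (n ∷ S) [] [] un ps part rest first) static stacks
          (pop-inn lists eqi) account
          (cleaning md (Sc.scan-skip hit) (Sc.live (kill-live n≢t n<N K ex mx)) refl fo out cnt)
          (node-lt (arrays s 2) cur (update inn n cs) n 5 n<N inn-other (inn-weight {arrays s 2} {cur} {inn} eqi) (s≤s (m≤n+m _ 4))))
          where
          hit : st₁ u ≡ 0 → ∀ {ds} → cur u ≢ c ∷ ds
          hit z {ds} eq = ne (cong₂ _+_ (subst (λ p → (p ∸ c) + (c ∸ p) ≡ 0)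
            (sym (proj₁ (linked-cons (l-cur u) eq))) (differ-0 c)) z)
        pushing : test ≡ 0 → Exec W (Post g₀ s) push-prog s₁
        pushing z = store⨾ refl refl (node-fits (tl<N Sc.arc)) (const-fits (s≤s z≤n)) $
          store⨾ h-S refl (below-fits (n≤1+n _) S-fits) (node-fits (tl<N Sc.arc)) $
          assign (length-suc _ h-S) S-fits $
            post (ghost cur (update inn n cs) (u ∷ n ∷ S) [] [] un ps part rest first) static
              (record { h-S = refl ; h-P = h-P ; h-L = h-L ; s-S = stack-push u s-S ; s-P = s-P ; s-L = s-L })
              (pop-inn lists eqi) account
              (cleaning md (Sc.scan-push u0) (Sc.push-live u0 (kill-live n≢t n<N K ex mx)) refl fo out cnt)
              (node-lt (arrays s 2) cur (update inn n cs) n 5 n<N inn-other (inn-weight {arrays s 2} {cur} {inn} eqi) (s≤s (s≤s (m≤n+m _ 3))))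
          where
          u0 : st₁ u ≡ 0
          u0 = m+n≡0⇒n≡0 ((arrays s 6 u ∸ c) + (c ∸ arrays s 6 u)) z

    based-≢[] : ∀ {xs} → Based xs → xs ≢ []
    based-≢[] base ()
    based-≢[] (_ ∷ _) ()

    clean-top : ∀ {cur inn S un ps part rest first s} → Inv B (ghost cur inn S [] [] un ps part rest first) s →
      regs s 4 ≡ 1 → CleanPre s (ghost cur inn S [] [] un ps part rest first) → Based S →
      Exec W (Post (ghost cur inn S [] [] un ps part rest first) s) cleanBody s
    clean-top i md pre base = CleanEnd.to-backing i md pre
    clean-top {cur} {inn} {n ∷ S} {un} {ps} {part} {rest} {first} {s} i md pre ((n≢t , n<N) ∷ b) =
      node (cur n) refl (inn n) refl
      where
      node : ∀ es → cur n ≡ es → ∀ fs → inn n ≡ fs →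
             Exec W (Post (ghost cur inn (n ∷ S) [] [] un ps part rest first) s) cleanBody s
      node (c ∷ cs) eq _ _ = CleanNode.skip-or-accept (based-≢[] b) i md n≢t n<N pre eq
      node [] eq [] eqi = CleanNode.discard-node (based-≢[] b) i md n≢t n<N pre eq eqi
      node [] eq (c ∷ cs) eqi = CleanNode.scan-node (based-≢[] b) i md n≢t n<N pre eq eqi

    clean-step : ∀ {g s} → Inv B g s → regs s 4 ≡ 1 → CleanPre s g → Ghost.P g ≡ [] → Exec W (Post g s) cleanBody s
    clean-step {ghost cur inn S P (v ∷ L) un ps part rest first} i md pre refl = Flush.flush i md pre
    clean-step {ghost cur inn S P [] un ps part rest first} i md pre refl =
      clean-top i md pre (InvK.based (proj₁ pre))

    -- Simulation of the backward phase

    last-arc : ∀ {y es} → Route y es t → y ≢ t → ∃[ e ] (e ∈ es × hd e ≡ t)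
    last-arc [] ne = ⊥-elim (ne refl)
    last-arc (_∷_ {e = e} o p) ne with hd e ≟ t
    ... | yes eq = e , here refl , eq
    ... | no ne′ with last-arc p ne′
    ...   | f , f∈ , eq = f , there f∈ , eq

    act-update : ∀ {act un op ps z} → Account act un op ps → Account (update act z 0) un op ps
    act-update {act} {z = z} a = record
      { act-Z = λ {y} → update-if act z 0 y (λ k → k ≢ 0 → Z y) (λ _ ne → ⊥-elim (ne refl)) (λ _ → act-Z)
      ; op-un = op-un }
      where open Account a

    module BackNode {cur inn x S r P un ps part rest first s}
      (i : Inv B (ghost cur inn (x ∷ S) (r ∷ P) [] un ps part rest first) s) (md : regs s 4 ≡ 2)
      (bs : Based (x ∷ S))
      (I : InvB (memory s (ghost cur inn (x ∷ S) (r ∷ P) [] un ps part rest first)) (r ∷ P))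
      (mx : Maximal (LiveM (memory s (ghost cur inn (x ∷ S) (r ∷ P) [] un ps part rest first))) (Unused ps) (arrays s 2))
      (fo : Found un ps) (out : Output (regs s 3) (regs s 11) (arrays s 4) (arrays s 5) ps [])
      (cnt : regs s 3 ≤ regs s 11) where
      open At i hiding (cur; inn; S; P; un; ps; part; rest; first)

      g₀ : Ghost
      g₀ = ghost cur inn (x ∷ S) (r ∷ P) [] un ps part rest first

      x<N : x < N
      x<N = InvB.vis<N I (Top.x-vis I refl)

      top≡ : arrays s 15 (regs s 5 ∸ 1) ≡ x
      top≡ = trans (cong (arrays s 15) (one-less h-S)) (stack-top s-S)

      S-less : length S < W
      S-less = below-fits (m≤n⇒m≤1+n (n≤1+n _)) S-fits

      P-less : length P < W
      P-less = below-fits (m≤n⇒m≤1+n (n≤1+n _)) P-fits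

      dead-mate : arrays s 2 x ≢ 0 → arrays s 11 (σ x) ∸ 2 ≢ 0 → Exec W (Post g₀ s) backBody s
      dead-mate az d =
        assign⨾ top≡ (node-fits x<N) $
        yes-branch az $
        assign⨾ (a-σ zx) (node-fits (Z<N (Z-σ zx))) $
        yes-branch d $
        store refl refl (node-fits x<N) (const-fits z≤n) $
        post g₀ static stacks lists (act-update account)
          (backing md I (max-dead {memory s g₀} mx zx (≤3-not-≤2 (InvB.st-≤ I (σ x)) d)) refl bs fo out cnt)
          (node-lt (update (arrays s 2) x 0) cur inn x (5 * arrays s 2 x) x<N act-other
            (act-weight {arrays s 2} {cur} {inn})
            (+-monoˡ-≤ _ (≤-trans (s≤s z≤n) (five-times az))))
        where
        zx : Z x
        zx = act-Z az

      begin-search : arrays s 2 x ≢ 0 → arrays s 11 (σ x) ∸ 2 ≡ 0 → Exec W (Post g₀ s) backBody s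
      begin-search az ok =
        assign⨾ top≡ (node-fits x<N) $
        yes-branch az $
        assign⨾ (a-σ zx) (node-fits (Z<N (Z-σ zx))) $
        no-branch ok $
        assign⨾ refl (node-fits x<N) $
        assign⨾ (one-less h-P) P-less $
        assign⨾ (stack-top s-P) (node-fits (InvB.vis<N I (InvB.C-vis I (here refl)))) $
        assign refl (const-fits (s≤s (s≤s (s≤s z≤n)))) $
        post (ghost cur inn (x ∷ S) P [] un ps part rest first) static
          (record { h-S = h-S ; h-P = refl ; h-L = h-L ; s-S = s-S ; s-P = stack-tail s-P ; s-L = s-L })
          lists account
          (searching refl (start-search I refl zx (λ eq → contradiction (trans (sym (cong (_∸ 2) eq)) ok) λ()))
            zx az mx bs fo out cnt)
          (other-lt (cong phase≡ md) (+-monoʳ-< (suc (length S)) (+-mono-≤-< (*-monoʳ-≤ 3 (n≤1+n (length P)))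
            (+-monoʳ-< (10 * sumTo un (suc M)) (s≤s (s≤s z≤n))))))
        where
        zx : Z x
        zx = act-Z az

      scan-in : ∀ {c cs} → arrays s 2 x ≡ 0 → inn x ≡ c ∷ cs → Exec W (Post g₀ s) backBody s
      scan-in {c} {cs} a0 eqi with linked-cons (l-inn x) eqi
      ... | p≡c , nz , l =
        assign⨾ top≡ (node-fits x<N) $
        no-branch a0 $
        assign⨾ p≡c (arc-fits arc) $
        yes-branch nz $
        store⨾ refl refl (node-fits x<N)
          (linked-fits l (λ e∈ → proj₁ (InvB.inn-in I (subst (_ ∈_) (sym eqi) (there e∈))))) $
        assign⨾ (tail≡ nz) (node-fits (tl<N arc)) $
        branch skipping pushing
        where
        arc : Arc c
        arc = proj₁ (InvB.inn-in I (subst (c ∈_) (sym eqi) (here refl)))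
        u : ℕ
        u = tl c
        s₁ : State
        s₁ = setReg (setCell (setReg (setReg s 14 x) 15 c) 8 x (arrays s 9 c)) 16 u
        push-prog : Program
        push-prog = 10 [ reg 15 ]≔ const 1 ⨾ 11 [ reg 16 ]≔ const 2 ⨾ 12 [ reg 16 ]≔ reg 5 ⨾
                    13 [ reg 16 ]≔ reg 15 ⨾ 14 [ reg 16 ]≔ reg 15 ⨾
                    15 [ reg 5 ]≔ reg 16 ⨾ inc 5 ⨾ 16 [ reg 6 ]≔ reg 16 ⨾ inc 6
        skipping : arrays s 10 c + arrays s 11 u ≢ 0 → Exec W (Post g₀ s) skip s₁
        skipping ne = done (post (ghost cur (update inn x cs) (x ∷ S) (r ∷ P) [] un ps part rest first) static stacks
          (pop-inn lists eqi) account
          (backing md (Top.skip-in I refl eqi (λ z z′ → ne (cong₂ _+_ z z′))) mx refl bs fo out cnt)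
          (node-lt (arrays s 2) cur (update inn x cs) x 5 x<N inn-other (inn-weight {arrays s 2} {cur} {inn} eqi)
            (s≤s (m≤n+m _ 4))))
        pushing : arrays s 10 c + arrays s 11 u ≡ 0 → Exec W (Post g₀ s) push-prog s₁
        pushing z =
          store⨾ refl refl (arc-fits arc) (const-fits (s≤s z≤n)) $
          store⨾ refl refl (node-fits (tl<N arc)) (const-fits (s≤s (s≤s z≤n))) $
          store⨾ refl h-S (node-fits (tl<N arc)) (below-fits (n≤1+n _) S-fits) $
          store⨾ refl refl (node-fits (tl<N arc)) (arc-fits arc) $
          store⨾ refl refl (node-fits (tl<N arc)) (arc-fits arc) $
          store⨾ h-S refl (below-fits (n≤1+n _) S-fits) (node-fits (tl<N arc)) $
          assign⨾ (length-suc _ h-S) S-fits $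
          store⨾ h-P refl (below-fits (n≤1+n _) P-fits) (node-fits (tl<N arc)) $
          assign (length-suc _ h-P) P-fits $
          post (ghost cur (update inn x cs) (u ∷ x ∷ S) (u ∷ r ∷ P) [] un ps part rest first) static
            (record { h-S = refl ; h-P = refl ; h-L = h-L ; s-S = stack-push u s-S ; s-P = stack-push u s-P ; s-L = s-L })
            (pop-inn lists eqi) account
            (backing md (Top.Push.pushed I refl eqi av fr) (max-bpush I mx arc av fr) refl
              (((λ eq → 0≢2 fr (trans (cong (arrays s 11) eq) (InvB.t-vis I))) , tl<N arc) ∷ bs) fo out cnt)
            (node-lt (arrays s 2) cur (update inn x cs) x 5 x<N inn-other (inn-weight {arrays s 2} {cur} {inn} eqi)
              (≤-reflexive (solve 3 (λ a p q → con 1 :+ (con 1 :+ a :+ (con 3 :* (con 1 :+ p) :+ q)) :=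
                                               con 5 :+ (a :+ (con 3 :* p :+ q))) refl
                (suc (length S)) (suc (length P)) _)))
          where
          av : arrays s 10 c ≡ 0
          av = m+n≡0⇒m≡0 (arrays s 10 c) z
          fr : arrays s 11 u ≡ 0
          fr = m+n≡0⇒n≡0 (arrays s 10 c) z

      leave-node : S ≢ [] → x ≢ t → arrays s 2 x ≡ 0 → inn x ≡ [] → Exec W (Post g₀ s) backBody s
      leave-node S≢[] x≢t a0 eqi =
        assign⨾ top≡ (node-fits x<N) $
        no-branch a0 $
        assign⨾ (linked-nil (l-inn x) eqi) (const-fits z≤n) $
        no-branch refl $
        yes-branch sp≢1 $
        store⨾ refl refl (node-fits x<N) (const-fits (s≤s (s≤s (s≤s z≤n)))) $
        assign⨾ (one-less h-S) S-less $
        branch other root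
        where
        sp≢1 : regs s 5 ∸ 1 ≢ 0
        sp≢1 z = nonzero S≢[] (trans (sym (one-less h-S)) z)
          where
          nonzero : ∀ {xs : List ℕ} → xs ≢ [] → length xs ≢ 0
          nonzero {[]} ne _ = ne refl
        bs′ : Based S
        bs′ = below bs x≢t
          where
          below : ∀ {y ys} → Based (y ∷ ys) → y ≢ t → Based ys
          below base ne = ⊥-elim (ne refl)
          below (_ ∷ b) _ = b
        s₁ : State
        s₁ = setReg (setCell (setReg (setReg s 14 x) 15 0) 11 x 3) 5 (length S)
        root≡ : arrays s 16 (regs s 6 ∸ 1) ≡ r
        root≡ = trans (cong (arrays s 16) (one-less h-P)) (stack-top s-P)
        other : (arrays s 16 (regs s 6 ∸ 1) ∸ x) + (x ∸ arrays s 16 (regs s 6 ∸ 1)) ≢ 0 → Exec W (Post g₀ s) skip s₁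
        other ne = done (post (ghost cur inn S (r ∷ P) [] un ps part rest first) static
          (record { h-S = refl ; h-P = h-P ; h-L = h-L ; s-S = stack-tail s-S ; s-P = s-P ; s-L = s-L })
          lists account
          (backing md (Top.pop-other I refl refl (λ eq → ne (subst (λ k → (k ∸ x) + (x ∸ k) ≡ 0) (sym (trans root≡ eq))
              (differ-0 x))) x≢t eqi)
            (max-pop I refl mx x≢t eqi a0) refl bs′ fo out cnt)
          (other-lt refl ≤-refl))
        root : (arrays s 16 (regs s 6 ∸ 1) ∸ x) + (x ∸ arrays s 16 (regs s 6 ∸ 1)) ≡ 0 → Exec W (Post g₀ s) (dec 6) s₁
        root z = assign (one-less h-P) P-less
          (post (ghost cur inn S P [] un ps part rest first) static
            (record { h-S = refl ; h-P = refl ; h-L = h-L ; s-S = stack-tail s-S ; s-P = stack-tail s-P ; s-L = s-L })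
            lists account
            (backing md (Top.pop-root I refl (cong (_∷ P) (trans (sym root≡) (differ-≢ z))) x≢t eqi)
              (max-pop I refl mx x≢t eqi a0) refl bs′ fo out cnt)
            (other-lt refl (s≤s (+-monoʳ-≤ (length S) (+-monoˡ-≤ _ (*-monoʳ-≤ 3 (n≤1+n (length P))))))))

      halt : S ≡ [] → x ≡ t → arrays s 2 x ≡ 0 → inn x ≡ [] → Exec W (Post g₀ s) backBody s
      halt S≡[] x≡t a0 eqi =
        assign⨾ top≡ (node-fits x<N) $
        no-branch a0 $
        assign⨾ (linked-nil (l-inn x) eqi) (const-fits z≤n) $
        no-branch refl $
        no-branch (trans (one-less h-S) (cong length S≡[])) $
        assign refl (const-fits z≤n) $
        post g₀ static stacks lists account (halted refl none-left fo out)
          (other-lt (cong phase≡ md) (+-monoʳ-< (suc (length S)) (+-monoʳ-< (3 * suc (length P))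
            (+-monoʳ-< (10 * sumTo un (suc M)) (s≤s z≤n)))))
        where
        open InvB I
        only-t : ∀ {y} → arrays s 11 y ≡ 2 → y ≡ t
        only-t v with subst (λ S → _ ∈ x ∷ S) S≡[] (vis-S v)
        ... | here eq = trans eq x≡t
        none-left : ∀ {z} → Z z → ¬ Feasible (Unused ps) z
        none-left {z} zz fe with Maximal.pairs mx [] (λ ()) zz (feasible-map (λ u → u , λ ()) fe)
        ... | _ , as , _ , p , _ , Ra , _ with last-arc p (λ { refl → t∉Z zz })
        ...   | e , e∈ , h≡t with proj₁ (Ra e∈)
        ...     | (arc , nt) , ne , inj₁ av = contradiction
                  (subst (e ∈_) (trans (cong inn (trans h≡t (sym x≡t))) eqi) (av-inn arc av ne nt)) λ()
        ...     | (arc , nt) , ne , inj₂ (inj₁ q , _) = noQ _ q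
        ...     | (arc , nt) , ne , inj₂ (inj₂ v , _) = nt (only-t v)

    back-step : ∀ {g s} → Inv B g s → regs s 4 ≡ 2 → InvB (memory s g) (Ghost.P g) →
      Maximal (LiveM (memory s g)) (Unused (Ghost.ps g)) (arrays s 2) → Ghost.L g ≡ [] → Based (Ghost.S g) →
      Found (Ghost.un g) (Ghost.ps g) → Output (regs s 3) (regs s 11) (arrays s 4) (arrays s 5) (Ghost.ps g) [] →
      regs s 3 ≤ regs s 11 → Exec W (Post g s) backBody s
    back-step {ghost cur inn S [] L un ps part rest first} i md I mx eqL b fo out cnt = contradiction (InvB.t∈C I) λ()
    back-step {ghost cur inn S (r ∷ P) L un ps part rest first} {s} i md I mx refl b fo out cnt =
      by-top b i I mx
      where
      by-top : ∀ {S} → Based S → Inv B (ghost cur inn S (r ∷ P) [] un ps part rest first) s →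
        InvB (memory s (ghost cur inn S (r ∷ P) [] un ps part rest first)) (r ∷ P) →
        Maximal (LiveM (memory s (ghost cur inn S (r ∷ P) [] un ps part rest first))) (Unused ps) (arrays s 2) →
        Exec W (Post (ghost cur inn S (r ∷ P) [] un ps part rest first) s) backBody s
      by-top {x ∷ S} b i I mx with arrays s 2 x ≟ 0 | arrays s 11 (σ x) ∸ 2 ≟ 0 | inn x in eqi
      ... | no az | yes ok | _ = BackNode.begin-search i md b I mx fo out cnt az ok
      ... | no az | no d | _ = BackNode.dead-mate i md b I mx fo out cnt az d
      ... | yes a0 | _ | c ∷ cs = BackNode.scan-in i md b I mx fo out cnt a0 eqi
      ... | yes a0 | _ | [] = finish b
        where
        finish : Based (x ∷ S) → Exec W (Post (ghost cur inn (x ∷ S) (r ∷ P) [] un ps part rest first) s) backBody s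
        finish base = BackNode.halt i md b I mx fo out cnt refl refl a0 eqi
        finish ((x≢t , _) ∷ b′) = BackNode.leave-node i md b I mx fo out cnt (based-≢[] b′) x≢t a0 eqi

    -- Simulation of the search phase

    record SearchPre (s : State) (g : Ghost) : Set where
      open Ghost g
      field
        searcher : InvF (memory s g) (regs s 8) P L (σ (regs s 10)) (regs s 10) (regs s 9)
        source   : Z (regs s 10)
        active   : arrays s 2 (regs s 10) ≢ 0
        maximal  : Maximal (LiveM (memory s g)) (Unused ps) (arrays s 2)
        based    : Based S
        found    : Found un ps
        written   : Output (regs s 3) (regs s 11) (arrays s 4) (arrays s 5) ps []
        count    : regs s 3 ≤ regs s 11

    module Searching {g s} (i : Inv B g s) (md : regs s 4 ≡ 3) (pre : SearchPre s g) where
      open At i public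
      open SearchPre pre public
      open InvF searcher public hiding (arcs)

      r x a : ℕ
      r = regs s 8
      x = regs s 9
      a = regs s 10

      r<N : r < N
      r<N = vis<N (r-visited searcher)

    module Descend {cur inn S ρ P L un ps part rest first s}
      (i : Inv B (ghost cur inn S (ρ ∷ P) L un ps part rest first) s) (md : regs s 4 ≡ 3)
      (pre : SearchPre s (ghost cur inn S (ρ ∷ P) L un ps part rest first)) where
      open Searching i md pre hiding (cur; inn; S; P; L; un; ps; part; rest; first)

      g₀ : Ghost
      g₀ = ghost cur inn S (ρ ∷ P) L un ps part rest first

      descend-step : r ≢ t → (arrays s 11 x ≡ 0 → key r ≤ key x) →
        (arrays s 11 x ≡ 2 → arrays s 12 x < arrays s 12 r) → Exec W (Post g₀ s) (descend skip) s
      descend-step r≢t above₀ above₂ =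
        store⨾ h-L refl (below-fits (n≤1+n _) L-fits) (node-fits r<N) $
        assign⨾ (length-suc _ h-L) L-fits $
        assign⨾ (one-less h-P) (below-fits (m≤n⇒m≤1+n (n≤1+n _)) P-fits) $
        assign⨾ (stack-top s-P) (node-fits (vis<N (C-vis (there (here refl))))) $
        done (post (ghost cur inn S P (r ∷ L) un ps part rest first) static
          (record { h-S = h-S ; h-P = refl ; h-L = refl ; s-S = s-S ; s-P = stack-tail s-P ; s-L = stack-push r s-L })
          lists account
          (searching md (MoveStep.moved searcher r≢t above₀ above₂) source active maximal based found written count)
          (other-lt refl (+-monoʳ-< (length S) (≤-reflexive (solve 3 (λ p l q →
              con 1 :+ (con 3 :* p :+ (con 2 :* (con 1 :+ l) :+ q)) := con 3 :* (con 1 :+ p) :+ (con 2 :* l :+ q))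
            refl (length P) (length L) _)))))

      module Split {c cs} (r≢t : r ≢ t) (vx : arrays s 11 x ≡ 2) (r≤x : arrays s 12 r ≤ arrays s 12 x)
        (eqc : cur r ≡ c ∷ cs) (av : arrays s 10 c ≡ 0) where

        c≢0 : c ≢ 0
        c≢0 = proj₁ (proj₂ (linked-cons (l-cur r) eqc))

        arc : Arc c
        arc = proj₁ (cur-out (subst (c ∈_) (sym eqc) (here refl)))

        s₁ : State
        s₁ = setCell (setReg s 15 c) 6 r (arrays s 7 c)

        split-step : Exec W (Post g₀ s)
          (10 [ reg 15 ]≔ const 1 ⨾ 14 [ reg 8 ]≔ reg 15 ⨾ descend (9 ≔ headₑ 15)) s₁
        split-step =
          store⨾ refl refl (arc-fits arc) (const-fits (s≤s z≤n)) $
          store⨾ refl refl (node-fits r<N) (arc-fits arc) $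
          store⨾ h-L refl (below-fits (n≤1+n _) L-fits) (node-fits r<N) $
          assign⨾ (length-suc _ h-L) L-fits $
          assign⨾ (one-less h-P) (below-fits (m≤n⇒m≤1+n (n≤1+n _)) P-fits) $
          assign⨾ (stack-top s-P) (node-fits (vis<N (C-vis (there (here refl))))) $
          assign (head≡ c≢0) (node-fits (hd<N arc)) $
          post (ghost (update cur r cs) inn S P (r ∷ L) un ps part rest first) static
            (record { h-S = h-S ; h-P = refl ; h-L = refl ; s-S = s-S ; s-P = stack-tail s-P ; s-L = stack-push r s-L })
            (pop-cur lists eqc) account
            (searching md (SplitStep.splitted searcher r≢t vx r≤x eqc av) source active
              (max-reserve searcher maximal eqc av r≢t (inj₂ (r-visited searcher)) (C-rt (here refl)))
              based found written count)
            (node-lt (arrays s 2) (update cur r cs) inn r 3 r<N cur-other (cur-weight {arrays s 2} {cur} {inn} eqc)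
              (≤-trans (+-monoʳ-< (length S) (≤-reflexive (solve 3 (λ p l q →
                  con 1 :+ (con 3 :* p :+ (con 2 :* (con 1 :+ l) :+ q)) := con 3 :* (con 1 :+ p) :+ (con 2 :* l :+ q))
                refl (length P) (length L) _))) (m≤n+m _ 3)))

    module Advance {cur inn S P L un ps part rest first s}
      (i : Inv B (ghost cur inn S P L un ps part rest first) s) (md : regs s 4 ≡ 3)
      (pre : SearchPre s (ghost cur inn S P L un ps part rest first)) where
      open Searching i md pre hiding (cur; inn; S; P; L; un; ps; part; rest; first)

      g₀ : Ghost
      g₀ = ghost cur inn S P L un ps part rest first

      push-step : arrays s 11 x ≡ 0 → key x < key r →
        Exec W (Post g₀ s)
          (15 ≔ load 6 (reg 9) ⨾ 11 [ reg 9 ]≔ const 1 ⨾ 13 [ reg 9 ]≔ const 0 ⨾ 14 [ reg 9 ]≔ reg 15 ⨾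
           10 [ reg 15 ]≔ const 1 ⨾ 6 [ reg 9 ]≔ load 7 (reg 15) ⨾ 17 [ reg 7 ]≔ reg 9 ⨾ inc 7 ⨾ 9 ≔ headₑ 15) s
      push-step fr x<r with fresh x<N fr
      ... | c , cs , eqc , av with linked-cons (l-cur x) eqc
      ...   | p≡c , nz , l =
        assign⨾ p≡c (arc-fits arc) $
        store⨾ refl refl (node-fits x<N) (const-fits (s≤s z≤n)) $
        store⨾ refl refl (node-fits x<N) (const-fits z≤n) $
        store⨾ refl refl (node-fits x<N) (arc-fits arc) $
        store⨾ refl refl (arc-fits arc) (const-fits (s≤s z≤n)) $
        store⨾ refl refl (node-fits x<N)
          (linked-fits l (λ e∈ → proj₁ (cur-out (subst (_ ∈_) (sym eqc) (there e∈))))) $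
        store⨾ h-L refl (below-fits (n≤1+n _) L-fits) (node-fits x<N) $
        assign⨾ (length-suc _ h-L) L-fits $
        assign (head≡ nz) (node-fits (hd<N arc)) $
        post (ghost (update cur x cs) inn S P (x ∷ L) un ps part rest first) static
          (record { h-S = h-S ; h-P = h-P ; h-L = refl ; s-S = s-S ; s-P = s-P ; s-L = stack-push x s-L })
          (pop-cur lists eqc) account
          (searching md (push-node searcher fr x<r eqc av) source active (max-push searcher maximal fr eqc av)
            based found written count)
          (node-lt (arrays s 2) (update cur x cs) inn x 3 x<N cur-other (cur-weight {arrays s 2} {cur} {inn} eqc)
            (≤-reflexive (solve 4 (λ s p l q →
                con 1 :+ (s :+ (con 3 :* p :+ (con 2 :* (con 1 :+ l) :+ q))) :=
                con 3 :+ (s :+ (con 3 :* p :+ (con 2 :* l :+ q)))) refl (length S) (length P) (length L) _)))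
        where
        arc : Arc c
        arc = proj₁ (cur-out (subst (c ∈_) (sym eqc) (here refl)))

      module AtRoot (r≢t : r ≢ t) (vx : arrays s 11 x ≡ 2) (r≤x : arrays s 12 r ≤ arrays s 12 x) where

        skip-root : ∀ {c cs} → cur r ≡ c ∷ cs → arrays s 10 c ≢ 0 →
          Exec W (Post g₀ s) skip (setCell (setReg s 15 c) 6 r (arrays s 7 c))
        skip-root {c} {cs} eqc dead = done (post (ghost (update cur r cs) inn S P L un ps part rest first) static stacks
          (pop-cur lists eqc) account
          (searching md (skip-arc searcher eqc dead (λ z → 0≢2 z (r-visited searcher))) source active maximal
            based found written count)
          (node-lt (arrays s 2) (update cur r cs) inn r 3 r<N cur-other (cur-weight {arrays s 2} {cur} {inn} eqc)
            (s≤s (m≤n+m _ 2))))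

    module Failing {cur inn S P un ps part rest first s}
      (i : Inv B (ghost cur inn S P [] un ps part rest first) s) (md : regs s 4 ≡ 3)
      (pre : SearchPre s (ghost cur inn S P [] un ps part rest first)) where
      open Searching i md pre hiding (cur; inn; S; P; un; ps; part; rest; first)

      fail-step : r ≢ t → arrays s 11 x ≡ 2 → arrays s 12 r ≤ arrays s 12 x → cur r ≡ [] →
        Exec W (Post (ghost cur inn S P [] un ps part rest first) s)
          (2 [ reg 10 ]≔ const 0 ⨾ 16 [ reg 6 ]≔ reg 8 ⨾ inc 6 ⨾ 4 ≔ const 2) (setReg s 15 0)
      fail-step r≢t vx r≤x ex =
        store⨾ refl refl (node-fits (Z<N source)) (const-fits z≤n) $
        store⨾ h-P refl (below-fits (n≤1+n _) P-fits) (node-fits r<N) $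
        assign⨾ (length-suc _ h-P) P-fits $
        assign refl (const-fits (s≤s (s≤s z≤n))) $
        post (ghost cur inn S (r ∷ P) [] un ps part rest first) static
          (record { h-S = h-S ; h-P = refl ; h-L = h-L ; s-S = s-S ; s-P = stack-push r s-P ; s-L = s-L })
          lists (act-update account)
          (backing refl (end-search searcher) (max-fail searcher maximal vx r≤x ex r≢t) refl based found written count)
          (node-lt (update (arrays s 2) a 0) cur inn a (5 * arrays s 2 a) (Z<N source) act-other
            (act-weight {arrays s 2} {cur} {inn})
            (subst (λ p → suc (length S + (3 * suc (length P) + (10 * sumTo un (suc M) + 2))) ≤
                          5 * arrays s 2 a + (length S + (3 * length P + (10 * sumTo un (suc M) + p))))
              (sym (cong phase≡ md))
              (≤-trans (≤-reflexive (solve 3 (λ s p u →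
                  con 1 :+ (s :+ (con 3 :* (con 1 :+ p) :+ (u :+ con 2))) :=
                  con 5 :+ (s :+ (con 3 :* p :+ (u :+ con 1)))) refl (length S) (length P) (10 * sumTo un (suc M))))
                (+-monoˡ-≤ (length S + (3 * length P + (10 * sumTo un (suc M) + 1))) (five-times active)))))

    take-prog : Program
    take-prog = 15 ≔ load 6 (reg 14) ⨾
      ifnz (reg 15)
        (6 [ reg 14 ]≔ load 7 (reg 15) ⨾
         ifnz (load 10 (reg 15))
           skip
           (10 [ reg 15 ]≔ const 1 ⨾ 14 [ reg 14 ]≔ reg 15 ⨾ 9 ≔ headₑ 15))
        (dec 7 ⨾
         ifnz (load 11 (reg 14) ⊖ const 1)
           skip
           (11 [ reg 14 ]≔ const 2 ⨾ 12 [ reg 14 ]≔ reg 5 ⨾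
            15 [ reg 5 ]≔ reg 14 ⨾ inc 5))

    -- The second half of a retreat, once the landing of v has been recorded.
    module Retreat {cur inn S P v L un ps part rest first s}
      (i : Inv B (ghost cur inn S P (v ∷ L) un ps part rest first) s) (md : regs s 4 ≡ 3)
      (pre : SearchPre s (ghost cur inn S P (v ∷ L) un ps part rest first)) where
      open Searching i md pre hiding (cur; inn; S; P; L; un; ps; part; rest; first)

      g₀ : Ghost
      g₀ = ghost cur inn S P (v ∷ L) un ps part rest first

      v-mark : Marked (arrays s 11) v
      v-mark = L-mark (here refl)

      v≢t : v ≢ t
      v≢t = L≢t (here refl)

      v<N : v < N
      v<N = st-N (mark≢0 v-mark)

      take-or-finish : regs s 14 ≡ v → r ≢ t → arrays s 11 x ≡ 2 → arrays s 12 r ≤ arrays s 12 x → cur r ≡ [] →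
        arrays s 13 v ≢ 0 → arrays s 14 v ≡ arrays s 13 v → Exec W (Post g₀ s) take-prog s
      take-or-finish at-v r≢t vx r≤x ex k≢0 rt≡ = by-cur (cur v) refl
        where
        by-cur : ∀ es → cur v ≡ es → Exec W (Post g₀ s) take-prog s
        by-cur (c ∷ cs) eqc =
          assign⨾ (trans (cong (arrays s 6) at-v) p≡c) (arc-fits arc) $
          yes-branch nz $
          store⨾ at-v refl (node-fits v<N)
            (linked-fits l (λ e∈ → proj₁ (cur-out (subst (_ ∈_) (sym eqc) (there e∈))))) $
          branch skipping taking
          where
          link = linked-cons (l-cur v) eqc
          p≡c = proj₁ link
          nz = proj₁ (proj₂ link)
          l = proj₂ (proj₂ link)
          arc : Arc c
          arc = proj₁ (cur-out (subst (c ∈_) (sym eqc) (here refl)))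
          s₁ : State
          s₁ = setCell (setReg s 15 c) 6 v (arrays s 7 c)
          lt : measure (ghost (update cur v cs) inn S P (v ∷ L) un ps part rest first) s < measure g₀ s
          lt = node-lt (arrays s 2) (update cur v cs) inn v 3 v<N cur-other (cur-weight {arrays s 2} {cur} {inn} eqc)
                 (s≤s (m≤n+m _ 2))
          skipping : arrays s 10 c ≢ 0 → Exec W (Post g₀ s) skip s₁
          skipping dead = done (post (ghost (update cur v cs) inn S P (v ∷ L) un ps part rest first) static stacks
            (pop-cur lists eqc) account
            (searching md (skip-arc searcher eqc dead (mark≢0 v-mark)) source active maximal based found written count) lt)
          taking : arrays s 10 c ≡ 0 →
            Exec W (Post g₀ s) (10 [ reg 15 ]≔ const 1 ⨾ 14 [ reg 14 ]≔ reg 15 ⨾ 9 ≔ headₑ 15) s₁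
          taking av =
            store⨾ refl refl (arc-fits arc) (const-fits (s≤s z≤n)) $
            store⨾ at-v refl (node-fits v<N) (arc-fits arc) $
            assign (head≡ nz) (node-fits (hd<N arc)) $
            post (ghost (update cur v cs) inn S P (v ∷ L) un ps part rest first) static stacks
              (pop-cur lists eqc) account
              (searching md (Back.Resolved.Take.taken searcher vx r≤x ex r≢t k≢0 rt≡ eqc av) source active (max-reserve searcher maximal eqc av v≢t v-mark rt≡)
                based found written count) lt
        by-cur [] eqv =
          assign⨾ (trans (cong (arrays s 6) at-v) (linked-nil (l-cur v) eqv)) (const-fits z≤n) $
          no-branch refl $
          assign⨾ (one-less h-L) (below-fits (m≤n⇒m≤1+n (n≤1+n _)) L-fits) $
          branch rooted joining
          where
          s₁ : State
          s₁ = setReg (setReg s 15 0) 7 (length L)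
          status : ℕ
          status = arrays s 11 (regs s 14)
          rooted : status ∸ 1 ≢ 0 → Exec W (Post g₀ s) skip s₁
          rooted ne = done (post (ghost cur inn S P L un ps part rest first) static
            (record { h-S = h-S ; h-P = h-P ; h-L = refl ; s-S = s-S ; s-P = s-P ; s-L = stack-tail s-L })
            lists account
            (searching md (Back.Resolved.Finish.Root.finished searcher vx r≤x ex r≢t k≢0 rt≡ eqv v2) source active maximal based found written count)
            (other-lt refl (+-monoʳ-< (length S) (+-monoʳ-< (3 * length P)
              (+-monoˡ-< _ (*-monoʳ-< 2 (n<1+n (length L))))))))
            where
            v2 : arrays s 11 v ≡ 2
            v2 = [ (λ q → ⊥-elim (ne (cong (_∸ 1) (trans (cong (arrays s 11) at-v) q)))) , (λ q → q) ]′ v-mark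
          joining : status ∸ 1 ≡ 0 →
            Exec W (Post g₀ s) (11 [ reg 14 ]≔ const 2 ⨾ 12 [ reg 14 ]≔ reg 5 ⨾ 15 [ reg 5 ]≔ reg 14 ⨾ inc 5) s₁
          joining z =
            store⨾ at-v refl (node-fits v<N) (const-fits (s≤s (s≤s z≤n))) $
            store⨾ at-v h-S (node-fits v<N) (below-fits (n≤1+n _) S-fits) $
            store⨾ h-S at-v (below-fits (n≤1+n _) S-fits) (node-fits v<N) $
            assign (length-suc _ h-S) S-fits $
            post (ghost cur inn (v ∷ S) P L un ps part rest first) static
              (record { h-S = refl ; h-P = h-P ; h-L = refl ; s-S = stack-push v s-S ; s-P = s-P ; s-L = stack-tail s-L })
              lists account
              (searching md (Back.Resolved.Finish.Joined.finished searcher vx r≤x ex r≢t k≢0 rt≡ eqv v1) source active (max-join searcher maximal v1)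
                ((v≢t , v<N) ∷ based) found written count)
              (other-lt refl (≤-reflexive (solve 4 (λ s p l q →
                  con 2 :+ (s :+ (con 3 :* p :+ (con 2 :* l :+ q))) :=
                  s :+ (con 3 :* p :+ (con 2 :* (con 1 :+ l) :+ q))) refl (length S) (length P) (length L) _)))
            where
            v1 : arrays s 11 v ≡ 1
            v1 = [ (λ q → q) , (λ q → contradiction (trans (cong (_∸ 1) (trans (cong (arrays s 11) at-v) q)) refl)
                     (λ e → contradiction (trans (sym e) z) λ())) ]′ v-mark

    follow-nonempty : ∀ {rt x es} → Follow rt x es → x ≢ t → es ≢ []
    follow-nonempty stop x≢t _ = x≢t refl
    follow-nonempty (along _ _ _) _ ()

    module Succeeding {cur inn S P L un ps part rest first s}
      (i : Inv B (ghost cur inn S P L un ps part rest first) s) (md : regs s 4 ≡ 3)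
      (pre : SearchPre s (ghost cur inn S P L un ps part rest first)) where
      open Searching i md pre hiding (cur; inn; S; P; L; un; ps; part; rest; first)

      g₀ : Ghost
      g₀ = ghost cur inn S P L un ps part rest first

      succeed-step : r ≡ t → arrays s 11 x ≡ 2 →
        Exec W (Post g₀ s) (9 ≔ load 3 (reg 10) ⨾ 12 ≔ const 0 ⨾ 4 ≔ const 4) s
      succeed-step r≡t vx =
        assign⨾ (a-σ source) (node-fits (Z<N (Z-σ source))) $
        assign⨾ refl (const-fits z≤n) $
        assign refl (const-fits ≤-refl) $
        post (ghost cur inn S P L un ps [] X 1) static stacks lists account
          (writing refl wr progress)
          (other-lt (cong phase≡ md) (+-monoʳ-< (length S) (+-monoʳ-< (3 * length P) (+-monoʳ-< (2 * length L)
            (+-monoʳ-< (10 * sumTo un (suc M)) (s≤s z≤n))))))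
        where
        F : InvF (memory s g₀) t P L (σ a) a x
        F = subst (λ r → InvF (memory s g₀) r P L (σ a) a x) r≡t searcher
        open Succeed F maximal vx (≤-trans (≤-reflexive pos-t) z≤n) using (X; Y; walks; P≡[]; used-live) renaming (maximal to maximal₁)
        b≢t : σ a ≢ t
        b≢t eq = t∉Z (subst Z eq (Z-σ source))
        live : ∀ {e} → e ∈ X ++ Y → Unused ps e
        live e∈ = Maximal.sound maximal (used-live ([ inj₁ , inj₂ ]′ (∈-++⁻ X e∈)))
        avoid : ∀ {e} → Unused (ps ++ X ∷ Y ∷ []) e → (Unused ps ∖ (X ++ Y)) e
        avoid {e} (arc , e∉) = (arc , λ e∈ → e∉ (subst (e ∈_) (sym (concat-pair ps X Y)) (∈-++⁺ˡ e∈))) ,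
          λ e∈ → e∉ (subst (e ∈_) (sym (concat-pair ps X Y)) (∈-++⁺ʳ (concat ps) e∈))
        avoided : ∀ {e} → (Unused ps ∖ (X ++ Y)) e → Unused (ps ++ X ∷ Y ∷ []) e
        avoided {e} ((arc , e∉) , e∉′) = arc , λ e∈ →
          [ e∉ , e∉′ ]′ (∈-++⁻ (concat ps) (subst (e ∈_) (concat-pair ps X Y) e∈))
        keeps : ∀ {e} → e ∈ X ++ Y → arrays s 13 (tl e) ≤ M
        keeps {e} e∈ with proj₁ (walks-kept walks ([ inj₁ , inj₂ ]′ (∈-++⁻ X e∈))) | proj₂ (proj₂ (walks-kept walks ([ inj₁ , inj₂ ]′ (∈-++⁻ X e∈))))
        ... | inj₂ v , _ | nt = proj₂ (proj₁ (kp-out v nt))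
        ... | inj₁ q , _ | nt with arrays s 13 (tl e) ≟ 0
        ...   | yes z = ≤-trans (≤-reflexive z) z≤n
        ...   | no nz = proj₂ (proj₁ (proj₁ (L-Q (L1 q) q nz)))
        s₁ : State
        s₁ = setReg (setReg (setReg s 9 (σ a)) 12 0) 4 4
        g₁ : Ghost
        g₁ = ghost cur inn S P L un ps [] X 1
        wr : Writing s₁ g₁
        wr = record
          { X = X ; Y = Y
          ; clean = success-clean F
          ; maximal = maximal-U maximal₁ avoid (λ l → avoided (Maximal.sound maximal₁ l))
          ; pairs = Found.pairs found
          ; source = source
          ; route-X = proj₁ (walks-routes walks) ; route-Y = proj₂ (walks-routes walks)
          ; distinct = subst (AllPairs _≢_) (sym (concat-pair ps X Y))
              (AllPairsP.++⁺ (Found.distinct found) (walks-distinct walks)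
                (All.tabulate (λ e∈ → All.tabulate (λ { f∈ refl → proj₂ (live f∈) e∈ }))))
          ; un-one = λ u → Found.un-one found (proj₁ (avoid u))
          ; no-roots = P≡[]
          ; kp-small = keeps }
        progress : Progress s₁ g₁ X Y
        progress = first-path refl written refl (proj₁ (walks-follow walks)) (proj₂ (walks-follow walks))
          (λ e∈ → Found.un-one found (live e∈)) (walks-distinct walks)
          (inj₁ (refl , follow-nonempty (proj₁ (walks-follow walks)) b≢t , count))

    module Retreating {cur inn S P v L un ps part rest first s}
      (i : Inv B (ghost cur inn S P (v ∷ L) un ps part rest first) s) (md : regs s 4 ≡ 3)
      (pre : SearchPre s (ghost cur inn S P (v ∷ L) un ps part rest first)) where
      open Searching i md pre hiding (cur; inn; S; P; L; un; ps; part; rest; first)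

      g₀ : Ghost
      g₀ = ghost cur inn S P (v ∷ L) un ps part rest first

      v-mark : Marked (arrays s 11) v
      v-mark = L-mark (here refl)

      v≢t : v ≢ t
      v≢t = L≢t (here refl)

      v<N : v < N
      v<N = st-N (mark≢0 v-mark)

      retreat-step : r ≢ t → arrays s 11 x ≡ 2 → arrays s 12 r ≤ arrays s 12 x → cur r ≡ [] →
        Exec W (Post g₀ s)
          (14 ≔ load 17 (reg 7 ⊖ const 1) ⨾
           ifnz (load 13 (reg 14))
             (14 [ reg 14 ]≔ load 13 (reg 14))
             (13 [ reg 14 ]≔ load 14 (reg 14)) ⨾
           take-prog) (setReg s 15 0)
      retreat-step r≢t vx r≤x ex =
        assign⨾ (trans (cong (arrays s 17) (one-less h-L)) (stack-top s-L)) (node-fits v<N) $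
        branch⨾ settle-old settle-new
        where
        s₁ : State
        s₁ = setReg (setReg s 15 0) 14 v
        settle-old : arrays s 13 v ≢ 0 → Exec W (Post g₀ s) (14 [ reg 14 ]≔ load 13 (reg 14) ⨾ take-prog) s₁
        settle-old k≢0 = store⨾ refl refl (node-fits v<N) (arc-fits (proj₁ (proj₁ (Back.Old-keep.kp-head searcher vx r≤x ex r≢t k≢0)))) $
          Retreat.take-or-finish {part = part} {rest} {first}
            (record { static = static ; stacks = stacks ; lists = lists ; account = account ; small = small
                    ; mode = searching md (Back.Old-keep.resolved searcher vx r≤x ex r≢t k≢0) source active mx based found written count })
            md
            (record { searcher = Back.Old-keep.resolved searcher vx r≤x ex r≢t k≢0 ; source = source ; active = active ; maximal = mx
                    ; based = based ; found = found ; written = written ; count = count })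
            refl r≢t vx r≤x ex k≢0 (update-same (arrays s 14) v (arrays s 13 v))
          where
          mx = max-resolve-old searcher maximal vx r≤x ex r≢t k≢0
        settle-new : arrays s 13 v ≡ 0 → Exec W (Post g₀ s) (13 [ reg 14 ]≔ load 14 (reg 14) ⨾ take-prog) s₁
        settle-new k0 = store⨾ refl refl (node-fits v<N) (arc-fits (proj₁ out)) $
          Retreat.take-or-finish {part = part} {rest} {first}
            (record { static = static ; stacks = stacks ; lists = lists ; account = account ; small = small
                    ; mode = searching md (Back.Fresh-keep.resolved searcher vx r≤x ex r≢t k0) source active mx based found written count })
            md
            (record { searcher = Back.Fresh-keep.resolved searcher vx r≤x ex r≢t k0 ; source = source ; active = active ; maximal = mx
                    ; based = based ; found = found ; written = written ; count = count })
            refl r≢t vx r≤x ex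
            (λ z → arc≢0 out (trans (sym (update-same (arrays s 13) v (arrays s 14 v))) z))
            (sym (update-same (arrays s 13) v (arrays s 14 v)))
          where
          out : Out v (arrays s 14 v)
          out = rt-out v-mark v≢t
          mx = max-resolve-new searcher maximal v-mark k0

    module SearchStep {cur inn S P L un ps part rest first s}
      (i : Inv B (ghost cur inn S P L un ps part rest first) s) (md : regs s 4 ≡ 3)
      (pre : SearchPre s (ghost cur inn S P L un ps part rest first)) where
      open Searching i md pre hiding (cur; inn; S; P; L; un; ps; part; rest; first)

      g₀ : Ghost
      g₀ = ghost cur inn S P L un ps part rest first

      -- There is a root to descend to: the sink is a root, and it is not `r`.
      go-down : r ≢ t → (arrays s 11 x ≡ 0 → key r ≤ key x) →
        (arrays s 11 x ≡ 2 → arrays s 12 x < arrays s 12 r) → Exec W (Post g₀ s) (descend skip) s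
      go-down r≢t = below P i pre (tail t∈C)
        where
        tail : t ∈ r ∷ P → t ∈ P
        tail (here eq) = ⊥-elim (r≢t (sym eq))
        tail (there t∈) = t∈
        below : ∀ D (i : Inv B (ghost cur inn S D L un ps part rest first) s)
          (pre : SearchPre s (ghost cur inn S D L un ps part rest first)) → t ∈ D →
          (arrays s 11 x ≡ 0 → key r ≤ key x) → (arrays s 11 x ≡ 2 → arrays s 12 x < arrays s 12 r) →
          Exec W (Post (ghost cur inn S D L un ps part rest first) s) (descend skip) s
        below (ρ ∷ D) i pre _ = Descend.descend-step i md pre r≢t

      at-root : r ≢ t → arrays s 11 x ≡ 2 → arrays s 12 r ≤ arrays s 12 x → ∀ es → cur r ≡ es → ∀ M → L ≡ M →
        Exec W (Post g₀ s)
          (15 ≔ load 6 (reg 8) ⨾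
           ifnz (reg 15)
             (6 [ reg 8 ]≔ load 7 (reg 15) ⨾
              ifnz (load 10 (reg 15))
                skip
                (10 [ reg 15 ]≔ const 1 ⨾ 14 [ reg 8 ]≔ reg 15 ⨾ descend (9 ≔ headₑ 15)))
             (ifnz (reg 7)
               (14 ≔ load 17 (reg 7 ⊖ const 1) ⨾
                ifnz (load 13 (reg 14))
                  (14 [ reg 14 ]≔ load 13 (reg 14))
                  (13 [ reg 14 ]≔ load 14 (reg 14)) ⨾
                15 ≔ load 6 (reg 14) ⨾
                ifnz (reg 15)
                  (6 [ reg 14 ]≔ load 7 (reg 15) ⨾
                   ifnz (load 10 (reg 15))
                     skip
                     (10 [ reg 15 ]≔ const 1 ⨾ 14 [ reg 14 ]≔ reg 15 ⨾ 9 ≔ headₑ 15))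
                  (dec 7 ⨾
                   ifnz (load 11 (reg 14) ⊖ const 1)
                     skip
                     (11 [ reg 14 ]≔ const 2 ⨾ 12 [ reg 14 ]≔ reg 5 ⨾
                      15 [ reg 5 ]≔ reg 14 ⨾ inc 5)))
               (2 [ reg 10 ]≔ const 0 ⨾ 16 [ reg 6 ]≔ reg 8 ⨾ inc 6 ⨾ 4 ≔ const 2))) s
      at-root r≢t vx r≤x (c ∷ cs) eqc _ _ =
        assign⨾ (proj₁ link) (arc-fits (proj₁ out)) $
        yes-branch (proj₁ (proj₂ link)) $
        store⨾ refl refl (node-fits r<N)
          (linked-fits (proj₂ (proj₂ link)) (λ e∈ → proj₁ (cur-out (subst (_ ∈_) (sym eqc) (there e∈))))) $
        branch (Advance.AtRoot.skip-root i md pre r≢t vx r≤x eqc) splitting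
        where
        link = linked-cons (l-cur r) eqc
        out : Out r c
        out = cur-out (subst (c ∈_) (sym eqc) (here refl))
        tail : t ∈ r ∷ P → t ∈ P
        tail (here eq) = ⊥-elim (r≢t (sym eq))
        tail (there t∈) = t∈
        splitting : arrays s 10 c ≡ 0 → Exec W (Post g₀ s)
          (10 [ reg 15 ]≔ const 1 ⨾ 14 [ reg 8 ]≔ reg 15 ⨾ descend (9 ≔ headₑ 15))
          (setCell (setReg s 15 c) 6 r (arrays s 7 c))
        splitting av = below P i pre (tail t∈C)
          where
          below : ∀ D (i : Inv B (ghost cur inn S D L un ps part rest first) s)
            (pre : SearchPre s (ghost cur inn S D L un ps part rest first)) → t ∈ D →
            Exec W (Post (ghost cur inn S D L un ps part rest first) s)
              (10 [ reg 15 ]≔ const 1 ⨾ 14 [ reg 8 ]≔ reg 15 ⨾ descend (9 ≔ headₑ 15))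
              (setCell (setReg s 15 c) 6 r (arrays s 7 c))
          below (ρ ∷ D) i pre _ = Descend.Split.split-step i md pre r≢t vx r≤x eqc av
      at-root r≢t vx r≤x [] ex (v ∷ L₁) refl =
        assign⨾ (linked-nil (l-cur r) ex) (const-fits z≤n) $
        no-branch refl $
        yes-branch (0≢suc h-L) $
        Retreating.retreat-step i md pre r≢t vx r≤x ex
      at-root r≢t vx r≤x [] ex [] refl =
        assign⨾ (linked-nil (l-cur r) ex) (const-fits z≤n) $
        no-branch refl $
        no-branch h-L $
        Failing.fail-step i md pre r≢t vx r≤x ex

      key-diff : arrays s 18 r ∸ arrays s 18 x ≡ key r ∸ key x
      key-diff = cong₂ _∸_ (a-key r) (a-key x)

      search-visited : arrays s 11 x ≡ 2 → Exec W (Post g₀ s) searchBody s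
      search-visited vx with arrays s 12 r ∸ arrays s 12 x ≟ 0
      ... | no ne = yes-branch (0≢suc vx) $ yes-branch ne $
        go-down (λ r≡t → <⇒≱ (monus-pos {arrays s 12 r} {arrays s 12 x} ne) (≤-trans (≤-reflexive (trans (cong (arrays s 12) r≡t) pos-t)) z≤n))
          (λ z → ⊥-elim (0≢2 z vx)) (λ _ → monus-pos {arrays s 12 r} {arrays s 12 x} ne)
      ... | yes z with r ≟ t
      ...   | yes r≡t = yes-branch (0≢suc vx) $ no-branch z $
        no-branch (trans (cong₂ (λ u w → (u ∸ w) + (w ∸ u)) r≡t r-t) (differ-0 t)) $
        Succeeding.succeed-step i md pre r≡t vx
      ...   | no r≢t = yes-branch (0≢suc vx) $ no-branch z $
        yes-branch (λ d → r≢t (trans (differ-≢ d) r-t)) $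
        at-root r≢t vx (m∸n≡0⇒m≤n {arrays s 12 r} {arrays s 12 x} z) (cur r) refl L refl

      search-fresh : arrays s 11 x ≡ 0 → Exec W (Post g₀ s) searchBody s
      search-fresh fr with key r ∸ key x ≟ 0
      ... | no ne = no-branch fr $ yes-branch (λ z → ne (trans (sym key-diff) z)) $
        Advance.push-step i md pre fr (monus-pos ne)
      ... | yes z = no-branch fr $ no-branch (trans key-diff z) $
        go-down (λ r≡t → <⇒≱ (key-t x<N (λ { x≡t → 0≢2 (trans (cong (arrays s 11) (sym x≡t)) fr) t-vis }))
                   (subst (λ u → key u ≤ key x) r≡t (m∸n≡0⇒m≤n z)))
          (λ _ → m∸n≡0⇒m≤n z) (λ vx → ⊥-elim (0≢2 fr vx))

      search-step : Exec W (Post g₀ s) searchBody s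
      search-step = [ search-fresh , search-visited ]′ x-st

    -- Simulation of the writing phase

    output-append : ∀ {cnt op a4 a5 ps part e} → Output cnt op a4 a5 ps part →
      Output cnt (suc op) a4 (update a5 op (pred e)) ps (part ++ e ∷ [])
    output-append {cnt} {op} {a4} {a5} {ps} {part} {e} o = record
      { finished = trans (applyUpTo-cong _ _ cnt (λ {j} j<cnt → applyUpTo-cong _ _ (a4 (suc j) ∸ a4 j)
          (λ {k} k< → update-other a5 op (pred e) (<⇒≢ (earlier j<cnt k<))))) finished
      ; bounded = bounded
      ; current = begin
          applyUpTo cells (length (part ++ e ∷ []))
            ≡⟨ cong (applyUpTo cells) (trans (length-++ part) (+-comm (length part) 1)) ⟩
          applyUpTo cells (suc (length part))
            ≡⟨ sym (applyUpTo-∷ʳ cells (length part)) ⟩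
          applyUpTo cells (length part) ++ cells (length part) ∷ []
            ≡⟨ cong₂ (λ xs x → xs ++ x ∷ [])
                 (trans (applyUpTo-cong cells _ (length part) (λ {k} k< →
                   update-other a5 op (pred e) (<⇒≢ (subst (a4 cnt + k <_) (sym position) (+-monoʳ-< (a4 cnt) k<))))) current)
                 (trans (cong (update a5 op (pred e)) (sym position)) (update-same a5 op (pred e))) ⟩
          map pred part ++ pred e ∷ []
            ≡⟨ sym (map-++ pred part (e ∷ [])) ⟩
          map pred (part ++ e ∷ []) ∎
      ; position = trans (cong suc position) (trans (sym (+-suc (a4 cnt) (length part)))
          (cong (a4 cnt +_) (sym (trans (length-++ part) (+-comm (length part) 1))))) }
      where
      open Output o
      open ≡-Reasoning
      cells : ℕ → ℕ
      cells k = update a5 op (pred e) (a4 cnt + k)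
      earlier : ∀ {j k} → j < cnt → k < a4 (suc j) ∸ a4 j → a4 j + k < op
      earlier {j} {k} j<cnt k< = <-≤-trans (+-monoʳ-< (a4 j) k<)
        (≤-trans (≤-reflexive (m+[n∸m]≡n {a4 j} (<⇒≤ (monus-pos {a4 (suc j)} (λ z → contradiction (subst (k <_) z k<) λ())))))
          (≤-trans (bounded j<cnt) (≤-trans (m≤m+n _ (length part)) (≤-reflexive (sym position)))))

    output-close : ∀ {cnt op a4 a5 ps part} → Output cnt op a4 a5 ps part →
      Output (suc cnt) op (update a4 (suc cnt) op) a5 (ps ++ part ∷ []) []
    output-close {cnt} {op} {a4} {a5} {ps} {part} o = record
      { finished = begin
          applyUpTo path (suc cnt)
            ≡⟨ sym (applyUpTo-∷ʳ path cnt) ⟩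
          applyUpTo path cnt ++ path cnt ∷ []
            ≡⟨ cong₂ (λ xs x → xs ++ x ∷ [])
                 (trans (applyUpTo-cong path _ cnt (λ {j} lt → cong₂ (λ u w → applyUpTo (λ k → a5 (w + k)) (u ∸ w))
                   (update-other a4 (suc cnt) op (<⇒≢ (s≤s lt)))
                   (update-other a4 (suc cnt) op (<⇒≢ (m≤n⇒m≤1+n lt))))) finished)
                 last-path ⟩
          map (map pred) ps ++ map pred part ∷ []
            ≡⟨ sym (map-++ (map pred) ps (part ∷ [])) ⟩
          map (map pred) (ps ++ part ∷ []) ∎
      ; bounded = λ {j} le → subst (a4′ j ≤_) (sym at-end) (bound j le)
      ; current = refl
      ; position = trans (sym at-end) (sym (+-identityʳ _)) }
      where
      open Output o
      open ≡-Reasoning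
      a4′ : ℕ → ℕ
      a4′ = update a4 (suc cnt) op
      at-end : a4′ (suc cnt) ≡ op
      at-end = update-same a4 (suc cnt) op
      path : ℕ → List ℕ
      path j = applyUpTo (λ k → a5 (a4′ j + k)) (a4′ (suc j) ∸ a4′ j)
      last-path : path cnt ≡ map pred part
      last-path = trans (cong₂ (λ u w → applyUpTo (λ k → a5 (w + k)) (u ∸ w)) at-end
          (update-other a4 (suc cnt) op (<⇒≢ ≤-refl)))
        (trans (cong (applyUpTo (λ k → a5 (a4 cnt + k))) (trans (cong (_∸ a4 cnt) position) (m+n∸m≡n (a4 cnt) (length part))))
               current)
      bound : ∀ j → j ≤ suc cnt → a4′ j ≤ op
      bound j le with j ≟ suc cnt
      ... | yes refl = ≤-reflexive at-end
      ... | no ne = ≤-trans (≤-reflexive (update-other a4 (suc cnt) op ne))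
        (≤-trans (bounded (≤-pred (≤∧≢⇒< le ne))) (≤-trans (m≤m+n _ (length part)) (≤-reflexive (sym position))))

    retarget : ∀ {st pos kp rt rt′ dl cur inn S L} → InvK st pos kp rt dl cur inn S L → rt′ t ≡ kp t →
      InvK st pos kp rt′ dl cur inn S L
    retarget i eq = record
      { arcs = arcs ; t-two = t-two ; pos-t = pos-t ; rt-t = eq ; based = based ; L-ok = L-ok
      ; waiting = waiting ; dead-cur = dead-cur ; dead-in = dead-in ; fresh = fresh }
      where open InvK i

    -- An inversion of `Follow` with propositional equations, so that it can be applied to the
    -- contents of registers and arrays.
    Continue : (rt : ℕ → ℕ) → ℕ → List ℕ → Set
    Continue rt x rs = (x ≡ t × rs ≡ []) ⊎
      (x ≢ t × Out x (rt x) × ∃[ es ] (rs ≡ rt x ∷ es × Follow rt (hd (rt x)) es))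

    continue : ∀ {rt x rs} → Follow rt x rs → Continue rt x rs
    continue stop = inj₁ (refl , refl)
    continue (along x≢t out f) = inj₂ (x≢t , out , _ , refl , f)

    module WriteStep {cur inn S P L un ps part rest first s}
      (i : Inv B (ghost cur inn S P L un ps part rest first) s) (md : regs s 4 ≡ 4)
      (w : Writing s (ghost cur inn S P L un ps part rest first)) where
      open At i hiding (cur; inn; S; P; L; un; ps; part; rest; first)
      open Writing w

      g₀ : Ghost
      g₀ = ghost cur inn S P L un ps part rest first

      a x : ℕ
      a = regs s 10
      x = regs s 9

      ps₁ : List (List ℕ)
      ps₁ = ps ++ X ∷ Y ∷ []

      op-fits : regs s 11 < W
      op-fits = fits (≤-trans (m≤m+n _ (sumTo un (suc M))) (≤-trans (≤-reflexive op-un) (s≤s M≤B)))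

      started : (first ≡ 1 × rest ≢ [] × regs s 3 ≤ regs s 11) ⊎ (first ≡ 0 × regs s 3 < regs s 11) →
        regs s 3 < suc (regs s 11)
      started (inj₁ (_ , _ , le)) = s≤s le
      started (inj₂ (_ , lt)) = m≤n⇒m≤1+n lt

      finished-count : rest ≡ [] →
        (first ≡ 1 × rest ≢ [] × regs s 3 ≤ regs s 11) ⊎ (first ≡ 0 × regs s 3 < regs s 11) →
        first ≡ 0 × regs s 3 < regs s 11
      finished-count eq (inj₁ (_ , ne , _)) = ⊥-elim (ne eq)
      finished-count eq (inj₂ z) = z

      module Emit {e} {es : List ℕ} (x≢t : x ≢ t) (out : Out x e) (e≡ : arrays s 14 x ≡ e) (e∈ : e ∈ X ++ Y) (un-e : un e ≡ 1) where
        un₁ : ℕ → ℕ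
        un₁ = update un e 0

        g₁ : Ghost
        g₁ = ghost cur inn S P L un₁ ps (part ++ e ∷ []) es 0

        s₁ : State
        s₁ = setReg (setCell (setReg (setCell (setReg s 15 e) 5 (regs s 11) (e ∸ 1)) 11 (suc (regs s 11)))
               14 x (arrays s 13 x)) 9 (hd e)

        sum₁ : sumTo un₁ (suc M) + 1 ≡ sumTo un (suc M)
        sum₁ = sum-drop (suc M) e (s≤s (proj₂ (proj₁ out))) (λ y ne → update-other un e 0 ne)
          (trans un-e (cong (_+ 1) (sym (update-same un e 0))))

        op-suc : suc (regs s 11) + sumTo un₁ (suc M) ≡ suc M
        op-suc = trans (sym (+-suc (regs s 11) _)) (trans (cong (regs s 11 +_) (trans (+-comm 1 _) sum₁)) op-un)

        in-paths : e ∈ concat ps₁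
        in-paths = subst (e ∈_) (sym (concat-pair ps X Y)) (∈-++⁺ʳ (concat ps) e∈)

        writing₁ : Writing s₁ g₁
        writing₁ = record
          { X = X ; Y = Y
          ; clean = retarget clean (trans (update-other (arrays s 14) x (arrays s 13 x) (λ eq → x≢t (sym eq)))
                                          (InvK.rt-t clean))
          ; maximal = maximal ; pairs = pairs ; source = source ; route-X = route-X ; route-Y = route-Y
          ; distinct = distinct
          ; un-one = λ u → trans (update-other un e 0 (λ { refl → proj₂ u in-paths })) (un-one u)
          ; no-roots = no-roots ; kp-small = kp-small }

        -- The arc frees 10 credits, so the measure falls whenever the new phase weight is at most
        -- 9.
        emit : (progress : Progress s₁ g₁ X Y) → phaseWeight (regs s 4) (regs s 12) 0 ≤ 9 → Exec W (Post g₀ s)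
          (15 ≔ load 14 (reg 9) ⨾ 5 [ reg 11 ]≔ reg 15 ⊖ const 1 ⨾ inc 11 ⨾
           14 [ reg 9 ]≔ load 13 (reg 9) ⨾ 9 ≔ headₑ 15) s
        emit progress ph≤ =
          assign⨾ e≡ (arc-fits arc) $
          store⨾ refl refl op-fits (below-fits (m∸n≤m e 1) (arc-fits arc)) $
          assign⨾ (length-suc _ refl) (fits (≤-trans (m≤m+n _ _) (≤-trans (≤-reflexive op-suc) (s≤s M≤B)))) $
          store⨾ refl refl (node-fits (subst (_< N) (proj₂ out) (tl<N arc)))
            (fits (≤-trans (subst (λ y → arrays s 13 y ≤ M) (proj₂ out) (kp-small e∈)) (m≤n⇒m≤1+n M≤B))) $
          assign (head≡ (arc≢0 out)) (node-fits (hd<N arc)) $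
          post g₁ static stacks lists (record { act-Z = act-Z ; op-un = op-suc })
            (writing md writing₁ progress)
            (+-monoʳ-< (sumTo (nodeWeight (arrays s 2) cur inn) N) (+-monoʳ-< (length S)
              (+-monoʳ-< (3 * length P) (+-monoʳ-< (2 * length L)
                (≤-trans (s≤s (+-monoʳ-≤ (10 * sumTo un₁ (suc M)) ph≤))
                  (≤-trans (≤-reflexive (trans (solve 1 (λ u → con 1 :+ (con 10 :* u :+ con 9) := con 10 :* (u :+ con 1))
                      refl (sumTo un₁ (suc M))) (cong (10 *_) sum₁)))
                    (m≤m+n _ _)))))))
          where
          arc : Arc e
          arc = proj₁ out

      un-rest : ∀ {e xs} → All (e ≢_) xs → (∀ {f} → f ∈ e ∷ xs → un f ≡ 1) → ∀ {f} → f ∈ xs → update un e 0 f ≡ 1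
      un-rest {e} al f∈ f∈xs = trans (update-other un e 0 (λ { refl → All.lookup al f∈xs refl })) (f∈ (there f∈xs))

      follow-rest : ∀ {es} → x ≢ t → Out x (arrays s 14 x) → Follow (arrays s 14) (hd (arrays s 14 x)) es →
        Follow (update (arrays s 14) x (arrays s 13 x)) (hd (arrays s 14 x)) es
      follow-rest x≢t out = follow-frame (λ le → update-other (arrays s 14) x (arrays s 13 x)
        (λ { refl → <⇒≱ (out-key x≢t out) le }))

      op≢ : x ≢ t → (x ∸ regs s 2) + (regs s 2 ∸ x) ≢ 0
      op≢ x≢t z = x≢t (trans (differ-≢ z) r-t)

      op≡ : x ≡ t → (x ∸ regs s 2) + (regs s 2 ∸ x) ≡ 0
      op≡ x≡t = trans (cong₂ (λ u w → (u ∸ w) + (w ∸ u)) x≡t r-t) (differ-0 t)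

      write-first : ∀ rs → Continue (arrays s 14) x rs → rest ≡ rs → regs s 12 ≡ 0 →
        Output (regs s 3) (regs s 11) (arrays s 4) (arrays s 5) ps part → X ≡ part ++ rs →
        Follow (after (arrays s 14) (arrays s 13) rs) a Y →
        (∀ {e} → e ∈ rs ++ Y → un e ≡ 1) → AllPairs _≢_ (rs ++ Y) →
        (first ≡ 1 × rest ≢ [] × regs s 3 ≤ regs s 11) ⊎ (first ≡ 0 × regs s 3 < regs s 11) →
        Exec W (Post g₀ s) writeBody s
      write-first .(arrays s 14 x ∷ es) (inj₂ (x≢t , out , es , refl , f)) eqr ph o eqX fY un1 (al ∷ ds) st =
        yes-branch (op≢ x≢t) (E.emit progress (≤-trans (≤-reflexive phase-8) (n≤1+n 8)))
        where
        e : ℕ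
        e = arrays s 14 x
        module E = Emit {e} {es} x≢t out refl
          (subst (λ Z → e ∈ Z ++ Y) (sym eqX) (∈-++⁺ˡ (∈-++⁺ʳ part (here refl)))) (un1 (here refl))
        phase-8 : phaseWeight (regs s 4) (regs s 12) 0 ≡ 8
        phase-8 = cong₂ (λ k p → phaseWeight k p 0) md ph
        progress : Progress E.s₁ E.g₁ X Y
        progress = first-path ph (output-append o) (trans eqX (sym (++-assoc part (e ∷ []) es))) (follow-rest x≢t out f)
          (subst (λ y → Follow (after (update (arrays s 14) y (arrays s 13 y)) (arrays s 13) es) a Y) (proj₂ out) fY)
          (un-rest al un1) ds (inj₂ (refl , started st))
      write-first .[] (inj₁ (x≡ , refl)) eqr ph o eqX fY un1 ds st = no-branch (op≡ x≡) $
        assign⨾ (length-suc _ refl) cnt-fits $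
        store⨾ refl refl cnt-fits op-fits $
        no-branch ph $
        assign⨾ refl (const-fits (s≤s z≤n)) $
        assign refl (node-fits (Z<N source)) $
        post g₁ static stacks lists account (writing md writing₁ progress)
          (+-monoʳ-< (sumTo (nodeWeight (arrays s 2) cur inn) N) (+-monoʳ-< (length S)
            (+-monoʳ-< (3 * length P) (+-monoʳ-< (2 * length L) (+-monoʳ-< (10 * sumTo un (suc M))
              (subst₂ (λ k p → phaseWeight k 1 1 < p) (sym md) (sym phase-8) ≤-refl))))))
        where
        cnt< : regs s 3 < regs s 11
        cnt< = proj₂ (finished-count eqr st)
        cnt-fits : suc (regs s 3) < W
        cnt-fits = below-fits cnt< op-fits
        phase-8 : phaseWeight (regs s 4) (regs s 12) first ≡ 8
        phase-8 = trans (cong (phaseWeight (regs s 4) (regs s 12)) (proj₁ (finished-count eqr st)))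
                        (cong₂ (λ k p → phaseWeight k p 0) md ph)
        g₁ : Ghost
        g₁ = ghost cur inn S P L un ps [] Y 1
        s₁ : State
        s₁ = setReg (setReg (setCell (setReg s 3 (suc (regs s 3))) 4 (suc (regs s 3)) (regs s 11)) 12 1) 9 a
        writing₁ : Writing s₁ g₁
        writing₁ = record
          { X = X ; Y = Y ; clean = clean ; maximal = maximal ; pairs = pairs ; source = source
          ; route-X = route-X ; route-Y = route-Y ; distinct = distinct ; un-one = un-one
          ; no-roots = no-roots ; kp-small = kp-small }
        progress : Progress s₁ g₁ X Y
        progress = second-path refl
          (subst (λ Z → Output (suc (regs s 3)) (regs s 11) (update (arrays s 4) (suc (regs s 3)) (regs s 11)) (arrays s 5)
                          (ps ++ Z ∷ []) []) (sym (trans eqX (++-identityʳ part))) (output-close o))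
          refl fY un1 ds
          (inj₁ (refl , follow-nonempty fY (λ eq → t∉Z (subst Z eq source)) , cnt<))

      write-second : ∀ rs → Continue (arrays s 14) x rs → rest ≡ rs → regs s 12 ≡ 1 →
        Output (regs s 3) (regs s 11) (arrays s 4) (arrays s 5) (ps ++ X ∷ []) part → Y ≡ part ++ rs →
        (∀ {e} → e ∈ rs → un e ≡ 1) → AllPairs _≢_ rs →
        (first ≡ 1 × rest ≢ [] × regs s 3 ≤ regs s 11) ⊎ (first ≡ 0 × regs s 3 < regs s 11) →
        Exec W (Post g₀ s) writeBody s
      write-second .(arrays s 14 x ∷ es) (inj₂ (x≢t , out , es , refl , f)) eqr ph o eqY un1 (al ∷ ds) st =
        yes-branch (op≢ x≢t) (E.emit progress (≤-trans (≤-reflexive phase-7) (m≤n+m 7 2)))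
        where
        e : ℕ
        e = arrays s 14 x
        module E = Emit {e} {es} x≢t out refl
          (∈-++⁺ʳ X (subst (e ∈_) (sym eqY) (∈-++⁺ʳ part (here refl)))) (un1 (here refl))
        phase-7 : phaseWeight (regs s 4) (regs s 12) 0 ≡ 7
        phase-7 = cong₂ (λ k p → phaseWeight k p 0) md ph
        progress : Progress E.s₁ E.g₁ X Y
        progress = second-path ph (output-append o) (trans eqY (sym (++-assoc part (e ∷ []) es))) (follow-rest x≢t out f)
          (un-rest al un1) ds (inj₂ (refl , started st))
      write-second .[] (inj₁ (x≡ , refl)) eqr ph o eqY un1 ds st = no-branch (op≡ x≡) $
        assign⨾ (length-suc _ refl) cnt-fits $
        store⨾ refl refl cnt-fits op-fits $
        yes-branch (0≢suc ph) $
        assign refl (const-fits (s≤s z≤n)) $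
        post (ghost cur inn S P L un ps₁ part rest first) static stacks lists
          (record { act-Z = act-Z ; op-un = op-un })
          (cleaning refl clean maximal no-roots
            (record { pairs = more pairs source route-X route-Y ; distinct = distinct ; un-one = un-one })
            (subst (λ Z → Output (suc (regs s 3)) (regs s 11) (update (arrays s 4) (suc (regs s 3)) (regs s 11)) (arrays s 5) Z [])
              (trans (++-assoc ps (X ∷ []) (part ∷ [])) (cong (λ Z → ps ++ X ∷ Z ∷ []) (sym (trans eqY (++-identityʳ part)))))
              (output-close o)) cnt<)
          (+-monoʳ-< (sumTo (nodeWeight (arrays s 2) cur inn) N) (+-monoʳ-< (length S)
            (+-monoʳ-< (3 * length P) (+-monoʳ-< (2 * length L) (+-monoʳ-< (10 * sumTo un (suc M))
              (subst (6 <_) (sym phase-7) ≤-refl))))))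
        where
        cnt< : regs s 3 < regs s 11
        cnt< = proj₂ (finished-count eqr st)
        cnt-fits : suc (regs s 3) < W
        cnt-fits = below-fits cnt< op-fits
        phase-7 : phaseWeight (regs s 4) (regs s 12) first ≡ 7
        phase-7 = trans (cong (phaseWeight (regs s 4) (regs s 12)) (proj₁ (finished-count eqr st)))
                        (cong₂ (λ k p → phaseWeight k p 0) md ph)

    -- The main loop

    main-step : ∀ g s → Inv B g s → regs s 4 ≢ 0 → Exec W (Post g s) mainBody s
    main-step g@(ghost cur inn S P L un ps part rest first) s i md≢0 with Inv.mode i
    ... | cleaning md K mx P≡ fo o le = no-branch (cong (_∸ 1) md) (clean-step i md (K , mx , fo , o , le) P≡)
    ... | backing md I mx L≡ b fo o le = yes-branch (0≢suc (cong (_∸ 1) md)) $ no-branch (cong (_∸ 2) md) $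
      back-step i md I mx L≡ b fo o le
    ... | searching md F z az mx b fo o le = yes-branch (0≢suc (cong (_∸ 1) md)) $
      yes-branch (0≢suc (cong (_∸ 2) md)) $ no-branch (cong (_∸ 3) md) $
      SearchStep.search-step i md (record { searcher = F ; source = z ; active = az ; maximal = mx ; based = b
                                          ; found = fo ; written = o ; count = le })
    ... | writing md w (first-path ph o eq f fY un1 ds st) = yes-branch (0≢suc (cong (_∸ 1) md)) $
      yes-branch (0≢suc (cong (_∸ 2) md)) $ yes-branch (0≢suc (cong (_∸ 3) md)) $
      WriteStep.write-first i md w rest (continue f) refl ph o eq fY un1 ds st
    ... | writing md w (second-path ph o eq f un1 ds st) = yes-branch (0≢suc (cong (_∸ 1) md)) $
      yes-branch (0≢suc (cong (_∸ 2) md)) $ yes-branch (0≢suc (cong (_∸ 3) md)) $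
      WriteStep.write-second i md w rest (continue f) refl ph o eq un1 ds st
    ... | halted md _ _ _ = ⊥-elim (md≢0 md)

    Solved : State → Set
    Solved s = ∃[ ps ] (Pairs ps × AllPairs _≢_ (concat ps) × (∀ {z} → Z z → ¬ Feasible (Unused ps) z) ×
      output s ≡ map (map pred) ps)

    main-halts : ∀ g s → Inv B g s → Halts W Solved (while (reg 4) mainBody)
      ((2 + maxCost mainBody) * suc (measure g s)) s
    main-halts g s i with while-halts {W} {reg 4} {mainBody} (Inv B) measure main-step g s i
    ... | n , s′ , run , n≤ , g′ , i′ , z = n , s′ , run , n≤ , solved (Inv.mode i′)
      where
      solved : Mode s′ g′ → Solved s′
      solved (halted _ stuck fo o) = _ , Found.pairs fo , Found.distinct fo , stuck , Output.finished o
      solved (cleaning md _ _ _ _ _ _) = contradiction (trans (sym md) z) λ()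
      solved (backing md _ _ _ _ _ _ _) = contradiction (trans (sym md) z) λ()
      solved (searching md _ _ _ _ _ _ _ _) = contradiction (trans (sym md) z) λ()
      solved (writing md _ _) = contradiction (trans (sym md) z) λ()

-- Adjacency lists and topological order

buildBody orderBody : Program

buildBody =
  14 ≔ load 0 (reg 15) ⨾
  16 ≔ load 1 (reg 15) ⨾
  7 [ reg 15 ⊕ const 1 ]≔ load 6 (reg 14) ⨾
  9 [ reg 15 ⊕ const 1 ]≔ load 8 (reg 16) ⨾
  inc 15 ⨾
  6 [ reg 14 ]≔ reg 15 ⨾
  8 [ reg 16 ]≔ reg 15 ⨾
  -- A copy of the list heads in array 8, which the depth-first search may consume.
  19 [ reg 16 ]≔ reg 15

-- Depth-first search along the entering arcs (array 19), with the stack in array 20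
-- of height reg 18; a node gets the next key (reg 19) when it is left.
orderBody =
  ifnz (reg 18)
    (14 ≔ load 20 (reg 18 ⊖ const 1) ⨾
     15 ≔ load 19 (reg 14) ⨾
     ifnz (reg 15)
       (19 [ reg 14 ]≔ load 9 (reg 15) ⨾
        16 ≔ tailₑ 15 ⨾
        ifnz (load 11 (reg 16))
          skip
          (11 [ reg 16 ]≔ const 1 ⨾ 20 [ reg 18 ]≔ reg 16 ⨾ inc 18))
       (dec 18 ⨾ inc 19 ⨾ 18 [ reg 14 ]≔ reg 19 ⨾
        -- The nodes are stacked above the sink for the first cleaning, which starts with all of
        -- them.
        ifnz (reg 14 ≠ₑ reg 2)
          (15 [ reg 5 ]≔ reg 14 ⨾ inc 5)
          skip))
    (ifnz (load 11 (reg 17))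
      (inc 17)
      (11 [ reg 17 ]≔ const 1 ⨾ 20 [ const 0 ]≔ reg 17 ⨾ 18 ≔ const 1 ⨾ inc 17))

solver : Program
solver =
  while (reg 1 ⊖ reg 15) buildBody ⨾
  (15 [ const 0 ]≔ reg 2 ⨾ 5 ≔ const 1) ⨾
  while ((reg 0 ⊖ reg 17) ⊕ reg 18) orderBody ⨾
  -- The sink gets the status of a stacked node and a key above all others. Every other node keeps
  -- the status 1 left by the depth-first search and waits for its first test.
  (11 [ reg 2 ]≔ const 2 ⨾ 18 [ reg 2 ]≔ reg 19 ⊕ const 1 ⨾ 4 ≔ const 1) ⨾
  while (reg 4) mainBody

halts-seq : ∀ {W Q R c d m n s} → Halts W Q c m s → (∀ {s′} → Q s′ → Halts W R d n s′) →
  Halts W R (c ⨾ d) (m + n) s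
halts-seq (k , s₁ , r₁ , k≤ , q) f with f q
... | l , s₂ , r₂ , l≤ , r = k + l , s₂ , seq r₁ r₂ , +-mono-≤ k≤ l≤ , r

data Reaches (Arc : ℕ → Set) (tl hd : ℕ → ℕ) : ℕ → ℕ → Set where
  here : ∀ {x} → Reaches Arc tl hd x x
  step : ∀ {e y} → Arc e → Reaches Arc tl hd (hd e) y → Reaches Arc tl hd (tl e) y

record PreGraph : Set₁ where
  field
    N M t   : ℕ
    tl hd σ : ℕ → ℕ
    Z       : ℕ → Set

  Arc : ℕ → Set
  Arc e = 0 < e × e ≤ M

  field
    t<N      : t < N
    tl<N     : ∀ {e} → Arc e → tl e < N
    hd<N     : ∀ {e} → Arc e → hd e < N
    acyclic  : ∀ {e} → Arc e → ¬ Reaches Arc tl hd (hd e) (tl e)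
    Z<N      : ∀ {z} → Z z → z < N
    Z-σ      : ∀ {z} → Z z → Z (σ z)
    σ-invol  : ∀ {z} → Z z → σ (σ z) ≡ z
    σ-free   : ∀ {z} → Z z → σ z ≢ z
    t∉Z      : ¬ Z t

module Preparation (H : PreGraph) (capacity : Capacity (PreGraph.N H) (PreGraph.M H)) where
  open PreGraph H
  open Capacity capacity

  node-fit : ∀ {x} → x < N → x < W
  node-fit lt = fits (≤-trans (<⇒≤ lt) (m≤n⇒m≤1+n N≤B))

  arc-fit : ∀ {e} → e ≤ M → e < W
  arc-fit le = fits (≤-trans le (m≤n⇒m≤1+n M≤B))

  const-fit : ∀ {k} → k ≤ 4 → k < W
  const-fit le = fits (≤-trans le (m≤n⇒m≤1+n 4≤B))

  record Untouched (r0 r1 r2 r3 r6 r7 r11 : ℕ) (a0 a1 a2 a3 a4 a10 a12 a13 a14 : ℕ → ℕ) : Set where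
    field
      r-N : r0 ≡ N
      r-M : r1 ≡ M
      r-t : r2 ≡ t
      r3-0 : r3 ≡ 0
      r6-0 : r6 ≡ 0
      r7-0 : r7 ≡ 0
      r11-0 : r11 ≡ 0
      a-tl : ∀ e → a0 e ≡ tl (suc e)
      a-hd : ∀ e → a1 e ≡ hd (suc e)
      a-σ  : ∀ {z} → Z z → a3 z ≡ σ z
      act-Z : ∀ {z} → a2 z ≢ 0 → Z z
      Z-act : ∀ {z} → Z z → a2 z ≢ 0
      act-1 : ∀ z → a2 z ≤ 1
      a4-0  : a4 0 ≡ 0
      a10-0 : ∀ x → a10 x ≡ 0
      a12-0 : ∀ x → a12 x ≡ 0
      a13-0 : ∀ x → a13 x ≡ 0
      a14-0 : ∀ x → a14 x ≡ 0

  Quiet : State → Set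
  Quiet s = Untouched (regs s 0) (regs s 1) (regs s 2) (regs s 3) (regs s 6) (regs s 7) (regs s 11)
    (arrays s 0) (arrays s 1) (arrays s 2) (arrays s 3) (arrays s 4) (arrays s 10) (arrays s 12) (arrays s 13) (arrays s 14)

  record Adjacency (k : ℕ) (a6 a7 a8 a9 : ℕ → ℕ) (cur inn : ℕ → List ℕ) : Set where
    field
      l-cur  : ∀ x → Linked a7 (a6 x) (cur x)
      l-inn  : ∀ x → Linked a9 (a8 x) (inn x)
      cur-ok : ∀ {x e} → e ∈ cur x → (0 < e × e ≤ k) × tl e ≡ x
      inn-ok : ∀ {x e} → e ∈ inn x → (0 < e × e ≤ k) × hd e ≡ x
      all-cur : ∀ {e} → 0 < e → e ≤ k → e ∈ cur (tl e)
      all-inn : ∀ {e} → 0 < e → e ≤ k → e ∈ inn (hd e)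
      n-cur  : sumTo (λ x → length (cur x)) N ≡ k
      n-inn  : sumTo (λ x → length (inn x)) N ≡ k

  record BuildInv (g : (ℕ → List ℕ) × (ℕ → List ℕ)) (s : State) : Set where
    field
      quiet : Quiet s
      k≤M   : regs s 15 ≤ M
      adj   : Adjacency (regs s 15) (arrays s 6) (arrays s 7) (arrays s 8) (arrays s 9) (proj₁ g) (proj₂ g)
      copy  : ∀ x → arrays s 19 x ≡ arrays s 8 x
      r17-0 : regs s 17 ≡ 0
      r18-0 : regs s 18 ≡ 0
      r19-0 : regs s 19 ≡ 0
      a11-0 : ∀ x → arrays s 11 x ≡ 0
      a18-0 : ∀ x → arrays s 18 x ≡ 0

  linked-le : ∀ {f p xs k} → Linked f p xs → (∀ {e} → e ∈ xs → e ≤ k) → p ≤ k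
  linked-le nil f = z≤n
  linked-le (cons _ l) f = f (here refl)

  -- One of the two adjacency structures, given the end point that indexes it.
  module Extend (end : ℕ → ℕ) {k : ℕ} {first next : ℕ → ℕ} {lists : ℕ → List ℕ}
    (v<N : end (suc k) < N)
    (linked : ∀ x → Linked next (first x) (lists x))
    (ok : ∀ {x e} → e ∈ lists x → (0 < e × e ≤ k) × end e ≡ x)
    (complete : ∀ {e} → 0 < e → e ≤ k → e ∈ lists (end e))
    (total : sumTo (λ x → length (lists x)) N ≡ k) where

    v : ℕ
    v = end (suc k)

    first₁ next₁ : ℕ → ℕ
    next₁ = update next (suc k) (first v)
    first₁ = update first v (suc k)

    lists₁ : ℕ → List ℕ
    lists₁ = update lists v (suc k ∷ lists v)

    short : ∀ x → All (_≢ suc k) (lists x)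
    short x = All.tabulate (λ e∈ eq → <⇒≱ ≤-refl (subst (_≤ k) eq (proj₂ (proj₁ (ok e∈)))))

    linked₁ : ∀ x → Linked next₁ (first₁ x) (lists₁ x)
    linked₁ x with x ≟ v
    ... | yes refl = subst₂ (Linked next₁) (sym (update-same first x (suc k))) (sym (update-same lists x (suc k ∷ lists x)))
      (cons (λ ()) (subst (λ p → Linked next₁ p (lists x)) (sym (update-same next (suc k) (first x)))
        (linked-update (linked x) (short x))))
    ... | no ne = subst₂ (Linked next₁) (sym (update-other first v (suc k) ne)) (sym (update-other lists v (suc k ∷ lists v) ne))
      (linked-update (linked x) (short x))

    ok₁ : ∀ {x e} → e ∈ lists₁ x → (0 < e × e ≤ suc k) × end e ≡ x
    ok₁ {x} {e} = update-if lists v (suc k ∷ lists v) x (λ es → e ∈ es → (0 < e × e ≤ suc k) × end e ≡ x)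
      (λ { refl (here refl) → (s≤s z≤n , ≤-refl) , refl ; refl (there e∈) → grow (ok e∈) }) (λ _ e∈ → grow (ok e∈))
      where
      grow : ∀ {x e} → (0 < e × e ≤ k) × end e ≡ x → (0 < e × e ≤ suc k) × end e ≡ x
      grow ((p , q) , eq) = (p , m≤n⇒m≤1+n q) , eq

    complete₁ : ∀ {e} → 0 < e → e ≤ suc k → e ∈ lists₁ (end e)
    complete₁ {e} pos le with e ≟ suc k
    ... | yes refl = subst (e ∈_) (sym (update-same lists v (suc k ∷ lists v))) (here refl)
    ... | no ne = update-if lists v (suc k ∷ lists v) (end e) (e ∈_)
      (λ eq → there (subst (λ y → e ∈ lists y) eq old-in)) (λ _ → old-in)
      where
      old-in : e ∈ lists (end e)
      old-in = complete pos (≤-pred (≤∧≢⇒< le ne))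

    total₁ : sumTo (λ x → length (lists₁ x)) N ≡ suc k
    total₁ = trans (sym (sum-drop {λ x → length (lists₁ x)} {λ x → length (lists x)} {1} N v v<N
        (λ x ne → cong length (sym (update-other lists v (suc k ∷ lists v) ne)))
        (trans (cong length (update-same lists v (suc k ∷ lists v))) (+-comm 1 _))))
      (trans (+-comm _ 1) (cong suc total))

  build-step : ∀ g s → BuildInv g s → regs s 1 ∸ regs s 15 ≢ 0 →
    Exec W (λ s′ → ∃[ g′ ] (BuildInv g′ s′ × M ∸ regs s′ 15 < M ∸ regs s 15)) buildBody s
  build-step (cur , inn) s i ne =
    assign⨾ (a-tl k) (node-fit (tl<N arc)) $
    assign⨾ (a-hd k) (node-fit (hd<N arc)) $
    store⨾ (+-comm k 1) refl (arc-fit k<M) (arc-fit (linked-le (l-cur (tl (suc k)))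
      (λ e∈ → ≤-trans (proj₂ (proj₁ (cur-ok e∈))) k≤M))) $
    store⨾ (+-comm k 1) refl (arc-fit k<M) (arc-fit (linked-le (l-inn (hd (suc k)))
      (λ e∈ → ≤-trans (proj₂ (proj₁ (inn-ok e∈))) k≤M))) $
    assign⨾ (+-comm k 1) (arc-fit k<M) $
    store⨾ refl refl (node-fit (tl<N arc)) (arc-fit k<M) $
    store⨾ refl refl (node-fit (hd<N arc)) (arc-fit k<M) $
    store refl refl (node-fit (hd<N arc)) (arc-fit k<M) $
    (C.lists₁ , I.lists₁) , record
      { quiet = quiet ; k≤M = k<M
      ; adj = record { l-cur = C.linked₁ ; l-inn = I.linked₁ ; cur-ok = C.ok₁ ; inn-ok = I.ok₁
                     ; all-cur = C.complete₁ ; all-inn = I.complete₁ ; n-cur = C.total₁ ; n-inn = I.total₁ }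
      ; copy = copied
      ; r17-0 = r17-0 ; r18-0 = r18-0 ; r19-0 = r19-0 ; a11-0 = a11-0 ; a18-0 = a18-0 } ,
      ∸-monoʳ-< ≤-refl k<M
    where
    open BuildInv i
    open Untouched quiet
    open Adjacency adj
    k : ℕ
    k = regs s 15
    k<M : k < M
    k<M = subst (k <_) r-M (monus-pos ne)
    arc : Arc (suc k)
    arc = s≤s z≤n , k<M
    module C = Extend tl (tl<N arc) l-cur cur-ok all-cur n-cur
    module I = Extend hd (hd<N arc) l-inn inn-ok all-inn n-inn
    copied : ∀ x → update (arrays s 19) (hd (suc k)) (suc k) x ≡ update (arrays s 8) (hd (suc k)) (suc k) x
    copied x with x ≟ hd (suc k)
    ... | yes refl = trans (update-same (arrays s 19) x (suc k)) (sym (update-same (arrays s 8) x (suc k)))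
    ... | no ne = trans (update-other (arrays s 19) (hd (suc k)) (suc k) ne)
                    (trans (copy x) (sym (update-other (arrays s 8) (hd (suc k)) (suc k) ne)))

  data Grounded : List ℕ → Set where
    ground : Grounded (t ∷ [])
    _∷_    : ∀ {x xs} → x ≢ t × x < N → Grounded xs → Grounded (x ∷ xs)

  unseen : (ℕ → ℕ) → ℕ → ℕ
  unseen seen x = 1 ∸ seen x

  record Order : Set where
    constructor order
    field
      T    : List ℕ
      rest : ℕ → List ℕ
      D    : List ℕ

  -- Topological numbering by depth-first search

  module Numbering (cur inn : ℕ → List ℕ) where

    -- `T` is the search stack, `rest` holds the arcs still to be scanned, and `D` is the future
    -- stack of the first cleaning. The search goes against the arcs, so a node of `T` reaches all
    -- nodes below it.
    record OrderInv (r5 r17 r18 r19 : ℕ) (a6 a7 a8 a9 seen a15 key a19 a20 : ℕ → ℕ)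
                    (T : List ℕ) (rest : ℕ → List ℕ) (D : List ℕ) : Set where
      field
        adj     : Adjacency M a6 a7 a8 a9 cur inn
        i≤N     : r17 ≤ N
        h-T     : r18 ≡ length T
        s-T     : Stack a20 T
        h-D     : r5 ≡ length D
        s-D     : Stack a15 D
        l-rest  : ∀ x → Linked a9 (a19 x) (rest x)
        rest-ok : ∀ {x e} → e ∈ rest x → Arc e × hd e ≡ x
        seen-≤  : ∀ x → seen x ≤ 1
        seen-N  : ∀ {x} → seen x ≢ 0 → x < N
        roots   : ∀ {x} → x < r17 → seen x ≢ 0
        T-seen  : ∀ {x} → x ∈ T → seen x ≢ 0
        T-new   : ∀ {x} → x ∈ T → key x ≡ 0
        T-uniq  : AllPairs _≢_ T
        T-path  : AllPairs (Reaches Arc tl hd) T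
        keyed   : ∀ {x} → key x ≢ 0 → seen x ≢ 0
        settled : ∀ {x} → seen x ≢ 0 → x ∈ T ⊎ key x ≢ 0
        earlier : ∀ {e} → Arc e → key (hd e) ≢ 0 → key (tl e) ≢ 0 × key (tl e) < key (hd e)
        scanned : ∀ {e} → Arc e → e ∈ rest (hd e) ⊎ seen (tl e) ≢ 0
        key-≤   : ∀ x → key x ≤ r19
        key-inj : ∀ {x y} → key x ≢ 0 → key x ≡ key y → x ≡ y
        D-ok    : Grounded D
        D-all   : ∀ {x} → key x ≢ 0 → x ≢ t → x ∈ D
        D-len   : length D ≤ suc r19
        counted : r19 + (length T + sumTo (unseen seen) N) ≡ N

    record Ordered (g : Order) (s : State) : Set where
      open Order g
      field
        quiet : Quiet s
        inv   : OrderInv (regs s 5) (regs s 17) (regs s 18) (regs s 19) (arrays s 6) (arrays s 7) (arrays s 8)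
                  (arrays s 9) (arrays s 11) (arrays s 15) (arrays s 18) (arrays s 19) (arrays s 20) T rest D

    -- An unseen node counts 2: one unit for its place on the search stack, one for the step that
    -- puts it there.
    left-over : Order → State → ℕ
    left-over g s = (N ∸ regs s 17) +
      (sumTo (λ x → length (rest x)) N + (length T + 2 * sumTo (unseen (arrays s 11)) N))
      where open Order g

    Post : Order → State → State → Set
    Post g s s′ = ∃[ g′ ] (Ordered g′ s′ × left-over g′ s′ < left-over g s)

    unseen-drop : ∀ {seen u} → u < N → seen u ≡ 0 →
      sumTo (unseen (update seen u 1)) N + 1 ≡ sumTo (unseen seen) N
    unseen-drop {seen} {u} u<N new = sum-drop N u u<N
      (λ x ne → cong (1 ∸_) (update-other seen u 1 ne))
      (trans (cong (1 ∸_) new) (cong (λ k → 1 ∸ k + 1) (sym (update-same seen u 1))))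

    -- The parameters `r17′` and `rest′` cover both ways to find a node, as a new start and as the
    -- tail of a scanned arc.
    enter : ∀ {r5 r17 r18 r19 a6 a7 a8 a9 seen a15 key a19 a20 T rest D} →
      OrderInv r5 r17 r18 r19 a6 a7 a8 a9 seen a15 key a19 a20 T rest D →
      ∀ {u r17′ a19′ rest′} → u < N → seen u ≡ 0 → r17′ ≤ N →
      (∀ {x} → x < r17′ → x ≡ u ⊎ seen x ≢ 0) → (∀ {x} → x ∈ T → Reaches Arc tl hd u x) →
      (∀ x → Linked a9 (a19′ x) (rest′ x)) → (∀ {x e} → e ∈ rest′ x → e ∈ rest x) →
      (∀ {e} → Arc e → e ∈ rest′ (hd e) ⊎ tl e ≡ u ⊎ seen (tl e) ≢ 0) →
      OrderInv r5 r17′ (suc (length T)) r19 a6 a7 a8 a9 (update seen u 1) a15 key a19′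
               (update a20 (length T) u) (u ∷ T) rest′ D
    enter {r19 = r19} {seen = seen} {key = key} {T = T} i {u} u<N new r17≤ rts reach l′ sub sc = record
      { adj = adj ; i≤N = r17≤ ; h-T = refl ; s-T = stack-push u s-T ; h-D = h-D ; s-D = s-D
      ; l-rest = l′ ; rest-ok = λ e∈ → rest-ok (sub e∈)
      ; seen-≤ = λ x → update-if seen u 1 x (_≤ 1) (λ _ → ≤-refl) (λ _ → seen-≤ x)
      ; seen-N = λ {x} → update-if seen u 1 x (λ k → k ≢ 0 → x < N) (λ { refl _ → u<N }) (λ _ → seen-N)
      ; roots = λ lt → [ (λ { refl → seen-u }) , grow ]′ (rts lt)
      ; T-seen = λ { (here refl) → seen-u ; (there x∈) → grow (T-seen x∈) }
      ; T-new = λ { (here refl) → key-u ; (there x∈) → T-new x∈ }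
      ; T-uniq = All.tabulate (λ { x∈ refl → T-seen x∈ new }) ∷ T-uniq
      ; T-path = All.tabulate (λ x∈ → reach x∈) ∷ T-path
      ; keyed = λ nz → grow (keyed nz)
      ; settled = λ {x} → update-if seen u 1 x (λ k → k ≢ 0 → x ∈ u ∷ T ⊎ key x ≢ 0)
          (λ eq _ → inj₁ (here eq)) (λ _ s → [ inj₁ ∘ there , inj₂ ]′ (settled s))
      ; earlier = earlier
      ; scanned = λ arc → [ inj₁ , inj₂ ∘ [ (λ eq → subst (λ y → update seen u 1 y ≢ 0) (sym eq) seen-u) , grow ]′ ]′ (sc arc)
      ; key-≤ = key-≤ ; key-inj = key-inj ; D-ok = D-ok ; D-all = D-all ; D-len = D-len
      ; counted = trans (cong (r19 +_) (trans (sym (+-suc (length T) _))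
          (cong (length T +_) (trans (+-comm 1 _) (unseen-drop u<N new))))) counted }
      where
      open OrderInv i
      grow : ∀ {x} → seen x ≢ 0 → update seen u 1 x ≢ 0
      grow {x} ne = update-if seen u 1 x (_≢ 0) (λ _ ()) (λ _ → ne)
      seen-u : update seen u 1 u ≢ 0
      seen-u z = contradiction (trans (sym (update-same seen u 1)) z) λ()
      key-u : key u ≡ 0
      key-u with key u ≟ 0
      ... | yes z = z
      ... | no nz = ⊥-elim (keyed nz new)

    -- With `rest x` empty, the tails of all arcs into `x` have been seen. One still on the search
    -- stack would close a cycle by `T-path`; so all of them have keys, and these are smaller than
    -- the new one.
    leave : ∀ {r5 r17 r18 r19 a6 a7 a8 a9 seen a15 key a19 a20 x T rest D} →
      OrderInv r5 r17 r18 r19 a6 a7 a8 a9 seen a15 key a19 a20 (x ∷ T) rest D → rest x ≡ [] →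
      ∀ {r5′ a15′ D′} → r5′ ≡ length D′ → Stack a15′ D′ → Grounded D′ → length D′ ≤ suc (suc r19) →
      (∀ {y} → y ∈ D → y ∈ D′) → (x ≢ t → x ∈ D′) →
      OrderInv r5′ r17 (length T) (suc r19) a6 a7 a8 a9 seen a15′ (update key x (suc r19)) a19 a20 T rest D′
    leave {r19 = r19} {seen = seen} {key = key} {x = x} {T} {rest} {D} i ex {D′ = D′} hD sD okD lenD sub new = record
      { adj = adj ; i≤N = i≤N ; h-T = refl ; s-T = stack-tail s-T ; h-D = hD ; s-D = sD
      ; l-rest = l-rest ; rest-ok = rest-ok ; seen-≤ = seen-≤ ; seen-N = seen-N ; roots = roots
      ; T-seen = λ y∈ → T-seen (there y∈)
      ; T-new = λ y∈ → trans (update-other key x (suc r19) (apart y∈)) (T-new (there y∈))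
      ; T-uniq = drop T-uniq ; T-path = drop T-path
      ; keyed = λ {y} → update-if key x (suc r19) y (λ k → k ≢ 0 → seen y ≢ 0)
          (λ { refl _ → T-seen (here refl) }) (λ _ → keyed)
      ; settled = settled′
      ; earlier = earlier′
      ; scanned = scanned
      ; key-≤ = λ y → update-if key x (suc r19) y (_≤ suc r19) (λ _ → ≤-refl) (λ _ → m≤n⇒m≤1+n (key-≤ y))
      ; key-inj = inj
      ; D-ok = okD
      ; D-all = λ {y} → update-if key x (suc r19) y (λ k → k ≢ 0 → y ≢ t → y ∈ D′)
          (λ { refl _ → new }) (λ _ nz y≢t → sub (D-all nz y≢t))
      ; D-len = lenD
      ; counted = trans (sym (+-suc r19 _)) counted }
      where
      open OrderInv i
      drop : ∀ {R : ℕ → ℕ → Set} {y ys} → AllPairs R (y ∷ ys) → AllPairs R ys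
      drop (_ ∷ ps) = ps
      heads : ∀ {R : ℕ → ℕ → Set} {y ys} → AllPairs R (y ∷ ys) → All (R y) ys
      heads (al ∷ _) = al
      apart : ∀ {y} → y ∈ T → y ≢ x
      apart y∈ eq = All.lookup (heads T-uniq) y∈ (sym eq)
      key₁ : ℕ → ℕ
      key₁ = update key x (suc r19)
      here-key : key₁ x ≡ suc r19
      here-key = update-same key x (suc r19)
      up : ∀ {y} → key y ≢ 0 → key₁ y ≢ 0
      up {y} nz = update-if key x (suc r19) y (_≢ 0) (λ _ ()) (λ _ → nz)
      x-new : key x ≡ 0
      x-new = T-new (here refl)
      settled′ : ∀ {y} → seen y ≢ 0 → y ∈ T ⊎ key₁ y ≢ 0
      settled′ s with settled s
      ... | inj₁ (here refl) = inj₂ (λ z → contradiction (trans (sym here-key) z) λ())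
      ... | inj₁ (there y∈)  = inj₁ y∈
      ... | inj₂ nz          = inj₂ (up nz)
      tails-keyed : ∀ {e} → Arc e → hd e ≡ x → key (tl e) ≢ 0
      tails-keyed {e} arc refl with scanned arc
      ... | inj₁ e∈ = contradiction (subst (e ∈_) ex e∈) λ()
      ... | inj₂ s with settled s
      ...   | inj₂ nz = nz
      ...   | inj₁ (here eq) = ⊥-elim (acyclic arc (subst (Reaches Arc tl hd (hd e)) (sym eq) here))
      ...   | inj₁ (there u∈) = ⊥-elim (acyclic arc (All.lookup (heads T-path) u∈))
      earlier′ : ∀ {e} → Arc e → key₁ (hd e) ≢ 0 → key₁ (tl e) ≢ 0 × key₁ (tl e) < key₁ (hd e)
      earlier′ {e} arc nz with hd e ≟ x
      ... | yes h≡x = up kt , subst₂ _<_ (sym (update-other key x (suc r19) t≢x)) (sym (trans (cong key₁ h≡x) here-key))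
                        (s≤s (key-≤ (tl e)))
        where
        kt : key (tl e) ≢ 0
        kt = tails-keyed arc h≡x
        t≢x : tl e ≢ x
        t≢x eq = kt (trans (cong key eq) x-new)
      ... | no h≢x with earlier arc (λ z → nz (trans (update-other key x (suc r19) h≢x) z))
      ...   | kt , lt = up kt , subst₂ _<_ (sym (update-other key x (suc r19) (λ eq → kt (trans (cong key eq) x-new))))
                (sym (update-other key x (suc r19) h≢x)) lt
      inj : ∀ {y z} → key₁ y ≢ 0 → key₁ y ≡ key₁ z → y ≡ z
      inj {y} {z} nz eq with y ≟ x | z ≟ x
      ... | yes refl | yes refl = refl
      ... | yes refl | no z≢x = contradiction (trans (sym here-key) (trans eq (update-other key x (suc r19) z≢x)))
                                  (λ q → <⇒≱ ≤-refl (subst (_≤ r19) (sym q) (key-≤ z)))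
      ... | no y≢x | yes refl = contradiction (trans (sym (update-other key x (suc r19) y≢x)) (trans eq here-key))
                                  (λ q → <⇒≱ ≤-refl (subst (_≤ r19) q (key-≤ y)))
      ... | no y≢x | no z≢x = key-inj (λ q → nz (trans (update-other key x (suc r19) y≢x) q))
                                (trans (sym (update-other key x (suc r19) y≢x)) (trans eq (update-other key x (suc r19) z≢x)))

    module OrderStep {T rest D s} (i : Ordered (order T rest D) s) where
      open Ordered i
      open OrderInv inv
      open Untouched quiet
      open Adjacency adj using (l-cur)

      g₀ : Order
      g₀ = order T rest D

      small : ∀ {k} → k ≤ suc N → k < W
      small le = fits (≤-trans le (s≤s N≤B))

      T-≤ : length T ≤ N
      T-≤ = ≤-trans (m≤m+n (length T) _) (≤-trans (m≤n+m _ (regs s 19)) (≤-reflexive counted))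

    next-root : ∀ {rest D s} → Ordered (order [] rest D) s → regs s 17 < N →
      Exec W (Post (order [] rest D) s) orderBody s
    next-root {rest} {D} {s} i lt = no-branch h-T (branch known unknown)
      where
      open Ordered i
      open OrderInv inv
      open OrderStep i using (small)
      r : ℕ
      r = regs s 17
      lower : ∀ {A A′} → A′ ≤ A → (N ∸ suc r) + A′ < (N ∸ r) + A
      lower le = +-mono-<-≤ (∸-monoʳ-< ≤-refl lt) le
      known : arrays s 11 r ≢ 0 → Exec W (Post (order [] rest D) s) (inc 17) s
      known ne = assign (+-comm r 1) (small (m≤n⇒m≤1+n lt))
        (order [] rest D , record { quiet = quiet ; inv = record
          { adj = adj ; i≤N = lt ; h-T = h-T ; s-T = s-T ; h-D = h-D ; s-D = s-D ; l-rest = l-rest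
          ; rest-ok = rest-ok ; seen-≤ = seen-≤ ; seen-N = seen-N
          ; roots = λ {x} x< → further x x<
          ; T-seen = T-seen ; T-new = T-new ; T-uniq = T-uniq ; T-path = T-path ; keyed = keyed
          ; settled = settled ; earlier = earlier ; scanned = scanned ; key-≤ = key-≤ ; key-inj = key-inj
          ; D-ok = D-ok ; D-all = D-all ; D-len = D-len ; counted = counted } } , lower ≤-refl)
        where
        further : ∀ x → x < suc r → arrays s 11 x ≢ 0
        further x x< with x ≟ r
        ... | yes refl = ne
        ... | no x≢r = roots (≤∧≢⇒< (≤-pred x<) x≢r)
      unknown : arrays s 11 r ≡ 0 → Exec W (Post (order [] rest D) s)
        (11 [ reg 17 ]≔ const 1 ⨾ 20 [ const 0 ]≔ reg 17 ⨾ 18 ≔ const 1 ⨾ inc 17) s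
      unknown z =
        store⨾ refl refl (node-fit lt) (const-fit (s≤s z≤n)) $
        store⨾ refl refl (const-fit z≤n) (node-fit lt) $
        assign⨾ refl (const-fit (s≤s z≤n)) $
        assign (+-comm r 1) (small (m≤n⇒m≤1+n lt)) $
        order (r ∷ []) rest D , record { quiet = quiet ; inv = enter inv lt z lt before (λ ()) l-rest (λ e∈ → e∈)
            (λ arc → [ inj₁ , inj₂ ∘ inj₂ ]′ (scanned arc)) } ,
          lower (+-monoʳ-≤ (sumTo (λ x → length (rest x)) N) (≤-trans (n≤1+n _) (≤-reflexive
            (trans (solve 1 (λ u → con 2 :+ con 2 :* u := con 2 :* (u :+ con 1)) refl
                      (sumTo (unseen (update (arrays s 11) r 1)) N))
                   (cong (2 *_) (unseen-drop lt z))))))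
        where
        before : ∀ {x} → x < suc r → x ≡ r ⊎ arrays s 11 x ≢ 0
        before {x} x< with x ≟ r
        ... | yes eq = inj₁ eq
        ... | no x≢r = inj₂ (roots (≤∧≢⇒< (≤-pred x<) x≢r))

    scan-arc : ∀ {x T rest D s e es} → Ordered (order (x ∷ T) rest D) s → rest x ≡ e ∷ es →
      Exec W (Post (order (x ∷ T) rest D) s) orderBody s
    scan-arc {x} {T} {rest} {D} {s} {e} {es} i eqr = yes-branch (0≢suc h-T) $
      assign⨾ (trans (cong (arrays s 20) (one-less h-T)) (stack-top s-T)) (node-fit x<N) $
      assign⨾ (proj₁ link) (arc-fit (proj₂ arc)) $
      yes-branch (proj₁ (proj₂ link)) $
      store⨾ refl refl (node-fit x<N) (arc-fit (linked-le (proj₂ (proj₂ link))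
        (λ f∈ → proj₂ (proj₁ (rest-ok (subst (_ ∈_) (sym eqr) (there f∈))))))) $
      assign⨾ (tail≡ (proj₁ (proj₂ link))) (node-fit (tl<N arc)) $
      branch known unknown
      where
      open Ordered i
      open OrderInv inv
      open Untouched quiet
      open OrderStep i using (small; T-≤)
      link = linked-cons (l-rest x) eqr
      x<N : x < N
      x<N = seen-N (T-seen (here refl))
      arc : Arc e
      arc = proj₁ (rest-ok (subst (e ∈_) (sym eqr) (here refl)))
      h≡x : hd e ≡ x
      h≡x = proj₂ (rest-ok (subst (e ∈_) (sym eqr) (here refl)))
      tail≡ : ∀ {c} → c ≢ 0 → arrays s 0 (c ∸ 1) ≡ tl c
      tail≡ {zero}  nz = ⊥-elim (nz refl)
      tail≡ {suc c} nz = a-tl c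
      u : ℕ
      u = tl e
      s₁ : State
      s₁ = setReg (setCell (setReg (setReg s 14 x) 15 e) 19 x (arrays s 9 e)) 16 u
      rest₁ : ℕ → List ℕ
      rest₁ = update rest x es
      l₁ : ∀ y → Linked (arrays s 9) (update (arrays s 19) x (arrays s 9 e) y) (rest₁ y)
      l₁ y with y ≟ x
      ... | yes refl = subst₂ (Linked (arrays s 9)) (sym (update-same (arrays s 19) y (arrays s 9 e)))
                         (sym (update-same rest y es)) (proj₂ (proj₂ link))
      ... | no ne = subst₂ (Linked (arrays s 9)) (sym (update-other (arrays s 19) x (arrays s 9 e) ne))
                      (sym (update-other rest x es ne)) (l-rest y)
      sub : ∀ {y f} → f ∈ rest₁ y → f ∈ rest y
      sub {y} {f} = update-if rest x es y (λ fs → f ∈ fs → f ∈ rest y)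
        (λ { refl f∈ → subst (f ∈_) (sym eqr) (there f∈) }) (λ _ f∈ → f∈)
      sc : ∀ {f} → Arc f → f ∈ rest₁ (hd f) ⊎ tl f ≡ u ⊎ arrays s 11 (tl f) ≢ 0
      sc {f} arcf with scanned arcf
      ... | inj₂ s = inj₂ (inj₂ s)
      ... | inj₁ f∈ with hd f ≟ x
      ...   | no ne = inj₁ (subst (f ∈_) (sym (update-other rest x es ne)) f∈)
      ...   | yes hx with subst (f ∈_) (trans (cong rest hx) eqr) f∈
      ...     | here refl = inj₂ (inj₁ refl)
      ...     | there f∈′ = inj₁ (subst (f ∈_) (sym (trans (cong rest₁ hx) (update-same rest x es))) f∈′)
      rest-sum : sumTo (λ y → length (rest₁ y)) N + 1 ≡ sumTo (λ y → length (rest y)) N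
      rest-sum = sum-drop N x x<N (λ y ne → cong length (update-other rest x es ne))
        (trans (cong length eqr) (trans (+-comm 1 _) (cong (λ k → length k + 1) (sym (update-same rest x es)))))
      known : arrays s 11 u ≢ 0 → Exec W (Post (order (x ∷ T) rest D) s) skip s₁
      known ne = done (order (x ∷ T) rest₁ D , record { quiet = quiet ; inv = record
          { adj = adj ; i≤N = i≤N ; h-T = h-T ; s-T = s-T ; h-D = h-D ; s-D = s-D ; l-rest = l₁
          ; rest-ok = λ f∈ → rest-ok (sub f∈) ; seen-≤ = seen-≤ ; seen-N = seen-N ; roots = roots
          ; T-seen = T-seen ; T-new = T-new ; T-uniq = T-uniq ; T-path = T-path ; keyed = keyed
          ; settled = settled ; earlier = earlier
          ; scanned = λ arcf → [ inj₁ , inj₂ ∘ [ (λ eq → subst (λ y → arrays s 11 y ≢ 0) (sym eq) ne) , (λ z → z) ]′ ]′ (sc arcf)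
          ; key-≤ = key-≤ ; key-inj = key-inj ; D-ok = D-ok ; D-all = D-all ; D-len = D-len ; counted = counted } } ,
        +-monoʳ-< (N ∸ regs s 17) (+-monoˡ-< _ (≤-reflexive (trans (+-comm 1 _) rest-sum))))
      unknown : arrays s 11 u ≡ 0 →
        Exec W (Post (order (x ∷ T) rest D) s) (11 [ reg 16 ]≔ const 1 ⨾ 20 [ reg 18 ]≔ reg 16 ⨾ inc 18) s₁
      unknown z =
        store⨾ refl refl (node-fit (tl<N arc)) (const-fit (s≤s z≤n)) $
        store⨾ h-T refl (small (m≤n⇒m≤1+n T-≤)) (node-fit (tl<N arc)) $
        assign (length-suc _ h-T) (small (s≤s T-≤)) $
        order (u ∷ x ∷ T) rest₁ D , record { quiet = quiet
          ; inv = enter inv (tl<N arc) z i≤N (λ lt → inj₂ (roots lt)) up l₁ sub sc } ,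
        +-monoʳ-< (N ∸ regs s 17) (+-mono-<-≤ (≤-reflexive (trans (+-comm 1 _) rest-sum))
          (≤-trans (≤-trans (n≤1+n _) (≤-reflexive (solve 2 (λ l w → con 2 :+ (l :+ con 2 :* w) := l :+ con 2 :* (w :+ con 1)) refl
              (suc (length T)) (sumTo (unseen (update (arrays s 11) u 1)) N))))
            (≤-reflexive (cong (λ w → suc (length T) + 2 * w) (unseen-drop (tl<N arc) z)))))
        where
        up : ∀ {y} → y ∈ x ∷ T → Reaches Arc tl hd u y
        up y∈ = step arc (subst (λ h → Reaches Arc tl hd h _) (sym h≡x) (from-top y∈))
          where
          heads : ∀ {R : ℕ → ℕ → Set} {y ys} → AllPairs R (y ∷ ys) → All (R y) ys
          heads (al ∷ _) = al
          from-top : ∀ {y} → y ∈ x ∷ T → Reaches Arc tl hd x y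
          from-top (here refl) = here
          from-top (there y∈) = All.lookup (heads T-path) y∈

    leave-top : ∀ {x T rest D s} → Ordered (order (x ∷ T) rest D) s → rest x ≡ [] →
      Exec W (Post (order (x ∷ T) rest D) s) orderBody s
    leave-top {x} {T} {rest} {D} {s} i ex = yes-branch (0≢suc h-T) $
      assign⨾ (trans (cong (arrays s 20) (one-less h-T)) (stack-top s-T)) (node-fit x<N) $
      assign⨾ (linked-nil (l-rest x) ex) (const-fit z≤n) $
      no-branch refl $
      assign⨾ (one-less h-T) (small (≤-trans (n≤1+n _) (m≤n⇒m≤1+n T-≤))) $
      assign⨾ (+-comm (regs s 19) 1) (small (m≤n⇒m≤1+n k<N)) $
      store⨾ refl refl (node-fit x<N) (small (m≤n⇒m≤1+n k<N)) $
      branch other sink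
      where
      open Ordered i
      open OrderInv inv
      open Untouched quiet
      open OrderStep i using (small; T-≤)
      x<N : x < N
      x<N = seen-N (T-seen (here refl))
      k<N : suc (regs s 19) ≤ N
      k<N = ≤-trans (≤-reflexive (+-comm 1 _)) (≤-trans (+-monoʳ-≤ (regs s 19) (s≤s z≤n)) (≤-reflexive counted))
      s₁ : State
      s₁ = setCell (setReg (setReg (setReg (setReg s 14 x) 15 0) 18 (length T)) 19 (suc (regs s 19))) 18 x (suc (regs s 19))
      lower : (N ∸ regs s 17) + (sumTo (λ y → length (rest y)) N + (length T + 2 * sumTo (unseen (arrays s 11)) N)) <
             left-over (order (x ∷ T) rest D) s
      lower = +-monoʳ-< (N ∸ regs s 17) (+-monoʳ-< (sumTo (λ y → length (rest y)) N) ≤-refl)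
      other : (x ∸ regs s 2) + (regs s 2 ∸ x) ≢ 0 →
        Exec W (Post (order (x ∷ T) rest D) s) (15 [ reg 5 ]≔ reg 14 ⨾ inc 5) s₁
      other ne =
        store⨾ h-D refl (small (≤-trans D-len (m≤n⇒m≤1+n k<N))) (node-fit x<N) $
        assign (length-suc _ h-D) (small (s≤s (≤-trans D-len k<N))) $
        order T rest (x ∷ D) , record { quiet = quiet
          ; inv = leave inv ex refl (stack-push x s-D) ((x≢t , x<N) ∷ D-ok) (s≤s D-len) there (λ _ → here refl) } , lower
        where
        x≢t : x ≢ t
        x≢t eq = ne (trans (cong₂ (λ v w → (v ∸ w) + (w ∸ v)) eq r-t) (differ-0 t))
      sink : (x ∸ regs s 2) + (regs s 2 ∸ x) ≡ 0 → Exec W (Post (order (x ∷ T) rest D) s) skip s₁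
      sink z = done (order T rest D , record { quiet = quiet
          ; inv = leave inv ex h-D s-D D-ok (m≤n⇒m≤1+n D-len) (λ y∈ → y∈)
              (λ x≢t → ⊥-elim (x≢t (trans (differ-≢ z) r-t))) } , lower)

    order-step : ∀ g s → Ordered g s → (regs s 0 ∸ regs s 17) + regs s 18 ≢ 0 → Exec W (Post g s) orderBody s
    order-step (order [] rest D) s i ne = next-root i (subst (regs s 17 <_) r-N (monus-pos {regs s 0}
        (λ z → ne (trans (cong₂ _+_ z h-T) refl))))
      where
      open Ordered i
      open OrderInv inv
      open Untouched quiet
    order-step (order (x ∷ T) rest D) s i ne = go (rest x) refl
      where
      go : ∀ es → rest x ≡ es → Exec W (Post (order (x ∷ T) rest D) s) orderBody s
      go [] ex = leave-top i ex
      go (e ∷ es) eq = scan-arc i eq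

-- Running time of the complete solver

halts-map : ∀ {W Q R c m n s} → m ≤ n → (∀ {s′} → Q s′ → R s′) → Halts W Q c m s → Halts W R c n s
halts-map le f (k , s′ , r , k≤ , q) = k , s′ , r , ≤-trans k≤ le , f q

record Keys (H : PreGraph) : Set where
  open PreGraph H
  field
    key      : ℕ → ℕ
    key-mono : ∀ {e} → Arc e → tl e ≢ t → key (tl e) < key (hd e)
    key-inj  : ∀ {x y} → x < N → y < N → key x ≡ key y → x ≡ y
    key-t    : ∀ {x} → x < N → x ≢ t → key x < key t

numbered : (H : PreGraph) → Keys H → Graph
numbered H n = record
  { N = N ; M = M ; t = t ; tl = tl ; hd = hd ; key = key ; σ = σ ; Z = Z
  ; t<N = t<N ; tl<N = tl<N ; hd<N = hd<N ; key-mono = key-mono ; key-inj = key-inj ; key-t = key-t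
  ; Z<N = Z<N ; Z-σ = Z-σ ; σ-invol = σ-invol ; σ-free = σ-free ; t∉Z = t∉Z }
  where
  open PreGraph H
  open Keys n

Solution : Graph → State → Set
Solution G s = ∃[ ps ] (Pairs ps × AllPairs _≢_ (concat ps) × (∀ {z} → Graph.Z G z → ¬ Feasible (Unused ps) z) ×
    output s ≡ map (map pred) ps)
  where open Algorithm G

sum-weights : ∀ (f g h : ℕ → ℕ) N → (∀ x → h x ≤ 1) →
  sumTo (λ x → 3 * f x + (5 * g x + 5 * h x)) N ≤ 3 * sumTo f N + (5 * sumTo g N + 5 * N)
sum-weights f g h zero    h≤ = z≤n
sum-weights f g h (suc N) h≤ = ≤-trans
  (+-mono-≤ (+-monoʳ-≤ (3 * f N) (+-monoʳ-≤ (5 * g N) (*-monoʳ-≤ 5 (h≤ N)))) (sum-weights f g h N h≤))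
  (≤-reflexive (solve 5 (λ a b c d n →
      (con 3 :* a :+ (con 5 :* b :+ con 5 :* con 1)) :+ (con 3 :* c :+ (con 5 :* d :+ con 5 :* n)) :=
      con 3 :* (a :+ c) :+ (con 5 :* (b :+ d) :+ con 5 :* (con 1 :+ n)))
    refl (f N) (g N) (sumTo f N) (sumTo g N) N))

buildCost orderCost mainCost : ℕ
buildCost = suc (cost (reg 1 ⊖ reg 15)) + maxCost buildBody
orderCost = suc (cost ((reg 0 ⊖ reg 17) ⊕ reg 18)) + maxCost orderBody
mainCost  = 2 + maxCost mainBody

-- The factors 2, 4 and 24 turn the iteration bounds of the three loops into multiples of N + M; 5
-- and 10 are the costs of the straight-line pieces between them.
solverCost : ℕ
solverCost = buildCost * 2 + (5 + (orderCost * 4 + (10 + mainCost * 24)))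

module Solver (H : PreGraph) (W : ℕ)
  (fits : ∀ {v} → v ≤ suc (23 * (PreGraph.N H + PreGraph.M H)) → v < W) where
  open PreGraph H

  size-pos : 1 ≤ N + M
  size-pos = ≤-trans (≤-trans (s≤s z≤n) t<N) (m≤m+n N M)

  capacity : Capacity N M
  capacity = record
    -- The initial measure is at most 17 + 6 N + 18 M. As there is a node, 17 is at most 17 N, and
    -- 17 + 6 = 23.
    { B = 23 * (N + M) ; W = W ; fits = fits
    ; N≤B = ≤-trans (m≤m+n N M) enough
    ; M≤B = ≤-trans (m≤n+m M N) enough
    ; 4≤B = ≤-trans (≤ᵇ⇒≤ 4 23 _) (*-monoʳ-≤ 23 size-pos) }
    where
    enough : N + M ≤ 23 * (N + M)
    enough = m≤m+n (N + M) _

  open Capacity capacity using (B; N≤B)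
  open Preparation H capacity

  begin-order : ∀ {cur inn s} → BuildInv (cur , inn) s → regs s 1 ∸ regs s 15 ≡ 0 →
    Numbering.Ordered cur inn (order [] inn (t ∷ [])) (setReg (setCell s 15 0 t) 5 1)
  begin-order {cur} {inn} {s} i z = record
    { quiet = record { Untouched quiet }
    ; inv = record
      { adj = subst (λ k → Adjacency k (arrays s 6) (arrays s 7) (arrays s 8) (arrays s 9) cur inn) k≡M adj
      ; i≤N = ≤-trans (≤-reflexive r17-0) z≤n
      ; h-T = r18-0 ; s-T = [] ; h-D = refl ; s-D = stack-push t []
      ; l-rest = λ x → subst (λ p → Linked (arrays s 9) p (inn x)) (sym (copy x)) (Adjacency.l-inn adj x)
      ; rest-ok = λ e∈ → let (p , le) , h = Adjacency.inn-ok adj e∈ in (p , ≤-trans le k≤M) , h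
      ; seen-≤ = λ x → ≤-trans (≤-reflexive (a11-0 x)) z≤n
      ; seen-N = λ {x} nz → ⊥-elim (nz (a11-0 x))
      ; roots = λ {x} x< → contradiction (subst (x <_) r17-0 x<) λ()
      ; T-seen = λ () ; T-new = λ () ; T-uniq = [] ; T-path = []
      ; keyed = λ {x} nz → ⊥-elim (nz (a18-0 x))
      ; settled = λ {x} nz → ⊥-elim (nz (a11-0 x))
      ; earlier = λ {e} _ nz → ⊥-elim (nz (a18-0 (hd e)))
      ; scanned = λ {e} (p , le) → inj₁ (Adjacency.all-inn adj p (≤-trans le (≤-reflexive (sym k≡M))))
      ; key-≤ = λ x → ≤-trans (≤-reflexive (a18-0 x)) z≤n
      ; key-inj = λ {x} nz _ → ⊥-elim (nz (a18-0 x))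
      ; D-ok = ground
      ; D-all = λ {x} nz → ⊥-elim (nz (a18-0 x))
      ; D-len = s≤s z≤n
      ; counted = cong₂ _+_ r19-0 all-unseen } }
    where
    open BuildInv i
    k≡M : regs s 15 ≡ M
    k≡M = ≤-antisym k≤M (m∸n≡0⇒m≤n (subst (λ m → m ∸ regs s 15 ≡ 0) (Untouched.r-M quiet) z))
    all-unseen : sumTo (unseen (arrays s 11)) N ≡ N
    all-unseen = trans (sumTo-cong N (λ x _ → cong (1 ∸_) (a11-0 x))) (trans (sumTo-const 1 N) (*-identityʳ N))

  order-size : ∀ {cur inn s} → Numbering.Ordered cur inn (order [] inn (t ∷ [])) s →
    Numbering.left-over cur inn (order [] inn (t ∷ [])) s ≤ N + (M + 2 * N)
  order-size {cur} {inn} {s} i = +-mono-≤ (m∸n≤m N (regs s 17)) (+-mono-≤ (≤-reflexive (Adjacency.n-inn adj))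
    (*-monoʳ-≤ 2 (≤-trans (m≤n+m _ (regs s 19)) (≤-reflexive counted))))
    where
    open Numbering cur inn
    open Ordered i
    open OrderInv inv

  module Start {cur inn : ℕ → List ℕ} {T rest D s} (i : Numbering.Ordered cur inn (order T rest D) s)
    (z : (regs s 0 ∸ regs s 17) + regs s 18 ≡ 0) where
    open Numbering cur inn
    open Ordered i
    open OrderInv inv
    open Untouched quiet
    open Adjacency adj

    r17≡N : regs s 17 ≡ N
    r17≡N = ≤-antisym i≤N (m∸n≡0⇒m≤n (subst (λ n → n ∸ regs s 17 ≡ 0) r-N (m+n≡0⇒m≡0 _ z)))

    T-empty : ∀ {x} → x ∉ T
    T-empty x∈ = empty (trans (sym h-T) (m+n≡0⇒n≡0 (regs s 0 ∸ regs s 17) z)) x∈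
      where
      empty : ∀ {x : ℕ} {xs} → length xs ≡ 0 → x ∉ xs
      empty {xs = []} _ ()

    key₀ : ℕ → ℕ
    key₀ = arrays s 18

    all-keyed : ∀ {x} → x < N → key₀ x ≢ 0
    all-keyed {x} x<N with settled (roots (subst (x <_) (sym r17≡N) x<N))
    ... | inj₁ x∈ = ⊥-elim (T-empty x∈)
    ... | inj₂ nz = nz

    key₁ : ℕ → ℕ
    key₁ = update key₀ t (suc (regs s 19))

    key-top : key₁ t ≡ suc (regs s 19)
    key-top = update-same key₀ t (suc (regs s 19))

    key-below : ∀ {x} → x ≢ t → key₁ x ≡ key₀ x
    key-below ne = update-other key₀ t (suc (regs s 19)) ne

    below-top : ∀ {x} → x ≢ t → key₁ x < key₁ t
    below-top {x} ne = subst₂ _<_ (sym (key-below ne)) (sym key-top) (s≤s (key-≤ x))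

    mono : ∀ {e} → Arc e → tl e ≢ t → key₁ (tl e) < key₁ (hd e)
    mono {e} arc ne with hd e ≟ t
    ... | yes h≡t = subst (λ y → key₁ (tl e) < key₁ y) (sym h≡t) (below-top ne)
    ... | no h≢t = subst₂ _<_ (sym (key-below ne)) (sym (key-below h≢t)) (proj₂ (earlier arc (all-keyed (hd<N arc))))

    inj : ∀ {x y} → x < N → y < N → key₁ x ≡ key₁ y → x ≡ y
    inj {x} {y} x<N y<N eq with x ≟ t | y ≟ t
    ... | yes x≡t | yes y≡t = trans x≡t (sym y≡t)
    ... | yes x≡t | no y≢t = contradiction (trans (cong key₁ (sym x≡t)) eq) (λ q → <⇒≢ (below-top y≢t) (sym q))
    ... | no x≢t | yes y≡t = contradiction (trans eq (cong key₁ y≡t)) (<⇒≢ (below-top x≢t))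
    ... | no x≢t | no y≢t = key-inj (all-keyed x<N) (trans (sym (key-below x≢t)) (trans eq (key-below y≢t)))

    numbering : Keys H
    numbering = record { key = key₁ ; key-mono = mono ; key-inj = inj ; key-t = λ _ → below-top }

    G : Graph
    G = numbered H numbering

    open Algorithm G using (Inv; cleaning; InvK; Based; base; Feasible; Unused; LiveK; Closed;
      Maximal; Route; route-cut; Output; Out; none; measure; _∖_; t∈based)
      renaming (_∷_ to _∷ᵇ_)
    open Algorithm.Simulation G capacity using (main-halts)

    status : ℕ → ℕ
    status = update (arrays s 11) t 2

    status-≤ : ∀ x → status x ≤ 2
    status-≤ x = update-if (arrays s 11) t 2 x (_≤ 2) (λ _ → ≤-refl) (λ _ → m≤n⇒m≤1+n (seen-≤ x))

    status-≢3 : ∀ x → status x ≢ 3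
    status-≢3 x eq = <⇒≱ (≤-refl {3}) (subst (_≤ 2) eq (status-≤ x))

    status-N : ∀ {x} → status x ≢ 0 → x < N
    status-N {x} = update-if (arrays s 11) t 2 x (λ k → k ≢ 0 → x < N) (λ { refl _ → t<N }) (λ _ → seen-N)

    status-pos : ∀ {x} → x < N → status x ≢ 0
    status-pos {x} x<N = update-if (arrays s 11) t 2 x (_≢ 0) (λ _ ()) (λ _ → roots (subst (x <_) (sym r17≡N) x<N))

    based : ∀ {D} → Grounded D → Based D
    based ground  = base
    based (p ∷ g) = p ∷ᵇ based g

    D-full : ∀ {x} → x < N → x ∈ D
    D-full {x} x<N with x ≟ t
    ... | yes refl = t∈based (based D-ok)
    ... | no x≢t = D-all (all-keyed x<N) x≢t

    -- All nodes wait on the stack and none is fresh or dead, so the conditions on fresh and dead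
    -- nodes hold vacuously.
    clean : InvK status (arrays s 12) (arrays s 13) (arrays s 14) (arrays s 10) cur inn D []
    clean = record
      { arcs = record
        { cur-out = cur-ok ; inn-in = inn-ok
        ; av-cur = λ (p , le) _ → all-cur p le
        ; av-inn = λ (p , le) _ _ _ → all-inn p le
        ; st-≤ = λ x → m≤n⇒m≤1+n (status-≤ x) ; st-N = status-N }
      ; t-two = update-same (arrays s 11) t 2
      ; pos-t = a12-0 t
      ; rt-t = trans (a14-0 t) (sym (a13-0 t))
      ; based = based D-ok ; L-ok = []
      ; waiting = λ nz _ → inj₁ (D-full (status-N nz))
      ; dead-cur = λ {x} _ eq → ⊥-elim (status-≢3 x eq)
      ; dead-in = λ {e} _ _ _ _ eq → ⊥-elim (status-≢3 (hd e) eq)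
      ; fresh = λ x<N eq → ⊥-elim (status-pos x<N eq) }

    reaches : ∀ {x es y} → Route x es y → Reaches Arc tl hd x y
    reaches Route.[] = here
    reaches ((arc , refl) Route.∷ r) = step arc (reaches r)

    maximal : Maximal (LiveK status (arrays s 10)) (Unused []) (arrays s 2)
    maximal = record
      { sound = λ ((arc , _) , _) → arc , λ ()
      ; pairs = λ F _ {z} zz (as , bs , p , q , Ra , Rb , dis) → Z-act zz ,
          as , bs , p , q , alive p Ra , alive q Rb , dis }
      where
      alive : ∀ {F x es} → Route x es t → (∀ {e} → e ∈ es → (Unused [] ∖ F) e) →
              ∀ {e} → e ∈ es → (LiveK status (arrays s 10) ∖ F) e
      alive r R {e} e∈ = ((proj₁ (proj₁ (R e∈)) , apart) , status-≢3 (tl e) , a10-0 e) , proj₂ (R e∈)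
        where
        -- On a walk to the sink, an arc out of the sink would close a cycle.
        apart : tl e ≢ t
        apart eq with route-cut r e∈
        ... | _ , _ , _ , _ , r₂ = acyclic (proj₁ (proj₁ (R e∈)))
                (subst (Reaches Arc tl hd (hd e)) (sym eq) (reaches r₂))

    s₁ : State
    s₁ = setReg (setCell (setCell s 11 t 2) 18 t (suc (regs s 19))) 4 1

    g₁ : Ghost
    g₁ = ghost cur inn D [] [] (λ _ → 1) [] [] [] 0

    no-output : ∀ {c p a4 a5} → c ≡ 0 → p ≡ 0 → a4 0 ≡ 0 → Output c p a4 a5 [] []
    no-output refl refl eq = record
      { finished = refl ; bounded = λ { z≤n → ≤-refl } ; current = refl ; position = trans (sym eq) (sym (+-identityʳ _)) }

    all-unwritten : sumTo (λ _ → 1) (suc M) ≡ suc M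
    all-unwritten = trans (sumTo-const 1 (suc M)) (*-identityʳ (suc M))

    small : measure g₁ s₁ ≤ B
    small = ≤-trans (+-mono-≤
        (≤-trans (sum-weights (λ x → length (cur x)) (λ x → length (inn x)) (arrays s 2) N act-1)
          (≤-reflexive (cong₂ (λ m n → 3 * m + (5 * n + 5 * N)) n-cur n-inn)))
        (+-mono-≤ (≤-trans D-len (s≤s last≤)) (≤-reflexive (cong (λ u → 10 * u + 6) all-unwritten))))
      (≤-trans (≤-reflexive (solve 2 (λ n m →
            con 3 :* m :+ (con 5 :* m :+ con 5 :* n) :+ (con 1 :+ n :+ (con 10 :* (con 1 :+ m) :+ con 6)) :=
            con 17 :+ (con 6 :* n :+ con 18 :* m)) refl N M))
        (≤-trans (+-mono-≤ (*-monoʳ-≤ 17 (≤-trans (s≤s z≤n) t<N)) (+-monoʳ-≤ (6 * N) (*-monoˡ-≤ M (≤ᵇ⇒≤ 18 23 _))))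
          (≤-reflexive (solve 2 (λ n m →
            con 17 :* n :+ (con 6 :* n :+ con 23 :* m) := con 23 :* (n :+ m)) refl N M))))
      where
      last≤ : regs s 19 ≤ N
      last≤ = ≤-trans (m≤m+n _ _) (≤-reflexive counted)

    start : Inv B g₁ s₁
    start = record
      { static = record { r-N = r-N ; r-M = r-M ; r-t = r-t ; a-tl = a-tl ; a-hd = a-hd ; a-σ = a-σ ; a-key = λ _ → refl }
      ; stacks = record { h-S = h-D ; h-P = r6-0 ; h-L = r7-0 ; s-S = s-D ; s-P = [] ; s-L = [] }
      ; lists = record { l-cur = l-cur ; l-inn = l-inn }
      ; account = record { act-Z = act-Z ; op-un = cong₂ _+_ r11-0 all-unwritten }
      ; small = small
      ; mode = cleaning refl clean maximal refl
          (record { pairs = none ; distinct = [] ; un-one = λ _ → refl })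
          (no-output r3-0 r11-0 a4-0) (≤-reflexive (trans r3-0 (sym r11-0))) }

    final : Halts W (λ s′ → ∃[ n ] Solution (numbered H n) s′) (while (reg 4) mainBody) (mainCost * suc B) s₁
    final = halts-map (*-monoʳ-≤ mainCost (s≤s small)) (numbering ,_) (main-halts g₁ s₁ start)

    post : Exec W (_≡ s₁) (11 [ reg 2 ]≔ const 2 ⨾ 18 [ reg 2 ]≔ reg 19 ⊕ const 1 ⨾ 4 ≔ const 1) s
    post =
      store⨾ r-t refl (node-fit t<N) (const-fit (≤ᵇ⇒≤ 2 4 _)) $
      store⨾ r-t (+-comm (regs s 19) 1) (node-fit t<N)
        (fits (s≤s (≤-trans (≤-trans (m≤m+n _ _) (≤-reflexive counted)) N≤B))) $
      assign refl (const-fit (s≤s z≤n)) refl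

  solver-cost : ∀ {b o m q r x y z} → x ≤ 2 * (N + M) → y ≤ 4 * (N + M) → z ≤ 24 * (N + M) →
    b * x + (q + (o * y + (r + m * z))) ≤ (b * 2 + (q + (o * 4 + (r + m * 24)))) * (N + M)
  solver-cost {b} {o} {m} {q} {r} x≤ y≤ z≤ = ≤-trans
    (+-mono-≤ (*-monoʳ-≤ b x≤) (+-mono-≤ (times q) (+-mono-≤ (*-monoʳ-≤ o y≤) (+-mono-≤ (times r) (*-monoʳ-≤ m z≤)))))
    (≤-reflexive (solve 6 (λ b q o r m n →
      b :* (con 2 :* n) :+ (q :* n :+ (o :* (con 4 :* n) :+ (r :* n :+ m :* (con 24 :* n)))) :=
      (b :* con 2 :+ (q :+ (o :* con 4 :+ (r :+ m :* con 24)))) :* n) refl b q o r m (N + M)))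
    where
    times : ∀ k → k ≤ k * (N + M)
    times k = ≤-trans (≤-reflexive (sym (*-identityʳ k))) (*-monoʳ-≤ k size-pos)

  solver-halts : ∀ {s} → BuildInv ((λ _ → []) , (λ _ → [])) s →
    Halts W (λ s′ → ∃[ n ] Solution (numbered H n) s′) solver (solverCost * (N + M)) s
  solver-halts {s} i = halts-map
    (solver-cost {buildCost} {orderCost} {mainCost} {5} {10} build≤ order≤ main≤) (λ sol → sol) $
    halts-seq (halts-map (*-monoʳ-≤ buildCost (s≤s (m∸n≤m M (regs s 15)))) (λ q → q)
      (while-halts BuildInv (λ _ s → M ∸ regs s 15) build-step _ s i)) λ { {s₂} ((cur , inn) , i₂ , z₂) →
    halts-seq (exec-halts (pre i₂)) λ { refl →
    halts-seq (halts-map (*-monoʳ-≤ orderCost (s≤s (order-size (begin-order i₂ z₂)))) (λ q → q)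
      (while-halts (Numbering.Ordered cur inn) (Numbering.left-over cur inn) (Numbering.order-step cur inn) _ _
        (begin-order i₂ z₂))) λ { (order T rest D , i₃ , z₃) →
    halts-seq (exec-halts (Start.post i₃ z₃)) λ { refl → Start.final i₃ z₃ } } } }
    where
    pre : ∀ {g s} → BuildInv g s →
      Exec W (_≡ setReg (setCell s 15 0 t) 5 1) (15 [ const 0 ]≔ reg 2 ⨾ 5 ≔ const 1) s
    pre i = store⨾ refl (Untouched.r-t (BuildInv.quiet i)) (const-fit z≤n) (node-fit t<N) $
      assign refl (const-fit (s≤s z≤n)) refl
    build≤ : suc M ≤ 2 * (N + M)
    build≤ = ≤-trans (+-mono-≤ size-pos (m≤n+m M N)) (≤-reflexive (cong ((N + M) +_) (sym (+-identityʳ _))))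
    order≤ : suc (N + (M + 2 * N)) ≤ 4 * (N + M)
    order≤ = ≤-trans (+-mono-≤ size-pos (m≤m+n (N + (M + 2 * N)) (2 * M)))
      (≤-reflexive (solve 2 (λ n m → (n :+ m) :+ ((n :+ (m :+ con 2 :* n)) :+ con 2 :* m) := con 4 :* (n :+ m)) refl N M))
    main≤ : suc B ≤ 24 * (N + M)
    main≤ = +-monoˡ-≤ B size-pos

-- Encoding of instances

table-toℕ : ∀ {k} (f : Fin k → ℕ) i → table f (toℕ i) ≡ f i
table-toℕ f zero    = refl
table-toℕ f (suc i) = table-toℕ (λ j → f (suc j)) i

table-≤ : ∀ {k b} (f : Fin k → ℕ) → (∀ i → f i ≤ b) → ∀ j → table f j ≤ b
table-≤ {zero}  f le j       = z≤n
table-≤ {suc k} f le zero    = le zero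
table-≤ {suc k} f le (suc j) = table-≤ (λ i → f (suc i)) (λ i → le (suc i)) j

table-≢0 : ∀ {k} (f : Fin k → ℕ) j → table f j ≢ 0 → ∃[ i ] (toℕ i ≡ j × f i ≢ 0)
table-≢0 {zero}  f j       nz = ⊥-elim (nz refl)
table-≢0 {suc k} f zero    nz = zero , refl , nz
table-≢0 {suc k} f (suc j) nz with table-≢0 (λ i → f (suc i)) j nz
... | i , eq , nz′ = suc i , cong suc eq , nz′

unique-length : {A : Set} {xs ys : List A} → AllPairs _≢_ xs → xs ⊆ ys → length xs ≤ length ys
unique-length []       sub = z≤n
unique-length {A} {x ∷ xs} (ne ∷ un) sub with ∈-∃++ (sub (here refl))
... | as , bs , refl = ≤-trans (s≤s (unique-length un smaller)) (≤-reflexive (trans (cong suc (length-++ as))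
                         (trans (sym (+-suc (length as) (length bs))) (sym (length-++ as)))))
  where
  smaller : xs ⊆ as ++ bs
  smaller y∈ with ∈-++⁻ as (sub (there y∈))
  ... | inj₁ y∈as         = ∈-++⁺ˡ y∈as
  ... | inj₂ (here refl)  = ⊥-elim (All.lookup ne y∈ refl)
  ... | inj₂ (there y∈bs) = ∈-++⁺ʳ as y∈bs

unique-disjoint : {A B : Set} (f : A → List B) (xs : List A) → AllPairs _≢_ (concat (map f xs)) →
  AllPairs (λ x y → Disjoint (f x) (f y)) xs
unique-disjoint f []       un = []
unique-disjoint f (x ∷ xs) un = All.tabulate (λ y∈ (b∈ , b∈′) → proj₁ (split (f x) un) b∈
    (∈-concat⁺′ b∈′ (∈-map⁺ f y∈)) refl) ∷ unique-disjoint f xs (proj₂ (split (f x) un))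
  where
  split : {B : Set} (as : List B) {bs : List B} → AllPairs _≢_ (as ++ bs) →
    (∀ {a b} → a ∈ as → b ∈ bs → a ≢ b) × AllPairs _≢_ bs
  split []       un        = (λ ()) , un
  split (a ∷ as) (ne ∷ un) = (λ { (here refl) b∈ → All.lookup ne (∈-++⁺ʳ as b∈)
                                ; (there a∈) b∈ → proj₁ (split as un) a∈ b∈ }) , proj₂ (split as un)

related : {A : Set} {R : A → A → Set} {xs : List A} {x y : A} → AllPairs R xs → x ∈ xs → y ∈ xs → x ≡ y ⊎ R x y ⊎ R y x
related (r ∷ rs) (here refl) (here refl) = inj₁ refl
related (r ∷ rs) (here refl) (there y∈)  = inj₂ (inj₁ (All.lookup r y∈))
related (r ∷ rs) (there x∈)  (here refl) = inj₂ (inj₂ (All.lookup r x∈))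
related (r ∷ rs) (there x∈)  (there y∈)  = related rs x∈ y∈

module Decoding (I : Instance) where
  open Instance I

  number : Arc → ℕ
  number e = suc (toℕ e)

  arcNumbers : Path → List ℕ
  arcNumbers p = map number (pathArcs p)

  shift : (ℕ → ℕ) → ℕ → ℕ
  shift f zero    = 0
  shift f (suc e) = f e

  tails heads member partner : ℕ → ℕ
  tails   = table (λ e → toℕ (tail e))
  heads   = table (λ e → toℕ (head e))
  member  = table (λ z → if lookup Z z then 1 else 0)
  partner = table (λ z → if lookup Z z then toℕ (σ z) else 0)

  IsArc : ℕ → Set
  IsArc e = 0 < e × e ≤ #arcs

  Source : ℕ → Set
  Source z = ∃[ x ] (x ∈ˢ Z × toℕ x ≡ z)

  arc-number : ∀ {e} → IsArc e → ∃[ i ] e ≡ number i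
  arc-number {suc e} (_ , lt) = fromℕ< lt , cong suc (sym (toℕ-fromℕ< lt))

  number-arc : ∀ i → IsArc (number i)
  number-arc i = s≤s z≤n , toℕ<n i

  partner≡ : ∀ {x} → x ∈ˢ Z → partner (toℕ x) ≡ toℕ (σ x)
  partner≡ {x} x∈ = trans (table-toℕ _ x) (cong (λ b → if b then toℕ (σ x) else 0) ([]=⇒lookup x∈))

  member≡ : ∀ {x} → x ∈ˢ Z → member (toℕ x) ≡ 1
  member≡ {x} x∈ = trans (table-toℕ _ x) (cong (λ b → if b then 1 else 0) ([]=⇒lookup x∈))

  walk : ∀ {x y u v} → Reaches IsArc (shift tails) (shift heads) x y → x ≡ toℕ u → y ≡ toℕ v → Walk u v
  walk here eq eq′ with toℕ-injective (trans (sym eq) eq′)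
  ... | refl = []
  walk (step arc r) eq eq′ with arc-number arc
  ... | i , refl with toℕ-injective (trans (sym (table-toℕ _ i)) eq)
  ...   | refl = i ∷ walk r (table-toℕ _ i) eq′

  preGraph : PreGraph
  preGraph = record
    { N = #nodes ; M = #arcs ; t = toℕ t ; tl = shift tails ; hd = shift heads ; σ = partner ; Z = Source
    ; t<N = toℕ<n t
    ; tl<N = λ arc → let i , eq = arc-number arc in
        subst (λ e → shift tails e < #nodes) (sym eq) (subst (_< #nodes) (sym (table-toℕ _ i)) (toℕ<n (tail i)))
    ; hd<N = λ arc → let i , eq = arc-number arc in
        subst (λ e → shift heads e < #nodes) (sym eq) (subst (_< #nodes) (sym (table-toℕ _ i)) (toℕ<n (head i)))
    ; acyclic = no-cycle
    ; Z<N = λ { (x , _ , refl) → toℕ<n x }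
    ; Z-σ = λ { (x , x∈ , refl) → σ x , σ-closed x∈ , sym (partner≡ x∈) }
    ; σ-invol = λ { (x , x∈ , refl) → trans (cong partner (partner≡ x∈))
                    (trans (partner≡ (σ-closed x∈)) (cong toℕ (σ-involutive x∈))) }
    ; σ-free = λ { (x , x∈ , refl) eq → σ-fixfree x∈ (toℕ-injective (trans (sym (partner≡ x∈)) eq)) }
    ; t∉Z = λ (x , x∈ , eq) → t∉Z (subst (_∈ˢ Z) (toℕ-injective eq) x∈) }
    where
    no-cycle : ∀ {e} → IsArc e → ¬ Reaches IsArc (shift tails) (shift heads) (shift heads e) (shift tails e)
    no-cycle arc r with arc-number arc
    ... | i , refl = acyclic i (walk r (table-toℕ _ i) (table-toℕ _ i))

  module Input (W : ℕ) (fits : ∀ {v} → v ≤ suc (23 * size) → v < W) where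
    open Solver preGraph W fits
    open Preparation preGraph capacity using (BuildInv)

    initial : BuildInv ((λ _ → []) , (λ _ → [])) (input I)
    initial = record
      { quiet = record
        { r-N = refl ; r-M = refl ; r-t = refl ; r3-0 = refl ; r6-0 = refl ; r7-0 = refl ; r11-0 = refl
        ; a-tl = λ _ → refl ; a-hd = λ _ → refl ; a-σ = λ _ → refl
        ; act-Z = act-Z
        ; Z-act = λ { (x , x∈ , refl) eq → contradiction (trans (sym (member≡ x∈)) eq) λ() }
        ; act-1 = table-≤ _ (λ i → at-most-1 (lookup Z i))
        ; a4-0 = refl ; a10-0 = λ _ → refl ; a12-0 = λ _ → refl ; a13-0 = λ _ → refl ; a14-0 = λ _ → refl }
      ; k≤M = z≤n
      ; adj = record
        { l-cur = λ _ → nil ; l-inn = λ _ → nil ; cur-ok = λ () ; inn-ok = λ ()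
        ; all-cur = λ { (s≤s _) () } ; all-inn = λ { (s≤s _) () }
        ; n-cur = empty ; n-inn = empty }
      ; copy = λ _ → refl ; r17-0 = refl ; r18-0 = refl ; r19-0 = refl ; a11-0 = λ _ → refl ; a18-0 = λ _ → refl }
      where
      at-most-1 : ∀ b → (if b then 1 else 0) ≤ 1
      at-most-1 false = z≤n
      at-most-1 true  = ≤-refl
      empty : sumTo (λ _ → 0) #nodes ≡ 0
      empty = trans (sumTo-const 0 #nodes) (*-zeroʳ #nodes)
      act-Z : ∀ {z} → member z ≢ 0 → Source z
      act-Z {z} nz with table-≢0 _ z nz
      ... | i , eq , ne = i , lookup⇒[]= i Z (inside (lookup Z i) ne) , eq
        where
        inside : ∀ b → (if b then 1 else 0) ≢ 0 → b ≡ true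
        inside true  _  = refl
        inside false ne = ⊥-elim (ne refl)

    halts : Halts W (λ s → ∃[ n ] Solution (numbered preGraph n) s) solver (solverCost * size) (input I)
    halts = solver-halts initial

  -- Balanced path-sets and their extensions

  data Paired : List Path → Set where
    none : Paired []
    more : ∀ {P z} → Paired P → z ∈ˢ Z → (v : Walk (σ z) t) (w : Walk z t) →
           Paired (P ++ (σ z , v) ∷ (z , w) ∷ [])

  startingAt-++ : ∀ y P Q → startingAt y (P ++ Q) ≡ startingAt y P + startingAt y Q
  startingAt-++ y P Q = trans (cong length (filter-++ (λ p → proj₁ p ≟ᶠ y) P Q)) (length-++ (filter (λ p → proj₁ p ≟ᶠ y) P))

  startingAt-yes : ∀ {y p} P → proj₁ p ≡ y → startingAt y (p ∷ P) ≡ suc (startingAt y P)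
  startingAt-yes {y} P eq = cong length (filter-accept (λ p → proj₁ p ≟ᶠ y) eq)

  startingAt-no : ∀ {y p} P → proj₁ p ≢ y → startingAt y (p ∷ P) ≡ startingAt y P
  startingAt-no {y} P ne = cong length (filter-reject (λ p → proj₁ p ≟ᶠ y) ne)

  pair-balanced : ∀ {y z v w} → y ∈ˢ Z → z ∈ˢ Z →
    startingAt y ((σ z , v) ∷ (z , w) ∷ []) ≡ startingAt (σ y) ((σ z , v) ∷ (z , w) ∷ [])
  pair-balanced {y} {z} {v} {w} y∈ z∈ with y ≟ᶠ z | y ≟ᶠ σ z
  ... | yes refl | yes eq = ⊥-elim (σ-fixfree z∈ (sym eq))
  ... | yes refl | no ne = trans (trans (startingAt-no {y} _ (ne ∘ sym)) (startingAt-yes {y} [] refl))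
          (sym (trans (startingAt-yes {σ y} _ refl) (cong suc (startingAt-no {σ y} [] ne))))
  ... | no y≢z | yes refl = trans (trans (startingAt-yes {σ z} _ refl) (cong suc (startingAt-no {σ z} [] (y≢z ∘ sym))))
          (sym (trans (startingAt-no {σ (σ z)} _ (λ eq → y≢z (trans eq (σ-involutive z∈))))
            (startingAt-yes {σ (σ z)} [] (sym (σ-involutive z∈)))))
  ... | no y≢z | no y≢σz = trans (trans (startingAt-no {y} _ (y≢σz ∘ sym)) (startingAt-no {y} [] (y≢z ∘ sym)))
          (sym (trans (startingAt-no {σ y} _ (λ eq → y≢z (trans (sym (σ-involutive y∈)) (trans (cong σ (sym eq)) (σ-involutive z∈)))))
            (startingAt-no {σ y} [] (λ eq → y≢σz (trans (sym (σ-involutive y∈)) (cong σ (sym eq)))))))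

  paired-balanced : ∀ {P y} → Paired P → y ∈ˢ Z → startingAt y P ≡ startingAt (σ y) P
  paired-balanced none y∈ = refl
  paired-balanced {y = y} (more {P} {z} p z∈ v w) y∈ = trans (startingAt-++ y P _)
    (trans (cong₂ _+_ (paired-balanced p y∈) (pair-balanced y∈ z∈)) (sym (startingAt-++ (σ y) P _)))

  paired-sources : ∀ {P} → Paired P → All (λ p → proj₁ p ∈ˢ Z) P
  paired-sources none            = []
  paired-sources (more p z∈ v w) = AllP.++⁺ (paired-sources p) (σ-closed z∈ ∷ z∈ ∷ [])

  nonempty : ∀ {p : Path} → proj₁ p ∈ˢ Z → ∃[ e ] e ∈ pathArcs p
  nonempty {_ , []}    z∈ = ⊥-elim (t∉Z z∈)
  nonempty {_ , e ∷ w} z∈ = e , here refl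

  usedArcs : List Path → List Arc
  usedArcs P = concat (map pathArcs P)

  -- If Q extends P by a path q from z, then it has more paths from z than P, hence also
  -- more paths from σ z.
  module Extension {P Q : List Path} (bP : BalancedPathSet P) (bQ : BalancedPathSet Q) (P⊆Q : P ⊆ Q) where
    module P = BalancedPathSet bP
    module Q = BalancedPathSet bQ

    -- For a path of `Q` this amounts to membership in `P`, but it is decided by comparing arcs,
    -- without an equality test for walks.
    Shares : Path → Set
    Shares q = Any (_∈ usedArcs P) (pathArcs q)

    shares? : ∀ q → Dec (Shares q)
    shares? q = any? (λ e → member? _≟ᶠ_ e (usedArcs P)) (pathArcs q)

    unique : ∀ {R} → BalancedPathSet R → AllPairs _≢_ R
    unique {R} b = go sources arc-disjoint
      where
      open BalancedPathSet b
      go : ∀ {R} → All (λ p → proj₁ p ∈ˢ Z) R → AllPairs (λ p q → Disjoint (pathArcs p) (pathArcs q)) R → AllPairs _≢_ R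
      go [] [] = []
      go (s ∷ ss) (d ∷ ds) = All.map (λ { dis refl → dis (proj₂ (nonempty s) , proj₂ (nonempty s)) }) d ∷ go ss ds

    apart : ∀ {p q} → p ∈ Q → q ∈ Q → p ≢ q → Disjoint (pathArcs p) (pathArcs q)
    apart p∈ q∈ ne with related Q.arc-disjoint p∈ q∈
    ... | inj₁ eq        = ⊥-elim (ne eq)
    ... | inj₂ (inj₁ d)  = d
    ... | inj₂ (inj₂ d)  = λ (x , y) → d (y , x)

    common : {as : List Arc} → Any (_∈ usedArcs P) as → ∃[ e ] (e ∈ as × e ∈ usedArcs P)
    common (here e∈) = _ , here refl , e∈
    common (there a) with common a
    ... | e , e∈ , e∈P = e , there e∈ , e∈P

    -- The shared arc belongs to a path of `P`, hence of `Q`; two paths of `Q` with a common arc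
    -- coincide.
    shares-P : ∀ {q} → q ∈ Q → Shares q → q ∈ P
    shares-P q∈ sh with common sh
    ... | e , e∈q , e∈P with ∈-concat⁻′ (map pathArcs P) e∈P
    ...   | _ , e∈p , es∈ with ∈-map⁻ pathArcs es∈
    ...     | p , p∈ , refl with related Q.arc-disjoint (P⊆Q p∈) q∈
    ...       | inj₁ refl       = p∈
    ...       | inj₂ (inj₁ dis) = ⊥-elim (dis (e∈p , e∈q))
    ...       | inj₂ (inj₂ dis) = ⊥-elim (dis (e∈q , e∈p))

    no-share : ∀ {q} → q ∈ Q → ¬ Shares q → q ∉ P
    no-share {q} q∈ ns q∈P = ns (first (proj₂ (nonempty {q} (All.lookup P.sources q∈P))) (∈-map⁺ pathArcs q∈P))
      where
      first : ∀ {e es} → e ∈ es → es ∈ map pathArcs P → Any (_∈ usedArcs P) es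
      first e∈ es∈ = go e∈ (λ f∈ → ∈-concat⁺′ f∈ es∈)
        where
        go : ∀ {e} {es : List Arc} → e ∈ es → (∀ {f} → f ∈ es → f ∈ usedArcs P) → Any (_∈ usedArcs P) es
        go (here _) f = here (f (here refl))
        go (there e∈) f = there (go e∈ (f ∘ there))

    starts? : ∀ y (p : Path) → Dec (proj₁ p ≡ y)
    starts? y p = proj₁ p ≟ᶠ y

    more-paths : ∀ {q} → q ∈ Q → ¬ Shares q → startingAt (proj₁ q) P < startingAt (proj₁ q) Q
    more-paths {q} q∈ ns = unique-length
      (All.tabulate (λ { p∈ refl → no-share q∈ ns (proj₁ (∈-filter⁻ (starts? (proj₁ q)) p∈)) })
        ∷ AllPairsP.filter⁺ (starts? (proj₁ q)) (unique bP))
      λ { (here refl) → ∈-filter⁺ (starts? (proj₁ q)) q∈ refl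
        ; (there p∈) → let p∈P , eq = ∈-filter⁻ (starts? (proj₁ q)) p∈ in ∈-filter⁺ (starts? (proj₁ q)) (P⊆Q p∈P) eq }

    New : Node → Path → Set
    New y q = ¬ Shares q × proj₁ q ≡ y

    new? : ∀ y q → Dec (New y q)
    new? y q = ¬? (shares? q) ×-dec starts? y q

    find-new : ∀ {y} {R : List Path} → Any (New y) R → ∃[ q ] (q ∈ R × New y q)
    find-new (here n) = _ , here refl , n
    find-new (there a) with find-new a
    ... | q , q∈ , n = q , there q∈ , n

    -- Otherwise all paths of `Q` from the partner node would be in `P`, and by balance `Q` could
    -- not have more paths than `P` from the start of `q`.
    new-partner : ∀ {q} → q ∈ Q → ¬ Shares q → ∃[ q′ ] (q′ ∈ Q × New (σ (proj₁ q)) q′)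
    new-partner {q} q∈ ns with any? (new? (σ (proj₁ q))) Q
    ... | yes a = find-new a
    ... | no na = ⊥-elim (<⇒≱ (more-paths q∈ ns) (≤-trans (≤-reflexive (Q.balanced z∈))
                    (≤-trans fewer (≤-reflexive (sym (P.balanced z∈))))))
      where
      z∈ : proj₁ q ∈ˢ Z
      z∈ = All.lookup Q.sources q∈
      old-path : ∀ {p} → p ∈ Q → proj₁ p ≡ σ (proj₁ q) → p ∈ P
      old-path {p} p∈ eq with shares? p
      ... | yes sh = shares-P p∈ sh
      ... | no nsh = ⊥-elim (All.lookup (AllP.¬Any⇒All¬ Q na) p∈ (nsh , eq))
      fewer : startingAt (σ (proj₁ q)) Q ≤ startingAt (σ (proj₁ q)) P
      fewer = unique-length (AllPairsP.filter⁺ (starts? (σ (proj₁ q))) (unique bQ)) λ p∈ →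
        let p∈Q , eq = ∈-filter⁻ (starts? (σ (proj₁ q))) p∈ in ∈-filter⁺ (starts? (σ (proj₁ q))) (old-path p∈Q eq) eq

    new-pair : ¬ (Q ⊆ P) → ∃[ q ] ∃[ q′ ] (q ∈ Q × q′ ∈ Q × ¬ Shares q × ¬ Shares q′ × proj₁ q′ ≡ σ (proj₁ q))
    new-pair Q⊈P with any? (λ q → ¬? (shares? q)) Q
    ... | no na = ⊥-elim (Q⊈P (λ q∈ → shared q∈))
      where
      shared : ∀ {q} → q ∈ Q → q ∈ P
      shared {q} q∈ with shares? q
      ... | yes sh = shares-P q∈ sh
      ... | no nsh = ⊥-elim (All.lookup (AllP.¬Any⇒All¬ Q na) q∈ nsh)
    ... | yes a with pick a
      where
      pick : ∀ {R} → Any (λ q → ¬ Shares q) R → ∃[ q ] (q ∈ R × ¬ Shares q)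
      pick (here n) = _ , here refl , n
      pick (there a) with pick a
      ... | q , q∈ , n = q , there q∈ , n
    ...   | q , q∈ , ns with new-partner q∈ ns
    ...     | q′ , q′∈ , ns′ , eq = q , q′ , q∈ , q′∈ , ns , ns′ , eq

  -- From lists of numbers back to paths

  module Decoded (n : Keys preGraph) where
    open Algorithm (numbered preGraph n) using (Route; []; _∷_; Pairs; none; more; Unused; Feasible)

    route : ∀ {u v} (w : Walk u v) → Route (toℕ u) (map number (arcs w)) (toℕ v)
    route []      = []
    route (e ∷ w) = (number-arc e , table-toℕ _ e) ∷
      subst (λ x → Route x (map number (arcs w)) _) (sym (table-toℕ _ e)) (route w)

    route-walk : ∀ {x es y u v} → Route x es y → x ≡ toℕ u → y ≡ toℕ v → Σ (Walk u v) (λ w → es ≡ map number (arcs w))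
    route-walk [] eq eq′ with toℕ-injective (trans (sym eq) eq′)
    ... | refl = [] , refl
    route-walk ((arc , t≡) ∷ r) eq eq′ with arc-number arc
    ... | i , refl with toℕ-injective (trans (sym (table-toℕ _ i)) (trans t≡ eq))
    ...   | refl with route-walk r (table-toℕ _ i) eq′
    ...     | w , refl = i ∷ w , refl

    paths : ∀ {ps} → Pairs ps → ∃[ P ] (Paired P × ps ≡ map arcNumbers P)
    paths none = [] , none , refl
    paths (more pr (z , z∈ , refl) r₁ r₂) with paths pr
    ... | P , paired , refl with route-walk r₁ (partner≡ z∈) refl | route-walk r₂ refl refl
    ...   | v , refl | w , refl = _ , more paired z∈ v w , sym (map-++ arcNumbers P _)

    module _ {P : List Path} (paired : Paired P) (distinct : AllPairs _≢_ (concat (map arcNumbers P)))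
      (stuck : ∀ {z} → Source z → ¬ Feasible (Unused (map arcNumbers P)) z) where

      separate : ∀ {p q} → Disjoint (arcNumbers p) (arcNumbers q) → Disjoint (pathArcs p) (pathArcs q)
      separate dis (x , y) = dis (∈-map⁺ number x , ∈-map⁺ number y)

      isBalanced : BalancedPathSet P
      isBalanced = record
        { sources = paired-sources paired
        ; arc-disjoint = AllPairs.map (λ {p} {q} → separate {p} {q}) (unique-disjoint arcNumbers P distinct)
        ; balanced = paired-balanced paired }

      numbers-used : concat (map arcNumbers P) ≡ map number (usedArcs P)
      numbers-used = trans (cong concat (map-∘ P)) (concat-map (map pathArcs P))

      number-injective : ∀ {i j} → number i ≡ number j → i ≡ j
      number-injective eq = toℕ-injective (suc-injective eq)

      -- A larger balanced path-set yields two new paths that start at partner nodes, share no arc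
      -- with each other and use no arc of `P`: just the pair that `stuck` excludes.
      maximality : ¬ (∃[ Q ] (BalancedPathSet Q × P ⊆ Q × ¬ (Q ⊆ P)))
      maximality (Q , bQ , P⊆Q , Q⊈P) with Extension.new-pair isBalanced bQ P⊆Q Q⊈P
      ... | (z , w) , (z′ , w′) , q∈ , q′∈ , ns , ns′ , refl = stuck (z , z∈ , refl)
          ( map number (arcs w) , map number (arcs w′) , route w
          , subst (λ x → Route x (map number (arcs w′)) (toℕ t)) (sym (partner≡ z∈)) (route w′)
          , unused ns , unused ns′ , disjoint )
        where
        open Extension isBalanced bQ P⊆Q
        z∈ : z ∈ˢ Z
        z∈ = All.lookup Q.sources q∈
        any-of : ∀ {e : Arc} {es} → e ∈ es → e ∈ usedArcs P → Any (_∈ usedArcs P) es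
        any-of (here refl) u = here u
        any-of (there e∈)  u = there (any-of e∈ u)
        unused : ∀ {q e} → ¬ Shares q → e ∈ arcNumbers q → Unused (map arcNumbers P) e
        unused ns e∈ with ∈-map⁻ number e∈
        ... | i , i∈ , refl = number-arc i , λ e∈P → ns (any-of i∈ (used (subst (number i ∈_) numbers-used e∈P)))
          where
          used : number i ∈ map number (usedArcs P) → i ∈ usedArcs P
          used m with ∈-map⁻ number m
          ... | j , j∈ , eq = subst (_∈ usedArcs P) (sym (number-injective eq)) j∈
        disjoint : Disjoint (map number (arcs w)) (map number (arcs w′))
        disjoint (e∈ , e∈′) with ∈-map⁻ number e∈ | ∈-map⁻ number e∈′
        ... | i , i∈ , refl | j , j∈ , eq = apart q∈ q′∈ (λ same → σ-fixfree z∈ (sym (cong proj₁ same)))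
                (i∈ , subst (_∈ arcs w′) (sym (number-injective eq)) j∈)

    decode : ∀ {s} → Solution (numbered preGraph n) s → ∃[ P ] (Encodes I s P × MaximalBalancedPathSet P)
    decode (ps , pairs , distinct , stuck , out) with paths pairs
    ... | P , paired , refl = P , trans out encoded , record
          { isBalanced = isBalanced paired distinct stuck ; maximal = maximality paired distinct stuck }
      where
      encoded : map (map pred) (map arcNumbers P) ≡ map (λ p → map toℕ (pathArcs p)) P
      encoded = trans (sym (map-∘ P)) (map-cong (λ p → sym (map-∘ (pathArcs p))) P)

-- 1 + 23 n is less than 32 (1 + n), and 32 = 2 ^ 5 is at most (1 + n) ^ 5; this gives the exponent
-- 6.
word-size : ∀ {n v} → 1 ≤ n → v ≤ suc (23 * n) → v < (1 + n) ^ 6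
word-size {n} {v} pos le = begin-strict
  v                 ≤⟨ le ⟩
  1 + 23 * n        <⟨ +-mono-<-≤ {1} {32} {23 * n} {32 * n} (s≤s (s≤s z≤n)) (*-monoˡ-≤ n {23} {32} (≤ᵇ⇒≤ 23 32 _)) ⟩
  32 + 32 * n       ≡⟨ sym (*-suc 32 n) ⟩
  32 * (1 + n)      ≡⟨ *-comm 32 (1 + n) ⟩
  (1 + n) * 2 ^ 5   ≤⟨ *-monoʳ-≤ (1 + n) (^-monoˡ-≤ 5 {2} {1 + n} (s≤s pos)) ⟩
  (1 + n) ^ 6       ∎
  where open ≤-Reasoning

solve-instance : ∀ I → ∃[ time ] ∃[ final ] ∃[ P ]
  (Run (wordBound 6 I) solver (input I) time final × time ≤ solverCost * Instance.size I ×
   Encodes I final P × Instance.MaximalBalancedPathSet I P)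
solve-instance I = finish (Decoding.Input.halts I (wordBound 6 I) (word-size size-pos))
  where
  size-pos : 1 ≤ Instance.size I
  size-pos = ≤-trans (≤-trans (s≤s z≤n) (toℕ<n (Instance.t I))) (m≤m+n _ _)
  finish : Halts (wordBound 6 I) (λ s → ∃[ n ] Solution (numbered (Decoding.preGraph I) n) s) solver
             (solverCost * Instance.size I) (input I) →
    ∃[ time ] ∃[ final ] ∃[ P ]
      (Run (wordBound 6 I) solver (input I) time final × time ≤ solverCost * Instance.size I ×
       Encodes I final P × Instance.MaximalBalancedPathSet I P)
  finish (time , s , run , time≤ , n , solution) =
    let P , encodes , maximal = Decoding.Decoded.decode I n {s} solution
    in time , s , P , run , time≤ , encodes , maximal

mainTheorem11 :
    ∃[ program ] ∃[ c ] ∃[ k ] ((I : Instance) →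
      ∃[ time ] ∃[ final ] ∃[ P ]
        (Run (wordBound k I) program (input I) time final
         × time ≤ c * Instance.size I
         × Encodes I final P
         × Instance.MaximalBalancedPathSet I P))
mainTheorem11 = solver , solverCost , 6 , solve-instance
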